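{- Let $a_n,b_n,c_n,d_n,e_n,f_n,g_n,h_n,k_n,v_n$ denote the numbers of vertices of type $A,B,C,D,E,F,G,H,K,1$, respectively, on level $n$ of the hyperbolic Pascal simplex based on the hypercube mosaic $\{4,3,3,5\}$. Then for all $n\ge 1$ $$\begin{aligned} a_{n+1}&=\tfrac12\left(2a_n+2b_n+3v_n\right),\\ b_{n+1}&=a_n+2b_n,\\ c_{n+1}&=\tfrac13\left(2a_n+3c_n+2d_n\right),\\ d_{n+1}&=\tfrac12\left(2b_n+3c_n+4d_n+5e_n\right),\\ e_{n+1}&=3c_n+4d_n+6e_n,\\ f_{n+1}&=\tfrac14\left(c_n+4f_n+2g_n\right),\\ g_{n+1}&=\tfrac13\left(d_n+6f_n+6g_n+5h_n\right),\\ h_{n+1}&=\tfrac12\left(e_n+12f_n+12g_n+12h_n+12k_n\right),\\ k_{n+1}&=94f_n+97g_n+101h_n+107k_n,\\ v_{n+1}&=v_n, \end{aligned}$$ with initial values $v_1=4$ and $a_1=b_1=c_1=d_1=e_1=f_1=g_1=h_1=k_1=0$.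
   Context: The mosaic $\{4,3,3,5\}$ is the regular tessellation of hyperbolic 4-space by 4-dimensional hypercubes $\{4,3,3\}$ with vertex figure the 600-cell $\{3,3,5\}$ (so 600 hypercubes and 120 edges meet at each vertex). Hyperbolic Pascal simplex. Fix a vertex $V_0$ of the mosaic. The value (sign) of a vertex is the number of shortest paths along mosaic edges from $V_0$ to that vertex (the value of $V_0$ is $1$). Define a convex part $\mathcal P$ of the mosaic as follows. Take one hypercube containing $V_0$ and let $V_1$ be its vertex opposite to $V_0$ (the vertex of this hypercube with the largest value, namely $24$). Next take all new hypercubes of the mosaic containing $V_1$, and in each of them the vertex with the largest value. Then take all hypercubes containing these vertices, and in each new one the vertex with the largest value, and so on without end. $\mathcal P$ is the set of all hypercubes obtained. The vertices and edges of $\mathcal P$, with each edge directed from its endpoint nearer to $V_0$ to its endpoint farther from $V_0$, form an infinite digraph called the hyperbolic Pascal simplex. Level $n$ is the set of its vertices whose edge-distance from $V_0$ along edges of $\mathcal P$ is $n$. An incoming edge of a vertex on level $n$ is an edge from a vertex on level $n-1$. Vertex types. The boundary of $\mathcal P$ has the combinatorial shape of an infinite simplicial cone with apex $V_0$: four boundary rays, six 2-dimensional faces and four 3-dimensional faces. - Type $1$: vertices on the boundary rays (value $1$). They have degree $5$ in $\mathcal P$, except $V_0$, which has degree $4$. - Types $A$, $B$: vertices in the interior of a 2-dimensional face (degree $7$ in $\mathcal P$), with exactly two (type $A$) or one (type $B$) incoming edges. - Types $C$, $D$, $E$: vertices in the interior of a 3-dimensional face (degree $13$ in $\mathcal P$),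 with exactly three (type $C$), two (type $D$) or one (type $E$) incoming edges. - Types $F$, $G$, $H$, $K$: vertices in the interior of $\mathcal P$ (degree $120$), with exactly four (type $F$), three (type $G$), two (type $H$) or one (type $K$) incoming edges.
   Formalization: The part 𝒫 is the smallest set of hypercubes closed under the stated rule and convex around 2-cells (two non-adjacent hypercubes at a 2-cell bring in all five there); the rule alone gives a non-convex set, with interior vertices of degree below 120. -}

module Defs where

open import Data.Fin using (Fin; #_)
open import Data.Integer as ℤ using (ℤ; +_; -[1+_])
open import Data.List using (List; []; _∷_; length; foldr)
open import Data.List.Membership.Propositional using (_∈_)
open import Data.List.Relation.Unary.Unique.Propositional using (Unique)
open import Data.Nat using (ℕ; suc; _≤_)
open import Data.Product using (∃; ∃-syntax; ∃!; _×_)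
open import Data.Rational as ℚ using (ℚ)
open import Data.Vec as Vec using (Vec; []; _∷_; lookup; tabulate)
open import Function using (_⇔_)
open import Relation.Binary.PropositionalEquality using (_≡_; _≢_; refl)
open import Relation.Nullary using (¬_)

------------------------------------------------------------------------
-- The ring ℤ[φ], φ the golden ratio; ⟨ a , b ⟩ stands for a + bφ.

record ℤ[φ] : Set where
  constructor ⟨_,_⟩
  field
    rational golden : ℤ

infixl 6 _⊕_
infixl 7 _⊛_

_⊕_ : ℤ[φ] → ℤ[φ] → ℤ[φ]
⟨ a , b ⟩ ⊕ ⟨ c , d ⟩ = ⟨ a ℤ.+ c , b ℤ.+ d ⟩

⊝_ : ℤ[φ] → ℤ[φ]
⊝ ⟨ a , b ⟩ = ⟨ ℤ.- a , ℤ.- b ⟩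

_⊛_ : ℤ[φ] → ℤ[φ] → ℤ[φ]
⟨ a , b ⟩ ⊛ ⟨ c , d ⟩ =
  ⟨ a ℤ.* c ℤ.+ b ℤ.* d , a ℤ.* d ℤ.+ b ℤ.* c ℤ.+ b ℤ.* d ⟩

int : ℤ → ℤ[φ]
int a = ⟨ a , + 0 ⟩

𝟎 𝟏 -𝟏 𝟐 φ² φ³ -φ⁻³ : ℤ[φ]
𝟎    = int (+ 0)
𝟏    = int (+ 1)
-𝟏   = ⊝ 𝟏
𝟐    = int (+ 2)
φ²   = ⟨ + 1 , + 1 ⟩
φ³   = ⟨ + 1 , + 2 ⟩
-φ⁻³ = ⟨ + 3 , -[1+ 1 ] ⟩

------------------------------------------------------------------------
-- The mosaic {4,3,3,5}, in the projective model of hyperbolic 4-space: a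
-- point is represented by a vector (x₀ ; x₁ , x₂ , x₃ , x₄) that is
-- timelike for the Lorentzian form x₁y₁ + x₂y₂ + x₃y₃ + x₄y₄ - φ³x₀y₀.
-- The scaling of x₀ is such that the hypercube with vertices
-- (1 ; ±1 , ±1 , ±1 , ±1) has dihedral angle 2π/5.

Point : Set
Point = Vec ℤ[φ] 5

⟪_,_⟫ : Point → Point → ℤ[φ]
⟪ x , y ⟫ =
  Vec.foldr′ _⊕_ 𝟎 (Vec.zipWith _⊛_ (⊝ φ³ ∷ 𝟏 ∷ 𝟏 ∷ 𝟏 ∷ 𝟏 ∷ []) (Vec.zipWith _⊛_ x y))

-- The mosaic is given by its characteristic simplex, whose vertices are
-- the centres of the base hypercube and of the members of a flag of its
-- faces: center j is the centre of the j-dimensional member.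

center : Fin 5 → Point
center = lookup
  ( (𝟏 ∷ 𝟏 ∷ 𝟏 ∷ 𝟏 ∷ 𝟏 ∷ [])
  ∷ (𝟏 ∷ 𝟎 ∷ 𝟏 ∷ 𝟏 ∷ 𝟏 ∷ [])
  ∷ (𝟏 ∷ 𝟎 ∷ 𝟎 ∷ 𝟏 ∷ 𝟏 ∷ [])
  ∷ (𝟏 ∷ 𝟎 ∷ 𝟎 ∷ 𝟎 ∷ 𝟏 ∷ [])
  ∷ (𝟏 ∷ 𝟎 ∷ 𝟎 ∷ 𝟎 ∷ 𝟎 ∷ [])
  ∷ [])

-- normal i is orthogonal to the wall of the simplex opposite center i.

normal : Fin 5 → Point
normal = lookup
  ( (𝟎    ∷ 𝟏  ∷ 𝟎  ∷ 𝟎  ∷ 𝟎  ∷ [])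
  ∷ (𝟎    ∷ -𝟏 ∷ 𝟏  ∷ 𝟎  ∷ 𝟎  ∷ [])
  ∷ (𝟎    ∷ 𝟎  ∷ -𝟏 ∷ 𝟏  ∷ 𝟎  ∷ [])
  ∷ (𝟎    ∷ 𝟎  ∷ 𝟎  ∷ -𝟏 ∷ 𝟏  ∷ [])
  ∷ (-φ⁻³ ∷ 𝟎  ∷ 𝟎  ∷ 𝟎  ∷ -𝟏 ∷ [])
  ∷ [])

-- κ i = 2 / ⟪ normal i , normal i ⟫

κ : Fin 5 → ℤ[φ]
κ = lookup (𝟐 ∷ 𝟏 ∷ 𝟏 ∷ 𝟏 ∷ φ² ∷ [])

dual : tabulate (λ i → tabulate λ j → ⟪ normal i , center j ⟫) ≡
  ( (𝟏 ∷ 𝟎 ∷ 𝟎 ∷ 𝟎 ∷ 𝟎 ∷ [])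
  ∷ (𝟎 ∷ 𝟏 ∷ 𝟎 ∷ 𝟎 ∷ 𝟎 ∷ [])
  ∷ (𝟎 ∷ 𝟎 ∷ 𝟏 ∷ 𝟎 ∷ 𝟎 ∷ [])
  ∷ (𝟎 ∷ 𝟎 ∷ 𝟎 ∷ 𝟏 ∷ 𝟎 ∷ [])
  ∷ (𝟎 ∷ 𝟎 ∷ 𝟎 ∷ 𝟎 ∷ 𝟏 ∷ [])
  ∷ [])
dual = refl

-- The product of the (i , j) and (j , i) entries is 4cos²(π/m), with
-- m = 4, 3, 3, 5 for consecutive walls and m = 2 for the other pairs: the
-- walls generate the Coxeter group [4,3,3,5].

cartan : tabulate (λ i → tabulate λ j → κ i ⊛ ⟪ normal i , normal j ⟫) ≡
  ( (𝟐  ∷ ⊝ 𝟐 ∷ 𝟎  ∷ 𝟎    ∷ 𝟎  ∷ [])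
  ∷ (-𝟏 ∷ 𝟐   ∷ -𝟏 ∷ 𝟎    ∷ 𝟎  ∷ [])
  ∷ (𝟎  ∷ -𝟏  ∷ 𝟐  ∷ -𝟏   ∷ 𝟎  ∷ [])
  ∷ (𝟎  ∷ 𝟎   ∷ -𝟏 ∷ 𝟐    ∷ -𝟏 ∷ [])
  ∷ (𝟎  ∷ 𝟎   ∷ 𝟎  ∷ ⊝ φ² ∷ 𝟐  ∷ [])
  ∷ [])
cartan = refl

reflect : Fin 5 → Point → Point
reflect i x =
  Vec.zipWith (λ xₖ nₖ → xₖ ⊕ ⊝ (κ i ⊛ ⟪ normal i , x ⟫ ⊛ nₖ)) x (normal i)

infixr 8 _▷_

_▷_ : List (Fin 5) → Point → Point
w ▷ x = foldr reflect x w

-- A cell of the mosaic is represented by its centre.  Incident i j x y: x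
-- is an i-cell and y is a j-cell, and they belong to a common flag; for
-- i ≤ j this means that x is a face of y.

Incident : Fin 5 → Fin 5 → Point → Point → Set
Incident i j x y = ∃[ w ] (x ≡ w ▷ center i × y ≡ w ▷ center j)

JoinedBy : Point → Point → Point → Set
JoinedBy e u v = u ≢ v × Incident (# 0) (# 1) u e × Incident (# 0) (# 1) v e

MosaicEdge : Point → Point → Set
MosaicEdge u v = ∃[ e ] JoinedBy e u v

------------------------------------------------------------------------
-- Cardinalities and shortest paths

HasCard : {X : Set} → (X → Set) → ℕ → Set
HasCard P m =
  ∃[ xs ] (Unique xs × (∀ x → x ∈ xs ⇔ P x) × length xs ≡ m)

-- A path from u is represented by the list of its vertices other than u.

IsPath : {X : Set} → (X → X → Set) → X → List X → X → Set
IsPath E u []       v = u ≡ v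
IsPath E u (x ∷ xs) v = E u x × IsPath E x xs v

IsShortestPath : {X : Set} → (X → X → Set) → X → List X → X → Set
IsShortestPath E u xs v =
  IsPath E u xs v × (∀ ys → IsPath E u ys v → length xs ≤ length ys)

data VertexType : Set where
  A B C D E F G H K One : VertexType

------------------------------------------------------------------------
-- The hyperbolic Pascal simplex with apex V₀ and first hypercube Q₀

module Simplex (V₀ Q₀ : Point) where

  HasValue : Point → ℕ → Set
  HasValue v m = HasCard (λ xs → IsShortestPath MosaicEdge V₀ xs v) m

  LargestVertex : Point → Point → Set
  LargestVertex q v =
    Incident (# 0) (# 4) v q ×
    ∃[ m ] (HasValue v m ×
            (∀ u k → Incident (# 0) (# 4) u q → HasValue u k → k ≤ m))

  -- The hypercubes of the convex part 𝒫.  The constructor convex is the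
  -- convexity of 𝒫: five hypercubes with dihedral angle 2π/5 surround each
  -- 2-cell s, so two of them that share no 3-cell subtend an angle greater
  -- than π together with the ones between them, on either side, and a
  -- convex region containing both contains a neighbourhood of the interior
  -- of s.  It cannot be omitted: the hypercubes around largest vertices
  -- alone leave some 2-cells surrounded by four hypercubes only.

  data In𝒫 : Point → Set where
    first  : In𝒫 Q₀
    around : ∀ {q v r} → In𝒫 q → LargestVertex q v →
             Incident (# 0) (# 4) v r → In𝒫 r
    convex : ∀ {q₁ q₂ s r} → In𝒫 q₁ → In𝒫 q₂ →
             Incident (# 2) (# 4) s q₁ → Incident (# 2) (# 4) s q₂ →
             ¬ (∃[ f ] (Incident (# 3) (# 4) f q₁ × Incident (# 3) (# 4) f q₂)) →
             Incident (# 2) (# 4) s r → In𝒫 r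

  𝒫HypercubeAt : Fin 5 → Point → Point → Set
  𝒫HypercubeAt j c q = In𝒫 q × Incident j (# 4) c q

  𝒫Edge : Point → Point → Set
  𝒫Edge u v = ∃[ e ] (JoinedBy e u v × ∃ (𝒫HypercubeAt (# 1) e))

  Level : ℕ → Point → Set
  Level n v = ∃[ xs ] (IsShortestPath 𝒫Edge V₀ xs v × length xs ≡ n)

  Incoming : Point → Point → Set
  Incoming v u = 𝒫Edge u v × ∃[ n ] (Level n u × Level (suc n) v)

  -- Near the interior of a j-cell that lies in just one hypercube of 𝒫, the
  -- region 𝒫 coincides with that hypercube, a simple polytope, so it is
  -- bounded by 4 - j hypersurfaces meeting along the cell.  Thus the
  -- j-dimensional faces of 𝒫 are made up of these j-cells; for j = 3 this is
  -- the usual description of the boundary of a union of cells.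

  OnFace : Fin 5 → Point → Set
  OnFace j v =
    ∃[ c ] (Incident (# 0) j v c × ∃! _≡_ (𝒫HypercubeAt j c))

  OnRay InFace₂ InFace₃ Inside : Point → Set
  OnRay   v = OnFace (# 1) v
  InFace₂ v = OnFace (# 2) v × ¬ OnFace (# 1) v
  InFace₃ v = OnFace (# 3) v × ¬ OnFace (# 2) v
  Inside  v = ∃ (𝒫HypercubeAt (# 0) v) × ¬ OnFace (# 3) v

  HasType : VertexType → Point → Set
  HasType One v = OnRay v
  HasType A   v = InFace₂ v × HasCard (Incoming v) 2
  HasType B   v = InFace₂ v × HasCard (Incoming v) 1
  HasType C   v = InFace₃ v × HasCard (Incoming v) 3
  HasType D   v = InFace₃ v × HasCard (Incoming v) 2
  HasType E   v = InFace₃ v × HasCard (Incoming v) 1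
  HasType F   v = Inside v × HasCard (Incoming v) 4
  HasType G   v = Inside v × HasCard (Incoming v) 3
  HasType H   v = Inside v × HasCard (Incoming v) 2
  HasType K   v = Inside v × HasCard (Incoming v) 1

  NumberOnLevel : VertexType → ℕ → ℕ → Set
  NumberOnLevel t n m = HasCard (λ v → Level n v × HasType t v) m

------------------------------------------------------------------------
-- Rational numbers

ι : ℕ → ℚ
ι m = + m ℚ./ 1

⅓ ¼ : ℚ
⅓ = + 1 ℚ./ 3
¼ = + 1 ℚ./ 4

{-# OPTIONS --safe #-}

-- An edge at a vertex u is represented by the unit normal ρ of its
-- perpendicular bisector, directed towards u.  The coordinates of all these
-- vectors are in ℤ[φ], and the Galois conjugate of the Lorentzian form is
-- positive definite: hence the product of two such normals is 0 or at least
-- 1 in absolute value, and the bisectors of two edges at u are orthogonal or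
-- disjoint.
--
-- The hyperplanes parallel to the facets of Q₀ through its centre are four
-- mirrors, and 𝒫 consists of the hypercubes whose centres are not on the
-- V₀-side of any of them.  The level of a vertex is the number of
-- bisecting mirrors between V₀ and the vertex.  Incoming edges at a vertex,
-- and the edges that cross the four mirrors there (its walls), are pairwise
-- orthogonal, so they belong to one hypercube, and the type of a vertex
-- amounts to the numbers i of its incoming edges and j of its walls.
--
-- An outgoing edge ρ stays in 𝒫 if it is one of the walls or orthogonal to
-- each of them, and it leads to a vertex with one more incoming edge than
-- there are incoming edges orthogonal to ρ, and with the walls orthogonal to
-- ρ.  Thus the numbers of edges between the types are read off the 120
-- vertices of the 600-cell, and counting the edges between consecutive
-- levels from both ends gives the recurrences.

module Submission where

open import Defs
open import Algebra using (CommutativeRing)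
open import Data.Empty using (⊥; ⊥-elim)
open import Data.Fin as Fin using (Fin; zero; suc; #_)
import Data.Fin.Properties as Fin
open import Data.Integer as ℤ using (ℤ; +_; -[1+_])
import Data.Integer.Properties as ℤ
open import Data.Integer.Tactic.RingSolver using () renaming (solve-∀ to ℤ-solve-∀)
open import Data.List
  using (List; []; _∷_; _++_; reverse; take; drop; map; concatMap; filter; deduplicate; allFin; length)
import Data.List.Membership.DecPropositional as DecMembership
open import Data.List.Membership.Propositional using (_∈_; _∉_; find)
open import Data.List.Membership.Propositional.Properties
  using (∈-map⁺; ∈-map⁻; ∈-concatMap⁻; ∈-++⁺ˡ; ∈-++⁺ʳ; ∈-++⁻; ∈-∃++; ∈-filter⁺; ∈-filter⁻;
         ∈-deduplicate⁺; ∈-deduplicate⁻; ∈-allFin; ∈-length)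
import Data.List.Properties as List
open import Data.List.Relation.Unary.All as All using (All; []; _∷_; all?)
import Data.List.Relation.Unary.All.Properties as All
open import Data.List.Relation.Unary.All.Properties.Core using (¬All⇒Any¬)
open import Data.List.Relation.Unary.AllPairs as AllPairs using (AllPairs; []; _∷_)
import Data.List.Relation.Unary.AllPairs.Properties as AllPairs
open import Data.List.Relation.Unary.Any as Any using (Any; here; there; any?)
import Data.List.Relation.Unary.Unique.DecPropositional as DecUnique
import Data.List.Relation.Unary.Unique.DecPropositional.Properties as DecUniqueProperties
open import Data.List.Relation.Unary.Unique.Propositional using (Unique)
import Data.List.Relation.Unary.Unique.Propositional.Properties as Unique
open import Data.Maybe as Maybe using (Maybe; just; nothing)
open import Data.Nat as ℕ using (ℕ; zero; suc; _+_; _*_; _≤_; s≤s; z≤n)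
open import Data.Nat.ListAction using (sum)
import Data.Nat.Properties as ℕ
open import Data.Product using (Σ-syntax; _×_; _,_; proj₁; proj₂; ∃; ∃-syntax; swap)
open import Data.Product.Properties using (,-injectiveʳ)
open import Data.Rational as ℚ using (ℚ; ½)
import Data.Rational.Properties as ℚ
import Data.Rational.Unnormalised as ℚᵘ
import Data.Rational.Unnormalised.Properties as ℚᵘ
open import Data.Sum using (_⊎_; inj₁; inj₂)
open import Data.Vec as Vec using (Vec; []; _∷_)
open import Data.Vec.Properties using (≡-dec)
open import Function using (case_of_; _⇔_; mk⇔; Equivalence)
open import Level using (0ℓ)
open import Relation.Binary.Definitions using (DecidableEquality)
open import Relation.Binary.PropositionalEquality
open import Relation.Nullary using (¬_; Dec; yes; no)
open import Relation.Nullary.Decidable using (from-yes; from-no; map′; _⊎-dec_; _→-dec_; _×-dec_; ¬?)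
open import Tactic.RingSolver using (solve-∀)
open import Tactic.RingSolver.Core.AlmostCommutativeRing using (AlmostCommutativeRing; fromCommutativeRing)

open Equivalence using (to; from)

-- No real numbers occur. The order of ℤ[φ] is an inductive predicate, and a geometric inequality is
-- a ring identity between terms of known sign. One fact replaces the geometry of hyperplanes that
-- do not meet: a vector that is not spacelike vanishes if its products with two future points have
-- weakly opposite signs (`causal-zero`). The gap between products extends to vertices: the product
-- of a bisector normal and a vertex is 1 modulo 2 and at least 1 in absolute value, so a vertex is
-- strictly on one side of each mirror. The obstacle is that 𝒫 is generated by steps while the
-- counting needs it as a region. That each step stays in the region is direct. The converse is a
-- double induction: on the level of a vertex and, around the vertex, on the distance from an
-- incoming edge to the hypercube, with the steps checked on all 120 edges. As the vertices of the
-- region are closed under descent along incoming edges, distances within 𝒫 are those of the mosaic.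
-- A word in the five reflections serves as a frame of a flag. Frames carry local questions to
-- `center zero`, where they are decided by computation.

-- The ordered ring ℤ[φ].

φ : ℤ[φ]
φ = ⟨ + 0 , + 1 ⟩

infix 4 _≟_

_≟_ : DecidableEquality ℤ[φ]
⟨ a , b ⟩ ≟ ⟨ c , d ⟩ =
  map′ (λ { (refl , refl) → refl }) (λ { refl → refl , refl }) (a ℤ.≟ c ×-dec b ℤ.≟ d)

⊕-assoc : ∀ x y z → (x ⊕ y) ⊕ z ≡ x ⊕ (y ⊕ z)
⊕-assoc ⟨ a , b ⟩ ⟨ c , d ⟩ ⟨ e , f ⟩ = cong₂ ⟨_,_⟩ (ℤ.+-assoc a c e) (ℤ.+-assoc b d f)

⊕-comm : ∀ x y → x ⊕ y ≡ y ⊕ x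
⊕-comm ⟨ a , b ⟩ ⟨ c , d ⟩ = cong₂ ⟨_,_⟩ (ℤ.+-comm a c) (ℤ.+-comm b d)

⊕-identityˡ : ∀ x → 𝟎 ⊕ x ≡ x
⊕-identityˡ ⟨ a , b ⟩ = cong₂ ⟨_,_⟩ (ℤ.+-identityˡ a) (ℤ.+-identityˡ b)

⊕-identityʳ : ∀ x → x ⊕ 𝟎 ≡ x
⊕-identityʳ x = trans (⊕-comm x 𝟎) (⊕-identityˡ x)

⊝-inverseˡ : ∀ x → ⊝ x ⊕ x ≡ 𝟎
⊝-inverseˡ ⟨ a , b ⟩ = cong₂ ⟨_,_⟩ (ℤ.+-inverseˡ a) (ℤ.+-inverseˡ b)

⊝-inverseʳ : ∀ x → x ⊕ ⊝ x ≡ 𝟎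
⊝-inverseʳ x = trans (⊕-comm x (⊝ x)) (⊝-inverseˡ x)

⊛-comm : ∀ x y → x ⊛ y ≡ y ⊛ x
⊛-comm ⟨ a , b ⟩ ⟨ c , d ⟩ = cong₂ ⟨_,_⟩ (p a b c d) (q a b c d)
  where
  p : ∀ a b c d → a ℤ.* c ℤ.+ b ℤ.* d ≡ c ℤ.* a ℤ.+ d ℤ.* b
  p = ℤ-solve-∀
  q : ∀ a b c d → a ℤ.* d ℤ.+ b ℤ.* c ℤ.+ b ℤ.* d ≡ c ℤ.* b ℤ.+ d ℤ.* a ℤ.+ d ℤ.* b
  q = ℤ-solve-∀

⊛-assoc : ∀ x y z → (x ⊛ y) ⊛ z ≡ x ⊛ (y ⊛ z)
⊛-assoc ⟨ a , b ⟩ ⟨ c , d ⟩ ⟨ e , f ⟩ = cong₂ ⟨_,_⟩ (p a b c d e f) (q a b c d e f)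
  where
  p : ∀ a b c d e f →
      (a ℤ.* c ℤ.+ b ℤ.* d) ℤ.* e ℤ.+ (a ℤ.* d ℤ.+ b ℤ.* c ℤ.+ b ℤ.* d) ℤ.* f ≡
      a ℤ.* (c ℤ.* e ℤ.+ d ℤ.* f) ℤ.+ b ℤ.* (c ℤ.* f ℤ.+ d ℤ.* e ℤ.+ d ℤ.* f)
  p = ℤ-solve-∀
  q : ∀ a b c d e f →
      (a ℤ.* c ℤ.+ b ℤ.* d) ℤ.* f ℤ.+ (a ℤ.* d ℤ.+ b ℤ.* c ℤ.+ b ℤ.* d) ℤ.* e ℤ.+
      (a ℤ.* d ℤ.+ b ℤ.* c ℤ.+ b ℤ.* d) ℤ.* f ≡
      a ℤ.* (c ℤ.* f ℤ.+ d ℤ.* e ℤ.+ d ℤ.* f) ℤ.+ b ℤ.* (c ℤ.* e ℤ.+ d ℤ.* f) ℤ.+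
      b ℤ.* (c ℤ.* f ℤ.+ d ℤ.* e ℤ.+ d ℤ.* f)
  q = ℤ-solve-∀

⊛-identityˡ : ∀ x → 𝟏 ⊛ x ≡ x
⊛-identityˡ ⟨ a , b ⟩ = cong₂ ⟨_,_⟩ (p a b) (q a b)
  where
  p : ∀ a b → + 1 ℤ.* a ℤ.+ + 0 ℤ.* b ≡ a
  p = ℤ-solve-∀
  q : ∀ a b → + 1 ℤ.* b ℤ.+ + 0 ℤ.* a ℤ.+ + 0 ℤ.* b ≡ b
  q = ℤ-solve-∀

⊛-identityʳ : ∀ x → x ⊛ 𝟏 ≡ x
⊛-identityʳ x = trans (⊛-comm x 𝟏) (⊛-identityˡ x)

⊛-distribˡ : ∀ x y z → x ⊛ (y ⊕ z) ≡ x ⊛ y ⊕ x ⊛ z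
⊛-distribˡ ⟨ a , b ⟩ ⟨ c , d ⟩ ⟨ e , f ⟩ = cong₂ ⟨_,_⟩ (p a b c d e f) (q a b c d e f)
  where
  p : ∀ a b c d e f →
      a ℤ.* (c ℤ.+ e) ℤ.+ b ℤ.* (d ℤ.+ f) ≡
      (a ℤ.* c ℤ.+ b ℤ.* d) ℤ.+ (a ℤ.* e ℤ.+ b ℤ.* f)
  p = ℤ-solve-∀
  q : ∀ a b c d e f →
      a ℤ.* (d ℤ.+ f) ℤ.+ b ℤ.* (c ℤ.+ e) ℤ.+ b ℤ.* (d ℤ.+ f) ≡
      (a ℤ.* d ℤ.+ b ℤ.* c ℤ.+ b ℤ.* d) ℤ.+ (a ℤ.* f ℤ.+ b ℤ.* e ℤ.+ b ℤ.* f)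
  q = ℤ-solve-∀

⊛-distribʳ : ∀ x y z → (y ⊕ z) ⊛ x ≡ y ⊛ x ⊕ z ⊛ x
⊛-distribʳ x y z =
  trans (⊛-comm (y ⊕ z) x) (trans (⊛-distribˡ x y z) (cong₂ _⊕_ (⊛-comm x y) (⊛-comm x z)))

ℤ[φ]-commutativeRing : CommutativeRing 0ℓ 0ℓ
ℤ[φ]-commutativeRing = record
  { Carrier = ℤ[φ] ; _≈_ = _≡_ ; _+_ = _⊕_ ; _*_ = _⊛_ ; -_ = ⊝_ ; 0# = 𝟎 ; 1# = 𝟏
  ; isCommutativeRing = record
    { isRing = record
      { +-isAbelianGroup = record
        { isGroup = record
          { isMonoid = record
            { isSemigroup = record
              { isMagma = record { isEquivalence = isEquivalence ; ∙-cong = cong₂ _⊕_ }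
              ; assoc = ⊕-assoc }
            ; identity = ⊕-identityˡ , ⊕-identityʳ }
          ; inverse = ⊝-inverseˡ , ⊝-inverseʳ
          ; ⁻¹-cong = cong ⊝_ }
        ; comm = ⊕-comm }
      ; *-cong = cong₂ _⊛_
      ; *-assoc = ⊛-assoc
      ; *-identity = ⊛-identityˡ , ⊛-identityʳ
      ; distrib = ⊛-distribˡ , ⊛-distribʳ }
    ; *-comm = ⊛-comm } }

ring : AlmostCommutativeRing 0ℓ 0ℓ
ring = fromCommutativeRing ℤ[φ]-commutativeRing
  λ x → case 𝟎 ≟ x of λ { (yes p) → just p ; (no _) → nothing }

-- A real number a + bφ is positive if and only if multiplication by some
-- power of φ makes both of its coefficients natural numbers, not both zero.

data NatCoeffs : ℤ[φ] → Set where
  coeffs₁ : ∀ a b → NatCoeffs ⟨ + suc a , + b ⟩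
  coeffs₂ : ∀ a b → NatCoeffs ⟨ + a , + suc b ⟩

data Positive : ℤ[φ] → Set where
  coeffs  : ∀ {x} → NatCoeffs x → Positive x
  unscale : ∀ {x} → Positive (φ ⊛ x) → Positive x

Nonneg : ℤ[φ] → Set
Nonneg x = x ≡ 𝟎 ⊎ Positive x

φ-⊛ : ∀ a b → φ ⊛ ⟨ a , b ⟩ ≡ ⟨ b , a ℤ.+ b ⟩
φ-⊛ a b = cong₂ ⟨_,_⟩ (p a b) (q a b)
  where
  p : ∀ a b → + 0 ℤ.* a ℤ.+ + 1 ℤ.* b ≡ b
  p = ℤ-solve-∀
  q : ∀ a b → + 0 ℤ.* b ℤ.+ + 1 ℤ.* a ℤ.+ + 1 ℤ.* b ≡ a ℤ.+ b
  q = ℤ-solve-∀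

NatCoeffs-scale : ∀ {x} → NatCoeffs x → NatCoeffs (φ ⊛ x)
NatCoeffs-scale (coeffs₁ a b) = subst NatCoeffs (sym (φ-⊛ (+ suc a) (+ b))) (coeffs₂ b (a ℕ.+ b))
NatCoeffs-scale (coeffs₂ a b) = subst NatCoeffs (sym (φ-⊛ (+ a) (+ suc b))) (coeffs₁ b (a ℕ.+ suc b))

Positive-scale : ∀ {x} → Positive x → Positive (φ ⊛ x)
Positive-scale (coeffs p)  = coeffs (NatCoeffs-scale p)
Positive-scale (unscale p) = p

NatCoeffs-⊕ : ∀ {x y} → NatCoeffs x → NatCoeffs y → NatCoeffs (x ⊕ y)
NatCoeffs-⊕ (coeffs₁ a b) (coeffs₁ c d) = coeffs₁ _ _
NatCoeffs-⊕ (coeffs₁ a b) (coeffs₂ c d) = coeffs₁ _ _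
NatCoeffs-⊕ (coeffs₂ a b) (coeffs₁ c d) =
  subst (λ n → NatCoeffs ⟨ + n , + suc (b ℕ.+ d) ⟩) (sym (ℕ.+-suc a c)) (coeffs₁ _ _)
NatCoeffs-⊕ (coeffs₂ a b) (coeffs₂ c d) = coeffs₂ _ _

Positive-⊕ : ∀ {x y} → Positive x → Positive y → Positive (x ⊕ y)
Positive-⊕ {x} {y} (unscale p) q =
  unscale (subst Positive (sym (⊛-distribˡ φ x y)) (Positive-⊕ p (Positive-scale q)))
Positive-⊕ {x} {y} (coeffs p) q = go p q
  where
  go : ∀ {x y} → NatCoeffs x → Positive y → Positive (x ⊕ y)
  go p (coeffs q) = coeffs (NatCoeffs-⊕ p q)
  go {x} {y} p (unscale q) =
    unscale (subst Positive (sym (⊛-distribˡ φ x y)) (go (NatCoeffs-scale p) q))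

ℕ-⊛ : ∀ a b c d →
      ⟨ + a , + b ⟩ ⊛ ⟨ + c , + d ⟩ ≡
      ⟨ + (a ℕ.* c ℕ.+ b ℕ.* d) , + (a ℕ.* d ℕ.+ b ℕ.* c ℕ.+ b ℕ.* d) ⟩
ℕ-⊛ a b c d
  rewrite ℤ.+◃n≡+n (a ℕ.* c) | ℤ.+◃n≡+n (b ℕ.* d)
        | ℤ.+◃n≡+n (a ℕ.* d) | ℤ.+◃n≡+n (b ℕ.* c) = refl

NatCoeffs-⊛ : ∀ {x y} → NatCoeffs x → NatCoeffs y → NatCoeffs (x ⊛ y)
NatCoeffs-⊛ (coeffs₁ a b) (coeffs₁ c d) =
  subst NatCoeffs (sym (ℕ-⊛ (suc a) b (suc c) d)) (coeffs₁ _ _)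
NatCoeffs-⊛ (coeffs₁ a b) (coeffs₂ c d) =
  subst NatCoeffs (sym (ℕ-⊛ (suc a) b c (suc d))) (coeffs₂ _ _)
NatCoeffs-⊛ (coeffs₂ a b) (coeffs₁ c d) =
  subst NatCoeffs (trans (sym (ℕ-⊛ (suc c) d a (suc b))) (⊛-comm ⟨ + suc c , + d ⟩ ⟨ + a , + suc b ⟩)) (coeffs₂ _ _)
NatCoeffs-⊛ (coeffs₂ a b) (coeffs₂ c d) =
  subst NatCoeffs (sym (trans (ℕ-⊛ a (suc b) c (suc d))
    (cong (λ n → ⟨ + n , + (a ℕ.* suc d ℕ.+ suc b ℕ.* c ℕ.+ suc b ℕ.* suc d) ⟩)
      (ℕ.+-suc (a ℕ.* c) (d ℕ.+ b ℕ.* suc d)))))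
    (coeffs₁ _ _)

Positive-⊛ : ∀ {x y} → Positive x → Positive y → Positive (x ⊛ y)
Positive-⊛ {x} {y} (unscale p) q = unscale (subst Positive (⊛-assoc φ x y) (Positive-⊛ p q))
Positive-⊛ {x} {y} (coeffs p) q = go p q
  where
  x⊛φy : ∀ x y → x ⊛ (φ ⊛ y) ≡ φ ⊛ (x ⊛ y)
  x⊛φy = solve-∀ ring
  go : ∀ {x y} → NatCoeffs x → Positive y → Positive (x ⊛ y)
  go p (coeffs q) = coeffs (NatCoeffs-⊛ p q)
  go {x} {y} p (unscale q) = unscale (subst Positive (x⊛φy x y) (go p q))

¬Positive-𝟎 : ¬ Positive 𝟎
¬Positive-𝟎 = go refl
  where
  go : ∀ {x} → x ≡ 𝟎 → ¬ Positive x
  go () (coeffs (coeffs₁ a b))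
  go () (coeffs (coeffs₂ a b))
  go eq (unscale p) = go (cong (φ ⊛_) eq) p

-- Multiplication by φ takes m - nφ to - n + (m - n)φ.
alternating : ∀ k m n → m ℕ.+ n ℕ.≤ k →
  let x = ⟨ + m , ℤ.- + n ⟩ in x ≡ 𝟎 ⊎ Positive x ⊎ Positive (⊝ x)
alternating zero    zero    zero    _ = inj₁ refl
alternating zero    (suc m) n       ()
alternating (suc k) zero    zero    _ = inj₁ refl
alternating (suc k) (suc m) zero    _ = inj₂ (inj₁ (coeffs (coeffs₁ m 0)))
alternating (suc k) m       (suc n) m+n≤k with ℕ.≤-total m (suc n)
... | inj₁ m≤n with ℕ.m≤n⇒∃[o]m+o≡n m≤n
...   | l , m+l≡n = inj₂ (inj₂ (unscale (coeffs (subst NatCoeffs (sym eq) (coeffs₁ n l)))))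
  where
  p : ∀ m l → ℤ.- m ℤ.+ (m ℤ.+ l) ≡ l
  p = ℤ-solve-∀
  eq : φ ⊛ ⟨ ℤ.- + m , + suc n ⟩ ≡ ⟨ + suc n , + l ⟩
  eq = trans (φ-⊛ (ℤ.- + m) (+ suc n))
    (cong ⟨ + suc n ,_⟩ (trans (cong (λ j → ℤ.- + m ℤ.+ + j) (sym m+l≡n)) (p (+ m) (+ l))))
alternating (suc k) m       (suc n) m+n≤k | inj₂ n≤m with ℕ.m≤n⇒∃[o]m+o≡n n≤m
... | l , refl = next (alternating k (suc n) l
                        (ℕ.≤-trans (ℕ.m≤m+n (suc n ℕ.+ l) n)
                          (ℕ.≤-pred (subst (ℕ._≤ suc k) (ℕ.+-suc (suc n ℕ.+ l) n) m+n≤k))))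
  where
  p : ∀ n l → (n ℤ.+ l) ℤ.+ ℤ.- n ≡ l
  p = ℤ-solve-∀
  p′ : ∀ n l → ℤ.- (n ℤ.+ l) ℤ.+ n ≡ ℤ.- l
  p′ = ℤ-solve-∀
  eq : φ ⊛ ⟨ + suc n ℤ.+ + l , ℤ.- + suc n ⟩ ≡ ⟨ ℤ.- + suc n , ℤ.- ℤ.- + l ⟩
  eq = trans (φ-⊛ (+ suc n ℤ.+ + l) (ℤ.- + suc n))
         (cong ⟨ ℤ.- + suc n ,_⟩ (trans (p (+ suc n) (+ l)) (sym (ℤ.neg-involutive (+ l)))))
  eq′ : φ ⊛ ⟨ ℤ.- (+ suc n ℤ.+ + l) , + suc n ⟩ ≡ ⟨ + suc n , ℤ.- + l ⟩
  eq′ = trans (φ-⊛ (ℤ.- (+ suc n ℤ.+ + l)) (+ suc n)) (cong ⟨ + suc n ,_⟩ (p′ (+ suc n) (+ l)))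
  next : (let y = ⟨ + suc n , ℤ.- + l ⟩ in y ≡ 𝟎 ⊎ Positive y ⊎ Positive (⊝ y)) →
         (let x = ⟨ + suc n ℤ.+ + l , ℤ.- + suc n ⟩ in x ≡ 𝟎 ⊎ Positive x ⊎ Positive (⊝ x))
  next (inj₁ ())
  next (inj₂ (inj₁ q)) = inj₂ (inj₂ (unscale (subst Positive (sym eq′) q)))
  next (inj₂ (inj₂ q)) = inj₂ (inj₁ (unscale (subst Positive (sym eq) q)))

trichotomy : ∀ x → x ≡ 𝟎 ⊎ Positive x ⊎ Positive (⊝ x)
trichotomy ⟨ + zero , + zero ⟩ = inj₁ refl
trichotomy ⟨ + suc a , + b ⟩ = inj₂ (inj₁ (coeffs (coeffs₁ a b)))
trichotomy ⟨ + zero , + suc b ⟩ = inj₂ (inj₁ (coeffs (coeffs₂ zero b)))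
trichotomy ⟨ + a , -[1+ b ] ⟩ = alternating _ a (suc b) ℕ.≤-refl
trichotomy ⟨ -[1+ a ] , + b ⟩ with alternating _ (suc a) b ℕ.≤-refl
... | inj₁ ()
... | inj₂ (inj₁ p) = inj₂ (inj₂ p)
... | inj₂ (inj₂ p) = inj₂ (inj₁ (subst (λ i → Positive ⟨ -[1+ a ] , i ⟩) (ℤ.neg-involutive (+ b)) p))
trichotomy ⟨ -[1+ a ] , -[1+ b ] ⟩ = inj₂ (inj₂ (coeffs (coeffs₁ a (suc b))))

Nonneg-⊕ : ∀ {x y} → Nonneg x → Nonneg y → Nonneg (x ⊕ y)
Nonneg-⊕ {y = y} (inj₁ refl) q           = subst Nonneg (sym (⊕-identityˡ y)) q
Nonneg-⊕ {x = x} (inj₂ p)    (inj₁ refl) = inj₂ (subst Positive (sym (⊕-identityʳ x)) p)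
Nonneg-⊕         (inj₂ p)    (inj₂ q)    = inj₂ (Positive-⊕ p q)

Positive-⊕-Nonneg : ∀ {x y} → Positive x → Nonneg y → Positive (x ⊕ y)
Positive-⊕-Nonneg {x} p (inj₁ refl) = subst Positive (sym (⊕-identityʳ x)) p
Positive-⊕-Nonneg     p (inj₂ q)    = Positive-⊕ p q

⊛-zeroˡ : ∀ x → 𝟎 ⊛ x ≡ 𝟎
⊛-zeroˡ = solve-∀ ring

⊛-zeroʳ : ∀ x → x ⊛ 𝟎 ≡ 𝟎
⊛-zeroʳ = solve-∀ ring

Nonneg-⊛ : ∀ {x y} → Nonneg x → Nonneg y → Nonneg (x ⊛ y)
Nonneg-⊛ {y = y} (inj₁ refl) q           = inj₁ (⊛-zeroˡ y)
Nonneg-⊛ {x = x} (inj₂ p)    (inj₁ refl) = inj₁ (⊛-zeroʳ x)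
Nonneg-⊛         (inj₂ p)    (inj₂ q)    = inj₂ (Positive-⊛ p q)

⊝-⊛-⊝ : ∀ x y → ⊝ x ⊛ ⊝ y ≡ x ⊛ y
⊝-⊛-⊝ = solve-∀ ring

⊝-involutive : ∀ x → ⊝ ⊝ x ≡ x
⊝-involutive = solve-∀ ring

Nonneg-square : ∀ x → Nonneg (x ⊛ x)
Nonneg-square x with trichotomy x
... | inj₁ refl     = inj₁ refl
... | inj₂ (inj₁ p) = inj₂ (Positive-⊛ p p)
... | inj₂ (inj₂ p) = inj₂ (subst Positive (⊝-⊛-⊝ x x) (Positive-⊛ p p))

Nonneg∧Positive⊝⇒⊥ : ∀ {x} → Nonneg x → Positive (⊝ x) → ⊥
Nonneg∧Positive⊝⇒⊥ {x} p q = ¬Positive-𝟎 (subst Positive (⊝-inverseˡ x) (Positive-⊕-Nonneg q p))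

Nonneg-antisym : ∀ {x} → Nonneg x → Nonneg (⊝ x) → x ≡ 𝟎
Nonneg-antisym     (inj₁ eq) _         = eq
Nonneg-antisym {x} (inj₂ p)  (inj₂ q)  = ⊥-elim (Nonneg∧Positive⊝⇒⊥ (inj₂ p) q)
Nonneg-antisym {x} (inj₂ p)  (inj₁ eq) = trans (sym (⊝-involutive x)) (cong ⊝_ eq)

Nonneg-or-Positive⊝ : ∀ x → Nonneg x ⊎ Positive (⊝ x)
Nonneg-or-Positive⊝ x with trichotomy x
... | inj₁ eq       = inj₁ (inj₁ eq)
... | inj₂ (inj₁ p) = inj₁ (inj₂ p)
... | inj₂ (inj₂ p) = inj₂ p

Positive⇒≢𝟎 : ∀ {x} → Positive x → x ≢ 𝟎
Positive⇒≢𝟎 p refl = ¬Positive-𝟎 p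

-- The signs of the factors determine that of the product, so the order excludes zero divisors.
⊛-integral : ∀ x y → x ⊛ y ≡ 𝟎 → x ≡ 𝟎 ⊎ y ≡ 𝟎
⊛-integral x y xy≡𝟎 with trichotomy x | trichotomy y
... | inj₁ eq       | _             = inj₁ eq
... | inj₂ _        | inj₁ eq       = inj₂ eq
... | inj₂ (inj₁ p) | inj₂ (inj₁ q) = ⊥-elim (Positive⇒≢𝟎 (Positive-⊛ p q) xy≡𝟎)
... | inj₂ (inj₁ p) | inj₂ (inj₂ q) =
  ⊥-elim (Positive⇒≢𝟎 (subst Positive (e x y) (Positive-⊛ p q)) (cong ⊝_ xy≡𝟎))
  where
  e : ∀ x y → x ⊛ ⊝ y ≡ ⊝ (x ⊛ y)
  e = solve-∀ ring
... | inj₂ (inj₂ p) | inj₂ (inj₁ q) =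
  ⊥-elim (Positive⇒≢𝟎 (subst Positive (e x y) (Positive-⊛ p q)) (cong ⊝_ xy≡𝟎))
  where
  e : ∀ x y → ⊝ x ⊛ y ≡ ⊝ (x ⊛ y)
  e = solve-∀ ring
... | inj₂ (inj₂ p) | inj₂ (inj₂ q) =
  ⊥-elim (Positive⇒≢𝟎 (Positive-⊛ p q) (trans (⊝-⊛-⊝ x y) xy≡𝟎))

square≡𝟎⇒≡𝟎 : ∀ x → x ⊛ x ≡ 𝟎 → x ≡ 𝟎
square≡𝟎⇒≡𝟎 x eq with ⊛-integral x x eq
... | inj₁ p = p
... | inj₂ p = p

Positive-int : ∀ m → Positive (int m) → ∃[ k ] m ≡ + suc k
Positive-int (+ zero)  p = ⊥-elim (¬Positive-𝟎 p)
Positive-int (+ suc k) p = k , refl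
Positive-int -[1+ k ]  p = ⊥-elim (Nonneg∧Positive⊝⇒⊥ (inj₂ p) (coeffs (coeffs₁ k 0)))

-- Galois conjugation and lower bounds in ℤ[φ].

-- The nontrivial automorphism of ℤ[φ]: it sends φ to 1 - φ = -1/φ.
conj : ℤ[φ] → ℤ[φ]
conj ⟨ a , b ⟩ = ⟨ a ℤ.+ b , ℤ.- b ⟩

conj-⊕ : ∀ x y → conj (x ⊕ y) ≡ conj x ⊕ conj y
conj-⊕ ⟨ a , b ⟩ ⟨ c , d ⟩ = cong₂ ⟨_,_⟩ (p a b c d) (q b d)
  where
  p : ∀ a b c d → (a ℤ.+ c) ℤ.+ (b ℤ.+ d) ≡ (a ℤ.+ b) ℤ.+ (c ℤ.+ d)
  p = ℤ-solve-∀
  q : ∀ b d → ℤ.- (b ℤ.+ d) ≡ ℤ.- b ℤ.+ ℤ.- d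
  q = ℤ-solve-∀

conj-⊛ : ∀ x y → conj (x ⊛ y) ≡ conj x ⊛ conj y
conj-⊛ ⟨ a , b ⟩ ⟨ c , d ⟩ = cong₂ ⟨_,_⟩ (p a b c d) (q a b c d)
  where
  p : ∀ a b c d → (a ℤ.* c ℤ.+ b ℤ.* d) ℤ.+ (a ℤ.* d ℤ.+ b ℤ.* c ℤ.+ b ℤ.* d) ≡
                  (a ℤ.+ b) ℤ.* (c ℤ.+ d) ℤ.+ ℤ.- b ℤ.* ℤ.- d
  p = ℤ-solve-∀
  q : ∀ a b c d → ℤ.- (a ℤ.* d ℤ.+ b ℤ.* c ℤ.+ b ℤ.* d) ≡
                  (a ℤ.+ b) ℤ.* ℤ.- d ℤ.+ ℤ.- b ℤ.* (c ℤ.+ d) ℤ.+ ℤ.- b ℤ.* ℤ.- d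
  q = ℤ-solve-∀

conj≡𝟎⇒≡𝟎 : ∀ x → conj x ≡ 𝟎 → x ≡ 𝟎
conj≡𝟎⇒≡𝟎 ⟨ a , b ⟩ eq =
  cong₂ ⟨_,_⟩ (trans (p a b) (cong₂ ℤ._+_ (cong ℤ[φ].rational eq) (cong ℤ[φ].golden eq)))
              (trans (q b) (cong (λ x → ℤ.- ℤ[φ].golden x) eq))
  where
  p : ∀ a b → a ≡ (a ℤ.+ b) ℤ.+ ℤ.- b
  p = ℤ-solve-∀
  q : ∀ b → b ≡ ℤ.- ℤ.- b
  q = ℤ-solve-∀

norm : ℤ[φ] → ℤ
norm ⟨ a , b ⟩ = a ℤ.* a ℤ.+ a ℤ.* b ℤ.+ ℤ.- (b ℤ.* b)

⊛-conj : ∀ x → x ⊛ conj x ≡ int (norm x)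
⊛-conj ⟨ a , b ⟩ = cong₂ ⟨_,_⟩ (p a b) (q a b)
  where
  p : ∀ a b → a ℤ.* (a ℤ.+ b) ℤ.+ b ℤ.* ℤ.- b ≡ a ℤ.* a ℤ.+ a ℤ.* b ℤ.+ ℤ.- (b ℤ.* b)
  p = ℤ-solve-∀
  q : ∀ a b → a ℤ.* ℤ.- b ℤ.+ b ℤ.* (a ℤ.+ b) ℤ.+ b ℤ.* ℤ.- b ≡ + 0
  q = ℤ-solve-∀

int-square<1⇒≡0 : ∀ n → Positive (𝟏 ⊕ ⊝ (int n ⊛ int n)) → n ≡ + 0
int-square<1⇒≡0 n pos = go n (proj₂ (Positive-int _ (subst Positive (cong₂ ⟨_,_⟩ (p n) (q n)) pos)))
  where
  p : ∀ n → + 1 ℤ.+ ℤ.- (n ℤ.* n ℤ.+ + 0 ℤ.* + 0) ≡ + 1 ℤ.+ ℤ.- (n ℤ.* n)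
  p = ℤ-solve-∀
  q : ∀ n → + 0 ℤ.+ ℤ.- (n ℤ.* + 0 ℤ.+ + 0 ℤ.* n ℤ.+ + 0 ℤ.* + 0) ≡ + 0
  q = ℤ-solve-∀
  r : ∀ x → + 1 ≡ (+ 1 ℤ.+ ℤ.- x) ℤ.+ x
  r = ℤ-solve-∀
  absurd : ∀ k m → + 1 ≢ + suc k ℤ.+ + suc m
  absurd k m eq with trans (ℤ.+-injective eq) (cong suc (ℕ.+-suc k m))
  ... | ()
  go : ∀ n {k} → + 1 ℤ.+ ℤ.- (n ℤ.* n) ≡ + suc k → n ≡ + 0
  go (+ zero)  _  = refl
  go (+ suc j) {k} eq = ⊥-elim (absurd k _ (trans (r (+ suc j ℤ.* + suc j)) (cong (ℤ._+ (+ suc j ℤ.* + suc j)) eq)))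
  go -[1+ j ]  {k} eq = ⊥-elim (absurd k _ (trans (r (-[1+ j ] ℤ.* -[1+ j ])) (cong (ℤ._+ (-[1+ j ] ℤ.* -[1+ j ])) eq)))

⊛-squares : ∀ x y → (x ⊛ x) ⊛ (y ⊛ y) ≡ (x ⊛ y) ⊛ (x ⊛ y)
⊛-squares = solve-∀ ring

-- The square of the integer `norm x` is below 1, so the norm is 0; there are no zero divisors, and
-- `conj` is injective.
norm-lt-one : ∀ x → Positive (𝟏 ⊕ ⊝ ((x ⊛ x) ⊛ (conj x ⊛ conj x))) → x ≡ 𝟎
norm-lt-one x pos = case ⊛-integral x (conj x) x⊛conj≡𝟎 of λ
  { (inj₁ eq) → eq
  ; (inj₂ eq) → conj≡𝟎⇒≡𝟎 x eq }
  where
  squares : (x ⊛ x) ⊛ (conj x ⊛ conj x) ≡ int (norm x) ⊛ int (norm x)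
  squares = trans (⊛-squares x (conj x)) (cong (λ y → y ⊛ y) (⊛-conj x))
  x⊛conj≡𝟎 : x ⊛ conj x ≡ 𝟎
  x⊛conj≡𝟎 = trans (⊛-conj x) (cong int (int-square<1⇒≡0 (norm x)
    (subst (λ y → Positive (𝟏 ⊕ ⊝ y)) squares pos)))

-- As 1 - x² factors into (1 - x)(1 + x), both alternatives fail only if x² < 1, the case left to
-- the hypothesis.
outside-unit : ∀ x → (Positive (𝟏 ⊕ ⊝ (x ⊛ x)) → Nonneg (x ⊕ ⊝ 𝟏) ⊎ Nonneg (⊝ x ⊕ ⊝ 𝟏)) →
               Nonneg (x ⊕ ⊝ 𝟏) ⊎ Nonneg (⊝ x ⊕ ⊝ 𝟏)
outside-unit x inside with Nonneg-or-Positive⊝ (x ⊕ ⊝ 𝟏) | Nonneg-or-Positive⊝ (⊝ x ⊕ ⊝ 𝟏)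
... | inj₁ p | _      = inj₁ p
... | inj₂ _ | inj₁ q = inj₂ q
... | inj₂ p | inj₂ q = inside (subst Positive (e x) (Positive-⊛ p q))
  where
  e : ∀ x → ⊝ (x ⊕ ⊝ 𝟏) ⊛ ⊝ (⊝ x ⊕ ⊝ 𝟏) ≡ 𝟏 ⊕ ⊝ (x ⊛ x)
  e = solve-∀ ring

-- The norm of t is an integer, so it vanishes as soon as |t| < 1.
root-product-gap : ∀ t → Nonneg (𝟏 ⊕ ⊝ (conj t ⊛ conj t)) →
                   t ≡ 𝟎 ⊎ Nonneg (t ⊕ ⊝ 𝟏) ⊎ Nonneg (⊝ t ⊕ ⊝ 𝟏)
root-product-gap t bound with t ≟ 𝟎
... | yes eq = inj₁ eq
... | no t≢𝟎 = inj₂ (outside-unit t λ p → ⊥-elim (t≢𝟎 (norm-lt-one t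
  (subst Positive (e t (conj t)) (Positive-⊕-Nonneg p (Nonneg-⊛ (Nonneg-square t) bound))))))
  where
  e : ∀ t s → (𝟏 ⊕ ⊝ (t ⊛ t)) ⊕ (t ⊛ t) ⊛ (𝟏 ⊕ ⊝ (s ⊛ s)) ≡ 𝟏 ⊕ ⊝ ((t ⊛ t) ⊛ (s ⊛ s))
  e = solve-∀ ring

φ⁻³ : ℤ[φ]
φ⁻³ = ⟨ -[1+ 2 ] , + 2 ⟩

φ⁻³-Positive : Positive φ⁻³
φ⁻³-Positive = unscale (unscale (unscale (coeffs (coeffs₁ 0 0))))

-- The conjugate may exceed 1, so the norm alone does not decide. For y = p + qφ, x is m + q√5 with
-- m = 2p + 1 + q, and the squares of x and its conjugate add up to 2(m² + 5q²). If |x| < 1, this is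
-- below 1 + φ³ < 6, so q = 0 and x is an odd integer of absolute value below 1.
odd-gap : ∀ x y → x ≡ 𝟏 ⊕ 𝟐 ⊛ y →
          Nonneg (φ³ ⊕ ⊝ (conj x ⊛ conj x)) → Nonneg (x ⊕ ⊝ 𝟏) ⊎ Nonneg (⊝ x ⊕ ⊝ 𝟏)
odd-gap x ⟨ p , q ⟩ x≡ bound = outside-unit x (λ pos → ⊥-elim (inside pos))
  where
  m : ℤ
  m = + 2 ℤ.* p ℤ.+ + 1 ℤ.+ q
  odd : ∀ p → + 1 ℤ.+ + 2 ℤ.* p ≢ + 0
  odd (+ zero)    ()
  odd (+ suc n)   ()
  odd -[1+ zero ] ()
  odd -[1+ suc n ] ()
  trace₀ : let z = 𝟏 ⊕ 𝟐 ⊛ ⟨ p , q ⟩ in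
           z ⊛ z ⊕ conj z ⊛ conj z ≡ int (+ 2 ℤ.* (m ℤ.* m ℤ.+ + 5 ℤ.* (q ℤ.* q)))
  trace₀ = cong₂ ⟨_,_⟩ (t₁ p q) (t₂ p q)
    where
    t₁ : ∀ p q →
      let a = + 1 ℤ.+ (+ 2 ℤ.* p ℤ.+ + 0 ℤ.* q)
          b = + 0 ℤ.+ (+ 2 ℤ.* q ℤ.+ + 0 ℤ.* p ℤ.+ + 0 ℤ.* q)
          m = + 2 ℤ.* p ℤ.+ + 1 ℤ.+ q in
      (a ℤ.* a ℤ.+ b ℤ.* b) ℤ.+ ((a ℤ.+ b) ℤ.* (a ℤ.+ b) ℤ.+ ℤ.- b ℤ.* ℤ.- b) ≡
      + 2 ℤ.* (m ℤ.* m ℤ.+ + 5 ℤ.* (q ℤ.* q))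
    t₁ = ℤ-solve-∀
    t₂ : ∀ p q →
      let a = + 1 ℤ.+ (+ 2 ℤ.* p ℤ.+ + 0 ℤ.* q)
          b = + 0 ℤ.+ (+ 2 ℤ.* q ℤ.+ + 0 ℤ.* p ℤ.+ + 0 ℤ.* q) in
      (a ℤ.* b ℤ.+ b ℤ.* a ℤ.+ b ℤ.* b) ℤ.+
      ((a ℤ.+ b) ℤ.* ℤ.- b ℤ.+ ℤ.- b ℤ.* (a ℤ.+ b) ℤ.+ ℤ.- b ℤ.* ℤ.- b) ≡ + 0
    t₂ = ℤ-solve-∀
  trace : x ⊛ x ⊕ conj x ⊛ conj x ≡ int (+ 2 ℤ.* (m ℤ.* m ℤ.+ + 5 ℤ.* (q ℤ.* q)))
  trace = trans (cong (λ z → z ⊛ z ⊕ conj z ⊛ conj z) x≡) trace₀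
  square : ∀ i → i ℤ.* i ≡ + (ℤ.∣ i ∣ ℕ.* ℤ.∣ i ∣)
  square (+ n)    = ℤ.+◃n≡+n (n ℕ.* n)
  square -[1+ n ] = refl
  small : ∀ M Q k → + 6 ℤ.+ ℤ.- (+ 2 ℤ.* (+ M ℤ.+ + 5 ℤ.* + (Q ℕ.* Q))) ≡ + suc k → Q ≡ 0
  small M zero    k _  = refl
  small M (suc Q) k eq = ⊥-elim (ℕ.<⇒≱ (ℕ.m≤m+n 7 3) (ℕ.≤-trans le (ℕ.≤-reflexive (sym nat))))
    where
    S = suc Q ℕ.* suc Q
    r : ∀ x → + 6 ≡ (+ 6 ℤ.+ ℤ.- x) ℤ.+ x
    r = ℤ-solve-∀
    nat : 6 ≡ suc k ℕ.+ 2 ℕ.* (M ℕ.+ 5 ℕ.* S)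
    nat = ℤ.+-injective (trans (r (+ 2 ℤ.* (+ M ℤ.+ + 5 ℤ.* + S)))
      (trans (cong (ℤ._+ (+ 2 ℤ.* (+ M ℤ.+ + 5 ℤ.* + S))) eq)
        (cong (λ i → + suc k ℤ.+ i) (trans (cong (λ i → + 2 ℤ.* (+ M ℤ.+ i)) (sym (ℤ.pos-* 5 S)))
                                     (sym (ℤ.pos-* 2 (M ℕ.+ 5 ℕ.* S)))))))
    le : 10 ℕ.≤ suc k ℕ.+ 2 ℕ.* (M ℕ.+ 5 ℕ.* S)
    le = ℕ.≤-trans (ℕ.*-monoʳ-≤ 2 (ℕ.≤-trans (ℕ.*-monoʳ-≤ 5 (s≤s z≤n)) (ℕ.m≤n+m (5 ℕ.* S) M)))
           (ℕ.m≤n+m _ (suc k))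
  -- The constant 4 - 2φ is the difference 6 - (1 + φ³), which is positive.
  rearrange : ∀ s t → ((𝟏 ⊕ ⊝ s) ⊕ (φ³ ⊕ ⊝ t)) ⊕ ⟨ + 4 , -[1+ 1 ] ⟩ ≡ int (+ 6) ⊕ ⊝ (s ⊕ t)
  rearrange = solve-∀ ring
  bounded : ∀ s t → Positive (𝟏 ⊕ ⊝ s) → Nonneg (φ³ ⊕ ⊝ t) → Positive (int (+ 6) ⊕ ⊝ (s ⊕ t))
  bounded s t p q = subst Positive (rearrange s t)
    (Positive-⊕ {(𝟏 ⊕ ⊝ s) ⊕ (φ³ ⊕ ⊝ t)} {⟨ + 4 , -[1+ 1 ] ⟩}
      (Positive-⊕-Nonneg {𝟏 ⊕ ⊝ s} {φ³ ⊕ ⊝ t} p q) (unscale (unscale (coeffs (coeffs₁ 1 0)))))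
  inside : ¬ Positive (𝟏 ⊕ ⊝ (x ⊛ x))
  inside pos = odd p (int-square<1⇒≡0 (+ 1 ℤ.+ + 2 ℤ.* p)
                 (subst (λ y → Positive (𝟏 ⊕ ⊝ (y ⊛ y))) x≡int pos))
    where
    bounded′ : Positive (int (+ 6) ⊕ ⊝ int (+ 2 ℤ.* (m ℤ.* m ℤ.+ + 5 ℤ.* (q ℤ.* q))))
    bounded′ = subst (λ t → Positive (int (+ 6) ⊕ ⊝ t)) trace (bounded (x ⊛ x) (conj x ⊛ conj x) pos bound)
    q≡0 : q ≡ + 0
    q≡0 = ℤ.∣i∣≡0⇒i≡0 (small (ℤ.∣ m ∣ ℕ.* ℤ.∣ m ∣) ℤ.∣ q ∣ _ (trans
      (cong₂ (λ i j → + 6 ℤ.+ ℤ.- (+ 2 ℤ.* (i ℤ.+ + 5 ℤ.* j))) (sym (square m)) (sym (square q)))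
      (proj₂ (Positive-int (+ 6 ℤ.+ ℤ.- (+ 2 ℤ.* (m ℤ.* m ℤ.+ + 5 ℤ.* (q ℤ.* q)))) bounded′))))
    x₁ : ∀ p → + 1 ℤ.+ (+ 2 ℤ.* p ℤ.+ + 0 ℤ.* + 0) ≡ + 1 ℤ.+ + 2 ℤ.* p
    x₁ = ℤ-solve-∀
    x₂ : ∀ p → + 0 ℤ.+ (+ 2 ℤ.* + 0 ℤ.+ + 0 ℤ.* p ℤ.+ + 0 ℤ.* + 0) ≡ + 0
    x₂ = ℤ-solve-∀
    x≡int : x ≡ int (+ 1 ℤ.+ + 2 ℤ.* p)
    x≡int = trans x≡ (trans (cong (λ q → 𝟏 ⊕ 𝟐 ⊛ ⟨ p , q ⟩) q≡0) (cong₂ ⟨_,_⟩ (x₁ p) (x₂ p)))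

-- Since |norm x| ≥ 1, a bound on the conjugate of x bounds x away from 0.
conj-bounded-gap : ∀ x → Positive x → Nonneg (int (+ 4) ⊛ φ³ ⊕ ⊝ (conj x ⊛ conj x)) → Nonneg (x ⊕ ⊝ φ⁻³)
conj-bounded-gap x pos bound with Nonneg-or-Positive⊝ (x ⊕ ⊝ φ⁻³)
... | inj₁ p = p
... | inj₂ q = ⊥-elim (Positive⇒≢𝟎 pos (norm-lt-one x (combine φ⁻³ (int (+ 4) ⊛ φ³) (conj x)
        -- The gap φ⁻³ is small enough because 1 - φ⁻⁶ · 4φ³ = 1 - 4φ⁻³ = φ⁻⁶ is positive; six
        -- multiplications by φ turn it into 1.
        (unscale (unscale (unscale (unscale (unscale (unscale (coeffs (coeffs₁ 0 0)))))))
        ) bound q φ⁻³-Positive)))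
  where
  e : ∀ d b x y → ((𝟏 ⊕ ⊝ ((d ⊛ d) ⊛ b)) ⊕ (d ⊛ d) ⊛ (b ⊕ ⊝ (y ⊛ y))) ⊕
                  (⊝ (x ⊕ ⊝ d) ⊛ (x ⊕ d)) ⊛ (y ⊛ y) ≡ 𝟏 ⊕ ⊝ ((x ⊛ x) ⊛ (y ⊛ y))
  e = solve-∀ ring
  combine : ∀ d b y → Positive (𝟏 ⊕ ⊝ ((d ⊛ d) ⊛ b)) → Nonneg (b ⊕ ⊝ (y ⊛ y)) →
            Positive (⊝ (x ⊕ ⊝ d)) → Positive d → Positive (𝟏 ⊕ ⊝ ((x ⊛ x) ⊛ (y ⊛ y)))
  combine d b y u v q d>0 = subst Positive (e d b x y)
    (Positive-⊕-Nonneg {(𝟏 ⊕ ⊝ ((d ⊛ d) ⊛ b)) ⊕ (d ⊛ d) ⊛ (b ⊕ ⊝ (y ⊛ y))} {(⊝ (x ⊕ ⊝ d) ⊛ (x ⊕ d)) ⊛ (y ⊛ y)}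
      (Positive-⊕-Nonneg {𝟏 ⊕ ⊝ ((d ⊛ d) ⊛ b)} {(d ⊛ d) ⊛ (b ⊕ ⊝ (y ⊛ y))} u
        (Nonneg-⊛ {d ⊛ d} {b ⊕ ⊝ (y ⊛ y)} (Nonneg-square d) v))
      (Nonneg-⊛ {⊝ (x ⊕ ⊝ d) ⊛ (x ⊕ d)} {y ⊛ y}
        (inj₂ (Positive-⊛ {⊝ (x ⊕ ⊝ d)} {x ⊕ d} q (Positive-⊕ {x} {d} pos d>0))) (Nonneg-square y)))

-- Linear algebra of the Lorentzian form and its reflections.

infixl 6 _+ᵥ_ _-ᵥ_
infixl 7 _·ᵥ_

_+ᵥ_ : ∀ {n} → Vec ℤ[φ] n → Vec ℤ[φ] n → Vec ℤ[φ] n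
_+ᵥ_ = Vec.zipWith _⊕_

_·ᵥ_ : ∀ {n} → ℤ[φ] → Vec ℤ[φ] n → Vec ℤ[φ] n
c ·ᵥ x = Vec.map (c ⊛_) x

_-ᵥ_ : ∀ {n} → Vec ℤ[φ] n → Vec ℤ[φ] n → Vec ℤ[φ] n
x -ᵥ y = x +ᵥ -𝟏 ·ᵥ y

0ᵥ : ∀ {n} → Vec ℤ[φ] n
0ᵥ = Vec.replicate _ 𝟎

+ᵥ-assoc : ∀ {n} (x y z : Vec ℤ[φ] n) → (x +ᵥ y) +ᵥ z ≡ x +ᵥ (y +ᵥ z)
+ᵥ-assoc []      []      []      = refl
+ᵥ-assoc (a ∷ x) (b ∷ y) (c ∷ z) = cong₂ _∷_ (⊕-assoc a b c) (+ᵥ-assoc x y z)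

+ᵥ-comm : ∀ {n} (x y : Vec ℤ[φ] n) → x +ᵥ y ≡ y +ᵥ x
+ᵥ-comm []      []      = refl
+ᵥ-comm (a ∷ x) (b ∷ y) = cong₂ _∷_ (⊕-comm a b) (+ᵥ-comm x y)

+ᵥ-identityʳ : ∀ {n} (x : Vec ℤ[φ] n) → x +ᵥ 0ᵥ ≡ x
+ᵥ-identityʳ []      = refl
+ᵥ-identityʳ (a ∷ x) = cong₂ _∷_ (⊕-identityʳ a) (+ᵥ-identityʳ x)

·ᵥ-distribˡ : ∀ {n} c (x y : Vec ℤ[φ] n) → c ·ᵥ (x +ᵥ y) ≡ c ·ᵥ x +ᵥ c ·ᵥ y
·ᵥ-distribˡ c []      []      = refl
·ᵥ-distribˡ c (a ∷ x) (b ∷ y) = cong₂ _∷_ (⊛-distribˡ c a b) (·ᵥ-distribˡ c x y)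

·ᵥ-assoc : ∀ {n} a b (x : Vec ℤ[φ] n) → (a ⊛ b) ·ᵥ x ≡ a ·ᵥ (b ·ᵥ x)
·ᵥ-assoc a b []      = refl
·ᵥ-assoc a b (c ∷ x) = cong₂ _∷_ (⊛-assoc a b c) (·ᵥ-assoc a b x)

·ᵥ-identityˡ : ∀ {n} (x : Vec ℤ[φ] n) → 𝟏 ·ᵥ x ≡ x
·ᵥ-identityˡ []      = refl
·ᵥ-identityˡ (c ∷ x) = cong₂ _∷_ (⊛-identityˡ c) (·ᵥ-identityˡ x)

·ᵥ-zeroˡ : ∀ {n} (x : Vec ℤ[φ] n) → 𝟎 ·ᵥ x ≡ 0ᵥ
·ᵥ-zeroˡ []      = refl
·ᵥ-zeroˡ (c ∷ x) = cong₂ _∷_ (⊛-zeroˡ c) (·ᵥ-zeroˡ x)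

x-y≡0⇒x≡y : ∀ {n} (x y : Vec ℤ[φ] n) → x -ᵥ y ≡ 0ᵥ → x ≡ y
x-y≡0⇒x≡y []      []      _  = refl
x-y≡0⇒x≡y (a ∷ x) (b ∷ y) eq = cong₂ _∷_
  (trans (e a b) (trans (cong (_⊕ b) (cong Vec.head eq)) (⊕-identityˡ b)))
  (x-y≡0⇒x≡y x y (cong Vec.tail eq))
  where
  e : ∀ a b → a ≡ (a ⊕ -𝟏 ⊛ b) ⊕ b
  e = solve-∀ ring

-- Length and weights are arbitrary so that bilinearity goes by induction. `⟪_,_⟫` is the instance
-- at `weights`; `conj-form` also uses the one at the conjugate weights.
form : ∀ {n} → Vec ℤ[φ] n → Vec ℤ[φ] n → Vec ℤ[φ] n → ℤ[φ]
form d x y = Vec.foldr′ _⊕_ 𝟎 (Vec.zipWith _⊛_ d (Vec.zipWith _⊛_ x y))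

form-+ˡ : ∀ {n} (d x y z : Vec ℤ[φ] n) → form d (x +ᵥ y) z ≡ form d x z ⊕ form d y z
form-+ˡ []      []      []      []      = refl
form-+ˡ (d ∷ ds) (a ∷ x) (b ∷ y) (c ∷ z) =
  trans (cong (d ⊛ ((a ⊕ b) ⊛ c) ⊕_) (form-+ˡ ds x y z)) (e d a b c (form ds x z) (form ds y z))
  where
  e : ∀ d a b c p q → d ⊛ ((a ⊕ b) ⊛ c) ⊕ (p ⊕ q) ≡ (d ⊛ (a ⊛ c) ⊕ p) ⊕ (d ⊛ (b ⊛ c) ⊕ q)
  e = solve-∀ ring

form-·ˡ : ∀ {n} (d : Vec ℤ[φ] n) k (x z : Vec ℤ[φ] n) → form d (k ·ᵥ x) z ≡ k ⊛ form d x z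
form-·ˡ []       k []      []      = sym (⊛-zeroʳ k)
form-·ˡ (d ∷ ds) k (a ∷ x) (c ∷ z) =
  trans (cong (d ⊛ ((k ⊛ a) ⊛ c) ⊕_) (form-·ˡ ds k x z)) (e d k a c (form ds x z))
  where
  e : ∀ d k a c p → d ⊛ ((k ⊛ a) ⊛ c) ⊕ k ⊛ p ≡ k ⊛ (d ⊛ (a ⊛ c) ⊕ p)
  e = solve-∀ ring

form-comm : ∀ {n} (d x y : Vec ℤ[φ] n) → form d x y ≡ form d y x
form-comm []       []      []      = refl
form-comm (d ∷ ds) (a ∷ x) (b ∷ y) = cong₂ _⊕_ (cong (d ⊛_) (⊛-comm a b)) (form-comm ds x y)

weights : Point
weights = ⊝ φ³ ∷ 𝟏 ∷ 𝟏 ∷ 𝟏 ∷ 𝟏 ∷ []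

⟪⟫-+ˡ : ∀ x y z → ⟪ x +ᵥ y , z ⟫ ≡ ⟪ x , z ⟫ ⊕ ⟪ y , z ⟫
⟪⟫-+ˡ = form-+ˡ weights

⟪⟫-·ˡ : ∀ k x z → ⟪ k ·ᵥ x , z ⟫ ≡ k ⊛ ⟪ x , z ⟫
⟪⟫-·ˡ = form-·ˡ weights

⟪⟫-comm : ∀ x y → ⟪ x , y ⟫ ≡ ⟪ y , x ⟫
⟪⟫-comm = form-comm weights

⟪⟫-+ʳ : ∀ x y z → ⟪ x , y +ᵥ z ⟫ ≡ ⟪ x , y ⟫ ⊕ ⟪ x , z ⟫
⟪⟫-+ʳ x y z = trans (⟪⟫-comm x (y +ᵥ z))
  (trans (⟪⟫-+ˡ y z x) (cong₂ _⊕_ (⟪⟫-comm y x) (⟪⟫-comm z x)))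

⟪⟫-·ʳ : ∀ k x z → ⟪ x , k ·ᵥ z ⟫ ≡ k ⊛ ⟪ x , z ⟫
⟪⟫-·ʳ k x z = trans (⟪⟫-comm x (k ·ᵥ z)) (trans (⟪⟫-·ˡ k z x) (cong (k ⊛_) (⟪⟫-comm z x)))

⟪⟫-zeroˡ : ∀ x → ⟪ 0ᵥ , x ⟫ ≡ 𝟎
⟪⟫-zeroˡ x = trans (cong ⟪_, x ⟫ (sym (·ᵥ-zeroˡ (0ᵥ {5}))))
                   (trans (⟪⟫-·ˡ 𝟎 0ᵥ x) (⊛-zeroˡ ⟪ 0ᵥ , x ⟫))

reflect-coefficient : Fin 5 → Point → ℤ[φ]
reflect-coefficient i x = ⊝ (κ i ⊛ ⟪ normal i , x ⟫)

reflect-formula : ∀ i x → reflect i x ≡ x +ᵥ reflect-coefficient i x ·ᵥ normal i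
reflect-formula i x = go (κ i ⊛ ⟪ normal i , x ⟫) x (normal i)
  where
  e : ∀ a c b → a ⊕ ⊝ (c ⊛ b) ≡ a ⊕ ⊝ c ⊛ b
  e = solve-∀ ring
  go : ∀ {n} c (x y : Vec ℤ[φ] n) → Vec.zipWith (λ a b → a ⊕ ⊝ (c ⊛ b)) x y ≡ x +ᵥ ⊝ c ·ᵥ y
  go c []      []      = refl
  go c (a ∷ x) (b ∷ y) = cong₂ _∷_ (e a c b) (go c x y)

κ-normal : ∀ i → κ i ⊛ ⟪ normal i , normal i ⟫ ≡ 𝟐
κ-normal zero = refl
κ-normal (suc zero) = refl
κ-normal (suc (suc zero)) = refl
κ-normal (suc (suc (suc zero))) = refl
κ-normal (suc (suc (suc (suc zero)))) = refl

reflect-+ᵥ : ∀ i x y → reflect i (x +ᵥ y) ≡ reflect i x +ᵥ reflect i y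
reflect-+ᵥ i x y = trans (reflect-formula i (x +ᵥ y))
  (trans (cong (λ t → (x +ᵥ y) +ᵥ t ·ᵥ normal i)
           (trans (cong (λ t → ⊝ (κ i ⊛ t)) (⟪⟫-+ʳ (normal i) x y))
                  (e (κ i) ⟪ normal i , x ⟫ ⟪ normal i , y ⟫)))
  (trans (go x y (normal i) (reflect-coefficient i x) (reflect-coefficient i y))
         (sym (cong₂ _+ᵥ_ (reflect-formula i x) (reflect-formula i y)))))
  where
  e : ∀ k a b → ⊝ (k ⊛ (a ⊕ b)) ≡ ⊝ (k ⊛ a) ⊕ ⊝ (k ⊛ b)
  e = solve-∀ ring
  f : ∀ a b c p q → (a ⊕ b) ⊕ (p ⊕ q) ⊛ c ≡ (a ⊕ p ⊛ c) ⊕ (b ⊕ q ⊛ c)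
  f = solve-∀ ring
  go : ∀ {n} (x y z : Vec ℤ[φ] n) p q → (x +ᵥ y) +ᵥ (p ⊕ q) ·ᵥ z ≡ (x +ᵥ p ·ᵥ z) +ᵥ (y +ᵥ q ·ᵥ z)
  go []      []      []      p q = refl
  go (a ∷ x) (b ∷ y) (c ∷ z) p q = cong₂ _∷_ (f a b c p q) (go x y z p q)

reflect-·ᵥ : ∀ i k x → reflect i (k ·ᵥ x) ≡ k ·ᵥ reflect i x
reflect-·ᵥ i k x = trans (reflect-formula i (k ·ᵥ x))
  (trans (cong (λ t → k ·ᵥ x +ᵥ t ·ᵥ normal i)
           (trans (cong (λ t → ⊝ (κ i ⊛ t)) (⟪⟫-·ʳ k (normal i) x))
                  (e (κ i) k ⟪ normal i , x ⟫)))
  (trans (go x (normal i) k (reflect-coefficient i x))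
         (sym (cong (k ·ᵥ_) (reflect-formula i x)))))
  where
  e : ∀ c k a → ⊝ (c ⊛ (k ⊛ a)) ≡ k ⊛ ⊝ (c ⊛ a)
  e = solve-∀ ring
  f : ∀ a c k p → k ⊛ a ⊕ (k ⊛ p) ⊛ c ≡ k ⊛ (a ⊕ p ⊛ c)
  f = solve-∀ ring
  go : ∀ {n} (x z : Vec ℤ[φ] n) k p → k ·ᵥ x +ᵥ (k ⊛ p) ·ᵥ z ≡ k ·ᵥ (x +ᵥ p ·ᵥ z)
  go []      []      k p = refl
  go (a ∷ x) (c ∷ z) k p = cong₂ _∷_ (f a c k p) (go x z k p)

⟪⟫-+·-+· : ∀ x y n a b → ⟪ x +ᵥ a ·ᵥ n , y +ᵥ b ·ᵥ n ⟫ ≡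
           (⟪ x , y ⟫ ⊕ b ⊛ ⟪ n , x ⟫) ⊕ a ⊛ (⟪ n , y ⟫ ⊕ b ⊛ ⟪ n , n ⟫)
⟪⟫-+·-+· x y n a b = trans (⟪⟫-+ˡ x (a ·ᵥ n) (y +ᵥ b ·ᵥ n)) (cong₂ _⊕_
  (trans (⟪⟫-+ʳ x y (b ·ᵥ n)) (cong (⟪ x , y ⟫ ⊕_) (trans (⟪⟫-·ʳ b x n) (cong (b ⊛_) (⟪⟫-comm x n)))))
  (trans (⟪⟫-·ˡ a n (y +ᵥ b ·ᵥ n)) (cong (a ⊛_)
    (trans (⟪⟫-+ʳ n y (b ·ᵥ n)) (cong (⟪ n , y ⟫ ⊕_) (⟪⟫-·ʳ b n n))))))

reflect-isometry : ∀ i x y → ⟪ reflect i x , reflect i y ⟫ ≡ ⟪ x , y ⟫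
reflect-isometry i x y = trans (cong₂ ⟪_,_⟫ (reflect-formula i x) (reflect-formula i y))
  (trans (⟪⟫-+·-+· x y (normal i) (reflect-coefficient i x) (reflect-coefficient i y))
  (trans (e (κ i) ⟪ normal i , x ⟫ ⟪ normal i , y ⟫ ⟪ normal i , normal i ⟫ ⟪ x , y ⟫)
  (trans (cong (λ t → ⟪ x , y ⟫ ⊕ (κ i ⊛ ⟪ normal i , x ⟫ ⊛ ⟪ normal i , y ⟫) ⊛ (t ⊕ ⊝ 𝟐)) (κ-normal i))
         (f ⟪ x , y ⟫ (κ i ⊛ ⟪ normal i , x ⟫ ⊛ ⟪ normal i , y ⟫)))))
  where
  e : ∀ k p q m s → (s ⊕ ⊝ (k ⊛ q) ⊛ p) ⊕ ⊝ (k ⊛ p) ⊛ (q ⊕ ⊝ (k ⊛ q) ⊛ m) ≡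
                    s ⊕ (k ⊛ p ⊛ q) ⊛ (k ⊛ m ⊕ ⊝ 𝟐)
  e = solve-∀ ring
  f : ∀ s t → s ⊕ t ⊛ (𝟐 ⊕ ⊝ 𝟐) ≡ s
  f = solve-∀ ring

reflect-involutive : ∀ i x → reflect i (reflect i x) ≡ x
reflect-involutive i x = trans (reflect-formula i (reflect i x))
  (trans (cong₂ (λ y t → y +ᵥ t ·ᵥ normal i) (reflect-formula i x) coefficient)
         (go x (normal i) (reflect-coefficient i x)))
  where
  n = normal i
  e : ∀ k p m → ⊝ (k ⊛ (p ⊕ ⊝ (k ⊛ p) ⊛ m)) ≡ (k ⊛ m) ⊛ (k ⊛ p) ⊕ ⊝ (k ⊛ p)
  e = solve-∀ ring
  f : ∀ s → 𝟐 ⊛ s ⊕ ⊝ s ≡ ⊝ ⊝ s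
  f = solve-∀ ring
  coefficient : reflect-coefficient i (reflect i x) ≡ ⊝ reflect-coefficient i x
  coefficient = trans (cong (λ t → ⊝ (κ i ⊛ t)) (trans (cong ⟪ n ,_⟫ (reflect-formula i x))
      (trans (⟪⟫-+ʳ n x (reflect-coefficient i x ·ᵥ n))
             (cong (⟪ n , x ⟫ ⊕_) (⟪⟫-·ʳ (reflect-coefficient i x) n n)))))
    (trans (e (κ i) ⟪ n , x ⟫ ⟪ n , n ⟫)
    (trans (cong (λ t → t ⊛ (κ i ⊛ ⟪ n , x ⟫) ⊕ ⊝ (κ i ⊛ ⟪ n , x ⟫)) (κ-normal i))
           (f (κ i ⊛ ⟪ n , x ⟫))))
  g : ∀ a b c → (a ⊕ c ⊛ b) ⊕ ⊝ c ⊛ b ≡ a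
  g = solve-∀ ring
  go : ∀ {n} (x y : Vec ℤ[φ] n) c → (x +ᵥ c ·ᵥ y) +ᵥ ⊝ c ·ᵥ y ≡ x
  go []      []      c = refl
  go (a ∷ x) (b ∷ y) c = cong₂ _∷_ (g a b c) (go x y c)

Word : Set
Word = List (Fin 5)

▷-+ᵥ : ∀ w x y → w ▷ (x +ᵥ y) ≡ w ▷ x +ᵥ w ▷ y
▷-+ᵥ []      x y = refl
▷-+ᵥ (i ∷ w) x y = trans (cong (reflect i) (▷-+ᵥ w x y)) (reflect-+ᵥ i (w ▷ x) (w ▷ y))

▷-·ᵥ : ∀ w k x → w ▷ (k ·ᵥ x) ≡ k ·ᵥ (w ▷ x)
▷-·ᵥ []      k x = refl
▷-·ᵥ (i ∷ w) k x = trans (cong (reflect i) (▷-·ᵥ w k x)) (reflect-·ᵥ i k (w ▷ x))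

▷-isometry : ∀ w x y → ⟪ w ▷ x , w ▷ y ⟫ ≡ ⟪ x , y ⟫
▷-isometry []      x y = refl
▷-isometry (i ∷ w) x y = trans (reflect-isometry i (w ▷ x) (w ▷ y)) (▷-isometry w x y)

▷-++ : ∀ w w′ x → (w ++ w′) ▷ x ≡ w ▷ w′ ▷ x
▷-++ w w′ x = List.foldr-++ reflect x w w′

▷-reverse : ∀ w x → reverse w ▷ w ▷ x ≡ x
▷-reverse []      x = refl
▷-reverse (i ∷ w) x = trans (cong (_▷ reflect i (w ▷ x)) (List.unfold-reverse i w))
  (trans (▷-++ (reverse w) (i ∷ []) (reflect i (w ▷ x)))
  (trans (cong (reverse w ▷_) (reflect-involutive i (w ▷ x))) (▷-reverse w x)))

▷-reverse′ : ∀ w x → w ▷ reverse w ▷ x ≡ x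
▷-reverse′ w x = trans (cong (_▷ reverse w ▷ x) (sym (List.reverse-involutive w))) (▷-reverse (reverse w) x)

▷-injective : ∀ w {x y} → w ▷ x ≡ w ▷ y → x ≡ y
▷-injective w {x} {y} eq = trans (sym (▷-reverse w x)) (trans (cong (reverse w ▷_) eq) (▷-reverse w y))

⟪⟫-transpose : ∀ w x y → ⟪ w ▷ x , y ⟫ ≡ ⟪ x , reverse w ▷ y ⟫
⟪⟫-transpose w x y = trans (cong ⟪ w ▷ x ,_⟫ (sym (▷-reverse′ w y))) (▷-isometry w x (reverse w ▷ y))

-- The future cone.

Nonneg-+≡𝟎ˡ : ∀ {x y} → Nonneg x → Nonneg y → x ⊕ y ≡ 𝟎 → x ≡ 𝟎
Nonneg-+≡𝟎ˡ {x} {y} p q eq = Nonneg-antisym p (subst Nonneg (e x y eq) q)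
  where
  f : ∀ x y → y ≡ (x ⊕ y) ⊕ ⊝ x
  f = solve-∀ ring
  e : ∀ x y → x ⊕ y ≡ 𝟎 → y ≡ ⊝ x
  e x y eq = trans (f x y) (trans (cong (_⊕ ⊝ x) eq) (⊕-identityˡ (⊝ x)))

Nonneg-+≡𝟎ʳ : ∀ {x y} → Nonneg x → Nonneg y → x ⊕ y ≡ 𝟎 → y ≡ 𝟎
Nonneg-+≡𝟎ʳ {x} {y} p q eq = Nonneg-+≡𝟎ˡ {y} {x} q p (trans (⊕-comm y x) eq)

-- A timelike vector has nonzero first coordinate, so this is the open future cone.
Future : Point → Set
Future x = Nonneg (Vec.head x) × Positive (⊝ ⟪ x , x ⟫)

-- The reverse Cauchy–Schwarz inequality, with the equality case.
causal-zero₊ : ∀ x y → Future x → Nonneg (⊝ ⟪ y , y ⟫) → Nonneg ⟪ y , x ⟫ →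
               Nonneg (Vec.head y) → y ≡ 0ᵥ
causal-zero₊ (x₀ ∷ x₁ ∷ x₂ ∷ x₃ ∷ x₄ ∷ []) (y₀ ∷ y₁ ∷ y₂ ∷ y₃ ∷ y₄ ∷ [])
             (x₀≥0 , c>0) n≥0 p′≥0 y₀≥0 =
  zeros (square≡𝟎⇒≡𝟎 y₀ y₀²≡𝟎) (squares≡𝟎 y₁ y₂ y₃ y₄ (Nonneg-antisym Y≥0 (subst (λ t → Nonneg (⊝ t)) Y-eq n≥0)))
  where
  X = x₁ ⊛ x₁ ⊕ x₂ ⊛ x₂ ⊕ x₃ ⊛ x₃ ⊕ x₄ ⊛ x₄
  Y = y₁ ⊛ y₁ ⊕ y₂ ⊛ y₂ ⊕ y₃ ⊛ y₃ ⊕ y₄ ⊛ y₄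
  P = y₁ ⊛ x₁ ⊕ y₂ ⊛ x₂ ⊕ y₃ ⊛ x₃ ⊕ y₄ ⊛ x₄
  expand : ∀ f a₀ b₀ a₁ b₁ a₂ b₂ a₃ b₃ a₄ b₄ →
    f ⊛ (a₀ ⊛ b₀) ⊕ (𝟏 ⊛ (a₁ ⊛ b₁) ⊕ (𝟏 ⊛ (a₂ ⊛ b₂) ⊕ (𝟏 ⊛ (a₃ ⊛ b₃) ⊕ (𝟏 ⊛ (a₄ ⊛ b₄) ⊕ 𝟎)))) ≡
    (a₁ ⊛ b₁ ⊕ a₂ ⊛ b₂ ⊕ a₃ ⊛ b₃ ⊕ a₄ ⊛ b₄) ⊕ f ⊛ (a₀ ⊛ b₀)
  expand = solve-∀ ring
  cauchy : ∀ a b c d x y z w →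
    (x ⊛ x ⊕ y ⊛ y ⊕ z ⊛ z ⊕ w ⊛ w) ⊛ (a ⊛ a ⊕ b ⊛ b ⊕ c ⊛ c ⊕ d ⊛ d) ⊕
      ⊝ ((a ⊛ x ⊕ b ⊛ y ⊕ c ⊛ z ⊕ d ⊛ w) ⊛ (a ⊛ x ⊕ b ⊛ y ⊕ c ⊛ z ⊕ d ⊛ w)) ≡
    (a ⊛ y ⊕ ⊝ (b ⊛ x)) ⊛ (a ⊛ y ⊕ ⊝ (b ⊛ x)) ⊕
    (a ⊛ z ⊕ ⊝ (c ⊛ x)) ⊛ (a ⊛ z ⊕ ⊝ (c ⊛ x)) ⊕
    (a ⊛ w ⊕ ⊝ (d ⊛ x)) ⊛ (a ⊛ w ⊕ ⊝ (d ⊛ x)) ⊕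
    (b ⊛ z ⊕ ⊝ (c ⊛ y)) ⊛ (b ⊛ z ⊕ ⊝ (c ⊛ y)) ⊕
    (b ⊛ w ⊕ ⊝ (d ⊛ y)) ⊛ (b ⊛ w ⊕ ⊝ (d ⊛ y)) ⊕
    (c ⊛ w ⊕ ⊝ (d ⊛ z)) ⊛ (c ⊛ w ⊕ ⊝ (d ⊛ z))
  cauchy = solve-∀ ring
  sum-of-squares : ∀ a b c d e f → Nonneg (a ⊛ a ⊕ b ⊛ b ⊕ c ⊛ c ⊕ d ⊛ d ⊕ e ⊛ e ⊕ f ⊛ f)
  sum-of-squares a b c d e f =
    Nonneg-⊕ {a ⊛ a ⊕ b ⊛ b ⊕ c ⊛ c ⊕ d ⊛ d ⊕ e ⊛ e} {f ⊛ f}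
      (Nonneg-⊕ {a ⊛ a ⊕ b ⊛ b ⊕ c ⊛ c ⊕ d ⊛ d} {e ⊛ e}
        (Nonneg-⊕ {a ⊛ a ⊕ b ⊛ b ⊕ c ⊛ c} {d ⊛ d}
          (Nonneg-⊕ {a ⊛ a ⊕ b ⊛ b} {c ⊛ c}
            (Nonneg-⊕ {a ⊛ a} {b ⊛ b} (Nonneg-square a) (Nonneg-square b))
            (Nonneg-square c)) (Nonneg-square d)) (Nonneg-square e)) (Nonneg-square f)
  sum₄ : ∀ a b c d → Nonneg (a ⊛ a ⊕ b ⊛ b ⊕ c ⊛ c ⊕ d ⊛ d)
  sum₄ a b c d =
    Nonneg-⊕ {a ⊛ a ⊕ b ⊛ b ⊕ c ⊛ c} {d ⊛ d}
      (Nonneg-⊕ {a ⊛ a ⊕ b ⊛ b} {c ⊛ c}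
        (Nonneg-⊕ {a ⊛ a} {b ⊛ b} (Nonneg-square a) (Nonneg-square b))
        (Nonneg-square c)) (Nonneg-square d)
  squares≡𝟎 : ∀ a b c d → a ⊛ a ⊕ b ⊛ b ⊕ c ⊛ c ⊕ d ⊛ d ≡ 𝟎 → a ≡ 𝟎 × b ≡ 𝟎 × c ≡ 𝟎 × d ≡ 𝟎
  squares≡𝟎 a b c d eq =
    square≡𝟎⇒≡𝟎 a (Nonneg-+≡𝟎ˡ {a ⊛ a} {b ⊛ b} (Nonneg-square a) (Nonneg-square b) ab) ,
    square≡𝟎⇒≡𝟎 b (Nonneg-+≡𝟎ʳ {a ⊛ a} {b ⊛ b} (Nonneg-square a) (Nonneg-square b) ab) ,
    square≡𝟎⇒≡𝟎 c (Nonneg-+≡𝟎ʳ {a ⊛ a ⊕ b ⊛ b} {c ⊛ c} ab≥0 (Nonneg-square c) abc) ,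
    square≡𝟎⇒≡𝟎 d (Nonneg-+≡𝟎ʳ {a ⊛ a ⊕ b ⊛ b ⊕ c ⊛ c} {d ⊛ d} abc≥0 (Nonneg-square d) eq)
    where
    ab≥0 : Nonneg (a ⊛ a ⊕ b ⊛ b)
    ab≥0 = Nonneg-⊕ {a ⊛ a} {b ⊛ b} (Nonneg-square a) (Nonneg-square b)
    abc≥0 : Nonneg (a ⊛ a ⊕ b ⊛ b ⊕ c ⊛ c)
    abc≥0 = Nonneg-⊕ {a ⊛ a ⊕ b ⊛ b} {c ⊛ c} ab≥0 (Nonneg-square c)
    abc : a ⊛ a ⊕ b ⊛ b ⊕ c ⊛ c ≡ 𝟎
    abc = Nonneg-+≡𝟎ˡ {a ⊛ a ⊕ b ⊛ b ⊕ c ⊛ c} {d ⊛ d} abc≥0 (Nonneg-square d) eq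
    ab : a ⊛ a ⊕ b ⊛ b ≡ 𝟎
    ab = Nonneg-+≡𝟎ˡ {a ⊛ a ⊕ b ⊛ b} {c ⊛ c} ab≥0 (Nonneg-square c) abc
  -- Here f is φ³, X and Y are the sums of squares of the space coordinates, and P is their inner
  -- product. All terms of this vanishing sum are nonnegative under the hypotheses, so the first is
  -- 0, and its factor at y₀² is positive.
  balance : ∀ f x₀ y₀ X Y P →
    (f ⊛ ⊝ (X ⊕ ⊝ f ⊛ (x₀ ⊛ x₀))) ⊛ (y₀ ⊛ y₀) ⊕
    (((X ⊛ Y ⊕ ⊝ (P ⊛ P)) ⊕ (P ⊕ ⊝ f ⊛ (y₀ ⊛ x₀)) ⊛ (P ⊕ ⊝ f ⊛ (y₀ ⊛ x₀))) ⊕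
    ((𝟐 ⊛ f) ⊛ ((P ⊕ ⊝ f ⊛ (y₀ ⊛ x₀)) ⊛ (y₀ ⊛ x₀)) ⊕ X ⊛ ⊝ (Y ⊕ ⊝ f ⊛ (y₀ ⊛ y₀)))) ≡ 𝟎
  balance = solve-∀ ring
  main : ∀ f x₀ y₀ X Y P → Positive f → Positive (⊝ (X ⊕ ⊝ f ⊛ (x₀ ⊛ x₀))) → Nonneg (X ⊛ Y ⊕ ⊝ (P ⊛ P)) →
    Nonneg (P ⊕ ⊝ f ⊛ (y₀ ⊛ x₀)) → Nonneg x₀ → Nonneg y₀ → Nonneg X → Nonneg (⊝ (Y ⊕ ⊝ f ⊛ (y₀ ⊛ y₀))) →
    y₀ ⊛ y₀ ≡ 𝟎
  main f x₀ y₀ X Y P f>0 c>0 cs≥0 p′ x₀≥0 y₀≥0 X≥0 n≥0 =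
    case ⊛-integral (f ⊛ ⊝ (X ⊕ ⊝ f ⊛ (x₀ ⊛ x₀))) (y₀ ⊛ y₀)
      (Nonneg-+≡𝟎ˡ {a} {b} a≥0 b≥0 (balance f x₀ y₀ X Y P)) of λ
      { (inj₁ eq) → ⊥-elim (Positive⇒≢𝟎 (Positive-⊛ {f} {⊝ (X ⊕ ⊝ f ⊛ (x₀ ⊛ x₀))} f>0 c>0) eq)
      ; (inj₂ eq) → eq }
    where
    a = (f ⊛ ⊝ (X ⊕ ⊝ f ⊛ (x₀ ⊛ x₀))) ⊛ (y₀ ⊛ y₀)
    a≥0 : Nonneg a
    a≥0 = Nonneg-⊛ {f ⊛ ⊝ (X ⊕ ⊝ f ⊛ (x₀ ⊛ x₀))} {y₀ ⊛ y₀}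
      (inj₂ (Positive-⊛ {f} {⊝ (X ⊕ ⊝ f ⊛ (x₀ ⊛ x₀))} f>0 c>0)) (Nonneg-square y₀)
    b₁ = (X ⊛ Y ⊕ ⊝ (P ⊛ P)) ⊕ (P ⊕ ⊝ f ⊛ (y₀ ⊛ x₀)) ⊛ (P ⊕ ⊝ f ⊛ (y₀ ⊛ x₀))
    b₂ = (𝟐 ⊛ f) ⊛ ((P ⊕ ⊝ f ⊛ (y₀ ⊛ x₀)) ⊛ (y₀ ⊛ x₀)) ⊕ X ⊛ ⊝ (Y ⊕ ⊝ f ⊛ (y₀ ⊛ y₀))
    b = b₁ ⊕ b₂
    b₁≥0 : Nonneg b₁
    b₁≥0 = Nonneg-⊕ {X ⊛ Y ⊕ ⊝ (P ⊛ P)} {(P ⊕ ⊝ f ⊛ (y₀ ⊛ x₀)) ⊛ (P ⊕ ⊝ f ⊛ (y₀ ⊛ x₀))} cs≥0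
             (Nonneg-square (P ⊕ ⊝ f ⊛ (y₀ ⊛ x₀)))
    b₂≥0 : Nonneg b₂
    b₂≥0 = Nonneg-⊕ {(𝟐 ⊛ f) ⊛ ((P ⊕ ⊝ f ⊛ (y₀ ⊛ x₀)) ⊛ (y₀ ⊛ x₀))} {X ⊛ ⊝ (Y ⊕ ⊝ f ⊛ (y₀ ⊛ y₀))}
      (Nonneg-⊛ {𝟐 ⊛ f} {(P ⊕ ⊝ f ⊛ (y₀ ⊛ x₀)) ⊛ (y₀ ⊛ x₀)}
        (inj₂ (Positive-⊛ {𝟐} {f} (coeffs (coeffs₁ 1 0)) f>0))
        (Nonneg-⊛ {P ⊕ ⊝ f ⊛ (y₀ ⊛ x₀)} {y₀ ⊛ x₀} p′ (Nonneg-⊛ {y₀} {x₀} y₀≥0 x₀≥0)))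
      (Nonneg-⊛ {X} {⊝ (Y ⊕ ⊝ f ⊛ (y₀ ⊛ y₀))} X≥0 n≥0)
    b≥0 : Nonneg b
    b≥0 = Nonneg-⊕ {b₁} {b₂} b₁≥0 b₂≥0
  φ³>0 : Positive φ³
  φ³>0 = coeffs (coeffs₁ 0 2)
  y₀²≡𝟎 : y₀ ⊛ y₀ ≡ 𝟎
  y₀²≡𝟎 = main φ³ x₀ y₀ X Y P φ³>0
    (subst (λ t → Positive (⊝ t)) (expand (⊝ φ³) x₀ x₀ x₁ x₁ x₂ x₂ x₃ x₃ x₄ x₄) c>0)
    (subst Nonneg (sym (cauchy y₁ y₂ y₃ y₄ x₁ x₂ x₃ x₄))
      (sum-of-squares (y₁ ⊛ x₂ ⊕ ⊝ (y₂ ⊛ x₁)) (y₁ ⊛ x₃ ⊕ ⊝ (y₃ ⊛ x₁)) (y₁ ⊛ x₄ ⊕ ⊝ (y₄ ⊛ x₁))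
                      (y₂ ⊛ x₃ ⊕ ⊝ (y₃ ⊛ x₂)) (y₂ ⊛ x₄ ⊕ ⊝ (y₄ ⊛ x₂)) (y₃ ⊛ x₄ ⊕ ⊝ (y₄ ⊛ x₃))))
    (subst Nonneg (expand (⊝ φ³) y₀ x₀ y₁ x₁ y₂ x₂ y₃ x₃ y₄ x₄) p′≥0) x₀≥0 y₀≥0
    (sum₄ x₁ x₂ x₃ x₄)
    (subst (λ t → Nonneg (⊝ t)) (expand (⊝ φ³) y₀ y₀ y₁ y₁ y₂ y₂ y₃ y₃ y₄ y₄) n≥0)
  Y≥0 : Nonneg Y
  Y≥0 = sum₄ y₁ y₂ y₃ y₄
  g : ∀ f Y → Y ⊕ f ⊛ 𝟎 ≡ Y
  g = solve-∀ ring
  Y-eq : ⟪ y₀ ∷ y₁ ∷ y₂ ∷ y₃ ∷ y₄ ∷ [] , y₀ ∷ y₁ ∷ y₂ ∷ y₃ ∷ y₄ ∷ [] ⟫ ≡ Y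
  Y-eq = trans (expand (⊝ φ³) y₀ y₀ y₁ y₁ y₂ y₂ y₃ y₃ y₄ y₄)
           (trans (cong (λ t → Y ⊕ ⊝ φ³ ⊛ t) y₀²≡𝟎) (g (⊝ φ³) Y))
  zeros : ∀ {a b c d e} → a ≡ 𝟎 → b ≡ 𝟎 × c ≡ 𝟎 × d ≡ 𝟎 × e ≡ 𝟎 → a ∷ b ∷ c ∷ d ∷ e ∷ [] ≡ 0ᵥ
  zeros refl (refl , refl , refl , refl) = refl

-𝟏-⊛ : ∀ x → -𝟏 ⊛ x ≡ ⊝ x
-𝟏-⊛ = solve-∀ ring

-ᵥ-involutive : ∀ {n} (x : Vec ℤ[φ] n) → -𝟏 ·ᵥ (-𝟏 ·ᵥ x) ≡ x
-ᵥ-involutive x = trans (sym (·ᵥ-assoc -𝟏 -𝟏 x)) (·ᵥ-identityˡ x)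

⟪⟫-negˡ : ∀ x y → ⟪ -𝟏 ·ᵥ x , y ⟫ ≡ ⊝ ⟪ x , y ⟫
⟪⟫-negˡ x y = trans (⟪⟫-·ˡ -𝟏 x y) (-𝟏-⊛ ⟪ x , y ⟫)

⟪⟫-negʳ : ∀ x y → ⟪ x , -𝟏 ·ᵥ y ⟫ ≡ ⊝ ⟪ x , y ⟫
⟪⟫-negʳ x y = trans (⟪⟫-·ʳ -𝟏 x y) (-𝟏-⊛ ⟪ x , y ⟫)

⟪⟫-neg-neg : ∀ x y → ⟪ -𝟏 ·ᵥ x , -𝟏 ·ᵥ y ⟫ ≡ ⟪ x , y ⟫
⟪⟫-neg-neg x y = trans (⟪⟫-negˡ x (-𝟏 ·ᵥ y)) (trans (cong ⊝_ (⟪⟫-negʳ x y)) (⊝-involutive ⟪ x , y ⟫))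

-- The half-spaces of a vector that is not spacelike contain all future
-- points or none.
causal-zero : ∀ {x x′ y} → Future x → Future x′ → Nonneg (⊝ ⟪ y , y ⟫) →
              Nonneg ⟪ y , x ⟫ → Nonneg (⊝ ⟪ y , x′ ⟫) → y ≡ 0ᵥ
causal-zero {x} {x′} {y} fx fx′ n p q = case Nonneg-or-Positive⊝ (Vec.head y) of λ
  { (inj₁ y₀) → causal-zero₊ x y fx n p y₀
  ; (inj₂ y₀) → trans (sym (-ᵥ-involutive y)) (cong (-𝟏 ·ᵥ_) (causal-zero₊ x′ (-𝟏 ·ᵥ y) fx′
      (subst (λ t → Nonneg (⊝ t)) (sym (⟪⟫-neg-neg y y)) n)
      (subst Nonneg (sym (⟪⟫-negˡ y x′)) q)
      (inj₂ (subst Positive (sym (trans (head-·ᵥ y) (-𝟏-⊛ (Vec.head y)))) y₀)))) }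
  where
  head-·ᵥ : ∀ (y : Point) → Vec.head (-𝟏 ·ᵥ y) ≡ -𝟏 ⊛ Vec.head y
  head-·ᵥ (_ ∷ _) = refl

-- Only the last reflection moves the first coordinate a, to φa - φ⁻¹e with e the last coordinate.
-- If this were negative, then e > φ²a ≥ 0 and e² ≥ φ⁴a² ≥ φ³a², but x is timelike. `certificate`
-- expresses this with h = e - φ²a.
Future-reflect : ∀ i x → Future x → Future (reflect i x)
Future-reflect i x (x₀≥0 , c>0) =
  head≥0 i x x₀≥0 c>0 , subst (λ t → Positive (⊝ t)) (sym (reflect-isometry i x x)) c>0
  where
  φ⁻¹ = ⟨ -[1+ 0 ] , + 1 ⟩
  fixed : ∀ a c → a ⊕ ⊝ (c ⊛ 𝟎) ≡ a
  fixed = solve-∀ ring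
  moved : ∀ a b c d e →
    a ⊕ ⊝ (φ² ⊛ (⊝ φ³ ⊛ (-φ⁻³ ⊛ a) ⊕ (𝟏 ⊛ (𝟎 ⊛ b) ⊕ (𝟏 ⊛ (𝟎 ⊛ c) ⊕ (𝟏 ⊛ (𝟎 ⊛ d) ⊕
      (𝟏 ⊛ (-𝟏 ⊛ e) ⊕ 𝟎))))) ⊛ -φ⁻³) ≡ φ ⊛ a ⊕ ⊝ (φ⁻¹ ⊛ e)
  moved = solve-∀ ring
  certificate : ∀ a b c d e → let h = φ ⊛ ⊝ (φ ⊛ a ⊕ ⊝ (φ⁻¹ ⊛ e)) in
    ⊝ (⊝ φ³ ⊛ (a ⊛ a) ⊕ (𝟏 ⊛ (b ⊛ b) ⊕ (𝟏 ⊛ (c ⊛ c) ⊕ (𝟏 ⊛ (d ⊛ d) ⊕ (𝟏 ⊛ (e ⊛ e) ⊕ 𝟎))))) ⊕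
    ((b ⊛ b ⊕ c ⊛ c) ⊕ ((d ⊛ d ⊕ h ⊛ h) ⊕ ((𝟐 ⊛ φ²) ⊛ (h ⊛ a) ⊕ φ² ⊛ (a ⊛ a)))) ≡ 𝟎
  certificate = solve-∀ ring
  φ²>0 : Positive φ²
  φ²>0 = coeffs (coeffs₁ 0 1)
  impossible : ∀ a b c d h t → Nonneg a → Positive t → Positive h →
    t ⊕ ((b ⊛ b ⊕ c ⊛ c) ⊕ ((d ⊛ d ⊕ h ⊛ h) ⊕ ((𝟐 ⊛ φ²) ⊛ (h ⊛ a) ⊕ φ² ⊛ (a ⊛ a)))) ≢ 𝟎
  impossible a b c d h t a≥0 t>0 h>0 = Positive⇒≢𝟎
    (Positive-⊕-Nonneg {t} {(b ⊛ b ⊕ c ⊛ c) ⊕ ((d ⊛ d ⊕ h ⊛ h) ⊕ ((𝟐 ⊛ φ²) ⊛ (h ⊛ a) ⊕ φ² ⊛ (a ⊛ a)))} t>0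
      (Nonneg-⊕ {b ⊛ b ⊕ c ⊛ c} {(d ⊛ d ⊕ h ⊛ h) ⊕ ((𝟐 ⊛ φ²) ⊛ (h ⊛ a) ⊕ φ² ⊛ (a ⊛ a))}
        (Nonneg-⊕ {b ⊛ b} {c ⊛ c} (Nonneg-square b) (Nonneg-square c))
        (Nonneg-⊕ {d ⊛ d ⊕ h ⊛ h} {(𝟐 ⊛ φ²) ⊛ (h ⊛ a) ⊕ φ² ⊛ (a ⊛ a)}
          (Nonneg-⊕ {d ⊛ d} {h ⊛ h} (Nonneg-square d) (Nonneg-square h))
          (Nonneg-⊕ {(𝟐 ⊛ φ²) ⊛ (h ⊛ a)} {φ² ⊛ (a ⊛ a)}
            (Nonneg-⊛ {𝟐 ⊛ φ²} {h ⊛ a} (inj₂ (coeffs (coeffs₁ 1 2))) (Nonneg-⊛ {h} {a} (inj₂ h>0) a≥0))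
            (Nonneg-⊛ {φ²} {a ⊛ a} (inj₂ φ²>0) (Nonneg-square a))))))
  head≥0 : ∀ i x → Nonneg (Vec.head x) → Positive (⊝ ⟪ x , x ⟫) → Nonneg (Vec.head (reflect i x))
  head≥0 zero                   x@(a ∷ _) p _ = subst Nonneg (sym (fixed a (κ zero ⊛ ⟪ normal zero , x ⟫))) p
  head≥0 i@(suc zero)             x@(a ∷ _) p _ = subst Nonneg (sym (fixed a (κ i ⊛ ⟪ normal i , x ⟫))) p
  head≥0 i@(suc (suc zero))       x@(a ∷ _) p _ = subst Nonneg (sym (fixed a (κ i ⊛ ⟪ normal i , x ⟫))) p
  head≥0 i@(suc (suc (suc zero))) x@(a ∷ _) p _ = subst Nonneg (sym (fixed a (κ i ⊛ ⟪ normal i , x ⟫))) p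
  head≥0 (suc (suc (suc (suc zero)))) (a ∷ b ∷ c ∷ d ∷ e ∷ []) p t =
    subst Nonneg (sym (moved a b c d e)) (case Nonneg-or-Positive⊝ (φ ⊛ a ⊕ ⊝ (φ⁻¹ ⊛ e)) of λ
      { (inj₁ q) → q
      ; (inj₂ q) → ⊥-elim (impossible a b c d (φ ⊛ ⊝ (φ ⊛ a ⊕ ⊝ (φ⁻¹ ⊛ e))) _ p t (Positive-scale q) (certificate a b c d e)) })

Future-▷ : ∀ w x → Future x → Future (w ▷ x)
Future-▷ []      x f = f
Future-▷ (i ∷ w) x f = Future-reflect i (w ▷ x) (Future-▷ w x f)

Future-center : ∀ j → Future (center j)
Future-center zero = inj₂ (coeffs (coeffs₁ 0 0)) , φ⁻³-Positive
Future-center (suc zero) = inj₂ (coeffs (coeffs₁ 0 0)) , unscale (unscale (coeffs (coeffs₂ 0 1)))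
Future-center (suc (suc zero)) = inj₂ (coeffs (coeffs₁ 0 0)) , unscale (coeffs (coeffs₁ 1 1))
Future-center (suc (suc (suc zero))) = inj₂ (coeffs (coeffs₁ 0 0)) , coeffs (coeffs₂ 0 1)
Future-center (suc (suc (suc (suc zero)))) = inj₂ (coeffs (coeffs₁ 0 0)) , coeffs (coeffs₁ 0 2)

-- Products of roots and vertices.

-- Only the orbit of `normal zero` is called `Root`: its mirrors bisect the edges, and its vectors
-- have norm 1.
Vertex Root : Point → Set
Vertex v = ∃[ w ] v ≡ w ▷ center zero
Root ρ   = ∃[ w ] ρ ≡ w ▷ normal zero

Future-vertex : ∀ {v} → Vertex v → Future v
Future-vertex (w , refl) = Future-▷ w (center zero) (Future-center zero)

Vertex-▷ : ∀ w {v} → Vertex v → Vertex (w ▷ v)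
Vertex-▷ w (w′ , refl) = w ++ w′ , sym (▷-++ w w′ (center zero))

Root-▷ : ∀ w {ρ} → Root ρ → Root (w ▷ ρ)
Root-▷ w (w′ , refl) = w ++ w′ , sym (▷-++ w w′ (normal zero))

Root-neg : ∀ {ρ} → Root ρ → Root (-𝟏 ·ᵥ ρ)
Root-neg (w , refl) = w ++ zero ∷ [] , trans (sym (▷-·ᵥ w -𝟏 (normal zero))) (sym (▷-++ w (zero ∷ []) (normal zero)))

Root-norm : ∀ {ρ} → Root ρ → ⟪ ρ , ρ ⟫ ≡ 𝟏
Root-norm (w , refl) = ▷-isometry w (normal zero) (normal zero)

-- Reflections fix all vertices modulo 2, as those other than reflect zero
-- fix center zero and 2 is the scale of reflect zero.
vertex-mod-𝟐 : ∀ w → ∃[ y ] w ▷ center zero ≡ center zero +ᵥ 𝟐 ·ᵥ y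
vertex-mod-𝟐 []      = 0ᵥ , refl
vertex-mod-𝟐 (i ∷ w) = step (vertex-mod-𝟐 w) (base i)
  where
  base : ∀ i → ∃[ y ] reflect i (center zero) ≡ center zero +ᵥ 𝟐 ·ᵥ y
  base zero                         = -𝟏 ·ᵥ normal zero , refl
  base (suc zero)                   = 0ᵥ , refl
  base (suc (suc zero))             = 0ᵥ , refl
  base (suc (suc (suc zero)))       = 0ᵥ , refl
  base (suc (suc (suc (suc zero)))) = 0ᵥ , refl
  step : ∀ {c x} → (∃[ y ] x ≡ c +ᵥ 𝟐 ·ᵥ y) → (∃[ y ] reflect i c ≡ c +ᵥ 𝟐 ·ᵥ y) →
         ∃[ y ] reflect i x ≡ c +ᵥ 𝟐 ·ᵥ y
  step {c} {x} (y , eq) (y′ , eq′) = y′ +ᵥ reflect i y ,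
    trans (cong (reflect i) eq) (trans (reflect-+ᵥ i c (𝟐 ·ᵥ y))
    (trans (cong₂ _+ᵥ_ eq′ (reflect-·ᵥ i 𝟐 y))
    (trans (+ᵥ-assoc c (𝟐 ·ᵥ y′) (𝟐 ·ᵥ reflect i y))
           (cong (c +ᵥ_) (sym (·ᵥ-distribˡ 𝟐 y′ (reflect i y)))))))

conj-form : ∀ {n} (d x y : Vec ℤ[φ] n) →
            conj (form d x y) ≡ form (Vec.map conj d) (Vec.map conj x) (Vec.map conj y)
conj-form []       []      []      = refl
conj-form (d ∷ ds) (a ∷ x) (b ∷ y) = trans (conj-⊕ (d ⊛ (a ⊛ b)) (form ds x y))
  (cong₂ _⊕_ (trans (conj-⊛ d (a ⊛ b)) (cong (conj d ⊛_) (conj-⊛ a b))) (conj-form ds x y))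

⟪normal₀⟫ : ∀ x → ⟪ normal zero , x ⟫ ≡ Vec.head (Vec.tail x)
⟪normal₀⟫ (a ∷ b ∷ c ∷ d ∷ e ∷ []) = f a b c d e
  where
  f : ∀ a b c d e → ⊝ φ³ ⊛ (𝟎 ⊛ a) ⊕ (𝟏 ⊛ (𝟏 ⊛ b) ⊕ (𝟏 ⊛ (𝟎 ⊛ c) ⊕ (𝟏 ⊛ (𝟎 ⊛ d) ⊕
      (𝟏 ⊛ (𝟎 ⊛ e) ⊕ 𝟎)))) ≡ b
  f = solve-∀ ring

-- The conjugate of the form is positive definite.
conj-coordinate-bound : ∀ x → let t = ⟪ normal zero , x ⟫ in Nonneg (conj ⟪ x , x ⟫ ⊕ ⊝ (conj t ⊛ conj t))
conj-coordinate-bound x@(a ∷ b ∷ c ∷ d ∷ e ∷ []) =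
  subst₂ (λ s t → Nonneg (s ⊕ ⊝ (conj t ⊛ conj t))) (sym (conj-form weights x x)) (sym (⟪normal₀⟫ x))
    (bound (conj a) (conj b) (conj c) (conj d) (conj e))
  where
  f : ∀ a b c d e → (φ⁻³ ⊛ (a ⊛ a) ⊕ c ⊛ c) ⊕ (d ⊛ d ⊕ e ⊛ e) ≡
      (φ⁻³ ⊛ (a ⊛ a) ⊕ (𝟏 ⊛ (b ⊛ b) ⊕ (𝟏 ⊛ (c ⊛ c) ⊕ (𝟏 ⊛ (d ⊛ d) ⊕ (𝟏 ⊛ (e ⊛ e) ⊕ 𝟎))))) ⊕ ⊝ (b ⊛ b)
  f = solve-∀ ring
  bound : ∀ a b c d e → Nonneg
      ((φ⁻³ ⊛ (a ⊛ a) ⊕ (𝟏 ⊛ (b ⊛ b) ⊕ (𝟏 ⊛ (c ⊛ c) ⊕ (𝟏 ⊛ (d ⊛ d) ⊕ (𝟏 ⊛ (e ⊛ e) ⊕ 𝟎))))) ⊕ ⊝ (b ⊛ b))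
  bound a b c d e = subst Nonneg (f a b c d e)
    (Nonneg-⊕ {φ⁻³ ⊛ (a ⊛ a) ⊕ c ⊛ c} {d ⊛ d ⊕ e ⊛ e}
      (Nonneg-⊕ {φ⁻³ ⊛ (a ⊛ a)} {c ⊛ c}
        (Nonneg-⊛ {φ⁻³} {a ⊛ a} (inj₂ φ⁻³-Positive) (Nonneg-square a)) (Nonneg-square c))
      (Nonneg-⊕ {d ⊛ d} {e ⊛ e} (Nonneg-square d) (Nonneg-square e)))

-- By `vertex-mod-𝟐` the product is 1 modulo 2. A vertex has norm 4 - φ³, whose conjugate 4 + φ⁻³
-- equals φ³; this bounds the square of the conjugate product as `odd-gap` requires.
root-vertex : ∀ {ρ v} → Root ρ → Vertex v → Nonneg (⟪ ρ , v ⟫ ⊕ ⊝ 𝟏) ⊎ Nonneg (⊝ ⟪ ρ , v ⟫ ⊕ ⊝ 𝟏)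
root-vertex (w , refl) (w′ , refl) =
  subst (λ t → Nonneg (t ⊕ ⊝ 𝟏) ⊎ Nonneg (⊝ t ⊕ ⊝ 𝟏))
        (trans (cong (λ x → ⟪ normal zero , x ⟫) (▷-++ (reverse w) w′ (center zero)))
               (sym (⟪⟫-transpose w (normal zero) (w′ ▷ center zero))))
        (go (reverse w ++ w′))
  where
  go : ∀ g → let t = ⟪ normal zero , g ▷ center zero ⟫ in Nonneg (t ⊕ ⊝ 𝟏) ⊎ Nonneg (⊝ t ⊕ ⊝ 𝟏)
  go g = let y , eq = vertex-mod-𝟐 g in
    odd-gap ⟪ normal zero , g ▷ center zero ⟫ ⟪ normal zero , y ⟫
      (trans (cong (λ x → ⟪ normal zero , x ⟫) eq)
        (trans (⟪⟫-+ʳ (normal zero) (center zero) (𝟐 ·ᵥ y))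
               (cong (𝟏 ⊕_) (⟪⟫-·ʳ 𝟐 (normal zero) y))))
      (subst (λ t → Nonneg (conj t ⊕ ⊝ (conj ⟪ normal zero , g ▷ center zero ⟫ ⊛ conj ⟪ normal zero , g ▷ center zero ⟫)))
        (▷-isometry g (center zero) (center zero)) (conj-coordinate-bound (g ▷ center zero)))

-- The norm 1 is its own conjugate, so the conjugate of the product is at most 1 in absolute value,
-- as `root-product-gap` requires.
root-root : ∀ {ρ ρ′} → Root ρ → Root ρ′ →
            ⟪ ρ , ρ′ ⟫ ≡ 𝟎 ⊎ Nonneg (⟪ ρ , ρ′ ⟫ ⊕ ⊝ 𝟏) ⊎ Nonneg (⊝ ⟪ ρ , ρ′ ⟫ ⊕ ⊝ 𝟏)
root-root {ρ′ = ρ′} (w , refl) r =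
  subst (λ t → t ≡ 𝟎 ⊎ Nonneg (t ⊕ ⊝ 𝟏) ⊎ Nonneg (⊝ t ⊕ ⊝ 𝟏))
    (sym (⟪⟫-transpose w (normal zero) ρ′))
    (root-product-gap ⟪ normal zero , reverse w ▷ ρ′ ⟫
      (subst (λ t → Nonneg (conj t ⊕ ⊝ (conj ⟪ normal zero , reverse w ▷ ρ′ ⟫ ⊛ conj ⟪ normal zero , reverse w ▷ ρ′ ⟫)))
        (Root-norm (Root-▷ (reverse w) r)) (conj-coordinate-bound (reverse w ▷ ρ′))))

-- Edges and their bisecting mirrors.

mirror : Point → Point → Point
mirror ρ x = x +ᵥ ⊝ (𝟐 ⊛ ⟪ ρ , x ⟫) ·ᵥ ρ

▷-reflect₀ : ∀ w x → w ▷ reflect zero x ≡ mirror (w ▷ normal zero) (w ▷ x)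
▷-reflect₀ w x = trans (cong (w ▷_) (reflect-formula zero x))
  (trans (▷-+ᵥ w x (reflect-coefficient zero x ·ᵥ normal zero))
  (cong (w ▷ x +ᵥ_) (trans (▷-·ᵥ w (reflect-coefficient zero x) (normal zero))
    (cong (λ t → ⊝ (𝟐 ⊛ t) ·ᵥ (w ▷ normal zero)) (sym (▷-isometry w (normal zero) x))))))

conjugate : Word → Word
conjugate w = w ++ zero ∷ reverse w

conjugate-▷ : ∀ w x → conjugate w ▷ x ≡ mirror (w ▷ normal zero) x
conjugate-▷ w x = trans (▷-++ w (zero ∷ reverse w) x)
  (trans (▷-reflect₀ w (reverse w ▷ x)) (cong (mirror (w ▷ normal zero)) (▷-reverse′ w x)))

-- EdgeAt ρ u: the mirror with normal ρ bisects an edge from u, and ρ points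
-- to the side of u.
EdgeAt : Point → Point → Set
EdgeAt ρ u = ∃[ w ] (ρ ≡ w ▷ normal zero × u ≡ w ▷ center zero)

EdgeAt⇒Root : ∀ {ρ u} → EdgeAt ρ u → Root ρ
EdgeAt⇒Root (w , eq , _) = w , eq

EdgeAt⇒Vertex : ∀ {ρ u} → EdgeAt ρ u → Vertex u
EdgeAt⇒Vertex (w , _ , eq) = w , eq

EdgeAt-pairing : ∀ {ρ u} → EdgeAt ρ u → ⟪ ρ , u ⟫ ≡ 𝟏
EdgeAt-pairing (w , refl , refl) = ▷-isometry w (normal zero) (center zero)

EdgeAt-▷ : ∀ w {ρ u} → EdgeAt ρ u → EdgeAt (w ▷ ρ) (w ▷ u)
EdgeAt-▷ w (w′ , refl , refl) = w ++ w′ , sym (▷-++ w w′ (normal zero)) , sym (▷-++ w w′ (center zero))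

-- The mirror image of u when ⟪ ρ , u ⟫ is 1. It is written as a translation, which makes
-- `across-back`, `across-comm` and `across-injective` plain vector algebra.
across : Point → Point → Point
across ρ u = u +ᵥ ⊝ 𝟐 ·ᵥ ρ

mirror-across : ∀ ρ u → ⟪ ρ , u ⟫ ≡ 𝟏 → mirror ρ u ≡ across ρ u
mirror-across ρ u eq = cong (λ t → u +ᵥ ⊝ (𝟐 ⊛ t) ·ᵥ ρ) eq

mirror-orthogonal : ∀ ρ x → ⟪ ρ , x ⟫ ≡ 𝟎 → mirror ρ x ≡ x
mirror-orthogonal ρ x eq = trans (cong (λ t → x +ᵥ ⊝ (𝟐 ⊛ t) ·ᵥ ρ) eq)
  (trans (cong (x +ᵥ_) (·ᵥ-zeroˡ ρ)) (+ᵥ-identityʳ x))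

mirror-self : ∀ ρ → ⟪ ρ , ρ ⟫ ≡ 𝟏 → mirror ρ ρ ≡ -𝟏 ·ᵥ ρ
mirror-self ρ eq = trans (mirror-across ρ ρ eq) (go ρ)
  where
  e : ∀ a → a ⊕ ⊝ 𝟐 ⊛ a ≡ -𝟏 ⊛ a
  e = solve-∀ ring
  go : ∀ {n} (x : Vec ℤ[φ] n) → x +ᵥ ⊝ 𝟐 ·ᵥ x ≡ -𝟏 ·ᵥ x
  go []      = refl
  go (a ∷ x) = cong₂ _∷_ (e a) (go x)

EdgeAt-mirror : ∀ {ρ τ u} → Root ρ → EdgeAt τ u → EdgeAt (mirror ρ τ) (mirror ρ u)
EdgeAt-mirror {τ = τ} {u} (w , refl) e =
  subst₂ EdgeAt (conjugate-▷ w τ) (conjugate-▷ w u) (EdgeAt-▷ (conjugate w) e)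

EdgeAt-back : ∀ {ρ u} → EdgeAt ρ u → EdgeAt (-𝟏 ·ᵥ ρ) (across ρ u)
EdgeAt-back {ρ} {u} e = subst₂ EdgeAt (mirror-self ρ (Root-norm (EdgeAt⇒Root e)))
  (mirror-across ρ u (EdgeAt-pairing e)) (EdgeAt-mirror (EdgeAt⇒Root e) e)

-- Orthogonal edges span a square, and opposite sides of a square have the same bisector: the mirror
-- of ρ fixes τ and moves u to the other end.
EdgeAt-across : ∀ {ρ τ u} → EdgeAt ρ u → EdgeAt τ u → ⟪ ρ , τ ⟫ ≡ 𝟎 → EdgeAt τ (across ρ u)
EdgeAt-across {ρ} {τ} {u} e f orthogonal = subst₂ EdgeAt (mirror-orthogonal ρ τ orthogonal)
  (mirror-across ρ u (EdgeAt-pairing e)) (EdgeAt-mirror (EdgeAt⇒Root e) f)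

across-back : ∀ ρ u → across (-𝟏 ·ᵥ ρ) (across ρ u) ≡ u
across-back = go
  where
  e : ∀ a b → (b ⊕ ⊝ 𝟐 ⊛ a) ⊕ ⊝ 𝟐 ⊛ (-𝟏 ⊛ a) ≡ b
  e = solve-∀ ring
  go : ∀ {n} (x y : Vec ℤ[φ] n) → (y +ᵥ ⊝ 𝟐 ·ᵥ x) +ᵥ ⊝ 𝟐 ·ᵥ (-𝟏 ·ᵥ x) ≡ y
  go []      []      = refl
  go (a ∷ x) (b ∷ y) = cong₂ _∷_ (e a b) (go x y)

across-comm : ∀ ρ τ u → across ρ (across τ u) ≡ across τ (across ρ u)
across-comm ρ τ u = trans (+ᵥ-assoc u (⊝ 𝟐 ·ᵥ τ) (⊝ 𝟐 ·ᵥ ρ))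
  (trans (cong (u +ᵥ_) (+ᵥ-comm (⊝ 𝟐 ·ᵥ τ) (⊝ 𝟐 ·ᵥ ρ))) (sym (+ᵥ-assoc u (⊝ 𝟐 ·ᵥ ρ) (⊝ 𝟐 ·ᵥ τ))))

across-injective : ∀ {ρ τ} u → across ρ u ≡ across τ u → ρ ≡ τ
across-injective {ρ} {τ} u eq = go ρ τ u eq
  where
  e : ∀ a b → 𝟐 ⊛ (a ⊕ -𝟏 ⊛ b) ≡ ⊝ 𝟐 ⊛ b ⊕ ⊝ (⊝ 𝟐 ⊛ a)
  e = solve-∀ ring
  f : ∀ c a b → ⊝ 𝟐 ⊛ b ⊕ ⊝ (⊝ 𝟐 ⊛ a) ≡ (c ⊕ ⊝ 𝟐 ⊛ b) ⊕ ⊝ (c ⊕ ⊝ 𝟐 ⊛ a)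
  f = solve-∀ ring
  component : ∀ c a b → c ⊕ ⊝ 𝟐 ⊛ a ≡ c ⊕ ⊝ 𝟐 ⊛ b → a ⊕ -𝟏 ⊛ b ≡ 𝟎
  component c a b eq = case ⊛-integral 𝟐 (a ⊕ -𝟏 ⊛ b) (trans (e a b) (trans (f c a b)
      (trans (cong (λ t → t ⊕ ⊝ (c ⊕ ⊝ 𝟐 ⊛ a)) (sym eq)) (⊝-inverseʳ (c ⊕ ⊝ 𝟐 ⊛ a))))) of λ
    { (inj₁ ()) ; (inj₂ p) → p }
  go : ∀ {n} (x y z : Vec ℤ[φ] n) → z +ᵥ ⊝ 𝟐 ·ᵥ x ≡ z +ᵥ ⊝ 𝟐 ·ᵥ y → x ≡ y
  go []      []      []      _  = refl
  go (a ∷ x) (b ∷ y) (c ∷ z) eq = x-y≡0⇒x≡y (a ∷ x) (b ∷ y)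
    (cong₂ _∷_ (component c a b (cong Vec.head eq)) (trans (cong (λ v → v -ᵥ y) (go x y z (cong Vec.tail eq))) (self y)))
    where
    g : ∀ a → a ⊕ -𝟏 ⊛ a ≡ 𝟎
    g = solve-∀ ring
    self : ∀ {n} (x : Vec ℤ[φ] n) → x -ᵥ x ≡ 0ᵥ
    self []      = refl
    self (a ∷ x) = cong₂ _∷_ (g a) (self x)

⟪⟫-across : ∀ x ρ u → ⟪ x , across ρ u ⟫ ≡ ⟪ x , u ⟫ ⊕ ⊝ 𝟐 ⊛ ⟪ x , ρ ⟫
⟪⟫-across x ρ u = trans (⟪⟫-+ʳ x u (⊝ 𝟐 ·ᵥ ρ)) (cong (⟪ x , u ⟫ ⊕_) (⟪⟫-·ʳ (⊝ 𝟐) x ρ))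

-- If the product is at most - 1, then ρ + τ is not spacelike, and `causal-zero` applies to it.
⟪⟫-sum : ∀ ρ τ → ⟪ ρ , ρ ⟫ ≡ 𝟏 → ⟪ τ , τ ⟫ ≡ 𝟏 → ⟪ ρ +ᵥ τ , ρ +ᵥ τ ⟫ ≡ 𝟐 ⊛ (𝟏 ⊕ ⟪ ρ , τ ⟫)
⟪⟫-sum ρ τ p q = trans (⟪⟫-+ˡ ρ τ (ρ +ᵥ τ))
  (trans (cong₂ _⊕_ (trans (⟪⟫-+ʳ ρ ρ τ) (cong (_⊕ ⟪ ρ , τ ⟫) p))
                    (trans (⟪⟫-+ʳ τ ρ τ) (cong₂ _⊕_ (⟪⟫-comm τ ρ) q)))
         (e ⟪ ρ , τ ⟫))
  where
  e : ∀ t → (𝟏 ⊕ t) ⊕ (t ⊕ 𝟏) ≡ 𝟐 ⊛ (𝟏 ⊕ t)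
  e = solve-∀ ring

𝟐>0 : Positive 𝟐
𝟐>0 = coeffs (coeffs₁ 1 0)

𝟏>0 : Positive 𝟏
𝟏>0 = coeffs (coeffs₁ 0 0)

-- Two mirrors whose normals have product at most - 1 do not meet.
ultraparallel : ∀ {ρ τ x x′} → Root ρ → Root τ → Nonneg (⊝ ⟪ ρ , τ ⟫ ⊕ ⊝ 𝟏) → Future x → Future x′ →
                Nonneg (⟪ ρ , x ⟫ ⊕ ⟪ τ , x ⟫) → Nonneg (⊝ (⟪ ρ , x′ ⟫ ⊕ ⟪ τ , x′ ⟫)) → ρ +ᵥ τ ≡ 0ᵥ
ultraparallel {ρ} {τ} {x} {x′} r s t f f′ p q = causal-zero f f′
  (subst Nonneg (trans (e ⟪ ρ , τ ⟫) (cong ⊝_ (sym (⟪⟫-sum ρ τ (Root-norm r) (Root-norm s)))))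
    (Nonneg-⊛ {𝟐} {⊝ ⟪ ρ , τ ⟫ ⊕ ⊝ 𝟏} (inj₂ 𝟐>0) t))
  (subst Nonneg (sym (⟪⟫-+ˡ ρ τ x)) p)
  (subst (λ t → Nonneg (⊝ t)) (sym (⟪⟫-+ˡ ρ τ x′)) q)
  where
  e : ∀ t → 𝟐 ⊛ (⊝ t ⊕ ⊝ 𝟏) ≡ ⊝ (𝟐 ⊛ (𝟏 ⊕ t))
  e = solve-∀ ring

-- A product of at least 1 makes ρ - τ a vector that is not spacelike, so it vanishes if it takes
-- weakly opposite signs on the future cone.
ultraparallel′ : ∀ {ρ τ x x′} → Root ρ → Root τ → Nonneg (⟪ ρ , τ ⟫ ⊕ ⊝ 𝟏) → Future x → Future x′ →
                 Nonneg (⟪ ρ , x ⟫ ⊕ ⊝ ⟪ τ , x ⟫) → Nonneg (⊝ (⟪ ρ , x′ ⟫ ⊕ ⊝ ⟪ τ , x′ ⟫)) → ρ ≡ τ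
ultraparallel′ {ρ} {τ} {x} {x′} r s t f f′ p q = x-y≡0⇒x≡y ρ τ (ultraparallel r (Root-neg s)
  (subst (λ t → Nonneg (t ⊕ ⊝ 𝟏)) (trans (sym (⊝-involutive ⟪ ρ , τ ⟫)) (cong ⊝_ (sym (⟪⟫-negʳ ρ τ)))) t) f f′
  (subst (λ t → Nonneg (⟪ ρ , x ⟫ ⊕ t)) (sym (⟪⟫-negˡ τ x)) p)
  (subst (λ t → Nonneg (⊝ (⟪ ρ , x′ ⟫ ⊕ t))) (sym (⟪⟫-negˡ τ x′)) q))

-- Both normals have product 1 with u, so ρ - τ is orthogonal to u; if their product is at least 1,
-- the two coincide.
edges-at-vertex : ∀ {ρ τ u} → EdgeAt ρ u → EdgeAt τ u →
                  ρ ≡ τ ⊎ ⟪ ρ , τ ⟫ ≡ 𝟎 ⊎ Nonneg (⊝ ⟪ ρ , τ ⟫ ⊕ ⊝ 𝟏)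
edges-at-vertex {ρ} {τ} {u} e f = case root-root (EdgeAt⇒Root e) (EdgeAt⇒Root f) of λ
  { (inj₁ p)        → inj₂ (inj₁ p)
  ; (inj₂ (inj₁ p)) → inj₁ (ultraparallel′ (EdgeAt⇒Root e) (EdgeAt⇒Root f) p
      (Future-vertex (EdgeAt⇒Vertex e)) (Future-vertex (EdgeAt⇒Vertex e))
      (inj₁ zero-difference) (inj₁ (cong ⊝_ zero-difference)))
  ; (inj₂ (inj₂ p)) → inj₂ (inj₂ p) }
  where
  zero-difference : ⟪ ρ , u ⟫ ⊕ ⊝ ⟪ τ , u ⟫ ≡ 𝟎
  zero-difference = cong₂ (λ s t → s ⊕ ⊝ t) (EdgeAt-pairing e) (EdgeAt-pairing f)

-- The sum ρ + τ is not spacelike and has product 2 with u, so it is positive on the whole future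
-- cone. Thus no vertex is behind both mirrors.
edges-separate : ∀ {ρ τ u v} → EdgeAt ρ u → EdgeAt τ u → Nonneg (⊝ ⟪ ρ , τ ⟫ ⊕ ⊝ 𝟏) → Vertex v →
                 Positive (⟪ ρ , v ⟫ ⊕ ⟪ τ , v ⟫)
edges-separate {ρ} {τ} {u} {v} e f p V =
  case Nonneg-or-Positive⊝ (⊝ (⟪ ρ , v ⟫ ⊕ ⟪ τ , v ⟫)) of λ
  { (inj₁ q) → case trans (sym pair) (trans (cong (⟪_, u ⟫) (ultraparallel (EdgeAt⇒Root e) (EdgeAt⇒Root f) p
      (Future-vertex (EdgeAt⇒Vertex e)) (Future-vertex V)
      (inj₂ (subst Positive (sym two) 𝟐>0)) q)) (⟪⟫-zeroˡ u)) of λ ()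
  ; (inj₂ q) → subst Positive (⊝-involutive (⟪ ρ , v ⟫ ⊕ ⟪ τ , v ⟫)) q }
  where
  two : ⟪ ρ , u ⟫ ⊕ ⟪ τ , u ⟫ ≡ 𝟐
  two = cong₂ _⊕_ (EdgeAt-pairing e) (EdgeAt-pairing f)
  pair : ⟪ ρ +ᵥ τ , u ⟫ ≡ 𝟐
  pair = trans (⟪⟫-+ˡ ρ τ u) two

1≤⇒Positive : ∀ {x} → Nonneg (x ⊕ ⊝ 𝟏) → Positive x
1≤⇒Positive {x} p = subst Positive (e x) (Positive-⊕-Nonneg {𝟏} {x ⊕ ⊝ 𝟏} 𝟏>0 p)
  where
  e : ∀ x → 𝟏 ⊕ (x ⊕ ⊝ 𝟏) ≡ x
  e = solve-∀ ring

side : ∀ {ρ v} → Root ρ → Vertex v → Positive ⟪ ρ , v ⟫ ⊎ Positive (⊝ ⟪ ρ , v ⟫)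
side {ρ} {v} r V = case root-vertex r V of λ
  { (inj₁ p) → inj₁ (1≤⇒Positive {⟪ ρ , v ⟫} p)
  ; (inj₂ p) → inj₂ (1≤⇒Positive {⊝ ⟪ ρ , v ⟫} p) }

Positive-asym : ∀ {x} → Positive x → Positive (⊝ x) → ⊥
Positive-asym p q = Nonneg∧Positive⊝⇒⊥ (inj₂ p) q

side≥1 : ∀ {ρ v} → Root ρ → Vertex v → Positive ⟪ ρ , v ⟫ → Nonneg (⟪ ρ , v ⟫ ⊕ ⊝ 𝟏)
side≥1 {ρ} {v} r V p = case root-vertex r V of λ
  { (inj₁ q) → q
  ; (inj₂ q) → ⊥-elim (Positive-asym {⟪ ρ , v ⟫} p (1≤⇒Positive {⊝ ⟪ ρ , v ⟫} q)) }

side≤-1 : ∀ {ρ v} → Root ρ → Vertex v → Positive (⊝ ⟪ ρ , v ⟫) → Nonneg (⊝ ⟪ ρ , v ⟫ ⊕ ⊝ 𝟏)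
side≤-1 {ρ} {v} r V p = case root-vertex r V of λ
  { (inj₁ q) → ⊥-elim (Positive-asym {⟪ ρ , v ⟫} (1≤⇒Positive {⟪ ρ , v ⟫} q) p)
  ; (inj₂ q) → q }

-- Frames of a hypercube and its walls.

infix 4 _≟ᵥ_

_≟ᵥ_ : DecidableEquality Point
_≟ᵥ_ = ≡-dec _≟_

axis : Fin 4 → Point
axis zero                   = 𝟎 ∷ 𝟏 ∷ 𝟎 ∷ 𝟎 ∷ 𝟎 ∷ []
axis (suc zero)             = 𝟎 ∷ 𝟎 ∷ 𝟏 ∷ 𝟎 ∷ 𝟎 ∷ []
axis (suc (suc zero))       = 𝟎 ∷ 𝟎 ∷ 𝟎 ∷ 𝟏 ∷ 𝟎 ∷ []
axis (suc (suc (suc zero))) = 𝟎 ∷ 𝟎 ∷ 𝟎 ∷ 𝟎 ∷ 𝟏 ∷ []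

s₀ s₁ s₂ s₃ s₄ : Fin 5
s₀ = # 0
s₁ = # 1
s₂ = # 2
s₃ = # 3
s₄ = # 4

EdgeAt-axis : ∀ k → EdgeAt (axis k) (center zero)
EdgeAt-axis zero                   = [] , refl , refl
EdgeAt-axis (suc zero)             = s₁ ∷ [] , refl , refl
EdgeAt-axis (suc (suc zero))       = s₂ ∷ s₁ ∷ [] , refl , refl
EdgeAt-axis (suc (suc (suc zero))) = s₃ ∷ s₂ ∷ s₁ ∷ [] , refl , refl

frame-edge : ∀ w k → EdgeAt (w ▷ axis k) (w ▷ center zero)
frame-edge w k = EdgeAt-▷ w (EdgeAt-axis k)

axis-orthogonal : ∀ k l → k ≡ l ⊎ ⟪ axis k , axis l ⟫ ≡ 𝟎
axis-orthogonal = from-yes (Fin.all? λ k → Fin.all? λ l → (k Fin.≟ l) ⊎-dec (⟪ axis k , axis l ⟫ ≟ 𝟎))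

frame-orthogonal : ∀ w k l → k ≢ l → ⟪ w ▷ axis k , w ▷ axis l ⟫ ≡ 𝟎
frame-orthogonal w k l k≢l = case axis-orthogonal k l of λ
  { (inj₁ k≡l) → ⊥-elim (k≢l k≡l)
  ; (inj₂ eq)  → trans (▷-isometry w (axis k) (axis l)) eq }

axis-center₄ : ∀ k → ⟪ axis k , center s₄ ⟫ ≡ 𝟎
axis-center₄ = from-yes (Fin.all? λ k → ⟪ axis k , center s₄ ⟫ ≟ 𝟎)

pairing-coordinates : ∀ α β γ δ a b c d e →
  ⊝ φ³ ⊛ (𝟎 ⊛ a) ⊕ (𝟏 ⊛ (α ⊛ b) ⊕ (𝟏 ⊛ (β ⊛ c) ⊕ (𝟏 ⊛ (γ ⊛ d) ⊕ (𝟏 ⊛ (δ ⊛ e) ⊕ 𝟎)))) ≡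
  (α ⊛ b ⊕ β ⊛ c) ⊕ (γ ⊛ d ⊕ δ ⊛ e)
pairing-coordinates = solve-∀ ring

axis-coordinates : ∀ a b c d e → let x = a ∷ b ∷ c ∷ d ∷ e ∷ [] in
  ⟪ axis (# 0) , x ⟫ ≡ b × ⟪ axis (# 1) , x ⟫ ≡ c × ⟪ axis (# 2) , x ⟫ ≡ d × ⟪ axis (# 3) , x ⟫ ≡ e
axis-coordinates a b c d e =
  trans (pairing-coordinates 𝟏 𝟎 𝟎 𝟎 a b c d e) (p b c d e) ,
  trans (pairing-coordinates 𝟎 𝟏 𝟎 𝟎 a b c d e) (q b c d e) ,
  trans (pairing-coordinates 𝟎 𝟎 𝟏 𝟎 a b c d e) (r b c d e) ,
  trans (pairing-coordinates 𝟎 𝟎 𝟎 𝟏 a b c d e) (s b c d e)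
  where
  p : ∀ b c d e → (𝟏 ⊛ b ⊕ 𝟎 ⊛ c) ⊕ (𝟎 ⊛ d ⊕ 𝟎 ⊛ e) ≡ b
  p = solve-∀ ring
  q : ∀ b c d e → (𝟎 ⊛ b ⊕ 𝟏 ⊛ c) ⊕ (𝟎 ⊛ d ⊕ 𝟎 ⊛ e) ≡ c
  q = solve-∀ ring
  r : ∀ b c d e → (𝟎 ⊛ b ⊕ 𝟎 ⊛ c) ⊕ (𝟏 ⊛ d ⊕ 𝟎 ⊛ e) ≡ d
  r = solve-∀ ring
  s : ∀ b c d e → (𝟎 ⊛ b ⊕ 𝟎 ⊛ c) ⊕ (𝟎 ⊛ d ⊕ 𝟏 ⊛ e) ≡ e
  s = solve-∀ ring

square : ℤ[φ] → ℤ[φ]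
square x = x ⊛ x

norm-coordinates : ∀ x → ⟪ x , x ⟫ ≡
  ((square ⟪ axis (# 0) , x ⟫ ⊕ square ⟪ axis (# 1) , x ⟫) ⊕
   (square ⟪ axis (# 2) , x ⟫ ⊕ square ⟪ axis (# 3) , x ⟫)) ⊕ ⊝ φ³ ⊛ square (Vec.head x)
norm-coordinates (a ∷ b ∷ c ∷ d ∷ e ∷ []) =
  let p , q , r , s = axis-coordinates a b c d e in
  trans (f (⊝ φ³) a b c d e) (cong (λ t → t ⊕ ⊝ φ³ ⊛ (a ⊛ a))
    (sym (cong₂ _⊕_ (cong₂ _⊕_ (cong square p) (cong square q)) (cong₂ _⊕_ (cong square r) (cong square s)))))
  where
  f : ∀ f a b c d e →
      f ⊛ (a ⊛ a) ⊕ (𝟏 ⊛ (b ⊛ b) ⊕ (𝟏 ⊛ (c ⊛ c) ⊕ (𝟏 ⊛ (d ⊛ d) ⊕ (𝟏 ⊛ (e ⊛ e) ⊕ 𝟎)))) ≡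
      ((b ⊛ b ⊕ c ⊛ c) ⊕ (d ⊛ d ⊕ e ⊛ e)) ⊕ f ⊛ (a ⊛ a)
  f = solve-∀ ring

pairing-center₀ : ∀ x → ⟪ x , center zero ⟫ ≡
  ((⟪ axis (# 0) , x ⟫ ⊕ ⟪ axis (# 1) , x ⟫) ⊕ (⟪ axis (# 2) , x ⟫ ⊕ ⟪ axis (# 3) , x ⟫)) ⊕ ⊝ φ³ ⊛ Vec.head x
pairing-center₀ (a ∷ b ∷ c ∷ d ∷ e ∷ []) =
  let p , q , r , s = axis-coordinates a b c d e in
  trans (f (⊝ φ³) a b c d e) (cong (λ t → t ⊕ ⊝ φ³ ⊛ a) (sym (cong₂ _⊕_ (cong₂ _⊕_ p q) (cong₂ _⊕_ r s))))
  where
  f : ∀ f a b c d e →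
      f ⊛ (a ⊛ 𝟏) ⊕ (𝟏 ⊛ (b ⊛ 𝟏) ⊕ (𝟏 ⊛ (c ⊛ 𝟏) ⊕ (𝟏 ⊛ (d ⊛ 𝟏) ⊕ (𝟏 ⊛ (e ⊛ 𝟏) ⊕ 𝟎)))) ≡
      ((b ⊕ c) ⊕ (d ⊕ e)) ⊕ f ⊛ a
  f = solve-∀ ring

⊕-𝟎-⊝ : ∀ s t → t ≡ 𝟎 → s ⊕ ⊝ t ≡ s
⊕-𝟎-⊝ s .𝟎 refl = ⊕-identityʳ s

-- A mirror that separates a vertex of a hypercube from its centre, or
-- contains the centre, is one of the four walls parallel to its facets.
wall-of-cube : ∀ w {M} → Root M → Nonneg (⊝ ⟪ M , w ▷ center s₄ ⟫) → Positive ⟪ M , w ▷ center zero ⟫ →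
               ∃[ k ] M ≡ w ▷ axis k
wall-of-cube w {M} r p q =
  let k , eq = base (Root-▷ (reverse w) r)
        (subst (λ t → Nonneg (⊝ t)) (pull (center s₄)) p) (subst Positive (pull (center zero)) q)
  in k , trans (sym (▷-reverse′ w M)) (cong (w ▷_) eq)
  where
  pull : ∀ x → ⟪ M , w ▷ x ⟫ ≡ ⟪ reverse w ▷ M , x ⟫
  pull x = trans (⟪⟫-comm M (w ▷ x)) (trans (⟪⟫-transpose w x M) (⟪⟫-comm x (reverse w ▷ M)))
  base : ∀ {M} → Root M → Nonneg (⊝ ⟪ M , center s₄ ⟫) → Positive ⟪ M , center zero ⟫ → ∃[ k ] M ≡ axis k
  -- Each axis equals M or is orthogonal to it, since a product of at most - 1 contradicts the sides
  -- of the vertex and the centre. Orthogonality to all four would give M the norm - φ³h², with h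
  -- its first coordinate, instead of 1.
  base {M} r p q = case each (# 0) of λ
    { (inj₁ eq) → # 0 , eq ; (inj₂ z₀) → case each (# 1) of λ
    { (inj₁ eq) → # 1 , eq ; (inj₂ z₁) → case each (# 2) of λ
    { (inj₁ eq) → # 2 , eq ; (inj₂ z₂) → case each (# 3) of λ
    { (inj₁ eq) → # 3 , eq ; (inj₂ z₃) → ⊥-elim (impossible z₀ z₁ z₂ z₃) }}}}
    where
    f₀ = Future-center zero
    f₄ = Future-center s₄
    above : Nonneg (⟪ M , center zero ⟫ ⊕ ⊝ 𝟏)
    above = side≥1 r ([] , refl) q
    e : ∀ t → 𝟐 ⊕ (t ⊕ ⊝ 𝟏) ≡ t ⊕ 𝟏
    e = solve-∀ ring
    opposite : ∀ k → ¬ (Nonneg (⊝ ⟪ M , axis k ⟫ ⊕ ⊝ 𝟏))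
    opposite k t = Positive⇒≢𝟎
      (subst Positive sum₀ (Positive-⊕-Nonneg {𝟐} {⟪ M , center zero ⟫ ⊕ ⊝ 𝟏} 𝟐>0 above))
      (trans (cong (⟪_, center zero ⟫) (ultraparallel {x = center zero} {x′ = center s₄} r (EdgeAt⇒Root (EdgeAt-axis k)) t f₀ f₄
        (inj₂ (subst Positive (trans sum₀ (⟪⟫-+ˡ M (axis k) (center zero))) (Positive-⊕-Nonneg {𝟐} {⟪ M , center zero ⟫ ⊕ ⊝ 𝟏} 𝟐>0 above)))
        (subst (λ t → Nonneg (⊝ t)) (sym (trans (cong (⟪ M , center s₄ ⟫ ⊕_) (axis-center₄ k)) (⊕-identityʳ ⟪ M , center s₄ ⟫))) p)))
        (⟪⟫-zeroˡ (center zero)))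
      where
      sum₀ : 𝟐 ⊕ (⟪ M , center zero ⟫ ⊕ ⊝ 𝟏) ≡ ⟪ M +ᵥ axis k , center zero ⟫
      sum₀ = trans (e ⟪ M , center zero ⟫) (trans (cong (⟪ M , center zero ⟫ ⊕_) (sym (EdgeAt-pairing (EdgeAt-axis k))))
               (sym (⟪⟫-+ˡ M (axis k) (center zero))))
    same : ∀ k → Nonneg (⟪ M , axis k ⟫ ⊕ ⊝ 𝟏) → M ≡ axis k
    same k t = ultraparallel′ {x = center zero} {x′ = center s₄} r (EdgeAt⇒Root (EdgeAt-axis k)) t f₀ f₄
      (subst (λ t → Nonneg (⟪ M , center zero ⟫ ⊕ ⊝ t)) (sym (EdgeAt-pairing (EdgeAt-axis k))) above)
      (subst (λ t → Nonneg (⊝ t)) (sym (⊕-𝟎-⊝ ⟪ M , center s₄ ⟫ ⟪ axis k , center s₄ ⟫ (axis-center₄ k))) p)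
    each : ∀ k → M ≡ axis k ⊎ ⟪ axis k , M ⟫ ≡ 𝟎
    each k = case root-root r (EdgeAt⇒Root (EdgeAt-axis k)) of λ
      { (inj₁ z)        → inj₂ (trans (⟪⟫-comm (axis k) M) z)
      ; (inj₂ (inj₁ t)) → inj₁ (same k t)
      ; (inj₂ (inj₂ t)) → ⊥-elim (opposite k t) }
    impossible : ⟪ axis (# 0) , M ⟫ ≡ 𝟎 → ⟪ axis (# 1) , M ⟫ ≡ 𝟎 → ⟪ axis (# 2) , M ⟫ ≡ 𝟎 → ⟪ axis (# 3) , M ⟫ ≡ 𝟎 → ⊥
    impossible z₀ z₁ z₂ z₃ = Positive-asym {𝟏} 𝟏>0 (subst (λ t → Positive (⊝ t)) (Root-norm r)
      (subst (λ t → Positive (⊝ t)) (sym (trans (norm-coordinates M)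
        (trans (cong (_⊕ ⊝ φ³ ⊛ square (Vec.head M)) (cong₂ _⊕_ (cong₂ _⊕_ (cong square z₀) (cong square z₁)) (cong₂ _⊕_ (cong square z₂) (cong square z₃))))
               (⊕-identityˡ (⊝ φ³ ⊛ square (Vec.head M))))))
        (case f≥0 of λ { (inj₂ pos) → pos ; (inj₁ eq) → ⊥-elim (case (trans (sym (Root-norm r)) (trans (norm-coordinates M)
          (trans (cong (_⊕ ⊝ φ³ ⊛ square (Vec.head M)) (cong₂ _⊕_ (cong₂ _⊕_ (cong square z₀) (cong square z₁)) (cong₂ _⊕_ (cong square z₂) (cong square z₃))))
          (trans (⊕-identityˡ (⊝ φ³ ⊛ square (Vec.head M)))
          (trans (sym (⊝-involutive (⊝ φ³ ⊛ square (Vec.head M)))) (cong ⊝_ eq)))))) of λ ()) })))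
      where
      g : ∀ f h → ⊝ (⊝ f ⊛ h) ≡ f ⊛ h
      g = solve-∀ ring
      f≥0 : Nonneg (⊝ (⊝ φ³ ⊛ square (Vec.head M)))
      f≥0 = subst Nonneg (sym (g φ³ (square (Vec.head M))))
        (Nonneg-⊛ {φ³} {square (Vec.head M)} (inj₂ (coeffs (coeffs₁ 0 2))) (Nonneg-square (Vec.head M)))

-- A mirror with V and u on different sides stays between them when u moves
-- away from V.
side-persists : ∀ {M ρ u V} → Root M → Vertex V → Positive ⟪ M , V ⟫ → EdgeAt ρ u → Positive ⟪ ρ , V ⟫ →
                Positive (⊝ ⟪ M , u ⟫) → Positive (⊝ ⟪ M , across ρ u ⟫)
side-persists {M} {ρ} {u} {V} r v MV e ρV Mu = case root-root r (EdgeAt⇒Root e) of λ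
  { (inj₁ z) → subst Positive (trans (cong ⊝_ (sym (trans (cong (λ t → ⟪ M , u ⟫ ⊕ ⊝ 𝟐 ⊛ t) z) (f ⟪ M , u ⟫)))) back) Mu
  ; (inj₂ (inj₁ t)) → subst Positive (trans (g ⟪ M , u ⟫ ⟪ M , ρ ⟫) back)
      (Positive-⊕ {⊝ ⟪ M , u ⟫} {𝟐 ⊛ ⟪ M , ρ ⟫} Mu (Positive-⊛ {𝟐} {⟪ M , ρ ⟫} 𝟐>0 (1≤⇒Positive {⟪ M , ρ ⟫} t)))
  ; (inj₂ (inj₂ t)) → ⊥-elim (nonzero (ultraparallel {x = V} {x′ = u} r (EdgeAt⇒Root e) t (Future-vertex v) (Future-vertex (EdgeAt⇒Vertex e))
      (inj₂ (Positive-⊕ {⟪ M , V ⟫} {⟪ ρ , V ⟫} MV ρV))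
      (subst (λ t → Nonneg (⊝ (⟪ M , u ⟫ ⊕ t))) (sym (EdgeAt-pairing e))
        (subst Nonneg (h ⟪ M , u ⟫) (side≤-1 r (EdgeAt⇒Vertex e) Mu))))) }
  where
  f : ∀ s → s ⊕ ⊝ 𝟐 ⊛ 𝟎 ≡ s
  f = solve-∀ ring
  g : ∀ s t → ⊝ s ⊕ 𝟐 ⊛ t ≡ ⊝ (s ⊕ ⊝ 𝟐 ⊛ t)
  g = solve-∀ ring
  h : ∀ s → ⊝ s ⊕ ⊝ 𝟏 ≡ ⊝ (s ⊕ 𝟏)
  h = solve-∀ ring
  back : ⊝ (⟪ M , u ⟫ ⊕ ⊝ 𝟐 ⊛ ⟪ M , ρ ⟫) ≡ ⊝ ⟪ M , across ρ u ⟫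
  back = cong ⊝_ (sym (⟪⟫-across M ρ u))
  nonzero : M +ᵥ ρ ≢ 0ᵥ
  nonzero eq = Positive⇒≢𝟎 (Positive-⊕ {⟪ M , V ⟫} {⟪ ρ , V ⟫} MV ρV)
    (trans (sym (⟪⟫-+ˡ M ρ V)) (trans (cong (⟪_, V ⟫) eq) (⟪⟫-zeroˡ V)))

-- The 120 edges at a vertex.

open DecMembership _≟ᵥ_ using (_∈?_; _∉?_)
open DecUnique _≟ᵥ_ using (unique?)

images : List Point → List Point
images = concatMap (λ x → map (λ i → reflect (suc i) x) (allFin 4))

-- Breadth-first search in an orbit. The generators are involutions, so the neighbours of a layer
-- lie in the previous, the same or the next one, and only two layers have to be excluded.
layers : ℕ → List Point → List Point → List Point
layers zero    previous current = []
layers (suc n) previous current =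
  current ++ layers n current (deduplicate _≟ᵥ_ (filter (_∉? previous ++ current) (images current)))

-- The 120 edges at center zero are the vertices of a 600-cell, the orbit of
-- one of them under the reflections that fix center zero.
linkRoots : List Point
-- The farthest root is 45 reflections away: 60 - 15 is the length of the longest minimal coset
-- representative of H₃ in H₄.
linkRoots = layers 46 [] (normal zero ∷ [])

reflect-center₀ : ∀ i → reflect (suc i) (center zero) ≡ center zero
reflect-center₀ zero                   = refl
reflect-center₀ (suc zero)             = refl
reflect-center₀ (suc (suc zero))       = refl
reflect-center₀ (suc (suc (suc zero))) = refl

EdgeAt-reflect : ∀ i {ρ} → EdgeAt ρ (center zero) → EdgeAt (reflect (suc i) ρ) (center zero)
EdgeAt-reflect i {ρ} e = subst (EdgeAt (reflect (suc i) ρ)) (reflect-center₀ i) (EdgeAt-▷ (suc i ∷ []) e)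

linkRoots-sound : ∀ {r} → r ∈ linkRoots → EdgeAt r (center zero)
linkRoots-sound = go 46 [] (normal zero ∷ []) λ { (here refl) → [] , refl , refl }
  where
  go : ∀ n previous current → (∀ {r} → r ∈ current → EdgeAt r (center zero)) →
       ∀ {r} → r ∈ layers n previous current → EdgeAt r (center zero)
  go (suc n) previous current edges {r} r∈ = case ∈-++⁻ current r∈ of λ
    { (inj₁ p) → edges p
    ; (inj₂ p) → go n current (deduplicate _≟ᵥ_ (filter (_∉? previous ++ current) (images current))) (λ q → new (proj₁ (∈-filter⁻ (_∉? previous ++ current) {xs = images current}
                   (∈-deduplicate⁻ _≟ᵥ_ (filter (_∉? previous ++ current) (images current)) q)))) p }
    where
    new : ∀ {r} → r ∈ images current → EdgeAt r (center zero)
    new p = case find (∈-concatMap⁻ (λ x → map (λ i → reflect (suc i) x) (allFin 4)) {xs = current} p) of λ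
      { (x , x∈ , q) → case ∈-map⁻ (λ i → reflect (suc i) x) {xs = allFin 4} q of λ
      { (i , _ , refl) → EdgeAt-reflect i (edges x∈) } }

Closed : List Point → Set
Closed xs = All (λ r → All (λ i → reflect (suc i) r ∈ xs) (allFin 4)) xs

closed? : ∀ xs → Dec (Closed xs)
closed? xs = all? (λ r → all? (λ i → reflect (suc i) r ∈? xs) (allFin 4)) xs

linkRoots-closed : Closed linkRoots
linkRoots-closed = from-yes (closed? linkRoots)

linkRoots-unique : Unique linkRoots
linkRoots-unique = from-yes (unique? linkRoots)

reflect-linkRoots : ∀ i {r} → r ∈ linkRoots → reflect (suc i) r ∈ linkRoots
reflect-linkRoots i r∈ = All.lookup (All.lookup linkRoots-closed r∈) (∈-allFin i)

reflect-linkRoots⁻ : ∀ i {r} → reflect (suc i) r ∈ linkRoots → r ∈ linkRoots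
reflect-linkRoots⁻ i {r} r∈ = subst (_∈ linkRoots) (reflect-involutive (suc i) r) (reflect-linkRoots i {reflect (suc i) r} r∈)

axis∈linkRoots : ∀ k → axis k ∈ linkRoots
axis∈linkRoots = λ { zero → a₀ ; (suc zero) → a₁ ; (suc (suc zero)) → a₂ ; (suc (suc (suc zero))) → a₃ }
  where
  a₀ = here refl
  a₁ = reflect-linkRoots (# 0) {axis (# 0)} a₀
  a₂ = reflect-linkRoots (# 1) {axis (# 1)} a₁
  a₃ = reflect-linkRoots (# 2) {axis (# 2)} a₂

head-reflect : ∀ (i : Fin 3) x → Vec.head (reflect (Fin.inject₁ (suc i)) x) ≡ Vec.head x
head-reflect i x = go i x
  where
  fixed : ∀ a c → a ⊕ ⊝ (c ⊛ 𝟎) ≡ a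
  fixed = solve-∀ ring
  go : ∀ i x → Vec.head (reflect (Fin.inject₁ (suc i)) x) ≡ Vec.head x
  go zero             x@(a ∷ _) = fixed a (κ s₁ ⊛ ⟪ normal s₁ , x ⟫)
  go (suc zero)       x@(a ∷ _) = fixed a (κ s₂ ⊛ ⟪ normal s₂ , x ⟫)
  go (suc (suc zero)) x@(a ∷ _) = fixed a (κ s₃ ⊛ ⟪ normal s₃ , x ⟫)

φ⁻¹ : ℤ[φ]
φ⁻¹ = ⟨ -[1+ 0 ] , + 1 ⟩

φ⁻¹>0 : Positive φ⁻¹
φ⁻¹>0 = unscale (coeffs (coeffs₁ 0 0))

head-reflect₄ : ∀ x → Vec.head (reflect s₄ x) ≡ Vec.head x ⊕ φ⁻¹ ⊛ (Vec.head x ⊕ ⊝ ⟪ axis (# 3) , x ⟫)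
head-reflect₄ (a ∷ b ∷ c ∷ d ∷ e ∷ []) = trans (moved a b c d e)
  (cong (λ t → a ⊕ φ⁻¹ ⊛ (a ⊕ ⊝ t)) (sym (proj₂ (proj₂ (proj₂ (axis-coordinates a b c d e))))))
  where
  moved : ∀ a b c d e →
    a ⊕ ⊝ (φ² ⊛ (⊝ φ³ ⊛ (-φ⁻³ ⊛ a) ⊕ (𝟏 ⊛ (𝟎 ⊛ b) ⊕ (𝟏 ⊛ (𝟎 ⊛ c) ⊕ (𝟏 ⊛ (𝟎 ⊛ d) ⊕
      (𝟏 ⊛ (-𝟏 ⊛ e) ⊕ 𝟎))))) ⊛ -φ⁻³) ≡ a ⊕ φ⁻¹ ⊛ (a ⊕ ⊝ e)
  moved = solve-∀ ring

-- toLast k exchanges the axes k and # 3.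
toLast : Fin 4 → List (Fin 3)
toLast zero                   = # 2 ∷ # 1 ∷ # 0 ∷ []
toLast (suc zero)             = # 2 ∷ # 1 ∷ []
toLast (suc (suc zero))       = # 2 ∷ []
toLast (suc (suc (suc zero))) = []

permutation : List (Fin 3) → Word
permutation = map (λ i → Fin.inject₁ (suc i))

toLast-axis : ∀ k → permutation (toLast k) ▷ axis k ≡ axis (# 3)
toLast-axis = from-yes (Fin.all? λ k → permutation (toLast k) ▷ axis k ≟ᵥ axis (# 3))

head-permutation : ∀ p x → Vec.head (permutation p ▷ x) ≡ Vec.head x
head-permutation []      x = refl
head-permutation (i ∷ p) x = trans (head-reflect i (permutation p ▷ x)) (head-permutation p x)

EdgeAt-permutation : ∀ p {ρ} → EdgeAt ρ (center zero) → EdgeAt (permutation p ▷ ρ) (center zero)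
EdgeAt-permutation []      e = e
EdgeAt-permutation (i ∷ p) {ρ} e = EdgeAt-reflect (Fin.inject₁ i) {permutation p ▷ ρ} (EdgeAt-permutation p {ρ} e)

permutation-linkRoots⁻ : ∀ p {r} → permutation p ▷ r ∈ linkRoots → r ∈ linkRoots
permutation-linkRoots⁻ []      r∈ = r∈
permutation-linkRoots⁻ (i ∷ p) {r} r∈ = permutation-linkRoots⁻ p {r} (reflect-linkRoots⁻ (Fin.inject₁ i) {permutation p ▷ r} r∈)

-- If h ≤ a, b, c, d ≤ 0, the four squares add up to at most 4h², so the norm is at most (4 - φ³)h²
-- = -φ⁻³h² and cannot be 1.
not-all-below : ∀ h a b c d → ((square a ⊕ square b) ⊕ (square c ⊕ square d)) ⊕ ⊝ φ³ ⊛ square h ≡ 𝟏 →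
  Nonneg (⊝ a) → Nonneg (⊝ b) → Nonneg (⊝ c) → Nonneg (⊝ d) →
  Nonneg (⊝ h ⊕ a) → Nonneg (⊝ h ⊕ b) → Nonneg (⊝ h ⊕ c) → Nonneg (⊝ h ⊕ d) → ⊥
not-all-below h a b c d norm a≤0 b≤0 c≤0 d≤0 ha hb hc hd =
  Positive⇒≢𝟎
    (dominates-norm (⊝ h ⊕ a) ((⊝ h ⊕ a) ⊕ 𝟐 ⊛ ⊝ a) (⊝ h ⊕ b) ((⊝ h ⊕ b) ⊕ 𝟐 ⊛ ⊝ b)
         (⊝ h ⊕ c) ((⊝ h ⊕ c) ⊕ 𝟐 ⊛ ⊝ c) (⊝ h ⊕ d) ((⊝ h ⊕ d) ⊕ 𝟐 ⊛ ⊝ d)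
         ha (step a a≤0 ha) hb (step b b≤0 hb) hc (step c c≤0 hc) hd (step d d≤0 hd))
    (trans (e h a b c d) (cong (λ t → 𝟏 ⊕ ⊝ t) norm))
  where
  e : ∀ h a b c d →
      𝟏 ⊕ (φ⁻³ ⊛ (h ⊛ h) ⊕ (((⊝ h ⊕ a) ⊛ ((⊝ h ⊕ a) ⊕ 𝟐 ⊛ ⊝ a) ⊕ (⊝ h ⊕ b) ⊛ ((⊝ h ⊕ b) ⊕ 𝟐 ⊛ ⊝ b)) ⊕
                           ((⊝ h ⊕ c) ⊛ ((⊝ h ⊕ c) ⊕ 𝟐 ⊛ ⊝ c) ⊕ (⊝ h ⊕ d) ⊛ ((⊝ h ⊕ d) ⊕ 𝟐 ⊛ ⊝ d)))) ≡
      𝟏 ⊕ ⊝ (((a ⊛ a ⊕ b ⊛ b) ⊕ (c ⊛ c ⊕ d ⊛ d)) ⊕ ⊝ φ³ ⊛ (h ⊛ h))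
  e = solve-∀ ring
  step : ∀ x → Nonneg (⊝ x) → Nonneg (⊝ h ⊕ x) → Nonneg ((⊝ h ⊕ x) ⊕ 𝟐 ⊛ ⊝ x)
  step x p q = Nonneg-⊕ {⊝ h ⊕ x} {𝟐 ⊛ ⊝ x} q (Nonneg-⊛ {𝟐} {⊝ x} (inj₂ 𝟐>0) p)
  dominates-norm : ∀ p p′ q q′ r r′ s s′ → Nonneg p → Nonneg p′ → Nonneg q → Nonneg q′ → Nonneg r → Nonneg r′ → Nonneg s → Nonneg s′ →
        Positive (𝟏 ⊕ (φ⁻³ ⊛ (h ⊛ h) ⊕ ((p ⊛ p′ ⊕ q ⊛ q′) ⊕ (r ⊛ r′ ⊕ s ⊛ s′))))
  dominates-norm p p′ q q′ r r′ s s′ np np′ nq nq′ nr nr′ ns ns′ =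
    Positive-⊕-Nonneg {𝟏} {φ⁻³ ⊛ (h ⊛ h) ⊕ ((p ⊛ p′ ⊕ q ⊛ q′) ⊕ (r ⊛ r′ ⊕ s ⊛ s′))} 𝟏>0
      (Nonneg-⊕ {φ⁻³ ⊛ (h ⊛ h)} {(p ⊛ p′ ⊕ q ⊛ q′) ⊕ (r ⊛ r′ ⊕ s ⊛ s′)}
        (Nonneg-⊛ {φ⁻³} {h ⊛ h} (inj₂ φ⁻³-Positive) (Nonneg-square h))
        (Nonneg-⊕ {p ⊛ p′ ⊕ q ⊛ q′} {r ⊛ r′ ⊕ s ⊛ s′}
          (Nonneg-⊕ {p ⊛ p′} {q ⊛ q′} (Nonneg-⊛ {p} {p′} np np′) (Nonneg-⊛ {q} {q′} nq nq′))
          (Nonneg-⊕ {r ⊛ r′} {s ⊛ s′} (Nonneg-⊛ {r} {r′} nr nr′) (Nonneg-⊛ {s} {s′} ns ns′))))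

-- All terms in the conjugate of ⟪ ρ , ρ ⟫ = 1 are nonnegative, and the first is φ⁻³ times the
-- square that is to be bounded.
conj-head-bound : ∀ {ρ} → Root ρ → Nonneg (φ³ ⊕ ⊝ (conj (Vec.head ρ) ⊛ conj (Vec.head ρ)))
conj-head-bound {x@(a ∷ b ∷ c ∷ d ∷ e ∷ [])} r =
  subst (λ t → Nonneg (φ³ ⊛ t ⊕ ⊝ (conj a ⊛ conj a))) (trans (sym (conj-form weights x x)) (cong conj (Root-norm r)))
    (bound (conj a) (conj b) (conj c) (conj d) (conj e))
  where
  f : ∀ a b c d e → φ³ ⊛ ((b ⊛ b ⊕ c ⊛ c) ⊕ (d ⊛ d ⊕ e ⊛ e)) ≡
      φ³ ⊛ (φ⁻³ ⊛ (a ⊛ a) ⊕ (𝟏 ⊛ (b ⊛ b) ⊕ (𝟏 ⊛ (c ⊛ c) ⊕ (𝟏 ⊛ (d ⊛ d) ⊕ (𝟏 ⊛ (e ⊛ e) ⊕ 𝟎))))) ⊕ ⊝ (a ⊛ a)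
  f = solve-∀ ring
  bound : ∀ a b c d e → Nonneg
      (φ³ ⊛ (φ⁻³ ⊛ (a ⊛ a) ⊕ (𝟏 ⊛ (b ⊛ b) ⊕ (𝟏 ⊛ (c ⊛ c) ⊕ (𝟏 ⊛ (d ⊛ d) ⊕ (𝟏 ⊛ (e ⊛ e) ⊕ 𝟎))))) ⊕ ⊝ (a ⊛ a))
  bound a b c d e = subst Nonneg (f a b c d e)
    (Nonneg-⊛ {φ³} {(b ⊛ b ⊕ c ⊛ c) ⊕ (d ⊛ d ⊕ e ⊛ e)} (inj₂ (coeffs (coeffs₁ 0 2)))
      (Nonneg-⊕ {b ⊛ b ⊕ c ⊛ c} {d ⊛ d ⊕ e ⊛ e}
        (Nonneg-⊕ {b ⊛ b} {c ⊛ c} (Nonneg-square b) (Nonneg-square c))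
        (Nonneg-⊕ {d ⊛ d} {e ⊛ e} (Nonneg-square d) (Nonneg-square e))))

conj-⊝ : ∀ x → conj (⊝ x) ≡ ⊝ conj x
conj-⊝ ⟨ a , b ⟩ = cong ⟨_, ℤ.- ℤ.- b ⟩ (sym (ℤ.neg-distrib-+ a b))

conj-difference-bound : ∀ f x y → Nonneg (f ⊕ ⊝ (conj x ⊛ conj x)) → Nonneg (f ⊕ ⊝ (conj y ⊛ conj y)) →
                        Nonneg (int (+ 4) ⊛ f ⊕ ⊝ (conj (x ⊕ ⊝ y) ⊛ conj (x ⊕ ⊝ y)))
conj-difference-bound f x y p q =
  subst (λ t → Nonneg (int (+ 4) ⊛ f ⊕ ⊝ (t ⊛ t)))
    (sym (trans (conj-⊕ x (⊝ y)) (cong (conj x ⊕_) (conj-⊝ y)))) (go (conj x) (conj y) p q)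
  where
  e : ∀ f x y → (𝟐 ⊛ (f ⊕ ⊝ (x ⊛ x)) ⊕ 𝟐 ⊛ (f ⊕ ⊝ (y ⊛ y))) ⊕ (x ⊕ y) ⊛ (x ⊕ y) ≡
      int (+ 4) ⊛ f ⊕ ⊝ ((x ⊕ ⊝ y) ⊛ (x ⊕ ⊝ y))
  e = solve-∀ ring
  go : ∀ x y → Nonneg (f ⊕ ⊝ (x ⊛ x)) → Nonneg (f ⊕ ⊝ (y ⊛ y)) →
       Nonneg (int (+ 4) ⊛ f ⊕ ⊝ ((x ⊕ ⊝ y) ⊛ (x ⊕ ⊝ y)))
  go x y p q = subst Nonneg (e f x y)
    (Nonneg-⊕ {𝟐 ⊛ (f ⊕ ⊝ (x ⊛ x)) ⊕ 𝟐 ⊛ (f ⊕ ⊝ (y ⊛ y))} {(x ⊕ y) ⊛ (x ⊕ y)}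
      (Nonneg-⊕ {𝟐 ⊛ (f ⊕ ⊝ (x ⊛ x))} {𝟐 ⊛ (f ⊕ ⊝ (y ⊛ y))}
        (Nonneg-⊛ {𝟐} {f ⊕ ⊝ (x ⊛ x)} (inj₂ 𝟐>0) p) (Nonneg-⊛ {𝟐} {f ⊕ ⊝ (y ⊛ y)} (inj₂ 𝟐>0) q))
      (Nonneg-square (x ⊕ y)))

archimedean : ∀ x → ∃[ n ] Nonneg (int (+ n) ⊛ φ⁻³ ⊕ ⊝ x)
archimedean x = case Nonneg-or-Positive⊝ x of λ
  { (inj₁ (inj₁ refl)) → 0 , inj₁ refl
  ; (inj₁ (inj₂ p))    → go p
  ; (inj₂ p)           → 0 , subst Nonneg (sym (⊕-identityˡ (⊝ x))) (inj₂ p) }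
  where
  nat : ∀ n → Nonneg (int (+ n))
  nat zero    = inj₁ refl
  nat (suc n) = inj₂ (coeffs (coeffs₁ n 0))
  -- The constants are 5φ⁻³ - 1 and 10φ⁻³ - φ, both positive.
  e : ∀ a b → a ⊛ ⟨ -[1+ 15 ] , + 10 ⟩ ⊕ b ⊛ ⟨ -[1+ 29 ] , + 19 ⟩ ≡ (int (+ 5) ⊛ (a ⊕ 𝟐 ⊛ b)) ⊛ φ⁻³ ⊕ ⊝ (a ⊕ b ⊛ φ)
  e = solve-∀ ring
  int-* : ∀ m n → int m ⊛ int n ≡ int (m ℤ.* n)
  int-* m n = cong₂ ⟨_,_⟩ (p m n) (q m n)
    where
    p : ∀ m n → m ℤ.* n ℤ.+ + 0 ℤ.* + 0 ≡ m ℤ.* n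
    p = ℤ-solve-∀
    q : ∀ m n → m ℤ.* + 0 ℤ.+ + 0 ℤ.* n ℤ.+ + 0 ℤ.* + 0 ≡ + 0
    q = ℤ-solve-∀
  int-φ : ∀ a b → int a ⊕ int b ⊛ φ ≡ ⟨ a , b ⟩
  int-φ a b = cong₂ ⟨_,_⟩ (p a b) (q b)
    where
    p : ∀ a b → a ℤ.+ (b ℤ.* + 0 ℤ.+ + 0 ℤ.* + 1) ≡ a
    p = ℤ-solve-∀
    q : ∀ b → + 0 ℤ.+ (b ℤ.* + 1 ℤ.+ + 0 ℤ.* + 0 ℤ.+ + 0 ℤ.* + 1) ≡ b
    q = ℤ-solve-∀
  natural : ∀ a b → ∃[ n ] Nonneg (int (+ n) ⊛ φ⁻³ ⊕ ⊝ ⟨ + a , + b ⟩)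
  natural a b = 5 ℕ.* (a ℕ.+ 2 ℕ.* b) ,
    subst₂ (λ s t → Nonneg (s ⊛ φ⁻³ ⊕ ⊝ t)) coefficient (int-φ (+ a) (+ b))
      (subst Nonneg (e (int (+ a)) (int (+ b)))
        (Nonneg-⊕ {int (+ a) ⊛ ⟨ -[1+ 15 ] , + 10 ⟩} {int (+ b) ⊛ ⟨ -[1+ 29 ] , + 19 ⟩}
          (Nonneg-⊛ {int (+ a)} {⟨ -[1+ 15 ] , + 10 ⟩} (nat a) (inj₂ (unscale (unscale (unscale (unscale (unscale (coeffs (coeffs₁ 1 0)))))))))
          (Nonneg-⊛ {int (+ b)} {⟨ -[1+ 29 ] , + 19 ⟩} (nat b) (inj₂ (unscale (unscale (unscale (unscale (unscale (coeffs (coeffs₁ 4 2))))))))) ))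
    where
    coefficient : int (+ 5) ⊛ (int (+ a) ⊕ 𝟐 ⊛ int (+ b)) ≡ int (+ (5 ℕ.* (a ℕ.+ 2 ℕ.* b)))
    coefficient = trans (cong (λ t → int (+ 5) ⊛ (int (+ a) ⊕ t)) (trans (int-* (+ 2) (+ b)) (cong int (sym (ℤ.pos-* 2 b)))))
      (trans (int-* (+ 5) (+ (a ℕ.+ 2 ℕ.* b))) (cong int (sym (ℤ.pos-* 5 (a ℕ.+ 2 ℕ.* b)))))
  g : ∀ s x → (s ⊕ ⊝ (φ ⊛ x)) ⊕ φ⁻¹ ⊛ x ≡ s ⊕ ⊝ x
  g = solve-∀ ring
  go : ∀ {x} → Positive x → ∃[ n ] Nonneg (int (+ n) ⊛ φ⁻³ ⊕ ⊝ x)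
  go (coeffs (coeffs₁ a b)) = natural (suc a) b
  go (coeffs (coeffs₂ a b)) = natural a (suc b)
  go {x} (unscale p) = let n , q = go p in
    n , subst Nonneg (g (int (+ n) ⊛ φ⁻³) x)
          (Nonneg-⊕ {int (+ n) ⊛ φ⁻³ ⊕ ⊝ (φ ⊛ x)} {φ⁻¹ ⊛ x} q (inj₂ (Positive-⊛ {φ⁻¹} {x} φ⁻¹>0 (unscale p))))

-- Reflecting in the wall of a facet that τ crosses decreases the distance of
-- τ from the centre of the hypercube, by at least φ⁻³.
linkRoots-complete : ∀ {τ} → EdgeAt τ (center zero) → τ ∈ linkRoots
linkRoots-complete {τ} e = let n , p = archimedean (⊝ Vec.head τ) in
  descend n τ e (subst (λ t → Nonneg (int (+ n) ⊛ φ⁻³ ⊕ t)) (⊝-involutive (Vec.head τ)) p)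
  where
  start : ∀ h → 𝟎 ⊛ φ⁻³ ⊕ h ≡ h
  start = solve-∀ ring
  budget : ∀ n x h h′ → ((𝟏 ⊕ n) ⊛ x ⊕ h) ⊕ ((h′ ⊕ ⊝ h) ⊕ ⊝ x) ≡ n ⊛ x ⊕ h′
  budget = solve-∀ ring
  gain : ∀ i h t → i ⊛ ⊝ (⊝ h ⊕ t) ≡ (h ⊕ i ⊛ (h ⊕ ⊝ t)) ⊕ ⊝ h
  gain = solve-∀ ring
  sums : ∀ a b c d f h → (𝟏 ⊕ ((⊝ a ⊕ ⊝ b) ⊕ (⊝ c ⊕ ⊝ d))) ⊕ f ⊛ h ≡ 𝟏 ⊕ ⊝ (((a ⊕ b) ⊕ (c ⊕ d)) ⊕ ⊝ f ⊛ h)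
  sums = solve-∀ ring
  head<0 : ∀ h a b c d → ((a ⊕ b) ⊕ (c ⊕ d)) ⊕ ⊝ φ³ ⊛ h ≡ 𝟏 →
           Nonneg (⊝ a) → Nonneg (⊝ b) → Nonneg (⊝ c) → Nonneg (⊝ d) → ¬ Nonneg h
  head<0 h a b c d eq na nb nc nd nh = Positive⇒≢𝟎
    (Positive-⊕-Nonneg {𝟏 ⊕ ((⊝ a ⊕ ⊝ b) ⊕ (⊝ c ⊕ ⊝ d))} {φ³ ⊛ h}
      (Positive-⊕-Nonneg {𝟏} {(⊝ a ⊕ ⊝ b) ⊕ (⊝ c ⊕ ⊝ d)} 𝟏>0
        (Nonneg-⊕ {⊝ a ⊕ ⊝ b} {⊝ c ⊕ ⊝ d} (Nonneg-⊕ {⊝ a} {⊝ b} na nb) (Nonneg-⊕ {⊝ c} {⊝ d} nc nd)))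
      (Nonneg-⊛ {φ³} {h} (inj₂ (coeffs (coeffs₁ 0 2))) nh))
    (trans (sums a b c d φ³ h) (cong (λ t → 𝟏 ⊕ ⊝ t) eq))
  compare : ∀ {τ} → EdgeAt τ (center zero) → ∀ k → τ ≡ axis k ⊎ Nonneg (⊝ ⟪ axis k , τ ⟫)
  compare {τ} e k = case edges-at-vertex (EdgeAt-axis k) e of λ
    { (inj₁ eq)        → inj₁ (sym eq)
    ; (inj₂ (inj₁ eq)) → inj₂ (inj₁ (cong ⊝_ eq))
    ; (inj₂ (inj₂ p))  → inj₂ (inj₂ (1≤⇒Positive {⊝ ⟪ axis k , τ ⟫} p)) }
  descend : ∀ n τ → EdgeAt τ (center zero) → Nonneg (int (+ n) ⊛ φ⁻³ ⊕ Vec.head τ) → τ ∈ linkRoots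
  descend n τ e fuel = case compare e (# 0) of λ
    { (inj₁ refl) → axis∈linkRoots (# 0) ; (inj₂ p₀) → case compare e (# 1) of λ
    { (inj₁ refl) → axis∈linkRoots (# 1) ; (inj₂ p₁) → case compare e (# 2) of λ
    { (inj₁ refl) → axis∈linkRoots (# 2) ; (inj₂ p₂) → case compare e (# 3) of λ
    { (inj₁ refl) → axis∈linkRoots (# 3) ; (inj₂ p₃) → outside n fuel p₀ p₁ p₂ p₃ }}}}
    where
    h = Vec.head τ
    t : Fin 4 → ℤ[φ]
    t k = ⟪ axis k , τ ⟫
    -- The first coordinate h grows by φ⁻¹(h - t) > 0, t being the coordinate k. The conjugates of
    -- the old and the new one have squares at most φ³, so by `conj-bounded-gap` the growth is at
    -- least φ⁻³, the price of one unit of fuel.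
    move : ∀ n → Nonneg (int (+ suc n) ⊛ φ⁻³ ⊕ h) → ∀ k → Positive (⊝ (⊝ h ⊕ ⟪ axis k , τ ⟫)) → τ ∈ linkRoots
    move n fuel k p = permutation-linkRoots⁻ (toLast k) {τ} (reflect-linkRoots⁻ (# 3) {τ₁}
        (descend n τ₂ e₂ (subst Nonneg (budget (int (+ n)) φ⁻³ h (Vec.head τ₂))
          (Nonneg-⊕ {int (+ suc n) ⊛ φ⁻³ ⊕ h} {(Vec.head τ₂ ⊕ ⊝ h) ⊕ ⊝ φ⁻³} fuel
            (conj-bounded-gap (Vec.head τ₂ ⊕ ⊝ h) gained
              (conj-difference-bound φ³ (Vec.head τ₂) h (conj-head-bound (EdgeAt⇒Root e₂)) (conj-head-bound (EdgeAt⇒Root e))))))))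
      where
      τ₁ = permutation (toLast k) ▷ τ
      τ₂ = reflect s₄ τ₁
      e₁ : EdgeAt τ₁ (center zero)
      e₁ = EdgeAt-permutation (toLast k) {τ} e
      e₂ : EdgeAt τ₂ (center zero)
      e₂ = EdgeAt-reflect (# 3) {τ₁} e₁
      t₁ : ⟪ axis (# 3) , τ₁ ⟫ ≡ ⟪ axis k , τ ⟫
      t₁ = trans (cong ⟪_, τ₁ ⟫ (sym (toLast-axis k))) (▷-isometry (permutation (toLast k)) (axis k) τ)
      head₂ : Vec.head τ₂ ≡ h ⊕ φ⁻¹ ⊛ (h ⊕ ⊝ ⟪ axis k , τ ⟫)
      head₂ = trans (head-reflect₄ τ₁) (cong₂ (λ h t → h ⊕ φ⁻¹ ⊛ (h ⊕ ⊝ t)) (head-permutation (toLast k) τ) t₁)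
      gained : Positive (Vec.head τ₂ ⊕ ⊝ h)
      gained = subst (λ x → Positive (x ⊕ ⊝ h)) (sym head₂)
        (subst Positive (gain φ⁻¹ h ⟪ axis k , τ ⟫) (Positive-⊛ {φ⁻¹} {⊝ (⊝ h ⊕ ⟪ axis k , τ ⟫)} φ⁻¹>0 p))
    outside : ∀ n → Nonneg (int (+ n) ⊛ φ⁻³ ⊕ h) → Nonneg (⊝ ⟪ axis (# 0) , τ ⟫) → Nonneg (⊝ ⟪ axis (# 1) , τ ⟫) →
              Nonneg (⊝ ⟪ axis (# 2) , τ ⟫) → Nonneg (⊝ ⟪ axis (# 3) , τ ⟫) → τ ∈ linkRoots
    -- With nonpositive coordinates ⟪ τ , center zero ⟫ = 1 forces h < 0, while exhausted fuel means
    -- h ≥ 0.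
    outside zero fuel p₀ p₁ p₂ p₃ = ⊥-elim (head<0 h ⟪ axis (# 0) , τ ⟫ ⟪ axis (# 1) , τ ⟫ ⟪ axis (# 2) , τ ⟫ ⟪ axis (# 3) , τ ⟫
      (trans (sym (pairing-center₀ τ)) (EdgeAt-pairing e)) p₀ p₁ p₂ p₃ (subst Nonneg (start h) fuel))
    outside (suc n) fuel p₀ p₁ p₂ p₃ = case Nonneg-or-Positive⊝ (⊝ h ⊕ ⟪ axis (# 0) , τ ⟫) of λ
      { (inj₂ q) → move n fuel (# 0) q ; (inj₁ q₀) → case Nonneg-or-Positive⊝ (⊝ h ⊕ ⟪ axis (# 1) , τ ⟫) of λ
      { (inj₂ q) → move n fuel (# 1) q ; (inj₁ q₁) → case Nonneg-or-Positive⊝ (⊝ h ⊕ ⟪ axis (# 2) , τ ⟫) of λ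
      { (inj₂ q) → move n fuel (# 2) q ; (inj₁ q₂) → case Nonneg-or-Positive⊝ (⊝ h ⊕ ⟪ axis (# 3) , τ ⟫) of λ
      { (inj₂ q) → move n fuel (# 3) q ; (inj₁ q₃) → ⊥-elim (not-all-below h ⟪ axis (# 0) , τ ⟫ ⟪ axis (# 1) , τ ⟫ ⟪ axis (# 2) , τ ⟫ ⟪ axis (# 3) , τ ⟫
          (trans (sym (norm-coordinates τ)) (Root-norm (EdgeAt⇒Root e))) p₀ p₁ p₂ p₃ q₀ q₁ q₂ q₃) }}}}

-- Vertices of cells and edges of the mosaic.

-- A vertex x as close to the centre of a face of the base hypercube as
-- center zero, and on its side, is center zero.
corner-unique : ∀ j {x} → Vertex x → ⟪ x , center j ⟫ ≡ ⟪ center zero , center j ⟫ →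
                Nonneg (⟪ x , center zero ⟫ ⊕ ⊝ ⟪ center zero , center zero ⟫) → x ≡ center zero
-- The difference of x and `center zero` is orthogonal to the timelike `center j`, and the last
-- hypothesis makes it not spacelike.
corner-unique j {x} (w , refl) eq p = x-y≡0⇒x≡y x c (causal-zero {center j} {center j} {x -ᵥ c} (Future-center j) (Future-center j)
    (subst Nonneg (sym (trans (cong ⊝_ norm-eq) (e ⟪ c , c ⟫ ⟪ x , c ⟫)))
      (Nonneg-⊛ {𝟐} {⟪ x , c ⟫ ⊕ ⊝ ⟪ c , c ⟫} (inj₂ 𝟐>0) p))
    (inj₁ orthogonal) (inj₁ (cong ⊝_ orthogonal)))
  where
  c = center zero
  e : ∀ n t → ⊝ ((n ⊕ ⊝ t) ⊕ ⊝ (t ⊕ ⊝ n)) ≡ 𝟐 ⊛ (t ⊕ ⊝ n)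
  e = solve-∀ ring
  minusˡ : ∀ y → ⟪ x -ᵥ c , y ⟫ ≡ ⟪ x , y ⟫ ⊕ ⊝ ⟪ c , y ⟫
  minusˡ y = trans (⟪⟫-+ˡ x (-𝟏 ·ᵥ c) y) (cong (⟪ x , y ⟫ ⊕_) (⟪⟫-negˡ c y))
  minusʳ : ∀ y → ⟪ y , x -ᵥ c ⟫ ≡ ⟪ y , x ⟫ ⊕ ⊝ ⟪ y , c ⟫
  minusʳ y = trans (⟪⟫-+ʳ y x (-𝟏 ·ᵥ c)) (cong (⟪ y , x ⟫ ⊕_) (⟪⟫-negʳ y c))
  norm-eq : ⟪ x -ᵥ c , x -ᵥ c ⟫ ≡ (⟪ c , c ⟫ ⊕ ⊝ ⟪ x , c ⟫) ⊕ ⊝ (⟪ x , c ⟫ ⊕ ⊝ ⟪ c , c ⟫)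
  norm-eq = trans (minusˡ (x -ᵥ c)) (cong₂ (λ s t → s ⊕ ⊝ t)
    (trans (minusʳ x) (cong (_⊕ ⊝ ⟪ x , c ⟫) (▷-isometry w c c)))
    (trans (minusʳ c) (cong (_⊕ ⊝ ⟪ c , c ⟫) (⟪⟫-comm c x))))
  orthogonal : ⟪ x -ᵥ c , center j ⟫ ≡ 𝟎
  orthogonal = trans (minusˡ (center j)) (trans (cong (_⊕ ⊝ ⟪ c , center j ⟫) eq) (⊝-inverseʳ ⟪ c , center j ⟫))

-- The reflection that negates axis k: the conjugate of `s₀` by the word that carries axis `# 0` to
-- axis k.
flip : Fin 4 → Word
flip zero                   = s₀ ∷ []
flip (suc zero)             = s₁ ∷ s₀ ∷ s₁ ∷ []
flip (suc (suc zero))       = s₂ ∷ s₁ ∷ s₀ ∷ s₁ ∷ s₂ ∷ []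
flip (suc (suc (suc zero))) = s₃ ∷ s₂ ∷ s₁ ∷ s₀ ∷ s₁ ∷ s₂ ∷ s₃ ∷ []

flip-axis : ∀ k → flip k ▷ axis k ≡ -𝟏 ·ᵥ axis k
flip-axis = from-yes (Fin.all? λ k → flip k ▷ axis k ≟ᵥ -𝟏 ·ᵥ axis k)

flip-axis-≢ : ∀ k l → l ≡ k ⊎ flip k ▷ axis l ≡ axis l
flip-axis-≢ = from-yes (Fin.all? λ k → Fin.all? λ l → (l Fin.≟ k) ⊎-dec (flip k ▷ axis l ≟ᵥ axis l))

flip-center : ∀ k j → k Fin.≤ j → flip k ▷ center (suc j) ≡ center (suc j)
flip-center = from-yes (Fin.all? λ k → Fin.all? λ j → (k Fin.≤? j) →-dec (flip k ▷ center (suc j) ≟ᵥ center (suc j)))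

flip-center₀ : ∀ k → flip k ▷ center zero ≡ across (axis k) (center zero)
flip-center₀ = from-yes (Fin.all? λ k → flip k ▷ center zero ≟ᵥ across (axis k) (center zero))

flip-involutive : ∀ k x → flip k ▷ flip k ▷ x ≡ x
flip-involutive k x = trans (cong (_▷ flip k ▷ x) (palindrome k)) (▷-reverse (flip k) x)
  where
  palindrome : ∀ k → flip k ≡ reverse (flip k)
  palindrome zero                   = refl
  palindrome (suc zero)             = refl
  palindrome (suc (suc zero))       = refl
  palindrome (suc (suc (suc zero))) = refl

⟪⟫-flip : ∀ k x y → ⟪ x , flip k ▷ y ⟫ ≡ ⟪ flip k ▷ x , y ⟫
⟪⟫-flip k x y = trans (cong (λ z → ⟪ z , flip k ▷ y ⟫) (sym (flip-involutive k x))) (▷-isometry (flip k) (flip k ▷ x) y)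

-- Reflections of the first n axes that bring x to the side of center zero.
record Corner (n : ℕ) (x : Point) : Set where
  field
    word    : Word
    fixes   : ∀ j → n ℕ.≤ suc (Fin.toℕ j) → word ▷ center (suc j) ≡ center (suc j)
    towards : ∀ k → Fin.toℕ k ℕ.< n → Nonneg (⟪ axis k , word ▷ x ⟫ ⊕ ⊝ 𝟏)

corner : ∀ n {x} → n ℕ.≤ 4 → Vertex x → Corner n x
corner zero    _   _ = record { word = [] ; fixes = λ _ _ → refl ; towards = λ _ () }
corner (suc n) {x} n<4 v = case root-vertex (EdgeAt⇒Root (EdgeAt-axis k)) (Vertex-▷ word v) of λ
    { (inj₁ p) → record { word = word ; fixes = λ j le → fixes j (ℕ.≤-trans (ℕ.n≤1+n n) le)
                        ; towards = λ l l≤n → case l Fin.≟ k of λ { (yes refl) → p ; (no l≢k) → towards l (below l≢k l≤n) } }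
    ; (inj₂ p) → record
      { word = flip k ++ word
      ; fixes = λ j le → trans (▷-++ (flip k) word (center (suc j)))
          (trans (cong (flip k ▷_) (fixes j (ℕ.≤-trans (ℕ.n≤1+n n) le)))
                 (flip-center k j (subst (ℕ._≤ Fin.toℕ j) (sym (Fin.toℕ-fromℕ< n<4)) (ℕ.≤-pred le))))
      ; towards = λ l l≤n → subst (λ y → Nonneg (⟪ axis l , y ⟫ ⊕ ⊝ 𝟏)) (sym (▷-++ (flip k) word x))
          (subst (λ t → Nonneg (t ⊕ ⊝ 𝟏)) (sym (⟪⟫-flip k (axis l) (word ▷ x)))
            (case l Fin.≟ k of λ
              { (yes refl) → subst (λ t → Nonneg (t ⊕ ⊝ 𝟏))
                  (sym (trans (cong (λ y → ⟪ y , word ▷ x ⟫) (flip-axis l)) (⟪⟫-negˡ (axis l) (word ▷ x)))) p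
              ; (no l≢k) → case flip-axis-≢ k l of λ
                { (inj₁ l≡k) → ⊥-elim (l≢k l≡k)
                ; (inj₂ eq) → subst (λ y → Nonneg (⟪ y , word ▷ x ⟫ ⊕ ⊝ 𝟏)) (sym eq) (towards l (below l≢k l≤n)) } })) } }
  where
  open Corner (corner n (ℕ.≤-trans (ℕ.n≤1+n n) n<4) v)
  k : Fin 4
  k = Fin.fromℕ< n<4
  below : ∀ {l} → l ≢ k → Fin.toℕ l ℕ.< suc n → Fin.toℕ l ℕ.< n
  below {l} l≢k (ℕ.s≤s l≤n) = ℕ.≤∧≢⇒< l≤n λ eq → l≢k (Fin.toℕ-injective (trans eq (sym (Fin.toℕ-fromℕ< n<4))))

-- Each centre is the next one plus an axis, so the bounds on the coordinates add up to the
-- comparison with `center zero` that `corner-unique` asks for.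
corner-unique-coordinates : ∀ j {x} → Vertex x → ⟪ x , center (suc j) ⟫ ≡ ⟪ center zero , center (suc j) ⟫ →
  (∀ k → Fin.toℕ k ℕ.≤ Fin.toℕ j → Nonneg (⟪ axis k , x ⟫ ⊕ ⊝ 𝟏)) → x ≡ center zero
corner-unique-coordinates j {x} vertex distance towards = corner-unique (suc j) vertex distance
    (all-closer j ℕ.≤-refl (inj₁ (trans (cong (_⊕ ⊝ ⟪ center zero , c ⟫) distance) (⊝-inverseʳ ⟪ center zero , c ⟫))))
  where
  c = center (suc j)
  Closer : Fin 5 → Set
  Closer i = Nonneg (⟪ x , center i ⟫ ⊕ ⊝ ⟪ center zero , center i ⟫)
  center-step : ∀ k → center (Fin.inject₁ k) ≡ center (suc k) +ᵥ axis k
  center-step = from-yes (Fin.all? λ k → center (Fin.inject₁ k) ≟ᵥ center (suc k) +ᵥ axis k)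
  e : ∀ s s′ t → (s ⊕ ⊝ s′) ⊕ (t ⊕ ⊝ 𝟏) ≡ (s ⊕ t) ⊕ ⊝ (s′ ⊕ 𝟏)
  e = solve-∀ ring
  closer : ∀ k → Fin.toℕ k ℕ.≤ Fin.toℕ j → Closer (suc k) → Closer (Fin.inject₁ k)
  closer k k≤j p = subst (λ z → Nonneg (⟪ x , z ⟫ ⊕ ⊝ ⟪ center zero , z ⟫)) (sym (center-step k))
    (subst₂ (λ s t → Nonneg (s ⊕ ⊝ t)) (sym (⟪⟫-+ʳ x (center (suc k)) (axis k)))
      (sym (trans (⟪⟫-+ʳ (center zero) (center (suc k)) (axis k))
        (cong (⟪ center zero , center (suc k) ⟫ ⊕_) (trans (⟪⟫-comm (center zero) (axis k)) (EdgeAt-pairing (EdgeAt-axis k))))))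
      (subst Nonneg (e ⟪ x , center (suc k) ⟫ ⟪ center zero , center (suc k) ⟫ ⟪ x , axis k ⟫)
        (Nonneg-⊕ {⟪ x , center (suc k) ⟫ ⊕ ⊝ ⟪ center zero , center (suc k) ⟫} {⟪ x , axis k ⟫ ⊕ ⊝ 𝟏} p
          (subst (λ t → Nonneg (t ⊕ ⊝ 𝟏)) (⟪⟫-comm (axis k) x) (towards k k≤j)))))
  all-closer : ∀ k → Fin.toℕ k ℕ.≤ Fin.toℕ j → Closer (suc k) → Closer zero
  all-closer zero                   k≤j p = closer (# 0) k≤j p
  all-closer (suc zero)             k≤j p = closer (# 0) ℕ.z≤n (closer (# 1) k≤j p)
  all-closer (suc (suc zero))       k≤j p = closer (# 0) ℕ.z≤n (closer (# 1) (ℕ.≤-trans (ℕ.n≤1+n 1) k≤j) (closer (# 2) k≤j p))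
  all-closer (suc (suc (suc zero))) k≤j p = closer (# 0) ℕ.z≤n (closer (# 1) (ℕ.≤-trans (ℕ.s≤s ℕ.z≤n) k≤j)
    (closer (# 2) (ℕ.≤-trans (ℕ.s≤s (ℕ.s≤s ℕ.z≤n)) k≤j) (closer (# 3) k≤j p)))

-- Any vertex of a face of a hypercube is center zero in some frame of both.
cell-corner : ∀ j w w′ → w ▷ center (suc j) ≡ w′ ▷ center (suc j) →
  ∃[ f ] ((∀ i → Fin.toℕ j ℕ.≤ Fin.toℕ i → f ▷ center (suc i) ≡ center (suc i)) × w ▷ f ▷ center zero ≡ w′ ▷ center zero)
cell-corner j w w′ eq = reverse word ,
  (λ i j≤i → trans (cong (reverse word ▷_) (sym (fixes i (ℕ.s≤s j≤i)))) (▷-reverse word (center (suc i)))) ,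
  trans (cong (λ y → w ▷ reverse word ▷ y) (sym y≡c)) (trans (cong (w ▷_) (▷-reverse word x)) (▷-reverse′ w (w′ ▷ center zero)))
  where
  c = center (suc j)
  x = reverse w ▷ w′ ▷ center zero
  vertex : Vertex x
  vertex = Vertex-▷ (reverse w) (w′ , refl)
  open Corner (corner (suc (Fin.toℕ j)) (Fin.toℕ<n j) vertex)
  y = word ▷ x
  distance : ⟪ y , c ⟫ ≡ ⟪ center zero , c ⟫
  distance = trans (cong ⟪ y ,_⟫ (sym (fixes j ℕ.≤-refl))) (trans (▷-isometry word x c)
    (trans (sym (▷-isometry w x c)) (trans (cong₂ ⟪_,_⟫ (▷-reverse′ w (w′ ▷ center zero)) eq) (▷-isometry w′ (center zero) c))))
  y≡c : y ≡ center zero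
  y≡c = corner-unique-coordinates j (Vertex-▷ word vertex) distance (λ k k≤j → towards k (ℕ.s≤s k≤j))

▷-across : ∀ w ρ u → w ▷ across ρ u ≡ across (w ▷ ρ) (w ▷ u)
▷-across w ρ u = trans (▷-+ᵥ w u (⊝ 𝟐 ·ᵥ ρ)) (cong (w ▷ u +ᵥ_) (▷-·ᵥ w (⊝ 𝟐) ρ))

JoinedBy-across : ∀ w → JoinedBy (w ▷ center s₁) (w ▷ center zero) (across (w ▷ normal zero) (w ▷ center zero))
JoinedBy-across w = distinct , (w , refl , refl) ,
  (w ++ s₀ ∷ [] , trans (sym (▷-across w (normal zero) (center zero))) (sym (▷-++ w (s₀ ∷ []) (center zero))) ,
                  sym (▷-++ w (s₀ ∷ []) (center s₁)))
  where
  distinct : w ▷ center zero ≢ across (w ▷ normal zero) (w ▷ center zero)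
  distinct eq = case ▷-injective w (trans eq (sym (▷-across w (normal zero) (center zero)))) of λ ()

-- An edge has two ends only: in the frame of the first, `corner-unique` identifies the other vertex
-- or its reflection in the bisector with `center zero`, according to its side.
JoinedBy⁻ : ∀ {e u v} → JoinedBy e u v →
            ∃[ w ] (u ≡ w ▷ center zero × e ≡ w ▷ center s₁ × v ≡ across (w ▷ normal zero) (w ▷ center zero))
JoinedBy⁻ (u≢v , (w , refl , refl) , (w′ , refl , eq)) = w , refl , refl , other
  where
  g = reverse w ++ w′
  x = reverse w ▷ w′ ▷ center zero
  vertex : Vertex x
  vertex = Vertex-▷ (reverse w) (w′ , refl)
  distance : ⟪ x , center s₁ ⟫ ≡ ⟪ center zero , center s₁ ⟫
  distance = trans (sym (▷-isometry w x (center s₁)))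
    (trans (cong₂ ⟪_,_⟫ (▷-reverse′ w (w′ ▷ center zero)) eq) (▷-isometry w′ (center zero) (center s₁)))
  f : ∀ s t → t ⊕ ⊝ 𝟏 ≡ (s ⊕ t) ⊕ ⊝ (s ⊕ 𝟏)
  f = solve-∀ ring
  near : ∀ {y} → Vertex y → ⟪ y , center s₁ ⟫ ≡ ⟪ center zero , center s₁ ⟫ → Nonneg (⟪ normal zero , y ⟫ ⊕ ⊝ 𝟏) → y ≡ center zero
  near {y} vy d p = corner-unique s₁ vy d (subst (λ t → Nonneg (t ⊕ ⊝ ⟪ center zero , center zero ⟫))
    (sym (trans (⟪⟫-+ʳ y (center s₁) (normal zero)) (cong₂ _⊕_ d (⟪⟫-comm y (normal zero)))))
    (subst Nonneg (f ⟪ center zero , center s₁ ⟫ ⟪ normal zero , y ⟫) p))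
  other : w′ ▷ center zero ≡ across (w ▷ normal zero) (w ▷ center zero)
  other = case root-vertex ([] , refl) vertex of λ
    { (inj₁ p) → ⊥-elim (u≢v (trans (cong (w ▷_) (sym (near vertex distance p))) (▷-reverse′ w (w′ ▷ center zero))))
    ; (inj₂ p) → trans (sym (▷-reverse′ w (w′ ▷ center zero))) (trans (cong (w ▷_)
        (trans (sym (reflect-involutive zero x)) (cong (reflect zero) (near (Vertex-▷ (s₀ ∷ []) vertex)
          (trans (reflect-isometry zero x (center s₁)) distance)
          (subst (λ t → Nonneg (t ⊕ ⊝ 𝟏)) (sym (trans (⟪⟫-flip zero (normal zero) x) (⟪⟫-negˡ (normal zero) x))) p)))))
        (▷-across w (normal zero) (center zero))) }

MosaicEdge⁺ : ∀ {ρ u} → EdgeAt ρ u → MosaicEdge u (across ρ u)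
MosaicEdge⁺ (w , refl , refl) = w ▷ center s₁ , JoinedBy-across w

MosaicEdge⁻ : ∀ {u v} → MosaicEdge u v → ∃[ ρ ] (EdgeAt ρ u × v ≡ across ρ u)
MosaicEdge⁻ (e , joined) = let w , u≡ , _ , v≡ = JoinedBy⁻ joined in
  w ▷ normal zero , (w , refl , u≡) , trans v≡ (cong (across (w ▷ normal zero)) (sym u≡))

-- Levels and distances in the mosaic.

module Levels (w₀ : Word) where

  V₀ : Point
  V₀ = w₀ ▷ center zero

  vertex₀ : Vertex V₀
  vertex₀ = w₀ , refl

  -- The normal of an edge at u points to u, so the edge leads away from V₀ when V₀ is on the
  -- positive side of the bisector.
  Outgoing Incoming : Point → Set
  Outgoing ρ = Positive ⟪ ρ , V₀ ⟫
  Incoming ρ = Positive (⊝ ⟪ ρ , V₀ ⟫)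

  direction : ∀ {ρ u} → EdgeAt ρ u → Outgoing ρ ⊎ Incoming ρ
  direction e = side (EdgeAt⇒Root e) vertex₀

  back-incoming : ∀ {ρ} → Outgoing ρ → Incoming (-𝟏 ·ᵥ ρ)
  back-incoming {ρ} = subst Positive (sym (trans (cong ⊝_ (⟪⟫-negˡ ρ V₀)) (⊝-involutive ⟪ ρ , V₀ ⟫)))

  back-outgoing : ∀ {ρ} → Incoming ρ → Outgoing (-𝟏 ·ᵥ ρ)
  back-outgoing {ρ} = subst Positive (sym (⟪⟫-negˡ ρ V₀))

  no-incoming₀ : ∀ {ρ} → EdgeAt ρ V₀ → ¬ Incoming ρ
  no-incoming₀ e p = Positive-asym {𝟏} 𝟏>0 (subst (λ t → Positive (⊝ t)) (EdgeAt-pairing e) p)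

  not-both : ∀ {ρ} → Outgoing ρ → ¬ Incoming ρ
  not-both {ρ} p q = Positive-asym {⟪ ρ , V₀ ⟫} p q

  -- The remaining case, a product of at most - 1, would put V₀ behind both mirrors, against
  -- `edges-separate`.
  incoming-orthogonal : ∀ {ρ τ u} → EdgeAt ρ u → EdgeAt τ u → Incoming ρ → Incoming τ → ρ ≡ τ ⊎ ⟪ ρ , τ ⟫ ≡ 𝟎
  incoming-orthogonal {ρ} {τ} e f p q = case edges-at-vertex e f of λ
    { (inj₁ eq)       → inj₁ eq
    ; (inj₂ (inj₁ z)) → inj₂ z
    ; (inj₂ (inj₂ t)) → ⊥-elim (Positive-asym {⟪ ρ , V₀ ⟫ ⊕ ⟪ τ , V₀ ⟫} (edges-separate e f t vertex₀)
        (subst Positive (⊝-sum ⟪ ρ , V₀ ⟫ ⟪ τ , V₀ ⟫) (Positive-⊕ {⊝ ⟪ ρ , V₀ ⟫} {⊝ ⟪ τ , V₀ ⟫} p q))) }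
    where
    ⊝-sum : ∀ a b → ⊝ a ⊕ ⊝ b ≡ ⊝ (a ⊕ b)
    ⊝-sum = solve-∀ ring

  -- Levels by climbing outgoing edges, with no minimality built in. `path-length` shows that they
  -- are distances in the mosaic; `Level⁺` and `Level⁻` compare them with the levels of 𝒫.
  data Lev : ℕ → Point → Set where
    apex : Lev 0 V₀
    up   : ∀ {n ρ u} → Lev n u → EdgeAt ρ u → Outgoing ρ → Lev (suc n) (across ρ u)

  -- Incoming edges span squares, so a descent may start with any of them.
  Lev-down : ∀ {n v τ} → Lev n v → EdgeAt τ v → Incoming τ → ∃[ m ] (n ≡ suc m × Lev m (across τ v))
  Lev-down apex f q = ⊥-elim (no-incoming₀ f q)
  Lev-down {τ = τ} (up {n} {ρ} {u} l e p) f q =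
    case incoming-orthogonal (EdgeAt-back e) f (back-incoming {ρ} p) q of λ
    { (inj₁ refl) → n , refl , subst (Lev n) (sym (across-back ρ u)) l
    ; (inj₂ z) →
        let f′ = subst (EdgeAt τ) (across-back ρ u) (EdgeAt-across (EdgeAt-back e) f z)
            ρτ = trans (sym (⊝-involutive ⟪ ρ , τ ⟫)) (cong ⊝_ (trans (sym (⟪⟫-negˡ ρ τ)) z))
            m , n≡ , l′ = Lev-down l f′ q
        in n , refl , subst₂ Lev (sym n≡) (across-comm ρ τ u)
             (up l′ (EdgeAt-across f′ e (trans (⟪⟫-comm τ ρ) ρτ)) p) }

  Lev-apex : ∀ {n v} → Lev n v → v ≡ V₀ → n ≡ 0
  Lev-apex apex                 _  = refl
  Lev-apex (up {ρ = ρ} {u} l e p) eq = ⊥-elim (no-incoming₀ (subst (EdgeAt (-𝟏 ·ᵥ ρ)) eq (EdgeAt-back e)) (back-incoming {ρ} p))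

  Lev-unique : ∀ {m n v} → Lev m v → Lev n v → m ≡ n
  Lev-unique apex l = sym (Lev-apex l refl)
  Lev-unique (up {m} {ρ} {u} l e p) l′ =
    let n , n≡ , l″ = Lev-down l′ (EdgeAt-back e) (back-incoming {ρ} p)
    in trans (cong suc (Lev-unique l (subst (Lev n) (across-back ρ u) l″))) (sym n≡)

  Lev-zero : ∀ {v} → Lev 0 v → v ≡ V₀
  Lev-zero apex = refl

  Lev-suc : ∀ {n v} → Lev (suc n) v → ∃[ ρ ] (EdgeAt ρ v × Incoming ρ × Lev n (across ρ v))
  Lev-suc (up {n} {ρ} {u} l e p) = -𝟏 ·ᵥ ρ , EdgeAt-back e , back-incoming {ρ} p , subst (Lev n) (sym (across-back ρ u)) l

  Lev-neighbour : ∀ {n u τ} → Lev n u → EdgeAt τ u →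
                  Lev (suc n) (across τ u) ⊎ (∃[ m ] (n ≡ suc m × Lev m (across τ u)))
  Lev-neighbour l e = case direction e of λ { (inj₁ p) → inj₁ (up l e p) ; (inj₂ p) → inj₂ (Lev-down l e p) }

  -- Read along a word that carries V₀ to v, the letters other than `s₀` keep the vertex, and `s₀`
  -- crosses an edge, which changes the level by one. The word is reversed because the induction
  -- appends letters at its end.
  Lev-exists : ∀ {v} → Vertex v → ∃[ n ] Lev n v
  Lev-exists (w , refl) = subst (λ x → ∃[ n ] Lev n x) cancel (go (reverse g))
    where
    g = reverse w₀ ++ w
    cancel : w₀ ▷ reverse (reverse g) ▷ center zero ≡ w ▷ center zero
    cancel = trans (cong (λ h → w₀ ▷ h ▷ center zero) (List.reverse-involutive g))
      (trans (cong (w₀ ▷_) (▷-++ (reverse w₀) w (center zero))) (▷-reverse′ w₀ (w ▷ center zero)))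
    append : ∀ i h → w₀ ▷ reverse (i ∷ h) ▷ center zero ≡ (w₀ ++ reverse h) ▷ reflect i (center zero)
    append i h = trans (cong (λ k → w₀ ▷ k ▷ center zero) (List.unfold-reverse i h))
      (trans (cong (w₀ ▷_) (▷-++ (reverse h) (i ∷ []) (center zero))) (sym (▷-++ w₀ (reverse h) (reflect i (center zero)))))
    go : ∀ h → ∃[ n ] Lev n (w₀ ▷ reverse h ▷ center zero)
    go []            = 0 , apex
    go (suc i ∷ h)   = let n , l = go h in n , subst (Lev n)
      (trans (sym (▷-++ w₀ (reverse h) (center zero)))
        (trans (cong ((w₀ ++ reverse h) ▷_) (sym (reflect-center₀ i))) (sym (append (suc i) h)))) l
    go (zero ∷ h)    = case Lev-neighbour (subst (Lev (proj₁ (go h))) (sym (▷-++ w₀ (reverse h) (center zero))) (proj₂ (go h)))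
                              (frame-edge (w₀ ++ reverse h) zero) of λ
      { (inj₁ l) → suc (proj₁ (go h)) , subst (Lev (suc (proj₁ (go h)))) eq l
      ; (inj₂ (m , _ , l)) → m , subst (Lev m) eq l }
      where
      eq : across ((w₀ ++ reverse h) ▷ axis zero) ((w₀ ++ reverse h) ▷ center zero) ≡ w₀ ▷ reverse (zero ∷ h) ▷ center zero
      eq = trans (sym (▷-across (w₀ ++ reverse h) (axis zero) (center zero))) (sym (append zero h))

  IsPath-snoc : ∀ {E : Point → Point → Set} {u v x} xs → IsPath E u xs v → E v x → IsPath E u (xs ++ x ∷ []) x
  IsPath-snoc []       refl    e = e , refl
  IsPath-snoc (y ∷ xs) (d , p) e = d , IsPath-snoc xs p e

  -- Each edge of the mosaic changes the level by one, up or down (`Lev-neighbour`).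
  path-length : ∀ {m n u v} xs → IsPath MosaicEdge u xs v → Lev m u → Lev n v → n ℕ.≤ m ℕ.+ length xs
  path-length {m} []       refl    l l′ = ℕ.≤-reflexive (trans (Lev-unique l′ l) (sym (ℕ.+-identityʳ m)))
  path-length {m} {n} (x ∷ xs) (d , p) l l′ = case MosaicEdge⁻ d of λ
    { (ρ , e , refl) → case Lev-neighbour l e of λ
      { (inj₁ k)              → subst (n ℕ.≤_) (sym (ℕ.+-suc m (length xs))) (path-length xs p k l′)
      ; (inj₂ (j , refl , k)) → ℕ.≤-trans (path-length xs p k l′)
          (ℕ.≤-trans (ℕ.+-monoʳ-≤ j (ℕ.n≤1+n (length xs))) (ℕ.n≤1+n (j ℕ.+ suc (length xs)))) } }

  Lev-path : ∀ {n v} → Lev n v → ∃[ xs ] (IsPath MosaicEdge V₀ xs v × length xs ≡ n)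
  Lev-path apex = [] , refl , refl
  Lev-path (up {ρ = ρ} {u} l e p) = let xs , path , len = Lev-path l in
    xs ++ across ρ u ∷ [] , IsPath-snoc xs path (MosaicEdge⁺ e) ,
    trans (List.length-++ xs) (trans (ℕ.+-comm (length xs) 1) (cong suc len))

  shortest⁺ : ∀ {n v xs} → Lev n v → IsPath MosaicEdge V₀ xs v → length xs ≡ n → IsShortestPath MosaicEdge V₀ xs v
  shortest⁺ l p eq = p , λ ys q → ℕ.≤-trans (ℕ.≤-reflexive eq) (path-length ys q apex l)

  shortest⁻ : ∀ {n v xs} → Lev n v → IsShortestPath MosaicEdge V₀ xs v → length xs ≡ n
  shortest⁻ {xs = xs} l (p , least) = let ys , q , len = Lev-path l in
    ℕ.≤-antisym (ℕ.≤-trans (least ys q) (ℕ.≤-reflexive len)) (path-length xs p apex l)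

-- Cardinalities of predicates.

private variable
  X Y : Set
  P Q : X → Set
  m n : ℕ

Unique-head : ∀ {x : X} {xs} → Unique (x ∷ xs) → x ∉ xs
Unique-head = Unique.Unique[x∷xs]⇒x∉xs

Unique-⊆-length : ∀ {xs ys : List X} → Unique xs → (∀ {x} → x ∈ xs → x ∈ ys) → length xs ℕ.≤ length ys
Unique-⊆-length {xs = []}     _          _  = ℕ.z≤n
Unique-⊆-length {xs = x ∷ xs} {ys} u@(_ ∷ u′) ⊆ with ∈-∃++ (⊆ (here refl))
... | as , bs , refl = ℕ.≤-trans (ℕ.s≤s (Unique-⊆-length u′ smaller))
    (ℕ.≤-reflexive (trans (cong suc (List.length-++ as)) (trans (sym (ℕ.+-suc (length as) (length bs))) (sym (List.length-++ as)))))
  where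
  smaller : ∀ {y} → y ∈ xs → y ∈ as ++ bs
  smaller {y} y∈ with ∈-++⁻ as (⊆ (there y∈))
  ... | inj₁ p           = ∈-++⁺ˡ p
  ... | inj₂ (here refl) = ⊥-elim (Unique-head u y∈)
  ... | inj₂ (there p)   = ∈-++⁺ʳ as p

HasCard-≤ : HasCard P m → HasCard Q n → (∀ x → P x → Q x) → m ℕ.≤ n
HasCard-≤ (xs , u , p , refl) (ys , v , q , refl) f =
  Unique-⊆-length u λ {x} x∈ → from (q x) (f x (to (p x) x∈))

HasCard-unique : HasCard P m → HasCard Q n → (∀ x → P x ⇔ Q x) → m ≡ n
HasCard-unique c d f = ℕ.≤-antisym (HasCard-≤ c d λ x → to (f x)) (HasCard-≤ d c λ x → from (f x))

HasCard-cong : (∀ x → P x ⇔ Q x) → HasCard P m → HasCard Q m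
HasCard-cong f (xs , u , p , len) =
  xs , u , (λ x → mk⇔ (λ x∈ → to (f x) (to (p x) x∈)) (λ q → from (p x) (from (f x) q))) , len

HasCard-empty : (∀ x → ¬ P x) → HasCard P 0
HasCard-empty f = [] , [] , (λ x → mk⇔ (λ ()) (λ p → ⊥-elim (f x p))) , refl

HasCard-singleton : (x : X) → HasCard (_≡ x) 1
HasCard-singleton x = x ∷ [] , All.[] ∷ [] , (λ y → mk⇔ (λ { (here eq) → eq ; (there ()) }) here) , refl

HasCard-map : (f : X → Y) → (∀ {x y} → f x ≡ f y → x ≡ y) → HasCard P m → HasCard (λ y → ∃[ x ] (P x × y ≡ f x)) m
HasCard-map f injective (xs , u , p , len) = map f xs , Unique.map⁺ injective u ,
  (λ y → mk⇔ (λ y∈ → let x , x∈ , eq = ∈-map⁻ f y∈ in x , to (p x) x∈ , eq)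
             (λ { (x , px , refl) → ∈-map⁺ f (from (p x) px) })) ,
  trans (List.length-map f xs) len

HasCard-⊎ : HasCard P m → HasCard Q n → (∀ x → P x → ¬ Q x) → HasCard (λ x → P x ⊎ Q x) (m ℕ.+ n)
HasCard-⊎ (xs , u , p , refl) (ys , v , q , refl) disjoint = xs ++ ys ,
  Unique.++⁺ u v (λ {x} (x∈ , x∈′) → disjoint x (to (p x) x∈) (to (q x) x∈′)) ,
  (λ x → mk⇔ (λ x∈ → case ∈-++⁻ xs x∈ of λ { (inj₁ y) → inj₁ (to (p x) y) ; (inj₂ y) → inj₂ (to (q x) y) })
             (λ { (inj₁ y) → ∈-++⁺ˡ (from (p x) y) ; (inj₂ y) → ∈-++⁺ʳ xs (from (q x) y) })) ,
  List.length-++ xs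

HasCard-proj₂ : ∀ {X Y : Set} {m} {R : X × Y → Set} → DecidableEquality Y → HasCard R m → ∃[ n ] HasCard (λ y → ∃[ x ] R (x , y)) n
HasCard-proj₂ {Y = Y} _≟_ (xs , u , p , len) = length ys , ys , DecUniqueProperties.deduplicate-! _≟_ (map proj₂ xs) ,
  (λ y → mk⇔ (λ y∈ → case ∈-map⁻ proj₂ (∈-deduplicate⁻ _≟_ (map proj₂ xs) y∈) of λ { ((x , .y) , x∈ , refl) → x , to (p (x , y)) x∈ })
             (λ (x , r) → ∈-deduplicate⁺ _≟_ (∈-map⁺ proj₂ (from (p (x , y)) r)))) , refl
  where
  ys : List Y
  ys = deduplicate _≟_ (map proj₂ xs)

Pairs : {X Y : Set} → (X → Set) → (X → Y → Set) → X × Y → Set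
Pairs P R (x , y) = P x × R x y

-- The size of a fibre may depend on x and on the proof of P x, so the total is existential; the
-- last component evaluates it when all fibres have size k.
HasCard-Σ′ : ∀ {X Y : Set} {P : X → Set} {R : X → Y → Set} {m} → HasCard P m → (c : ∀ x → P x → ∃[ k ] HasCard (R x) k) →
             ∃[ t ] (HasCard (Pairs P R) t × (∀ k → (∀ x p → proj₁ (c x p) ≡ k) → t ≡ m ℕ.* k))
HasCard-Σ′ {X} {Y} {P} {R} (xs , u , p , refl) c =
  let t , h , eq = go xs u (λ x x∈ → c x (to (p x) x∈))
  in t , HasCard-cong (λ (x , y) → mk⇔ (λ (x∈ , r) → to (p x) x∈ , r) (λ (px , r) → from (p x) px , r)) h ,
     λ k f → eq k (λ x x∈ → f x (to (p x) x∈))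
  where
  go : ∀ xs → Unique xs → (c : ∀ x → x ∈ xs → ∃[ k ] HasCard (R x) k) →
       ∃[ t ] (HasCard (Pairs (_∈ xs) R) t × (∀ k → (∀ x x∈ → proj₁ (c x x∈) ≡ k) → t ≡ length xs ℕ.* k))
  go []       _          c = 0 , HasCard-empty (λ { _ (() , _) }) , λ _ _ → refl
  go (x ∷ xs) u@(_ ∷ u′) c =
    let t , h , eq = go xs u′ (λ y y∈ → c y (there y∈))
        k , d = c x (here refl)
    in k ℕ.+ t ,
       HasCard-cong (λ (x′ , y) → mk⇔ (λ { (inj₁ (y′ , r , refl)) → here refl , r ; (inj₂ (x∈ , r)) → there x∈ , r })
                                      (λ { (here refl , r) → inj₁ (y , r , refl) ; (there x∈ , r) → inj₂ (x∈ , r) }))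
         (HasCard-⊎ (HasCard-map (x ,_) ,-injectiveʳ d) h (λ { (.x , y) (_ , _ , refl) (x∈ , _) → Unique-head u x∈ })) ,
       λ k f → cong₂ ℕ._+_ (f x (here refl)) (eq k (λ y y∈ → f y (there y∈)))

HasCard-Σ : ∀ {X Y : Set} {P : X → Set} {R : X → Y → Set} {m} → HasCard P m → (∀ x → P x → ∃[ k ] HasCard (R x) k) →
            ∃[ t ] HasCard (Pairs P R) t
HasCard-Σ c d = let t , h , _ = HasCard-Σ′ c d in t , h

HasCard-Σ-uniform : ∀ {X Y : Set} {P : X → Set} {R : X → Y → Set} {m} k → HasCard P m → (∀ x → P x → HasCard (R x) k) →
                    HasCard (Pairs P R) (m ℕ.* k)
HasCard-Σ-uniform k c d =
  let t , h , eq = HasCard-Σ′ c (λ x p → k , d x p) in subst (HasCard _) (eq k (λ _ _ → refl)) h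

-- Finiteness of paths and the values of vertices.

EdgeAt-link : ∀ w {ρ} → EdgeAt ρ (w ▷ center zero) → ∃[ r ] (r ∈ linkRoots × ρ ≡ w ▷ r)
EdgeAt-link w {ρ} e = reverse w ▷ ρ ,
  linkRoots-complete (subst (EdgeAt (reverse w ▷ ρ)) (▷-reverse w (center zero)) (EdgeAt-▷ (reverse w) e)) ,
  sym (▷-reverse′ w ρ)

link-EdgeAt : ∀ w {r} → r ∈ linkRoots → EdgeAt (w ▷ r) (w ▷ center zero)
link-EdgeAt w r∈ = EdgeAt-▷ w (linkRoots-sound r∈)

edges-finite : ∀ {u} → Vertex u → ∃[ n ] HasCard (λ ρ → EdgeAt ρ u) n
edges-finite {u} (w , refl) = go linkRoots linkRoots-unique (λ r → EdgeAt-link w) (λ r → link-EdgeAt w)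
  where
  go : ∀ xs → Unique xs → (∀ ρ → EdgeAt ρ u → ∃[ r ] (r ∈ xs × ρ ≡ w ▷ r)) → (∀ r → r ∈ xs → EdgeAt (w ▷ r) u) →
       ∃[ n ] HasCard (λ ρ → EdgeAt ρ u) n
  go xs unique complete sound = length xs , HasCard-cong
    (λ ρ → mk⇔ (λ { (r , r∈ , refl) → sound r r∈ }) (complete ρ))
    (HasCard-map (w ▷_) (▷-injective w) (xs , unique , (λ _ → mk⇔ (λ p → p) (λ p → p)) , refl))

mosaicEdges-finite : ∀ {u} → Vertex u → ∃[ n ] HasCard (MosaicEdge u) n
mosaicEdges-finite {u} v = let n , c = edges-finite v in n , HasCard-cong
  (λ x → mk⇔ (λ { (ρ , e , refl) → MosaicEdge⁺ e }) (λ d → MosaicEdge⁻ d))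
  (HasCard-map (λ ρ → across ρ u) (across-injective u) c)

MosaicEdge⇒Vertex : ∀ {u v} → MosaicEdge u v → Vertex v
MosaicEdge⇒Vertex d with MosaicEdge⁻ d
... | ρ , e , refl = EdgeAt⇒Vertex (EdgeAt-back e)

paths-finite : ∀ n {u} v → Vertex u → ∃[ m ] HasCard (λ xs → IsPath MosaicEdge u xs v × length xs ≡ n) m
paths-finite zero {u} v _ = case u ≟ᵥ v of λ
  { (yes u≡v) → 1 , HasCard-cong (λ xs → mk⇔ (λ { refl → u≡v , refl }) (λ { (_ , eq) → empty xs eq })) (HasCard-singleton [])
  ; (no u≢v) → 0 , HasCard-empty (λ { [] (u≡v , _) → u≢v u≡v ; (_ ∷ _) (_ , ()) }) }
  where
  empty : ∀ (xs : List Point) → length xs ≡ 0 → xs ≡ []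
  empty [] _ = refl
paths-finite (suc n) {u} v vertex =
  let m , c = mosaicEdges-finite vertex
      k , d = HasCard-Σ c (λ x e → paths-finite n v (MosaicEdge⇒Vertex e))
  in k , HasCard-cong
    (λ xs → mk⇔ (λ { ((x , ys) , (e , p , eq) , refl) → (e , p) , cong suc eq })
                (λ { (p , eq) → split xs p eq }))
    (HasCard-map (λ (x , ys) → x ∷ ys) (λ { refl → refl }) d)
  where
  split : ∀ xs → IsPath MosaicEdge u xs v → length xs ≡ suc n →
          ∃[ y ] (Pairs (MosaicEdge u) (λ x ys → IsPath MosaicEdge x ys v × length ys ≡ n) y × xs ≡ proj₁ y ∷ proj₂ y)
  split (x ∷ ys) (e , p) eq = (x , ys) , (e , p , ℕ.suc-injective eq) , refl

module Values (w₀ : Word) where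

  open Levels w₀

  Q₀ : Point
  Q₀ = w₀ ▷ center s₄

  open Simplex V₀ Q₀ using (HasValue; LargestVertex)

  HasValue-exists : ∀ {v} → Vertex v → ∃[ m ] HasValue v m
  HasValue-exists {v} vertex =
    let n , l = Lev-exists vertex
        m , c = paths-finite n v vertex₀
    in m , HasCard-cong (λ xs → mk⇔ (λ (p , eq) → shortest⁺ l p eq) (λ s → proj₁ s , shortest⁻ l s)) c

  extend : ∀ {n u v xs} → Lev n u → Lev (suc n) v → MosaicEdge u v → IsShortestPath MosaicEdge V₀ xs u →
           IsShortestPath MosaicEdge V₀ (xs ++ v ∷ []) v
  extend {xs = xs} l l′ d s = shortest⁺ l′ (IsPath-snoc xs (proj₁ s) d)
    (trans (List.length-++ xs) (trans (ℕ.+-comm (length xs) 1) (cong suc (shortest⁻ l s))))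

  value-≤ : ∀ {n u v a b} → Lev n u → Lev (suc n) v → MosaicEdge u v → HasValue u a → HasValue v b → a ℕ.≤ b
  value-≤ {v = v} l l′ d c c′ = HasCard-≤ (HasCard-map (_++ v ∷ []) (λ {xs} {ys} → List.++-cancelʳ (v ∷ []) xs ys) c) c′
    (λ { _ (xs , s , refl) → extend l l′ d s })

  snoc-endpoint : ∀ {u v x} xs ys → IsPath MosaicEdge V₀ xs u → IsPath MosaicEdge V₀ ys v → xs ++ x ∷ [] ≡ ys ++ x ∷ [] → u ≡ v
  snoc-endpoint {x = x} xs ys p q eq = go p (subst (λ zs → IsPath MosaicEdge V₀ zs _) (sym (List.++-cancelʳ (x ∷ []) xs ys eq)) q)
    where
    go : ∀ {a u v xs} → IsPath MosaicEdge a xs u → IsPath MosaicEdge a xs v → u ≡ v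
    go {xs = []}    refl    refl    = refl
    go {xs = _ ∷ _} (_ , p) (_ , q) = go p q

  -- Appending v embeds the shortest paths to u into those to v, and a path through the other lower
  -- neighbour u′ is not in the image.
  value-< : ∀ {n u u′ v a b} → Lev n u → Lev n u′ → Lev (suc n) v → MosaicEdge u v → MosaicEdge u′ v → u ≢ u′ →
            HasValue u a → HasValue v b → a ℕ.< b
  value-< {v = v} l k l′ d d′ u≢u′ c c′ =
    let ys , p , len = Lev-path k in
    HasCard-≤ (HasCard-⊎ (HasCard-singleton (ys ++ v ∷ []))
                         (HasCard-map (_++ v ∷ []) (λ {xs} {ys} → List.++-cancelʳ (v ∷ []) xs ys) c)
                         (λ { _ refl (xs , s , eq) → u≢u′ (sym (snoc-endpoint ys xs p (proj₁ s) eq)) })) c′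
      (λ { _ (inj₁ refl) → extend k l′ d′ (shortest⁺ k p len) ; _ (inj₂ (xs , s , refl)) → extend l l′ d s })

-- The vertex of largest value in a hypercube.

module Tops (w₀ : Word) where

  open Levels w₀
  open Values w₀
  open Simplex V₀ Q₀ using (HasValue; LargestVertex)

  raise-center₀ : ∀ w k → (w ++ flip k) ▷ center zero ≡ across (w ▷ axis k) (w ▷ center zero)
  raise-center₀ w k = trans (▷-++ w (flip k) (center zero))
    (trans (cong (w ▷_) (flip-center₀ k)) (▷-across w (axis k) (center zero)))

  raise-center₄ : ∀ w k → (w ++ flip k) ▷ center s₄ ≡ w ▷ center s₄
  raise-center₄ w k = trans (▷-++ w (flip k) (center s₄)) (cong (w ▷_) (flip-center k (# 3) (ℕ.≤-pred (Fin.toℕ<n k))))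

  raise-axis : ∀ w k → (w ++ flip k) ▷ axis k ≡ -𝟏 ·ᵥ (w ▷ axis k)
  raise-axis w k = trans (▷-++ w (flip k) (axis k)) (trans (cong (w ▷_) (flip-axis k)) (▷-·ᵥ w -𝟏 (axis k)))

  raise-axis-≢ : ∀ w k l → l ≢ k → (w ++ flip k) ▷ axis l ≡ w ▷ axis l
  raise-axis-≢ w k l l≢k = trans (▷-++ w (flip k) (axis l)) (case flip-axis-≢ k l of λ
    { (inj₁ l≡k) → ⊥-elim (l≢k l≡k) ; (inj₂ eq) → cong (w ▷_) eq })

  -- A frame at the vertex where all four edges of the hypercube are incoming. `largest⇒Top` and
  -- `Top⇒largest` show that this vertex has the largest value, after which values can be forgotten.
  Top : Word → Set
  Top w = ∀ k → Incoming (w ▷ axis k)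

  record Below (u v : Point) : Set where
    constructor below
    field
      values : ∀ a b → HasValue u a → HasValue v b → a ℕ.≤ b

  Below-refl : ∀ {u} → Below u u
  Below-refl = below λ _ _ c d → HasCard-≤ c d (λ _ p → p)

  Below-trans : ∀ {u v x} → Vertex v → Below u v → Below v x → Below u x
  Below-trans vertex (below p) (below q) = below λ a b c d →
    let m , e = HasValue-exists vertex in ℕ.≤-trans (p a m c e) (q m b e d)

  frame-vertex : ∀ w → Vertex (w ▷ center zero)
  frame-vertex w = w , refl

  step-below : ∀ w k → Outgoing (w ▷ axis k) → Below (w ▷ center zero) ((w ++ flip k) ▷ center zero)
  step-below w k out = below λ a b c d →
    let n , l = Lev-exists (frame-vertex w)
        e = frame-edge w k
    in value-≤ l (up l e out) (MosaicEdge⁺ e) c (subst (λ v → HasValue v b) (raise-center₀ w k) d)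

  -- The incoming axis l persists across the orthogonal edge k, so the upper end has a second lower
  -- neighbour.
  step-strict : ∀ w k l → l ≢ k → Outgoing (w ▷ axis k) → Incoming (w ▷ axis l) →
                ∀ a b → HasValue (w ▷ center zero) a → HasValue ((w ++ flip k) ▷ center zero) b → a ℕ.< b
  step-strict w k l l≢k out inc a b c d =
    let n , lev = Lev-exists (frame-vertex w)
        lev⁺ = up lev e out
        m , eq , lev′ = Lev-down lev⁺ f inc
    in value-< lev (subst (λ m → Lev m (across τ v⁺)) (sym (ℕ.suc-injective eq)) lev′) lev⁺ (MosaicEdge⁺ e)
         (subst (MosaicEdge (across τ v⁺)) (across-back τ v⁺) (MosaicEdge⁺ (EdgeAt-back f)))
         distinct c (subst (λ v → HasValue v b) (raise-center₀ w k) d)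
    where
    ρ = w ▷ axis k
    τ = w ▷ axis l
    v = w ▷ center zero
    v⁺ = across ρ v
    e : EdgeAt ρ v
    e = frame-edge w k
    orthogonal : ⟪ ρ , τ ⟫ ≡ 𝟎
    orthogonal = frame-orthogonal w k l (λ k≡l → l≢k (sym k≡l))
    f : EdgeAt τ v⁺
    f = EdgeAt-across e (frame-edge w l) orthogonal
    distinct : v ≢ across τ v⁺
    distinct eq = case trans (sym (trans (⟪⟫-negʳ ρ ρ) (cong ⊝_ (Root-norm (EdgeAt⇒Root e)))))
        (trans (cong ⟪ ρ ,_⟫ (across-injective v⁺ (trans (across-back ρ v) eq))) orthogonal) of λ ()

  -- One step along an outgoing axis k might preserve the value. It is strict if another axis is
  -- incoming; if the other axis is outgoing too, a second step along it is strict, because k has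
  -- become incoming.
  largest⇒Top : ∀ w → LargestVertex (w ▷ center s₄) (w ▷ center zero) → Top w
  largest⇒Top w (_ , m , c , largest) k = case direction (frame-edge w k) of λ
    { (inj₂ inc) → inc
    ; (inj₁ out) → ⊥-elim (case direction (frame-edge w (other k)) of λ
        { (inj₂ inc) →
            let b , d = HasValue-exists (frame-vertex (w ++ flip k))
            in ℕ.<⇒≱ (step-strict w k (other k) (other-≢ k) out inc m b c d)
                     (largest _ b (w ++ flip k , refl , sym (raise-center₄ w k)) d)
        ; (inj₁ out′) →
            let w⁺ = w ++ flip k
                b , d = HasValue-exists (frame-vertex w⁺)
                b′ , d′ = HasValue-exists (frame-vertex (w⁺ ++ flip (other k)))
            in ℕ.<⇒≱ (ℕ.≤-<-trans (Below.values (step-below w k out) m b c d)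
                       (step-strict w⁺ (other k) k (λ eq → other-≢ k (sym eq))
                         (subst Outgoing (sym (raise-axis-≢ w k (other k) (other-≢ k))) out′)
                         (subst Incoming (sym (raise-axis w k)) (back-incoming {w ▷ axis k} out)) b b′ d d′))
                     (largest _ b′ (w⁺ ++ flip (other k) , refl , sym (trans (raise-center₄ w⁺ (other k)) (raise-center₄ w k))) d′) }) }
    where
    other : Fin 4 → Fin 4
    other zero    = # 1
    other (suc _) = # 0
    other-≢ : ∀ k → other k ≢ k
    other-≢ zero    ()
    other-≢ (suc _) ()

  record Climb (k : Fin 4) (w w⁺ : Word) : Set where
    constructor climbed
    field
      same-cube : w⁺ ▷ center s₄ ≡ w ▷ center s₄
      higher    : Below (w ▷ center zero) (w⁺ ▷ center zero)
      incoming  : Incoming (w⁺ ▷ axis k)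
      others    : ∀ l → l ≢ k → w⁺ ▷ axis l ≡ w ▷ axis l

  climb-out : ∀ k w → Outgoing (w ▷ axis k) → Climb k w (w ++ flip k)
  climb-out k w out = climbed (raise-center₄ w k) (step-below w k out)
    (subst Incoming (sym (raise-axis w k)) (back-incoming {w ▷ axis k} out)) (raise-axis-≢ w k)

  climb : ∀ k w → ∃[ w⁺ ] Climb k w w⁺
  climb k w = case direction (frame-edge w k) of λ
    { (inj₁ out) → w ++ flip k , climb-out k w out
    ; (inj₂ inc) → w , climbed refl Below-refl inc (λ _ _ → refl) }

  ascend : ∀ w → ∃[ t ] (t ▷ center s₄ ≡ w ▷ center s₄ × Below (w ▷ center zero) (t ▷ center zero) × Top t)
  ascend w =
    case climb (# 0) w of λ { (w₁ , climbed q₁ b₁ i₁ a₁) →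
    case climb (# 1) w₁ of λ { (w₂ , climbed q₂ b₂ i₂ a₂) →
    case climb (# 2) w₂ of λ { (w₃ , climbed q₃ b₃ i₃ a₃) →
    case climb (# 3) w₃ of λ { (w₄ , climbed q₄ b₄ i₄ a₄) →
      w₄ , trans q₄ (trans q₃ (trans q₂ q₁)) ,
      Below-trans (frame-vertex w₃) (Below-trans (frame-vertex w₂) (Below-trans (frame-vertex w₁) b₁ b₂) b₃) b₄ ,
      λ { zero → subst Incoming (sym (trans (a₄ (# 0) λ ()) (trans (a₃ (# 0) λ ()) (a₂ (# 0) λ ())))) i₁
        ; (suc zero) → subst Incoming (sym (trans (a₄ (# 1) λ ()) (a₃ (# 1) λ ()))) i₂
        ; (suc (suc zero)) → subst Incoming (sym (a₄ (# 2) λ ())) i₃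
        ; (suc (suc (suc zero))) → i₄ } }}}}

  -- If the vertex of t′ were behind the mirror of an axis of t, the opposite root would be an axis
  -- of t′ by `wall-of-cube`; it is outgoing, but the axes of t′ are incoming.
  Top-unique : ∀ t t′ → t ▷ center s₄ ≡ t′ ▷ center s₄ → Top t → Top t′ → t ▷ center zero ≡ t′ ▷ center zero
  Top-unique t t′ eq top top′ = trans (cong (t ▷_) (sym x≡c)) (▷-reverse′ t (t′ ▷ center zero))
    where
    x = reverse t ▷ t′ ▷ center zero
    vertex : Vertex x
    vertex = Vertex-▷ (reverse t) (t′ , refl)
    distance : ⟪ x , center s₄ ⟫ ≡ ⟪ center zero , center s₄ ⟫
    distance = trans (sym (▷-isometry t x (center s₄)))
      (trans (cong₂ ⟪_,_⟫ (▷-reverse′ t (t′ ▷ center zero)) eq) (▷-isometry t′ (center zero) (center s₄)))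
    pairing : ∀ k → ⟪ t ▷ axis k , t′ ▷ center zero ⟫ ≡ ⟪ axis k , x ⟫
    pairing k = ⟪⟫-transpose t (axis k) (t′ ▷ center zero)
    root : ∀ k → Root (t ▷ axis k)
    root k = EdgeAt⇒Root (frame-edge t k)
    flat : ∀ k → ⟪ t ▷ axis k , t′ ▷ center s₄ ⟫ ≡ 𝟎
    flat k = trans (cong ⟪ t ▷ axis k ,_⟫ (sym eq)) (trans (▷-isometry t (axis k) (center s₄)) (axis-center₄ k))
    towards : ∀ k → Nonneg (⟪ axis k , x ⟫ ⊕ ⊝ 𝟏)
    towards k = subst (λ s → Nonneg (s ⊕ ⊝ 𝟏)) (pairing k) (side≥1 (root k) (t′ , refl) (case side (root k) (t′ , refl) of λ
      { (inj₁ p) → p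
      ; (inj₂ p) → ⊥-elim (impossible k (wall-of-cube t′ (Root-neg (root k))
          (inj₁ (cong ⊝_ (trans (⟪⟫-negˡ (t ▷ axis k) (t′ ▷ center s₄)) (cong ⊝_ (flat k)))))
          (subst Positive (sym (⟪⟫-negˡ (t ▷ axis k) (t′ ▷ center zero))) p))) }))
      where
      impossible : ∀ k → ¬ (∃[ l ] -𝟏 ·ᵥ (t ▷ axis k) ≡ t′ ▷ axis l)
      impossible k (l , M≡) = not-both {t′ ▷ axis l} (subst Outgoing M≡ (back-outgoing {t ▷ axis k} (top k))) (top′ l)
    x≡c : x ≡ center zero
    x≡c = corner-unique-coordinates (# 3) vertex distance (λ k _ → towards k)

  Top⇒largest : ∀ t → Top t → LargestVertex (t ▷ center s₄) (t ▷ center zero)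
  Top⇒largest t top = largest (HasValue-exists (frame-vertex t))
    where
    largest : (∃[ m ] HasValue (t ▷ center zero) m) → LargestVertex (t ▷ center s₄) (t ▷ center zero)
    largest (m , c) = (t , refl , refl) , m , c , λ { u k (w , refl , eq) d → case ascend w of λ
      { (t′ , q≡ , below t′-largest , top′) → t′-largest k m d (subst (λ v → HasValue v m) (Top-unique t t′ (trans eq (sym q≡)) top top′) c) } }

-- Hypercubes around a vertex and around a square.

permutation-center₀ : ∀ p → permutation p ▷ center zero ≡ center zero
permutation-center₀ []      = refl
permutation-center₀ (i ∷ p) = trans (cong (reflect (Fin.inject₁ (suc i))) (permutation-center₀ p)) (go i)
  where
  go : ∀ i → reflect (Fin.inject₁ (suc i)) (center zero) ≡ center zero
  go zero             = refl
  go (suc zero)       = refl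
  go (suc (suc zero)) = refl

permutation-center₄ : ∀ p → permutation p ▷ center s₄ ≡ center s₄
permutation-center₄ []      = refl
permutation-center₄ (i ∷ p) = trans (cong (reflect (Fin.inject₁ (suc i))) (permutation-center₄ p)) (go i)
  where
  go : ∀ i → reflect (Fin.inject₁ (suc i)) (center s₄) ≡ center s₄
  go zero             = refl
  go (suc zero)       = refl
  go (suc (suc zero)) = refl

reverse-fixes : ∀ w {x} → w ▷ x ≡ x → reverse w ▷ x ≡ x
reverse-fixes w {x} eq = trans (cong (reverse w ▷_) (sym eq)) (▷-reverse w x)

++-fixes : ∀ w w′ {x} → w′ ▷ x ≡ x → (w ++ w′) ▷ x ≡ w ▷ x
++-fixes w w′ {x} eq = trans (▷-++ w w′ x) (cong (w ▷_) eq)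

++-reverse : ∀ w w′ x → (w ++ reverse w′) ▷ w′ ▷ x ≡ w ▷ x
++-reverse w w′ x = trans (▷-++ w (reverse w′) (w′ ▷ x)) (cong (w ▷_) (▷-reverse w′ x))

-- The difference of the centres is a null vector orthogonal to the common vertex, which is
-- timelike; hence it vanishes.
cube-unique′ : ∀ w w′ → w ▷ center zero ≡ w′ ▷ center zero → ⟪ w ▷ center s₄ , w′ ▷ center s₄ ⟫ ≡ ⟪ center s₄ , center s₄ ⟫ →
               w ▷ center s₄ ≡ w′ ▷ center s₄
cube-unique′ w w′ eq pairing = trans (cong (w ▷_) (sym x≡c)) (▷-reverse′ w (w′ ▷ center s₄))
  where
  c = center s₄
  x = reverse w ▷ w′ ▷ c
  vertex : ⟪ center zero , x ⟫ ≡ ⟪ center zero , c ⟫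
  vertex = trans (sym (⟪⟫-transpose w (center zero) (w′ ▷ c)))
    (trans (cong (λ v → ⟪ v , w′ ▷ c ⟫) eq) (▷-isometry w′ (center zero) c))
  same : ⟪ c , x ⟫ ≡ ⟪ c , c ⟫
  same = trans (sym (⟪⟫-transpose w c (w′ ▷ c))) pairing
  norm-x : ⟪ x , x ⟫ ≡ ⟪ c , c ⟫
  norm-x = trans (▷-isometry (reverse w) (w′ ▷ c) (w′ ▷ c)) (▷-isometry w′ c c)
  minusˡ : ∀ y → ⟪ x -ᵥ c , y ⟫ ≡ ⟪ x , y ⟫ ⊕ ⊝ ⟪ c , y ⟫
  minusˡ y = trans (⟪⟫-+ˡ x (-𝟏 ·ᵥ c) y) (cong (⟪ x , y ⟫ ⊕_) (⟪⟫-negˡ c y))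
  null : ⟪ x -ᵥ c , x -ᵥ c ⟫ ≡ 𝟎
  null = trans (minusˡ (x -ᵥ c)) (trans (cong₂ (λ s t → s ⊕ ⊝ t)
    (trans (⟪⟫-+ʳ x x (-𝟏 ·ᵥ c)) (cong₂ _⊕_ norm-x (trans (⟪⟫-negʳ x c) (cong ⊝_ (trans (⟪⟫-comm x c) same)))))
    (trans (⟪⟫-+ʳ c x (-𝟏 ·ᵥ c)) (cong₂ _⊕_ same (⟪⟫-negʳ c c)))) refl)
  orthogonal : ⟪ x -ᵥ c , center zero ⟫ ≡ 𝟎
  orthogonal = trans (minusˡ (center zero))
    (trans (cong (λ t → t ⊕ ⊝ ⟪ c , center zero ⟫) (trans (⟪⟫-comm x (center zero)) vertex)) refl)
  x≡c : x ≡ c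
  x≡c = x-y≡0⇒x≡y x c (causal-zero {center zero} {center zero} {x -ᵥ c} (Future-center zero) (Future-center zero)
    (inj₁ (cong ⊝_ null)) (inj₁ orthogonal) (inj₁ (cong ⊝_ orthogonal)))

⟪⟫-vanishes-+ : ∀ w x y z → ⟪ w ▷ x , z ⟫ ≡ 𝟎 → ⟪ w ▷ y , z ⟫ ≡ 𝟎 → ⟪ w ▷ (x +ᵥ y) , z ⟫ ≡ 𝟎
⟪⟫-vanishes-+ w x y z p q = trans (cong ⟪_, z ⟫ (▷-+ᵥ w x y)) (trans (⟪⟫-+ˡ (w ▷ x) (w ▷ y) z) (cong₂ _⊕_ p q))

⟪⟫-absorb : ∀ w x y a z → y ≡ x +ᵥ a → ⟪ w ▷ a , z ⟫ ≡ 𝟎 → ⟪ w ▷ y , z ⟫ ≡ ⟪ w ▷ x , z ⟫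
⟪⟫-absorb w x y a z refl p = trans (cong ⟪_, z ⟫ (▷-+ᵥ w x a))
  (trans (⟪⟫-+ˡ (w ▷ x) (w ▷ a) z) (trans (cong (⟪ w ▷ x , z ⟫ ⊕_) p) (⊕-identityʳ ⟪ w ▷ x , z ⟫)))

-- A hypercube is determined by one of its vertices and the edges there.
cube-unique : ∀ w w′ → w ▷ center zero ≡ w′ ▷ center zero → (∀ k → ⟪ w ▷ axis k , w′ ▷ center s₄ ⟫ ≡ 𝟎) →
              w ▷ center s₄ ≡ w′ ▷ center s₄
cube-unique w w′ eq flat = cube-unique′ w w′ eq
  (trans (sym (⟪⟫-absorb w (center s₄) (center zero) ((axis (# 0) +ᵥ axis (# 1)) +ᵥ (axis (# 2) +ᵥ axis (# 3))) q refl
           (⟪⟫-vanishes-+ w (axis (# 0) +ᵥ axis (# 1)) (axis (# 2) +ᵥ axis (# 3)) q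
             (⟪⟫-vanishes-+ w (axis (# 0)) (axis (# 1)) q (flat (# 0)) (flat (# 1)))
             (⟪⟫-vanishes-+ w (axis (# 2)) (axis (# 3)) q (flat (# 2)) (flat (# 3))))))
    (trans (cong ⟪_, q ⟫ eq) (▷-isometry w′ (center zero) (center s₄))))
  where
  q = w′ ▷ center s₄

-- The two edges of a square at one of its vertices are determined by it.
square-edges : ∀ w w′ → w ▷ center zero ≡ w′ ▷ center zero → w ▷ center s₂ ≡ w′ ▷ center s₂ →
               ∀ k → Fin.toℕ k ℕ.< 2 → ∃[ l ] w ▷ axis k ≡ w′ ▷ axis l
square-edges w w′ p q k k<2 = case compare (# 0) of λ
  { (inj₁ eq) → # 0 , eq ; (inj₂ n₀) → case compare (# 1) of λ
  { (inj₁ eq) → # 1 , eq ; (inj₂ n₁) → ⊥-elim (contradiction n₀ n₁) } }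
  where
  ρ = w ▷ axis k
  same-vertex : EdgeAt ρ (w′ ▷ center zero)
  same-vertex = subst (EdgeAt ρ) p (frame-edge w k)
  compare : ∀ l → ρ ≡ w′ ▷ axis l ⊎ Nonneg (⊝ ⟪ ρ , w′ ▷ axis l ⟫)
  compare l = case edges-at-vertex same-vertex (frame-edge w′ l) of λ
    { (inj₁ eq)        → inj₁ eq
    ; (inj₂ (inj₁ eq)) → inj₂ (inj₁ (cong ⊝_ eq))
    ; (inj₂ (inj₂ t))  → inj₂ (inj₂ (1≤⇒Positive {⊝ ⟪ ρ , w′ ▷ axis l ⟫} t)) }
  diagonal : ∀ k → Fin.toℕ k ℕ.< 2 → ⟪ axis k , center zero -ᵥ center s₂ ⟫ ≡ 𝟏
  diagonal = from-yes (Fin.all? λ k → (Fin.toℕ k ℕ.<? 2) →-dec (⟪ axis k , center zero -ᵥ center s₂ ⟫ ≟ 𝟏))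
  ▷-minus : ∀ w → w ▷ (center zero -ᵥ center s₂) ≡ w ▷ center zero -ᵥ w ▷ center s₂
  ▷-minus w = trans (▷-+ᵥ w (center zero) (-𝟏 ·ᵥ center s₂)) (cong (w ▷ center zero +ᵥ_) (▷-·ᵥ w -𝟏 (center s₂)))
  facet-sum : ⟪ ρ , w′ ▷ axis (# 0) ⟫ ⊕ ⟪ ρ , w′ ▷ axis (# 1) ⟫ ≡ 𝟏
  facet-sum = trans (sym (⟪⟫-+ʳ ρ (w′ ▷ axis (# 0)) (w′ ▷ axis (# 1))))
    (trans (cong ⟪ ρ ,_⟫ (trans (sym (▷-+ᵥ w′ (axis (# 0)) (axis (# 1))))
      (trans (▷-minus w′) (trans (cong₂ _-ᵥ_ (sym p) (sym q)) (sym (▷-minus w))))))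
    (trans (▷-isometry w (axis k) (center zero -ᵥ center s₂)) (diagonal k k<2)))
  f : ∀ a b → ⊝ a ⊕ ⊝ b ≡ ⊝ (a ⊕ b)
  f = solve-∀ ring
  contradiction : Nonneg (⊝ ⟪ ρ , w′ ▷ axis (# 0) ⟫) → Nonneg (⊝ ⟪ ρ , w′ ▷ axis (# 1) ⟫) → ⊥
  contradiction n₀ n₁ = Nonneg∧Positive⊝⇒⊥ {⊝ 𝟏}
    (subst (λ t → Nonneg (⊝ t)) facet-sum (subst Nonneg (f ⟪ ρ , w′ ▷ axis (# 0) ⟫ ⟪ ρ , w′ ▷ axis (# 1) ⟫)
      (Nonneg-⊕ {⊝ ⟪ ρ , w′ ▷ axis (# 0) ⟫} {⊝ ⟪ ρ , w′ ▷ axis (# 1) ⟫} n₀ n₁))) 𝟏>0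

-- Around a square, the hypercubes are centered at center s₄ and its images
-- under the group generated by reflect s₃ and reflect s₄; these two are
-- not adjacent.
far₁ far₂ : Word
far₁ = s₄ ∷ []
far₂ = s₃ ∷ s₄ ∷ s₃ ∷ s₄ ∷ []

-- The centre of a facet is the centre of the hypercube plus a root orthogonal to it, and
-- `wall-of-cube` leaves only the axes and their opposites. For each of these eight, the product
-- with the second centre is computed and is not that of a facet and its hypercube.
no-shared-facet : ∀ w → ¬ (∃[ f ] (Incident (# 3) (# 4) f ((w ++ far₁) ▷ center s₄) × Incident (# 3) (# 4) f ((w ++ far₂) ▷ center s₄)))
no-shared-facet w (f , (x , f≡ , q≡) , (x′ , f≡′ , q≡′)) = case side root (y , refl) of λ
    { (inj₁ p) → case wall-of-cube y root (inj₁ (cong ⊝_ flat)) p of λ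
        { (k , τ≡) → proj₁ (apart k) (trans (pairing (axis k) τ≡) distance) }
    ; (inj₂ p) → case wall-of-cube y (Root-neg root)
          (inj₁ (cong ⊝_ (trans (⟪⟫-negˡ τ (y ▷ center s₄)) (cong ⊝_ flat))))
          (subst Positive (sym (⟪⟫-negˡ τ (y ▷ center zero))) p) of λ
        { (k , τ≡) → proj₂ (apart k) (trans (pairing (-𝟏 ·ᵥ axis k)
            (trans (sym (-ᵥ-involutive τ)) (trans (cong (-𝟏 ·ᵥ_) τ≡) (sym (▷-·ᵥ y -𝟏 (axis k)))))) distance) } }
  where
  y = w ++ far₁
  q′ = s₄ ∷ s₃ ∷ s₄ ∷ s₃ ∷ s₄ ∷ []
  τ = x ▷ axis (# 3)
  root : Root τ
  root = EdgeAt⇒Root (frame-edge x (# 3))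
  flat : ⟪ τ , y ▷ center s₄ ⟫ ≡ 𝟎
  flat = trans (cong ⟪ τ ,_⟫ q≡) (▷-isometry x (axis (# 3)) (center s₄))
  f-split : f ≡ y ▷ center s₄ +ᵥ τ
  f-split = trans f≡ (trans (▷-+ᵥ x (center s₄) (axis (# 3))) (cong (_+ᵥ τ) (sym q≡)))
  distance : ⟪ f , (w ++ far₂) ▷ center s₄ ⟫ ≡ ⟪ center s₃ , center s₄ ⟫
  distance = trans (cong₂ ⟪_,_⟫ f≡′ q≡′) (▷-isometry x′ (center s₃) (center s₄))
  second : (w ++ far₂) ▷ center s₄ ≡ y ▷ q′ ▷ center s₄
  second = trans (▷-++ w far₂ (center s₄)) (trans (cong (w ▷_) (sym (reflect-involutive s₄ (far₂ ▷ center s₄))))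
    (sym (▷-++ w far₁ (q′ ▷ center s₄))))
  pairing : ∀ a → τ ≡ y ▷ a → ⟪ center s₄ +ᵥ a , q′ ▷ center s₄ ⟫ ≡ ⟪ f , (w ++ far₂) ▷ center s₄ ⟫
  pairing a eq = trans (sym (▷-isometry y (center s₄ +ᵥ a) (q′ ▷ center s₄)))
    (cong₂ ⟪_,_⟫ (trans (▷-+ᵥ y (center s₄) a) (trans (cong (y ▷ center s₄ +ᵥ_) (sym eq)) (sym f-split))) (sym second))
  apart : ∀ k → ⟪ center s₄ +ᵥ axis k , q′ ▷ center s₄ ⟫ ≢ ⟪ center s₃ , center s₄ ⟫ ×
                ⟪ center s₄ +ᵥ -𝟏 ·ᵥ axis k , q′ ▷ center s₄ ⟫ ≢ ⟪ center s₃ , center s₄ ⟫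
  apart = from-yes (Fin.all? λ k → ¬? (⟪ center s₄ +ᵥ axis k , q′ ▷ center s₄ ⟫ ≟ ⟪ center s₃ , center s₄ ⟫) ×-dec
                                  ¬? (⟪ center s₄ +ᵥ -𝟏 ·ᵥ axis k , q′ ▷ center s₄ ⟫ ≟ ⟪ center s₃ , center s₄ ⟫))

-- Twelve permutations, one for each choice of the two axes that go to `# 3` and `# 2`; only these
-- two take part in turning about a square.
pairsToLast : List (List (Fin 3))
pairsToLast = concatMap (λ k → map (_++ toLast k) ([] ∷ (# 1 ∷ []) ∷ (# 1 ∷ # 0 ∷ []) ∷ [])) (allFin 4)

-- An integer approximation to the distance between the edge r and the centre
-- of the base hypercube.
offset : Point → ℕ
offset r = ℤ.∣ + 1000 ℤ.* ℤ[φ].rational (Vec.head r) ℤ.+ + 1618 ℤ.* ℤ[φ].golden (Vec.head r) ∣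

opaque
  turn₁ turn₂ : Point → Point
  turn₁ r = reverse far₁ ▷ r
  turn₂ r = reverse far₂ ▷ r

  turn₁-def : ∀ r → turn₁ r ≡ reverse far₁ ▷ r
  turn₁-def r = refl

  turn₂-def : ∀ r → turn₂ r ≡ reverse far₂ ▷ r
  turn₂-def r = refl

-- The edge r belongs to the neighbouring hypercube `far₁`. An incoming edge is orthogonal to the
-- walls, so `apart₃` ensures that axis `# 3` is not a wall and that the neighbour is in the region.
record Adjacent (r : Point) : Set where
  constructor is-adjacent
  field
    apart₃ : ⟪ axis (# 3) , r ⟫ ≢ 𝟎
    shared : turn₁ r ≡ axis (# 3)

record Closer (bound : ℕ) (r : Point) : Set where
  constructor is-closer
  field
    closer : offset r ℕ.< bound

closer? : ∀ b r → Dec (Closer b r)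
closer? b r = map′ is-closer Closer.closer (offset r ℕ.<? b)

-- In the frames turned by `far₁` and `far₂`, the edge r is closer to the hypercube. As in
-- `Adjacent`, lack of orthogonality keeps the axes that are moved from being walls.
record Between (bound : ℕ) (r : Point) : Set where
  constructor is-between
  field
    apart₃  : ⟪ axis (# 3) , r ⟫ ≢ 𝟎
    apart₂  : ⟪ axis (# 2) , r ⟫ ≢ 𝟎
    closer₁ : Closer bound (turn₁ r)
    closer₂ : Closer bound (turn₂ r)

adjacent? : ∀ r → Dec (Adjacent r)
adjacent? r = map′ (λ (a , b) → is-adjacent a b) (λ (is-adjacent a b) → a , b)
  (¬? (⟪ axis (# 3) , r ⟫ ≟ 𝟎) ×-dec (turn₁ r ≟ᵥ axis (# 3)))

between? : ∀ b r → Dec (Between b r)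
between? b r = map′ (λ (m , n , p , q) → is-between m n p q) (λ (is-between m n p q) → m , n , p , q)
  (¬? (⟪ axis (# 3) , r ⟫ ≟ 𝟎) ×-dec ¬? (⟪ axis (# 2) , r ⟫ ≟ 𝟎) ×-dec
   closer? b (turn₁ r) ×-dec closer? b (turn₂ r))

data Approach (r : Point) : Set where
  edge     : ∀ k → r ≡ axis k → Approach r
  adjacent : ∀ p → Adjacent (permutation p ▷ r) → Approach r
  between  : ∀ p → Between (offset r) (permutation p ▷ r) → Approach r

approach? : ∀ r → Dec ((∃[ k ] r ≡ axis k) ⊎ Any (λ p → Adjacent (permutation p ▷ r) ⊎ Between (offset r) (permutation p ▷ r)) pairsToLast)
approach? r = Fin.any? (λ k → r ≟ᵥ axis k) ⊎-dec
  any? (λ p → adjacent? (permutation p ▷ r) ⊎-dec between? (offset r) (permutation p ▷ r)) pairsToLast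

opaque
  unfolding turn₁

  approaches : All (λ r → (∃[ k ] r ≡ axis k) ⊎ Any (λ p → Adjacent (permutation p ▷ r) ⊎ Between (offset r) (permutation p ▷ r)) pairsToLast) linkRoots
  approaches = from-yes (all? approach? linkRoots)

approach : ∀ {r} → r ∈ linkRoots → Approach r
approach r∈ = case All.lookup approaches r∈ of λ
  { (inj₁ (k , eq)) → edge k eq
  ; (inj₂ p) → case Any.satisfied p of λ
    { (p , inj₁ a) → adjacent p a
    ; (p , inj₂ b) → between p b } }

-- The generated hypercubes lie in the region.

module Region (w₀ : Word) where

  open Levels w₀
  open Values w₀
  open Tops w₀
  open Simplex V₀ Q₀ using (In𝒫; first; around; convex)

  wall : Fin 4 → Point
  wall k = w₀ ▷ axis k

  wall-edge : ∀ k → EdgeAt (wall k) V₀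
  wall-edge = frame-edge w₀

  wall-outgoing : ∀ k → Outgoing (wall k)
  wall-outgoing k = subst Positive (sym (EdgeAt-pairing (wall-edge k))) 𝟏>0

  -- 𝒫 consists of the hypercubes that are crossed by, or beyond, the mirrors
  -- parallel to the facets of Q₀.
  Good : Point → Set
  Good q = ∀ k → Nonneg (⊝ ⟪ wall k , q ⟫)

  -- If the mirror does not separate the vertex of a hypercube in the region from V₀, it is parallel
  -- to facets of the hypercube by `wall-of-cube`. In this form the condition refers only to the
  -- vertex and its edges, so it can be passed to other hypercubes around the vertex.
  data Position (w : Word) (k : Fin 4) : Set where
    beyond : Positive (⊝ ⟪ wall k , w ▷ center zero ⟫) → Position w k
    along  : ∀ l → wall k ≡ w ▷ axis l → Position w k

  position : ∀ w → Good (w ▷ center s₄) → ∀ k → Position w k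
  position w good k = case side (EdgeAt⇒Root (wall-edge k)) (frame-vertex w) of λ
    { (inj₂ p) → beyond p
    ; (inj₁ p) → case wall-of-cube w (EdgeAt⇒Root (wall-edge k)) (good k) p of λ { (l , eq) → along l eq } }

  axis-flat : ∀ w l → ⟪ w ▷ axis l , w ▷ center s₄ ⟫ ≡ 𝟎
  axis-flat w l = trans (▷-isometry w (axis l) (center s₄)) (axis-center₄ l)

  good : ∀ w → (∀ k → Position w k) → Good (w ▷ center s₄)
  good w f k = case f k of λ
    { (along l eq) → inj₁ (cong ⊝_ (trans (cong ⟪_, w ▷ center s₄ ⟫ eq) (axis-flat w l)))
    ; (beyond p) → case Nonneg-or-Positive⊝ (⊝ ⟪ wall k , w ▷ center s₄ ⟫) of λ
      { (inj₁ n) → n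
      ; (inj₂ n) → case wall-of-cube w (Root-neg (EdgeAt⇒Root (wall-edge k)))
            (inj₂ (subst Positive (cong ⊝_ (sym (⟪⟫-negˡ (wall k) (w ▷ center s₄)))) n))
            (subst Positive (sym (⟪⟫-negˡ (wall k) (w ▷ center zero))) p) of λ
          { (l , eq) → inj₁ (trans (sym (⟪⟫-negˡ (wall k) (w ▷ center s₄)))
              (trans (cong ⟪_, w ▷ center s₄ ⟫ eq) (axis-flat w l))) } } }

  move : ∀ {w w′ k} → w′ ▷ center zero ≡ w ▷ center zero → (∀ l → wall k ≡ w ▷ axis l → ∃[ l′ ] wall k ≡ w′ ▷ axis l′) →
         Position w k → Position w′ k
  move {k = k} eq f (beyond p)   = beyond (subst (λ v → Positive (⊝ ⟪ wall k , v ⟫)) (sym eq) p)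
  move         eq f (along l eq′) = case f l eq′ of λ { (l′ , eq″) → along l′ eq″ }

  beyond-not-along : ∀ {w k l} → Positive (⊝ ⟪ wall k , w ▷ center zero ⟫) → wall k ≢ w ▷ axis l
  beyond-not-along {w} {k} {l} p eq = Positive-asym {𝟏} 𝟏>0 (subst (λ t → Positive (⊝ t))
    (trans (cong ⟪_, w ▷ center zero ⟫ eq) (EdgeAt-pairing (frame-edge w l))) p)

  -- Walls are outgoing, so none is among the incoming axes of a top frame. Hence all hypercubes
  -- around a largest vertex are in the region.
  top-beyond : ∀ {w} → Top w → ∀ {k} → Position w k → Positive (⊝ ⟪ wall k , w ▷ center zero ⟫)
  top-beyond top     (beyond p)    = p
  top-beyond {w} top {k} (along l eq) = ⊥-elim (not-both {wall k} (wall-outgoing k) (subst Incoming (sym eq) (top l)))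

  good-at : ∀ {w v} → w ▷ center zero ≡ v → (∀ k → Positive (⊝ ⟪ wall k , v ⟫)) → Good (w ▷ center s₄)
  good-at {w} eq f = good w λ k → beyond (subst (λ v → Positive (⊝ ⟪ wall k , v ⟫)) (sym eq) (f k))

  square-facet : ∀ w l → 2 ℕ.≤ Fin.toℕ l → Incident (# 3) (# 4) (w ▷ center s₂ -ᵥ w ▷ axis l) (w ▷ center s₄)
  square-facet w zero             ()
  square-facet w (suc zero)       (ℕ.s≤s ())
  square-facet w (suc (suc zero)) _ = w , minus , refl
    where
    minus : w ▷ center s₂ -ᵥ w ▷ axis (# 2) ≡ w ▷ center s₃
    minus = trans (cong (w ▷ center s₂ +ᵥ_) (sym (▷-·ᵥ w -𝟏 (axis (# 2))))) (sym (▷-+ᵥ w (center s₂) (-𝟏 ·ᵥ axis (# 2))))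
  square-facet w (suc (suc (suc zero))) _ = w ++ s₃ ∷ [] ,
    trans minus (sym (▷-++ w (s₃ ∷ []) (center s₃))) , sym (++-fixes w (s₃ ∷ []) refl)
    where
    minus : w ▷ center s₂ -ᵥ w ▷ axis (# 3) ≡ w ▷ reflect s₃ (center s₃)
    minus = trans (cong (w ▷ center s₂ +ᵥ_) (sym (▷-·ᵥ w -𝟏 (axis (# 3))))) (sym (▷-+ᵥ w (center s₂) (-𝟏 ·ᵥ axis (# 3))))

  axis-square : ∀ l → (Fin.toℕ l ℕ.< 2 × ⟪ axis l , center s₂ ⟫ ≡ 𝟎) ⊎ (2 ℕ.≤ Fin.toℕ l × ⟪ axis l , center s₂ ⟫ ≡ 𝟏)
  axis-square = from-yes (Fin.all? λ l → ((Fin.toℕ l ℕ.<? 2) ×-dec (⟪ axis l , center s₂ ⟫ ≟ 𝟎)) ⊎-dec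
                                        ((2 ℕ.≤? Fin.toℕ l) ×-dec (⟪ axis l , center s₂ ⟫ ≟ 𝟏)))

  -- Suppose that the wall is an edge of both given hypercubes at the common vertex. If it lies in
  -- the square, it is an edge of every hypercube around the square; otherwise it spans with the
  -- square a facet of both, which `disjoint` excludes.
  convex-good : ∀ w₁ w₂ w₃ → w₂ ▷ center zero ≡ w₁ ▷ center zero → w₃ ▷ center zero ≡ w₁ ▷ center zero →
    w₂ ▷ center s₂ ≡ w₁ ▷ center s₂ → w₃ ▷ center s₂ ≡ w₁ ▷ center s₂ →
    ¬ (∃[ f ] (Incident (# 3) (# 4) f (w₁ ▷ center s₄) × Incident (# 3) (# 4) f (w₂ ▷ center s₄))) →
    ∀ k → Position w₁ k → Position w₂ k → Position w₃ k
  convex-good w₁ w₂ w₃ v₂ v₃ c₂ c₃ disjoint k (beyond p) _ =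
    beyond (subst (λ v → Positive (⊝ ⟪ wall k , v ⟫)) (sym v₃) p)
  convex-good w₁ w₂ w₃ v₂ v₃ c₂ c₃ disjoint k (along l eq) (beyond p) =
    ⊥-elim (beyond-not-along {w₁} {k} {l} (subst (λ v → Positive (⊝ ⟪ wall k , v ⟫)) v₂ p) eq)
  convex-good w₁ w₂ w₃ v₂ v₃ c₂ c₃ disjoint k (along l eq) (along l′ eq′) = case axis-square l of λ
    { (inj₁ (l<2 , _)) → case square-edges w₁ w₃ (sym v₃) (sym c₃) l l<2 of λ { (m , eq″) → along m (trans eq eq″) }
    ; (inj₂ (2≤l , one)) → case axis-square l′ of λ
      { (inj₁ (_ , none)) → case trans (sym (pairing w₂ l′ eq′ none)) (trans (cong ⟪ wall k ,_⟫ c₂) (pairing w₁ l eq one)) of λ ()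
      ; (inj₂ (2≤l′ , _)) → ⊥-elim (disjoint (w₁ ▷ center s₂ -ᵥ wall k ,
          subst (λ ρ → Incident (# 3) (# 4) (w₁ ▷ center s₂ -ᵥ ρ) (w₁ ▷ center s₄)) (sym eq) (square-facet w₁ l 2≤l) ,
          subst₂ (λ s ρ → Incident (# 3) (# 4) (s -ᵥ ρ) (w₂ ▷ center s₄)) c₂ (sym eq′) (square-facet w₂ l′ 2≤l′))) } }
    where
    pairing : ∀ w l {t} → wall k ≡ w ▷ axis l → ⟪ axis l , center s₂ ⟫ ≡ t → ⟪ wall k , w ▷ center s₂ ⟫ ≡ t
    pairing w l eq eq′ = trans (cong ⟪_, w ▷ center s₂ ⟫ eq) (trans (▷-isometry w (axis l) (center s₂)) eq′)

  -- All frames of a square and a hypercube around it can be moved to a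
  -- common vertex.
  align : ∀ {s q} w → Incident (# 2) (# 4) s q → s ≡ w ▷ center s₂ →
          ∃[ x ] (x ▷ center zero ≡ w ▷ center zero × x ▷ center s₂ ≡ s × x ▷ center s₄ ≡ q)
  align w (x , refl , refl) eq = case cell-corner (# 1) x w eq of λ
    { (f , fixes , v) → x ++ f , trans (▷-++ x f (center zero)) v ,
        ++-fixes x f (fixes (# 1) ℕ.≤-refl) , ++-fixes x f (fixes (# 3) (ℕ.s≤s ℕ.z≤n)) }

  sound : ∀ {q} → In𝒫 q → Good q × (∃[ w ] q ≡ w ▷ center s₄)
  sound first = good w₀ (λ k → along k refl) , w₀ , refl
  sound (around {q} {v} {r} p largest (x , v≡ , refl)) = result (proj₁ largest) largest (proj₁ (sound p)) , x , refl
    where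
    result : Incident (# 0) (# 4) v q → Simplex.LargestVertex V₀ Q₀ q v → Good q → Good (x ▷ center s₄)
    result (w , refl , refl) largest g = good-at {x} (sym v≡) λ k → top-beyond {w} (largest⇒Top w largest) (position w g k)
  sound (convex {q₁} {q₂} {s} {r} p₁ p₂ i₁ i₂ disjoint i) =
    result i₁ (proj₁ (sound p₁)) (proj₁ (sound p₂)) , (proj₁ i , proj₂ (proj₂ i))
    where
    result : Incident (# 2) (# 4) s q₁ → Good q₁ → Good q₂ → Good r
    result (w , refl , refl) g₁ g₂ = case align w i₂ refl of λ { (w₂ , v₂ , c₂ , refl) →
      case align w i refl of λ { (w₃ , v₃ , c₃ , refl) →
        good w₃ λ k → convex-good w w₂ w₃ v₂ v₃ c₂ c₃ disjoint k (position w g₁ k) (position w₂ g₂ k) } }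

-- All hypercubes of the region are generated.

far₁-axis : ∀ l → l ≡ # 3 ⊎ far₁ ▷ axis l ≡ axis l
far₁-axis = from-yes (Fin.all? λ l → (l Fin.≟ # 3) ⊎-dec (far₁ ▷ axis l ≟ᵥ axis l))

far₂-axis : ∀ l → l ≡ # 2 ⊎ l ≡ # 3 ⊎ far₂ ▷ axis l ≡ axis l
far₂-axis = from-yes (Fin.all? λ l → (l Fin.≟ # 2) ⊎-dec (l Fin.≟ # 3) ⊎-dec (far₂ ▷ axis l ≟ᵥ axis l))

module Completeness (w₀ : Word) where

  open Levels w₀
  open Values w₀
  open Tops w₀
  open Region w₀
  open Simplex V₀ Q₀ using (In𝒫; first; around; convex)

  -- A product of at most - 1 is excluded: ⟪ wall k , V₀ ⟫ is exactly 1 and ⟪ ρ , V₀ ⟫ is at most -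
  -- 1, but `edges-separate` makes their sum positive.
  wall-orthogonal : ∀ {k u ρ} → EdgeAt (wall k) u → EdgeAt ρ u → Incoming ρ → ⟪ wall k , ρ ⟫ ≡ 𝟎
  wall-orthogonal {k} {u} {ρ} e f inc = case edges-at-vertex e f of λ
    { (inj₁ eq)       → ⊥-elim (not-both {wall k} (wall-outgoing k) (subst Incoming (sym eq) inc))
    ; (inj₂ (inj₁ z)) → z
    ; (inj₂ (inj₂ t)) → ⊥-elim (Nonneg∧Positive⊝⇒⊥ (side≤-1 (EdgeAt⇒Root f) vertex₀ inc)
        (subst Positive (g ⟪ ρ , V₀ ⟫) (subst (λ s → Positive (s ⊕ ⟪ ρ , V₀ ⟫)) (EdgeAt-pairing (wall-edge k))
          (edges-separate e f t vertex₀)))) }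
    where
    g : ∀ t → 𝟏 ⊕ t ≡ ⊝ (⊝ t ⊕ ⊝ 𝟏)
    g = solve-∀ ring

  apex-cube : ∀ w → w ▷ center zero ≡ V₀ → Good (w ▷ center s₄) → w ▷ center s₄ ≡ Q₀
  apex-cube w eq g = sym (cube-unique w₀ w (sym eq) λ k → case position w g k of λ
    { (beyond p)   → ⊥-elim (Positive-asym {𝟏} 𝟏>0 (subst (λ t → Positive (⊝ t))
        (trans (cong ⟪ wall k ,_⟫ eq) (EdgeAt-pairing (wall-edge k))) p))
    ; (along l eq) → trans (cong ⟪_, w ▷ center s₄ ⟫ eq) (axis-flat w l) })

  -- The incoming edge is an axis at the largest vertex as well, since its opposite is outgoing. So
  -- the facet to which it points contains that vertex, and `around` adds the hypercube beyond this
  -- facet.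
  far-neighbour : ∀ w → In𝒫 (w ▷ center s₄) → Incoming (w ▷ axis (# 3)) → In𝒫 ((w ++ far₁) ▷ center s₄)
  far-neighbour w p inc = case ascend w of λ { (t , q≡ , _ , top) → go t q≡ top }
    where
    ρ = w ▷ axis (# 3)
    root : Root ρ
    root = EdgeAt⇒Root (frame-edge w (# 3))
    facet : ∀ x → x ▷ center s₃ ≡ x ▷ center s₄ +ᵥ x ▷ axis (# 3)
    facet x = ▷-+ᵥ x (center s₄) (axis (# 3))
    go : ∀ t → t ▷ center s₄ ≡ w ▷ center s₄ → Top t → In𝒫 ((w ++ far₁) ▷ center s₄)
    go t q≡ top = case side root (frame-vertex t) of λ
        { (inj₁ n) → case wall-of-cube t root (inj₁ (cong ⊝_ flat)) n of λ { (l , eq) → found l eq }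
        ; (inj₂ n) → case wall-of-cube t (Root-neg root)
              (inj₁ (cong ⊝_ (trans (⟪⟫-negˡ ρ (t ▷ center s₄)) (cong ⊝_ flat))))
              (subst Positive (sym (⟪⟫-negˡ ρ (t ▷ center zero))) n) of λ
            { (l , eq) → ⊥-elim (not-both {t ▷ axis l} (subst Outgoing eq (back-outgoing {ρ} inc)) (top l)) } }
      where
      flat : ⟪ ρ , t ▷ center s₄ ⟫ ≡ 𝟎
      flat = trans (cong ⟪ ρ ,_⟫ q≡) (axis-flat w (# 3))
      found : ∀ l → ρ ≡ t ▷ axis l → In𝒫 ((w ++ far₁) ▷ center s₄)
      found l eq = case cell-corner (# 2) (w ++ far₁) t′ (sym shared) of λ
        { (f , fixes , v) → around (subst In𝒫 (sym q≡) p) (Top⇒largest t top)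
            ((w ++ far₁) ++ f , trans (sym v₀) (trans (sym v) (sym (▷-++ (w ++ far₁) f (center zero)))) ,
             sym (++-fixes (w ++ far₁) f (fixes (# 3) (ℕ.s≤s (ℕ.s≤s ℕ.z≤n))))) }
        where
        g = permutation (toLast l)
        t′ = t ++ reverse g
        v₀ : t′ ▷ center zero ≡ t ▷ center zero
        v₀ = ++-fixes t (reverse g) (reverse-fixes g (permutation-center₀ (toLast l)))
        q₀ : t′ ▷ center s₄ ≡ t ▷ center s₄
        q₀ = ++-fixes t (reverse g) (reverse-fixes g (permutation-center₄ (toLast l)))
        ρ₀ : t′ ▷ axis (# 3) ≡ ρ
        ρ₀ = trans (cong (t′ ▷_) (sym (toLast-axis l))) (trans (++-reverse t g (axis l)) (sym eq))
        shared : t′ ▷ center s₃ ≡ (w ++ far₁) ▷ center s₃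
        shared = trans (facet t′) (trans (cong₂ _+ᵥ_ (trans q₀ q≡) ρ₀) (trans (sym (facet w)) (sym (++-fixes w far₁ refl))))

  Complete : ℕ → Set
  Complete n = ∀ w → Lev n (w ▷ center zero) → Good (w ▷ center s₄) → In𝒫 (w ▷ center s₄)

  -- The other end of the incoming edge is a vertex of the same hypercube, one level lower.
  lower-edge : ∀ {n} → Complete n → ∀ w k → Lev (suc n) (w ▷ center zero) → Incoming (w ▷ axis k) →
               Good (w ▷ center s₄) → In𝒫 (w ▷ center s₄)
  lower-edge {n} complete w k l inc g = subst In𝒫 (raise-center₄ w k) (complete (w ++ flip k) lower (subst Good (sym (raise-center₄ w k)) g))
    where
    lower : Lev n ((w ++ flip k) ▷ center zero)
    lower = case Lev-down l (frame-edge w k) inc of λ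
      { (m , eq , l′) → subst₂ Lev (sym (ℕ.suc-injective eq)) (sym (raise-center₀ w k)) l′ }

  record Turned (w w′ : Word) : Set where
    field
      same-vertex : w′ ▷ center zero ≡ w ▷ center zero
      same-walls  : ∀ k l → wall k ≡ w ▷ axis l → ∃[ l′ ] wall k ≡ w′ ▷ axis l′

  Turned-good : ∀ {w w′} → Turned w w′ → Good (w ▷ center s₄) → Good (w′ ▷ center s₄)
  Turned-good {w} {w′} t g = good w′ λ k → move {w} {w′} (Turned.same-vertex t) (Turned.same-walls t k) (position w g k)

  link-fixes : ∀ g {r} → g ▷ center zero ≡ center zero → r ∈ linkRoots → g ▷ r ∈ linkRoots
  link-fixes g {r} eq r∈ = linkRoots-complete (subst (EdgeAt (g ▷ r)) eq (EdgeAt-▷ g (linkRoots-sound r∈)))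

  -- Induction on the distance between the incoming edge r and the hypercube. An edge of the
  -- hypercube leads to the level below. If r is an edge of a neighbour, the neighbour is generated
  -- and `far-neighbour` leads back. Otherwise two hypercubes around a square that share no facet
  -- are closer to r, and `convex` supplies the given one.
  fill : ∀ {n} → Complete n → ∀ m w {r} → r ∈ linkRoots → offset r ℕ.< m → Lev (suc n) (w ▷ center zero) →
         Incoming (w ▷ r) → Good (w ▷ center s₄) → In𝒫 (w ▷ center s₄)
  fill complete zero    w r∈ () l inc g
  fill complete (suc m) w {r} r∈ (ℕ.s≤s r≤m) l inc g = case approach r∈ of λ
    { (edge k refl) → lower-edge complete w k l inc g
    ; (adjacent p a) → subst In𝒫 (cube p) (go-adjacent p a)
    ; (between p b) → subst In𝒫 (cube p) (go-between p b) }
    where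
    w′ : List (Fin 3) → Word
    w′ p = w ++ reverse (permutation p)
    vertex : ∀ p → w′ p ▷ center zero ≡ w ▷ center zero
    vertex p = ++-fixes w (reverse (permutation p)) (reverse-fixes (permutation p) (permutation-center₀ p))
    cube : ∀ p → w′ p ▷ center s₄ ≡ w ▷ center s₄
    cube p = ++-fixes w (reverse (permutation p)) (reverse-fixes (permutation p) (permutation-center₄ p))
    root : ∀ p → w′ p ▷ permutation p ▷ r ≡ w ▷ r
    root p = ++-reverse w (permutation p) r
    turned-root : ∀ p g → (w′ p ++ g) ▷ reverse g ▷ permutation p ▷ r ≡ w ▷ r
    turned-root p g = trans (▷-++ (w′ p) g (reverse g ▷ permutation p ▷ r))
      (trans (cong (w′ p ▷_) (▷-reverse′ g (permutation p ▷ r))) (root p))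
    turned-vertex : ∀ p g → g ▷ center zero ≡ center zero → (w′ p ++ g) ▷ center zero ≡ w ▷ center zero
    turned-vertex p g eq = trans (++-fixes (w′ p) g eq) (vertex p)
    flat : ∀ p k l → wall k ≡ w′ p ▷ axis l → ⟪ axis l , permutation p ▷ r ⟫ ≡ 𝟎
    flat p k l eq = trans (sym (▷-isometry (w′ p) (axis l) (permutation p ▷ r)))
      (trans (cong₂ ⟪_,_⟫ (sym eq) (root p))
        (wall-orthogonal {k} (subst₂ EdgeAt (sym eq) (vertex p) (frame-edge (w′ p) l)) (link-EdgeAt w r∈) inc))
    turned₁ : ∀ p → ⟪ axis (# 3) , permutation p ▷ r ⟫ ≢ 𝟎 → Turned (w′ p) (w′ p ++ far₁)
    turned₁ p apart = record
      { same-vertex = ++-fixes (w′ p) far₁ refl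
      ; same-walls  = λ k l eq → case far₁-axis l of λ
        { (inj₁ refl) → ⊥-elim (apart (flat p k l eq))
        ; (inj₂ fixed) → l , trans eq (sym (++-fixes (w′ p) far₁ fixed)) } }
    turned₂ : ∀ p → ⟪ axis (# 3) , permutation p ▷ r ⟫ ≢ 𝟎 → ⟪ axis (# 2) , permutation p ▷ r ⟫ ≢ 𝟎 → Turned (w′ p) (w′ p ++ far₂)
    turned₂ p apart₃ apart₂ = record
      { same-vertex = ++-fixes (w′ p) far₂ refl
      ; same-walls  = λ k l eq → case far₂-axis l of λ
        { (inj₁ refl)        → ⊥-elim (apart₂ (flat p k l eq))
        ; (inj₂ (inj₁ refl)) → ⊥-elim (apart₃ (flat p k l eq))
        ; (inj₂ (inj₂ fixed)) → l , trans eq (sym (++-fixes (w′ p) far₂ fixed)) } }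
    good′ : ∀ p → Good (w′ p ▷ center s₄)
    good′ p = subst Good (sym (cube p)) g
    go-adjacent : ∀ p → Adjacent (permutation p ▷ r) → In𝒫 (w′ p ▷ center s₄)
    go-adjacent p (is-adjacent apart shared) = subst In𝒫 back
      (far-neighbour y (lower-edge complete y (# 3) level incoming (Turned-good (turned₁ p apart) (good′ p))) incoming)
      where
      y = w′ p ++ far₁
      level : Lev _ (y ▷ center zero)
      level = subst (Lev _) (sym (turned-vertex p far₁ refl)) l
      incoming : Incoming (y ▷ axis (# 3))
      incoming = subst Incoming (trans (sym (turned-root p far₁))
        (cong (y ▷_) (trans (sym (turn₁-def (permutation p ▷ r))) shared))) inc
      back : (y ++ far₁) ▷ center s₄ ≡ w′ p ▷ center s₄
      back = trans (▷-++ y far₁ (center s₄)) (trans (▷-++ (w′ p) far₁ (far₁ ▷ center s₄))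
        (cong (w′ p ▷_) (reflect-involutive s₄ (center s₄))))
    go-between : ∀ p → Between (offset r) (permutation p ▷ r) → In𝒫 (w′ p ▷ center s₄)
    go-between p (is-between apart₃ apart₂ (is-closer closer₁) (is-closer closer₂)) =
      convex {q₁ = (w′ p ++ far₁) ▷ center s₄} {(w′ p ++ far₂) ▷ center s₄} {w′ p ▷ center s₂}
        (filled far₁ (turn₁ (permutation p ▷ r)) (turn₁-def (permutation p ▷ r)) refl closer₁ (Turned-good (turned₁ p apart₃) (good′ p)))
        (filled far₂ (turn₂ (permutation p ▷ r)) (turn₂-def (permutation p ▷ r)) refl closer₂ (Turned-good (turned₂ p apart₃ apart₂) (good′ p)))
        (w′ p ++ far₁ , sym (++-fixes (w′ p) far₁ refl) , refl)
        (w′ p ++ far₂ , sym (++-fixes (w′ p) far₂ refl) , refl)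
        (no-shared-facet (w′ p)) (w′ p , refl , refl)
      where
      filled : ∀ h r′ → r′ ≡ reverse h ▷ permutation p ▷ r → h ▷ center zero ≡ center zero → offset r′ ℕ.< offset r →
               Good ((w′ p ++ h) ▷ center s₄) → In𝒫 ((w′ p ++ h) ▷ center s₄)
      filled h r′ refl fixes closer g′ = fill complete m (w′ p ++ h)
        (link-fixes (reverse h) (reverse-fixes h fixes) (link-fixes (permutation p) (permutation-center₀ p) r∈))
        (ℕ.<-≤-trans closer r≤m) (subst (Lev _) (sym (turned-vertex p h fixes)) l)
        (subst Incoming (sym (turned-root p h)) inc) g′

  complete-level : ∀ n → Complete n
  complete-level zero    w l g = subst In𝒫 (sym (apex-cube w (Lev-zero l) g)) first
  complete-level (suc n) w l g = case Lev-suc l of λ { (ρ , e , inc , _) →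
    case EdgeAt-link w e of λ { (r , r∈ , refl) →
      fill (complete-level n) (suc (offset r)) w r∈ ℕ.≤-refl l inc g } }

  complete : ∀ w → Good (w ▷ center s₄) → In𝒫 (w ▷ center s₄)
  complete w g = case Lev-exists (frame-vertex w) of λ { (n , l) → complete-level n w l g }

-- Frames through given orthogonal edges.

coordinate : Fin 4 → Point → ℤ[φ]
coordinate l x = Vec.lookup x (suc l)

axis-coordinate : ∀ l x → ⟪ axis l , x ⟫ ≡ coordinate l x
axis-coordinate l (a ∷ b ∷ c ∷ d ∷ e ∷ []) = go l (axis-coordinates a b c d e)
  where
  x = a ∷ b ∷ c ∷ d ∷ e ∷ []
  go : ∀ l → ⟪ axis (# 0) , x ⟫ ≡ b × ⟪ axis (# 1) , x ⟫ ≡ c × ⟪ axis (# 2) , x ⟫ ≡ d × ⟪ axis (# 3) , x ⟫ ≡ e →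
       ⟪ axis l , x ⟫ ≡ coordinate l x
  go zero                   (p , _ , _ , _) = p
  go (suc zero)             (_ , p , _ , _) = p
  go (suc (suc zero))       (_ , _ , p , _) = p
  go (suc (suc (suc zero))) (_ , _ , _ , p) = p

-- Words in the reflections that fix the axes up to k; they carry the axis
-- suc k to all edges orthogonal to those.
turnings : Fin 3 → List Word
-- The 12, 5 and 2 words correspond to the vertices of the 600-cell joined to a given vertex, to
-- both ends of a given edge and to all vertices of a given triangle.
turnings zero =
  [] ∷
  (s₂ ∷ []) ∷
  (s₃ ∷ s₂ ∷ []) ∷
  (s₄ ∷ s₃ ∷ s₂ ∷ []) ∷
  (s₃ ∷ s₄ ∷ s₃ ∷ s₂ ∷ []) ∷
  (s₂ ∷ s₃ ∷ s₄ ∷ s₃ ∷ s₂ ∷ []) ∷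
  (s₄ ∷ s₃ ∷ s₄ ∷ s₃ ∷ s₂ ∷ []) ∷
  (s₄ ∷ s₂ ∷ s₃ ∷ s₄ ∷ s₃ ∷ s₂ ∷ []) ∷
  (s₃ ∷ s₄ ∷ s₂ ∷ s₃ ∷ s₄ ∷ s₃ ∷ s₂ ∷ []) ∷
  (s₄ ∷ s₃ ∷ s₄ ∷ s₂ ∷ s₃ ∷ s₄ ∷ s₃ ∷ s₂ ∷ []) ∷
  (s₃ ∷ s₄ ∷ s₃ ∷ s₄ ∷ s₂ ∷ s₃ ∷ s₄ ∷ s₃ ∷ s₂ ∷ []) ∷
  (s₂ ∷ s₃ ∷ s₄ ∷ s₃ ∷ s₄ ∷ s₂ ∷ s₃ ∷ s₄ ∷ s₃ ∷ s₂ ∷ []) ∷ []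
turnings (suc zero) =
  [] ∷ (s₃ ∷ []) ∷ (s₄ ∷ s₃ ∷ []) ∷ (s₃ ∷ s₄ ∷ s₃ ∷ []) ∷ (s₄ ∷ s₃ ∷ s₄ ∷ s₃ ∷ []) ∷ []
turnings (suc (suc zero)) = [] ∷ (s₄ ∷ []) ∷ []

Orthogonal-to : Fin 3 → Point → Set
Orthogonal-to k r = ∀ l → Fin.toℕ l ℕ.≤ Fin.toℕ k → coordinate l r ≡ 𝟎

orthogonal-to? : ∀ k r → Dec (Orthogonal-to k r)
orthogonal-to? k r = Fin.all? λ l → (Fin.toℕ l ℕ.≤? Fin.toℕ k) →-dec (coordinate l r ≟ 𝟎)

turning-complete : ∀ k → All (λ r → Orthogonal-to k r → Any (λ g → g ▷ axis (suc k) ≡ r) (turnings k)) linkRoots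
turning-complete k = go k linkRoots (from-yes (check? linkRoots))
  where
  Check : List Point → Set
  Check xs = ∀ k → All (λ r → Orthogonal-to k r → Any (λ g → g ▷ axis (suc k) ≡ r) (turnings k)) xs
  check? : ∀ xs → Dec (Check xs)
  check? xs = Fin.all? λ k → all? (λ r → orthogonal-to? k r →-dec any? (λ g → g ▷ axis (suc k) ≟ᵥ r) (turnings k)) xs
  go : ∀ k xs → Check xs → All (λ r → Orthogonal-to k r → Any (λ g → g ▷ axis (suc k) ≡ r) (turnings k)) xs
  go k xs c = c k

turning-fixes : ∀ k → All (λ g → g ▷ center zero ≡ center zero × (∀ l → Fin.toℕ l ℕ.≤ Fin.toℕ k → g ▷ axis l ≡ axis l)) (turnings k)
turning-fixes = from-yes (Fin.all? λ k → all? (λ g → (g ▷ center zero ≟ᵥ center zero) ×-dec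
  Fin.all? (λ l → (Fin.toℕ l ℕ.≤? Fin.toℕ k) →-dec (g ▷ axis l ≟ᵥ axis l))) (turnings k))

record Extension (k : Fin 3) (w : Word) (ρ : Point) (w′ : Word) : Set where
  constructor extension
  field
    same-vertex : w′ ▷ center zero ≡ w ▷ center zero
    same-axes   : ∀ l → Fin.toℕ l ℕ.≤ Fin.toℕ k → w′ ▷ axis l ≡ w ▷ axis l
    new-axis    : w′ ▷ axis (suc k) ≡ ρ

extend : ∀ k w {ρ} → EdgeAt ρ (w ▷ center zero) → (∀ l → Fin.toℕ l ℕ.≤ Fin.toℕ k → ⟪ w ▷ axis l , ρ ⟫ ≡ 𝟎) →
         ∃[ w′ ] Extension k w ρ w′
extend k w e orthogonal = case EdgeAt-link w e of λ { (r , r∈ , refl) → go r r∈ orthogonal }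
  where
  go : ∀ r → r ∈ linkRoots → (∀ l → Fin.toℕ l ℕ.≤ Fin.toℕ k → ⟪ w ▷ axis l , w ▷ r ⟫ ≡ 𝟎) → ∃[ w′ ] Extension k w (w ▷ r) w′
  go r r∈ orthogonal = case find (All.lookup (turning-complete k) r∈ λ l l≤k →
      trans (sym (axis-coordinate l r)) (trans (sym (▷-isometry w (axis l) r)) (orthogonal l l≤k))) of λ
    { (g , g∈ , eq) → w ++ g , extension (++-fixes w g (proj₁ (All.lookup (turning-fixes k) g∈)))
        (λ l l≤k → ++-fixes w g (proj₂ (All.lookup (turning-fixes k) g∈) l l≤k))
        (trans (▷-++ w g (axis (suc k))) (cong (w ▷_) eq)) }

Orthogonal : Point → Point → Set
Orthogonal ρ τ = ⟪ ρ , τ ⟫ ≡ 𝟎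

axes : ℕ → List (Fin 4)
axes n = take n (allFin 4)

record Frame (v : Point) (cs : List Point) (w : Word) : Set where
  constructor frame
  field
    at     : w ▷ center zero ≡ v
    starts : map (λ l → w ▷ axis l) (axes (length cs)) ≡ cs

-- Pairwise orthogonal edges at a vertex lie in a common hypercube.
frame-of : ∀ {v} cs → length cs ℕ.≤ 4 → Vertex v → All (λ ρ → EdgeAt ρ v) cs → AllPairs Orthogonal cs → ∃[ w ] Frame v cs w
frame-of [] _ (w , refl) _ _ = w , frame refl refl
frame-of (a ∷ []) _ _ ((w , refl , refl) ∷ []) _ = w , frame refl refl
frame-of (a ∷ b ∷ []) _ _ ((w , refl , refl) ∷ eb ∷ []) ((ab ∷ []) ∷ _) =
  case extend (# 0) w eb (λ { zero _ → ab }) of λ { (w′ , extension v f n) →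
    w′ , frame v (cong₂ (λ x y → x ∷ y ∷ []) (f (# 0) ℕ.z≤n) n) }
frame-of (a ∷ b ∷ c ∷ []) _ _ ((w , refl , refl) ∷ eb ∷ ec ∷ []) ((ab ∷ ac ∷ []) ∷ (bc ∷ []) ∷ _) =
  case extend (# 0) w eb (λ { zero _ → ab }) of λ { (w′ , extension v f n) →
  case extend (# 1) w′ (subst (EdgeAt c) (sym v) ec)
         (λ { zero _ → trans (cong ⟪_, c ⟫ (f (# 0) ℕ.z≤n)) ac ; (suc zero) _ → trans (cong ⟪_, c ⟫ n) bc
            ; (suc (suc _)) (ℕ.s≤s ()) }) of λ { (w″ , extension v′ f′ n′) →
    w″ , frame (trans v′ v) (cong₂ _∷_ (trans (f′ (# 0) ℕ.z≤n) (f (# 0) ℕ.z≤n))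
           (cong₂ (λ x y → x ∷ y ∷ []) (trans (f′ (# 1) ℕ.≤-refl) n) n′)) } }
frame-of (a ∷ b ∷ c ∷ d ∷ []) _ _ ((w , refl , refl) ∷ eb ∷ ec ∷ ed ∷ []) ((ab ∷ ac ∷ ad ∷ []) ∷ (bc ∷ bd ∷ []) ∷ (cd ∷ []) ∷ _) =
  case extend (# 0) w eb (λ { zero _ → ab }) of λ { (w′ , extension v f n) →
  case extend (# 1) w′ (subst (EdgeAt c) (sym v) ec)
         (λ { zero _ → trans (cong ⟪_, c ⟫ (f (# 0) ℕ.z≤n)) ac ; (suc zero) _ → trans (cong ⟪_, c ⟫ n) bc
            ; (suc (suc _)) (ℕ.s≤s ()) }) of λ { (w″ , extension v′ f′ n′) →
  case extend (# 2) w″ (subst (EdgeAt d) (sym (trans v′ v)) ed)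
         (λ { zero _ → trans (cong ⟪_, d ⟫ (trans (f′ (# 0) ℕ.z≤n) (f (# 0) ℕ.z≤n))) ad
            ; (suc zero) _ → trans (cong ⟪_, d ⟫ (trans (f′ (# 1) ℕ.≤-refl) n)) bd
            ; (suc (suc zero)) _ → trans (cong ⟪_, d ⟫ n′) cd
            ; (suc (suc (suc _))) (ℕ.s≤s (ℕ.s≤s ())) }) of λ { (w‴ , extension v″ f″ n″) →
    w‴ , frame (trans v″ (trans v′ v))
           (cong₂ _∷_ (trans (f″ (# 0) ℕ.z≤n) (trans (f′ (# 0) ℕ.z≤n) (f (# 0) ℕ.z≤n)))
           (cong₂ _∷_ (trans (f″ (# 1) (ℕ.s≤s ℕ.z≤n)) (trans (f′ (# 1) ℕ.≤-refl) n))
           (cong₂ (λ x y → x ∷ y ∷ []) (trans (f″ (# 2) ℕ.≤-refl) n′) n″))) } } }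
frame-of (_ ∷ _ ∷ _ ∷ _ ∷ _ ∷ _) (ℕ.s≤s (ℕ.s≤s (ℕ.s≤s (ℕ.s≤s ())))) _ _ _

-- Types and the steps between them in the 600-cell.

-- The types of vertices, together with the apex V₀.
Kind : Set
Kind = Maybe VertexType

kinds : List Kind
kinds = nothing ∷ just A ∷ just B ∷ just C ∷ just D ∷ just E ∷ just F ∷ just G ∷ just H ∷ just K ∷ just One ∷ []

kind∈kinds : ∀ s → s ∈ kinds
kind∈kinds nothing    = here refl
kind∈kinds (just A)   = there (here refl)
kind∈kinds (just B)   = there (there (here refl))
kind∈kinds (just C)   = there (there (there (here refl)))
kind∈kinds (just D)   = there (there (there (there (here refl))))
kind∈kinds (just E)   = there (there (there (there (there (here refl)))))
kind∈kinds (just F)   = there (there (there (there (there (there (here refl))))))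
kind∈kinds (just G)   = there (there (there (there (there (there (there (here refl)))))))
kind∈kinds (just H)   = there (there (there (there (there (there (there (there (here refl))))))))
kind∈kinds (just K)   = there (there (there (there (there (there (there (there (there (here refl)))))))))
kind∈kinds (just One) = there (there (there (there (there (there (there (there (there (there (here refl))))))))))

-- A vertex in the interior of a boundary face of dimension d has 4 - d walls; the pair of counts
-- determines the kind (`kind-unique`).
incomingCount wallCount : Kind → ℕ
incomingCount nothing    = 0
incomingCount (just A)   = 2
incomingCount (just B)   = 1
incomingCount (just C)   = 3
incomingCount (just D)   = 2
incomingCount (just E)   = 1
incomingCount (just F)   = 4
incomingCount (just G)   = 3
incomingCount (just H)   = 2
incomingCount (just K)   = 1
incomingCount (just One) = 1
wallCount nothing    = 4
wallCount (just A)   = 2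
wallCount (just B)   = 2
wallCount (just C)   = 1
wallCount (just D)   = 1
wallCount (just E)   = 1
wallCount (just F)   = 0
wallCount (just G)   = 0
wallCount (just H)   = 0
wallCount (just K)   = 0
wallCount (just One) = 3

-- The number of edges to vertices of a given kind on the next level.
outgoings : Kind → Kind → ℕ
outgoings nothing    (just One) = 4
outgoings (just One) (just One) = 1
outgoings (just One) (just A)   = 3
outgoings (just A)   (just A)   = 2
outgoings (just A)   (just B)   = 1
outgoings (just A)   (just C)   = 2
outgoings (just B)   (just A)   = 2
outgoings (just B)   (just B)   = 2
outgoings (just B)   (just D)   = 2
outgoings (just C)   (just C)   = 3
outgoings (just C)   (just D)   = 3
outgoings (just C)   (just E)   = 3
outgoings (just C)   (just F)   = 1
outgoings (just D)   (just C)   = 2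
outgoings (just D)   (just D)   = 4
outgoings (just D)   (just E)   = 4
outgoings (just D)   (just G)   = 1
outgoings (just E)   (just D)   = 5
outgoings (just E)   (just E)   = 6
outgoings (just E)   (just H)   = 1
outgoings (just F)   (just F)   = 4
outgoings (just F)   (just G)   = 6
outgoings (just F)   (just H)   = 12
outgoings (just F)   (just K)   = 94
outgoings (just G)   (just F)   = 2
outgoings (just G)   (just G)   = 6
outgoings (just G)   (just H)   = 12
outgoings (just G)   (just K)   = 97
outgoings (just H)   (just G)   = 5
outgoings (just H)   (just H)   = 12
outgoings (just H)   (just K)   = 101
outgoings (just K)   (just H)   = 12
outgoings (just K)   (just K)   = 107
outgoings _          _          = 0

-- In the frame of a vertex with i incoming edges and j walls, the former are
-- the first i axes and the latter the next j ones.
incomingAxes wallAxes : ℕ → ℕ → List (Fin 4)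
incomingAxes i j = take i (axes (i ℕ.+ j))
wallAxes     i j = drop i (axes (i ℕ.+ j))

orthogonals : Point → List (Fin 4) → ℕ
orthogonals r ls = length (filter (λ l → coordinate l r ≟ 𝟎) ls)

record Leaves (i j : ℕ) (r : Point) : Set where
  constructor leaves
  field
    outgoing : All (λ l → axis l ≢ r) (incomingAxes i j)
    inside   : All (λ l → axis l ≡ r ⊎ coordinate l r ≡ 𝟎) (wallAxes i j)

record LeadsTo (i j i′ j′ : ℕ) (r : Point) : Set where
  constructor leads-to
  field
    leaving    : Leaves i j r
    incomings≡ : suc (orthogonals r (incomingAxes i j)) ≡ i′
    walls≡     : orthogonals r (wallAxes i j) ≡ j′

leaves? : ∀ i j r → Dec (Leaves i j r)
leaves? i j r = map′ (λ (p , q) → leaves p q) (λ (leaves p q) → p , q)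
  (all? (λ l → ¬? (axis l ≟ᵥ r)) (incomingAxes i j) ×-dec all? (λ l → (axis l ≟ᵥ r) ⊎-dec (coordinate l r ≟ 𝟎)) (wallAxes i j))

leads-to? : ∀ i j i′ j′ r → Dec (LeadsTo i j i′ j′ r)
leads-to? i j i′ j′ r = map′ (λ (p , q , s) → leads-to p q s) (λ (leads-to p q s) → p , q , s)
  (leaves? i j r ×-dec (suc (orthogonals r (incomingAxes i j)) ℕ.≟ i′) ×-dec (orthogonals r (wallAxes i j) ℕ.≟ j′))

steps : Kind → Kind → List Point → List Point
steps s t = filter (leads-to? (incomingCount s) (wallCount s) (incomingCount t) (wallCount t))

StepCounts : List Point → Set
StepCounts xs = All (λ s → All (λ t → length (steps s t xs) ≡ outgoings s t) kinds) kinds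

stepCounts? : ∀ xs → Dec (StepCounts xs)
stepCounts? xs = all? (λ s → all? (λ t → length (steps s t xs) ℕ.≟ outgoings s t) kinds) kinds

stepCounts : StepCounts linkRoots
stepCounts = from-yes (stepCounts? linkRoots)

steps-length : ∀ s t → length (steps s t linkRoots) ≡ outgoings s t
steps-length s t = All.lookup (All.lookup stepCounts (kind∈kinds s)) (kind∈kinds t)

-- This closes the list of kinds: no upward edge of 𝒫 ends at a vertex with another pair of counts,
-- which `classify` relies on.
Leading : Kind → Point → Set
Leading s r = Leaves (incomingCount s) (wallCount s) r → Any (λ t → LeadsTo (incomingCount s) (wallCount s) (incomingCount t) (wallCount t) r) kinds

leading? : ∀ xs → Dec (All (λ s → All (Leading s) xs) kinds)
leading? xs = all? (λ s → all? (λ r → leaves? (incomingCount s) (wallCount s) r →-dec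
  any? (λ t → leads-to? (incomingCount s) (wallCount s) (incomingCount t) (wallCount t) r) kinds) xs) kinds

leadings : All (λ s → All (Leading s) linkRoots) kinds
leadings = from-yes (leading? linkRoots)

leading : ∀ s {r} → r ∈ linkRoots → Leaves (incomingCount s) (wallCount s) r →
          ∃[ t ] LeadsTo (incomingCount s) (wallCount s) (incomingCount t) (wallCount t) r
leading s r∈ l = Any.satisfied (All.lookup (All.lookup leadings (kind∈kinds s)) r∈ l)

incomings+walls≤4 : ∀ s → incomingCount s ℕ.+ wallCount s ℕ.≤ 4
incomings+walls≤4 s = All.lookup bounds (kind∈kinds s)
  where
  bounds : All (λ s → incomingCount s ℕ.+ wallCount s ℕ.≤ 4) kinds
  bounds = from-yes (all? (λ s → incomingCount s ℕ.+ wallCount s ℕ.≤? 4) kinds)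

kind-unique : ∀ s t → incomingCount s ≡ incomingCount t → wallCount s ≡ wallCount t → s ≡ t
kind-unique s t p q = trans (sym (kind-of s)) (trans (cong₂ kind p q) (kind-of t))
  where
  kind : ℕ → ℕ → Kind
  kind 1 3 = just One
  kind 2 2 = just A
  kind 1 2 = just B
  kind 3 1 = just C
  kind 2 1 = just D
  kind 1 1 = just E
  kind 4 0 = just F
  kind 3 0 = just G
  kind 2 0 = just H
  kind 1 0 = just K
  kind _ _ = nothing
  kind-of : ∀ s → kind (incomingCount s) (wallCount s) ≡ s
  kind-of nothing    = refl
  kind-of (just A)   = refl
  kind-of (just B)   = refl
  kind-of (just C)   = refl
  kind-of (just D)   = refl
  kind-of (just E)   = refl
  kind-of (just F)   = refl
  kind-of (just G)   = refl
  kind-of (just H)   = refl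
  kind-of (just K)   = refl
  kind-of (just One) = refl

-- Incoming edges and walls along the edges of 𝒫.

-- Passing to the other end changes ⟪ M , u ⟫ by - 2⟪ M , ρ ⟫, so a change of sign requires a
-- product of at least 1. Then the half-spaces are nested, and an edge that crosses both mirrors
-- forces them to coincide.
crossing : ∀ {M ρ u} → Root M → EdgeAt ρ u → Positive ⟪ M , u ⟫ → Positive (⊝ ⟪ M , across ρ u ⟫) → M ≡ ρ
crossing {M} {ρ} {u} root e p q = case root-root root (EdgeAt⇒Root e) of λ
  { (inj₁ z) → ⊥-elim (Positive-asym {⟪ M , u ⟫} p (subst (λ t → Positive (⊝ t))
      (trans (⟪⟫-across M ρ u) (trans (cong (λ t → ⟪ M , u ⟫ ⊕ ⊝ 𝟐 ⊛ t) z) (f ⟪ M , u ⟫))) q))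
  ; (inj₂ (inj₁ t)) → ultraparallel′ {x = u} {x′ = across ρ u} root (EdgeAt⇒Root e) t
      (Future-vertex (EdgeAt⇒Vertex e)) (Future-vertex (EdgeAt⇒Vertex (EdgeAt-back e)))
      (subst (λ s → Nonneg (⟪ M , u ⟫ ⊕ ⊝ s)) (sym (EdgeAt-pairing e)) (side≥1 root (EdgeAt⇒Vertex e) p))
      (subst Nonneg (trans (g ⟪ M , across ρ u ⟫) (cong (λ s → ⊝ (⟪ M , across ρ u ⟫ ⊕ ⊝ s)) (sym behind)))
        (side≤-1 root (EdgeAt⇒Vertex (EdgeAt-back e)) q))
  ; (inj₂ (inj₂ t)) → ⊥-elim (Positive-asym {⟪ M , u ⟫ ⊕ 𝟐 ⊛ ⊝ ⟪ M , ρ ⟫}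
      (Positive-⊕ {⟪ M , u ⟫} {𝟐 ⊛ ⊝ ⟪ M , ρ ⟫} p (Positive-⊛ {𝟐} {⊝ ⟪ M , ρ ⟫} 𝟐>0 (1≤⇒Positive {⊝ ⟪ M , ρ ⟫} t)))
      (subst (λ s → Positive (⊝ s)) (trans (⟪⟫-across M ρ u) (h ⟪ M , u ⟫ ⟪ M , ρ ⟫)) q)) }
  where
  f : ∀ s → s ⊕ ⊝ 𝟐 ⊛ 𝟎 ≡ s
  f = solve-∀ ring
  g : ∀ s → ⊝ s ⊕ ⊝ 𝟏 ≡ ⊝ (s ⊕ ⊝ ⊝ 𝟏)
  g = solve-∀ ring
  h : ∀ s t → s ⊕ ⊝ 𝟐 ⊛ t ≡ s ⊕ 𝟐 ⊛ ⊝ t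
  h = solve-∀ ring
  behind : ⟪ ρ , across ρ u ⟫ ≡ ⊝ 𝟏
  behind = trans (⟪⟫-across ρ ρ u) (cong₂ (λ s t → s ⊕ ⊝ 𝟐 ⊛ t) (EdgeAt-pairing e) (Root-norm (EdgeAt⇒Root e)))

length-filter-map : ∀ {X Y : Set} {P : Y → Set} {Q : X → Set} (P? : ∀ y → Dec (P y)) (Q? : ∀ x → Dec (Q x)) (f : X → Y) →
                    (∀ x → P (f x) ⇔ Q x) → ∀ xs → length (filter P? (map f xs)) ≡ length (filter Q? xs)
length-filter-map P? Q? f iff [] = refl
length-filter-map P? Q? f iff (x ∷ xs) with P? (f x) | Q? x
... | yes _ | yes _ = cong suc (length-filter-map P? Q? f iff xs)
... | no _  | no _  = length-filter-map P? Q? f iff xs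
... | yes p | no q  = ⊥-elim (q (to (iff x) p))
... | no p  | yes q = ⊥-elim (p (from (iff x) q))

take-++ : ∀ {X : Set} (xs ys : List X) → take (length xs) (xs ++ ys) ≡ xs
take-++ []       ys = refl
take-++ (x ∷ xs) ys = cong (x ∷_) (take-++ xs ys)

drop-++ : ∀ {X : Set} (xs ys : List X) → drop (length xs) (xs ++ ys) ≡ ys
drop-++ []       ys = refl
drop-++ (x ∷ xs) ys = drop-++ xs ys

orthogonal-unique : ∀ {xs} → (∀ {ρ} → ρ ∈ xs → Root ρ) → AllPairs Orthogonal xs → Unique xs
orthogonal-unique roots []       = []
orthogonal-unique roots (p ∷ ps) =
  All.map (λ { {τ} z refl → case trans (sym (Root-norm (roots (here refl)))) z of λ () }) p ∷
  orthogonal-unique (λ ρ∈ → roots (there ρ∈)) ps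

module States (w₀ : Word) where

  open Levels w₀
  open Values w₀
  open Tops w₀
  open Region w₀
  open Completeness w₀

  IncomingAt WallAt : Point → Point → Set
  IncomingAt v ρ = EdgeAt ρ v × Incoming ρ
  WallAt     v ρ = EdgeAt ρ v × (∃[ k ] wall k ≡ ρ)

  -- The vertices of the region, described without a hypercube: `good-placed` derives this from a
  -- hypercube, and `framed-good` finds a hypercube from the state.
  Placed : Point → Set
  Placed v = ∀ k → Positive (⊝ ⟪ wall k , v ⟫) ⊎ EdgeAt (wall k) v

  record State (i j : ℕ) (v : Point) : Set where
    field
      vertex      : Vertex v
      incs walls  : List Point
      incs-length : length incs ≡ i
      walls-length : length walls ≡ j
      orthogonal  : AllPairs Orthogonal (incs ++ walls)
      incs-sound  : ∀ {ρ} → ρ ∈ incs → IncomingAt v ρ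
      incs-complete : ∀ {ρ} → IncomingAt v ρ → ρ ∈ incs
      walls-sound : ∀ {ρ} → ρ ∈ walls → WallAt v ρ
      walls-complete : ∀ {ρ} → WallAt v ρ → ρ ∈ walls
      placed      : Placed v

  apex-state : State 0 4 V₀
  apex-state = record
    { vertex = vertex₀ ; incs = [] ; walls = map wall (allFin 4) ; incs-length = refl ; walls-length = refl
    ; orthogonal = (o (# 0) (# 1) (λ ()) ∷ o (# 0) (# 2) (λ ()) ∷ o (# 0) (# 3) (λ ()) ∷ []) ∷
                   (o (# 1) (# 2) (λ ()) ∷ o (# 1) (# 3) (λ ()) ∷ []) ∷ (o (# 2) (# 3) (λ ()) ∷ []) ∷ [] ∷ []
    ; incs-sound = λ () ; incs-complete = λ (e , p) → ⊥-elim (no-incoming₀ e p)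
    ; walls-sound = λ ρ∈ → case ∈-map⁻ wall {xs = allFin 4} ρ∈ of λ { (k , _ , refl) → wall-edge k , k , refl }
    ; walls-complete = λ { (_ , k , refl) → ∈-map⁺ wall (∈-allFin k) }
    ; placed = λ k → inj₂ (wall-edge k) }
    where
    o : ∀ k l → k ≢ l → Orthogonal (wall k) (wall l)
    o = frame-orthogonal w₀

  back-orthogonal : ∀ {ρ τ} → ⟪ ρ , τ ⟫ ≡ 𝟎 → ⟪ -𝟏 ·ᵥ ρ , τ ⟫ ≡ 𝟎
  back-orthogonal {ρ} {τ} z = trans (⟪⟫-negˡ ρ τ) (cong ⊝_ z)

  back-orthogonal⁻ : ∀ {ρ τ} → ⟪ -𝟏 ·ᵥ ρ , τ ⟫ ≡ 𝟎 → ⟪ ρ , τ ⟫ ≡ 𝟎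
  back-orthogonal⁻ {ρ} {τ} z = trans (sym (⊝-involutive ⟪ ρ , τ ⟫)) (cong ⊝_ (trans (sym (⟪⟫-negˡ ρ τ)) z))

  EdgeAt-across⁻ : ∀ {ρ τ u} → EdgeAt ρ u → EdgeAt τ (across ρ u) → ⟪ ρ , τ ⟫ ≡ 𝟎 → EdgeAt τ u
  EdgeAt-across⁻ {ρ} {τ} {u} e f z = subst (EdgeAt τ) (across-back ρ u) (EdgeAt-across (EdgeAt-back e) f (back-orthogonal {ρ} z))

  orthogonal? : ∀ ρ τ → Dec (⟪ ρ , τ ⟫ ≡ 𝟎)
  orthogonal? ρ τ = ⟪ ρ , τ ⟫ ≟ 𝟎

  -- At the other end of an outgoing edge, the edges that span a square with
  -- it continue, and the edge itself is incoming.
  step : ∀ {i j v ρ} (s : State i j v) → EdgeAt ρ v → Outgoing ρ → (∀ {τ} → τ ∈ State.walls s → τ ≡ ρ ⊎ ⟪ ρ , τ ⟫ ≡ 𝟎) →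
         State (suc (length (filter (orthogonal? ρ) (State.incs s)))) (length (filter (orthogonal? ρ) (State.walls s))) (across ρ v)
  step {v = v} {ρ} s e out passable = record
    { vertex = EdgeAt⇒Vertex (EdgeAt-back e)
    ; incs = -𝟏 ·ᵥ ρ ∷ filter (orthogonal? ρ) incs
    ; walls = filter (orthogonal? ρ) walls
    ; incs-length = refl
    ; walls-length = refl
    ; orthogonal = subst (λ xs → AllPairs Orthogonal (-𝟏 ·ᵥ ρ ∷ xs)) (List.filter-++ (orthogonal? ρ) incs walls)
        (All.tabulate (λ {τ} τ∈ → back-orthogonal {ρ} {τ} (proj₂ (∈-filter⁻ (orthogonal? ρ) {xs = incs ++ walls} τ∈))) ∷
         AllPairs.filter⁺ (orthogonal? ρ) orthogonal)
    ; incs-sound = λ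
        { (here refl) → EdgeAt-back e , back-incoming {ρ} out
        ; (there τ∈) → case ∈-filter⁻ (orthogonal? ρ) {xs = incs} τ∈ of λ
          { (τ∈′ , z) → EdgeAt-across e (proj₁ (incs-sound τ∈′)) z , proj₂ (incs-sound τ∈′) } }
    ; incs-complete = λ { {τ} (f , inc) → case incoming-orthogonal (EdgeAt-back e) f (back-incoming {ρ} out) inc of λ
        { (inj₁ eq) → here (sym eq)
        ; (inj₂ z) → let z′ = back-orthogonal⁻ {ρ} {τ} z in
            there (∈-filter⁺ (orthogonal? ρ) (incs-complete (EdgeAt-across⁻ e f z′ , inc)) z′) } }
    ; walls-sound = λ {τ} τ∈ → case ∈-filter⁻ (orthogonal? ρ) {xs = walls} τ∈ of λ
        { (τ∈′ , z) → EdgeAt-across e (proj₁ (walls-sound τ∈′)) z , proj₂ (walls-sound τ∈′) }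
    ; walls-complete = λ { (f , k , refl) → let z = wall-orthogonal′ k f in
        ∈-filter⁺ (orthogonal? ρ) (walls-complete (EdgeAt-across⁻ e f z , k , refl)) z }
    ; placed = λ k → case placed k of λ
        { (inj₁ p) → inj₁ (side-persists (EdgeAt⇒Root (wall-edge k)) vertex₀ (wall-outgoing k) e out p)
        ; (inj₂ f) → case passable (walls-complete (f , k , refl)) of λ
          { (inj₁ eq) → inj₁ (subst (λ M → Positive (⊝ ⟪ M , across ρ v ⟫)) (sym eq)
              (subst (λ t → Positive (⊝ t)) (sym behind) 𝟏>0))
          ; (inj₂ z) → inj₂ (EdgeAt-across e f z) } } }
    where
    open State s
    behind : ⟪ ρ , across ρ v ⟫ ≡ ⊝ 𝟏
    behind = trans (⟪⟫-across ρ ρ v) (cong₂ (λ s t → s ⊕ ⊝ 𝟐 ⊛ t) (EdgeAt-pairing e) (Root-norm (EdgeAt⇒Root e)))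
    wall-orthogonal′ : ∀ k → EdgeAt (wall k) (across ρ v) → ⟪ ρ , wall k ⟫ ≡ 𝟎
    wall-orthogonal′ k f = back-orthogonal⁻ {ρ} (trans (⟪⟫-comm (-𝟏 ·ᵥ ρ) (wall k))
      (wall-orthogonal {k} f (EdgeAt-back e) (back-incoming {ρ} out)))

  -- A mirror that separates v from V₀ but not its lower neighbour is the bisector of the edge
  -- between them, by `crossing`, so it is a wall at the lower end.
  Placed-lower : ∀ {v τ} → EdgeAt τ v → Incoming τ → Placed v → Placed (across τ v)
  Placed-lower {v} {τ} e inc placed k = case placed k of λ
    { (inj₂ f) → inj₂ (EdgeAt-across e f (trans (⟪⟫-comm τ (wall k)) (wall-orthogonal {k} f e inc)))
    ; (inj₁ p) → case side (EdgeAt⇒Root (wall-edge k)) (EdgeAt⇒Vertex (EdgeAt-back e)) of λ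
      { (inj₂ q) → inj₁ q
      ; (inj₁ q) → inj₂ (subst (λ M → EdgeAt M (across τ v)) (sym (crossing (EdgeAt⇒Root (wall-edge k)) (EdgeAt-back e) q
          (subst (λ u → Positive (⊝ ⟪ wall k , u ⟫)) (sym (across-back τ v)) p))) (EdgeAt-back e)) } }

  -- An edge belongs to 𝒫 if it spans squares with the walls at its end.
  Passable : Point → Point → Set
  Passable v ρ = ∀ {τ} → WallAt v τ → τ ≡ ρ ⊎ ⟪ ρ , τ ⟫ ≡ 𝟎

  Passable-back : ∀ {v τ} → EdgeAt τ v → Incoming τ → Placed v → Passable (across τ v) (-𝟏 ·ᵥ τ)
  Passable-back {v} {τ} e inc placed (f , k , refl) = case placed k of λ
    { (inj₂ g) → inj₂ (back-orthogonal {τ} (trans (⟪⟫-comm τ (wall k)) (wall-orthogonal {k} g e inc)))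
    ; (inj₁ p) → inj₁ (crossing (EdgeAt⇒Root (wall-edge k)) (EdgeAt-back e)
        (subst Positive (sym (EdgeAt-pairing f)) 𝟏>0) (subst (λ u → Positive (⊝ ⟪ wall k , u ⟫)) (sym (across-back τ v)) p)) }

-- Counting the edges between consecutive levels.

AllPairs-++⁻ˡ : ∀ {X : Set} {R : X → X → Set} xs {ys} → AllPairs R (xs ++ ys) → AllPairs R xs
AllPairs-++⁻ˡ []       _        = []
AllPairs-++⁻ˡ (x ∷ xs) (p ∷ ps) = All.++⁻ˡ xs p ∷ AllPairs-++⁻ˡ xs ps

AllPairs-++⁻ʳ : ∀ {X : Set} {R : X → X → Set} xs {ys} → AllPairs R (xs ++ ys) → AllPairs R ys
AllPairs-++⁻ʳ []       ps       = ps
AllPairs-++⁻ʳ (x ∷ xs) (_ ∷ ps) = AllPairs-++⁻ʳ xs ps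

_≟ₖ_ : DecidableEquality Kind
s ≟ₖ t = map′ (λ (p , q) → kind-unique s t p q) (λ { refl → refl , refl })
  ((incomingCount s ℕ.≟ incomingCount t) ×-dec (wallCount s ℕ.≟ wallCount t))

apex-only : Kind → ℕ
apex-only nothing  = 1
apex-only (just _) = 0

kinds-unique : Unique kinds
kinds-unique = from-yes (DecUnique.unique? _≟ₖ_ kinds)

HasCard-⋃ : ∀ {X S : Set} {P : S → X → Set} {c : S → ℕ} → (∀ {s t x} → P s x → P t x → s ≡ t) →
            (∀ s → HasCard (P s) (c s)) → ∀ ss → Unique ss →
            HasCard (λ x → ∃[ s ] (s ∈ ss × P s x)) (sum (map c ss))
HasCard-⋃ exclusive cards []       _            = HasCard-empty λ { _ (_ , () , _) }
HasCard-⋃ exclusive cards (s ∷ ss) u@(_ ∷ u′) = HasCard-cong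
  (λ x → mk⇔ (λ { (inj₁ p) → s , here refl , p ; (inj₂ (t , t∈ , p)) → t , there t∈ , p })
             (λ { (.s , here refl , p) → inj₁ p ; (t , there t∈ , p) → inj₂ (t , t∈ , p) }))
  (HasCard-⊎ (cards s) (HasCard-⋃ exclusive cards ss u′)
    (λ { x p (t , t∈ , q) → Unique-head u (subst (_∈ ss) (exclusive q p) t∈) }))

steps-unique : ∀ s t xs → Unique xs → Unique (steps s t xs)
steps-unique s t xs = Unique.filter⁺ (leads-to? (incomingCount s) (wallCount s) (incomingCount t) (wallCount t))

steps-∈⁻ : ∀ s t xs {r} → r ∈ steps s t xs → r ∈ xs × LeadsTo (incomingCount s) (wallCount s) (incomingCount t) (wallCount t) r
steps-∈⁻ s t xs = ∈-filter⁻ (leads-to? (incomingCount s) (wallCount s) (incomingCount t) (wallCount t)) {xs = xs}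

steps-∈⁺ : ∀ s t xs {r} → r ∈ xs → LeadsTo (incomingCount s) (wallCount s) (incomingCount t) (wallCount t) r → r ∈ steps s t xs
steps-∈⁺ s t xs = ∈-filter⁺ (leads-to? (incomingCount s) (wallCount s) (incomingCount t) (wallCount t))

module Counting (w₀ : Word) where

  open Levels w₀
  open Values w₀
  open Tops w₀
  open Region w₀
  open Completeness w₀
  open States w₀

  record Framed {i j v} (s : State i j v) (w : Word) : Set where
    constructor framed
    open State s
    field
      at     : w ▷ center zero ≡ v
      incs≡  : incs ≡ map (λ l → w ▷ axis l) (incomingAxes i j)
      walls≡ : walls ≡ map (λ l → w ▷ axis l) (wallAxes i j)

  frame-state : ∀ {i j v} (s : State i j v) → i ℕ.+ j ℕ.≤ 4 → ∃[ w ] Framed s w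
  frame-state {i} {j} s i+j≤4 = case frame-of (incs ++ walls) (subst (ℕ._≤ 4) (sym total) i+j≤4) vertex edges orthogonal of λ
      { (w , frame at starts) → w , framed at (sym (trans (sym (List.take-map {f = λ l → w ▷ axis l} i (axes (i ℕ.+ j))))
            (trans (cong (take i) (starts′ w starts)) (trans (cong (λ n → take n (incs ++ walls)) (sym incs-length)) (take-++ incs walls)))))
          (sym (trans (sym (List.drop-map {f = λ l → w ▷ axis l} i (axes (i ℕ.+ j))))
            (trans (cong (drop i) (starts′ w starts)) (trans (cong (λ n → drop n (incs ++ walls)) (sym incs-length)) (drop-++ incs walls))))) }
    where
    open State s
    total : length (incs ++ walls) ≡ i ℕ.+ j
    total = trans (List.length-++ incs) (cong₂ ℕ._+_ incs-length walls-length)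
    starts′ : ∀ w → map (λ l → w ▷ axis l) (axes (length (incs ++ walls))) ≡ incs ++ walls → map (λ l → w ▷ axis l) (axes (i ℕ.+ j)) ≡ incs ++ walls
    starts′ w = subst (λ n → map (λ l → w ▷ axis l) (axes n) ≡ incs ++ walls) total
    edges : All (λ ρ → EdgeAt ρ _) (incs ++ walls)
    edges = All.tabulate λ ρ∈ → case ∈-++⁻ incs ρ∈ of λ
      { (inj₁ p) → proj₁ (incs-sound p) ; (inj₂ p) → proj₁ (walls-sound p) }

  module _ {i j v} (s : State i j v) {w} (fr : Framed s w) where
    open State s
    open Framed fr

    orthogonal⇔ : ∀ r l → (⟪ w ▷ r , w ▷ axis l ⟫ ≡ 𝟎) ⇔ (coordinate l r ≡ 𝟎)
    orthogonal⇔ r l = mk⇔ (trans (sym pairing)) (trans pairing)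
      where
      pairing : ⟪ w ▷ r , w ▷ axis l ⟫ ≡ coordinate l r
      pairing = trans (▷-isometry w r (axis l)) (trans (⟪⟫-comm r (axis l)) (axis-coordinate l r))

    incs-count : ∀ r → length (filter (orthogonal? (w ▷ r)) incs) ≡ orthogonals r (incomingAxes i j)
    incs-count r = trans (cong (λ xs → length (filter (orthogonal? (w ▷ r)) xs)) incs≡)
      (length-filter-map (orthogonal? (w ▷ r)) (λ l → coordinate l r ≟ 𝟎) (λ l → w ▷ axis l) (orthogonal⇔ r) (incomingAxes i j))

    walls-count : ∀ r → length (filter (orthogonal? (w ▷ r)) walls) ≡ orthogonals r (wallAxes i j)
    walls-count r = trans (cong (λ xs → length (filter (orthogonal? (w ▷ r)) xs)) walls≡)
      (length-filter-map (orthogonal? (w ▷ r)) (λ l → coordinate l r ≟ 𝟎) (λ l → w ▷ axis l) (orthogonal⇔ r) (wallAxes i j))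

    leaves⁺ : ∀ {r} → Outgoing (w ▷ r) → Passable v (w ▷ r) → Leaves i j r
    leaves⁺ {r} out passable = leaves
      (All.tabulate λ {l} l∈ eq → not-both {w ▷ r} out (subst (λ x → Incoming (w ▷ x)) eq
        (proj₂ (incs-sound (subst (w ▷ axis l ∈_) (sym incs≡) (∈-map⁺ (λ l → w ▷ axis l) l∈))))))
      (All.tabulate λ {l} l∈ → case passable (walls-sound (subst (w ▷ axis l ∈_) (sym walls≡) (∈-map⁺ (λ l → w ▷ axis l) l∈))) of λ
        { (inj₁ eq) → inj₁ (▷-injective w eq) ; (inj₂ z) → inj₂ (to (orthogonal⇔ r l) z) })

    leaves-outgoing : ∀ {r} → r ∈ linkRoots → Leaves i j r → Outgoing (w ▷ r)
    leaves-outgoing {r} r∈ (leaves outgoing _) = case direction (link-EdgeAt w r∈) of λ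
      { (inj₁ out) → out
      ; (inj₂ inc) → case ∈-map⁻ (λ l → w ▷ axis l) {xs = incomingAxes i j}
            (subst (w ▷ r ∈_) incs≡ (incs-complete (subst (EdgeAt (w ▷ r)) at (link-EdgeAt w r∈) , inc))) of λ
          { (l , l∈ , eq) → ⊥-elim (All.lookup outgoing l∈ (sym (▷-injective w eq))) } }

    leaves-passable : ∀ {r} → Leaves i j r → ∀ {τ} → τ ∈ walls → τ ≡ w ▷ r ⊎ ⟪ w ▷ r , τ ⟫ ≡ 𝟎
    leaves-passable {r} (leaves _ inside) τ∈ = case ∈-map⁻ (λ l → w ▷ axis l) {xs = wallAxes i j} (subst (_ ∈_) walls≡ τ∈) of λ
      { (l , l∈ , refl) → case All.lookup inside l∈ of λ
        { (inj₁ eq) → inj₁ (cong (w ▷_) eq) ; (inj₂ z) → inj₂ (from (orthogonal⇔ r l) z) } }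

    leads : ∀ {i′ j′ r} → r ∈ linkRoots → LeadsTo i j i′ j′ r → State i′ j′ (across (w ▷ r) v)
    leads {r = r} r∈ (leads-to l inc≡ wall≡) = subst₂ (λ i j → State i j (across (w ▷ r) v))
      (trans (cong suc (incs-count r)) inc≡) (trans (walls-count r) wall≡)
      (step s (subst (EdgeAt (w ▷ r)) at (link-EdgeAt w r∈)) (leaves-outgoing r∈ l) (leaves-passable l))

  OfKind : Kind → Point → Set
  OfKind s = State (incomingCount s) (wallCount s)

  incs-card : ∀ {i j v} → State i j v → HasCard (IncomingAt v) i
  incs-card s = incs , orthogonal-unique (λ ρ∈ → EdgeAt⇒Root (proj₁ (incs-sound ρ∈))) (AllPairs-++⁻ˡ incs orthogonal) ,
    (λ ρ → mk⇔ incs-sound incs-complete) , incs-length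
    where open State s

  walls-card : ∀ {i j v} → State i j v → HasCard (WallAt v) j
  walls-card s = walls , orthogonal-unique (λ ρ∈ → EdgeAt⇒Root (proj₁ (walls-sound ρ∈))) (AllPairs-++⁻ʳ incs orthogonal) ,
    (λ ρ → mk⇔ walls-sound walls-complete) , walls-length
    where open State s

  kind-exclusive : ∀ {s t v} → OfKind s v → OfKind t v → s ≡ t
  kind-exclusive {s} {t} p q = kind-unique s t
    (HasCard-unique (incs-card p) (incs-card q) (λ _ → mk⇔ (λ x → x) (λ x → x)))
    (HasCard-unique (walls-card p) (walls-card q) (λ _ → mk⇔ (λ x → x) (λ x → x)))

  next-kind : ∀ {s v ρ} → OfKind s v → EdgeAt ρ v → Outgoing ρ → Passable v ρ → ∃[ t ] OfKind t (across ρ v)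
  next-kind {s} {v} p e out passable = case frame-state p (incomings+walls≤4 s) of λ { (w , fr@(framed refl _ _)) →
    case EdgeAt-link w e of λ { (r , r∈ , refl) →
    case leading s r∈ (leaves⁺ p fr out passable) of λ { (t , l) → t , leads p fr r∈ l } } }

  -- A descent along incoming edges stays among placed vertices and reaches the apex, whose state is
  -- known; `next-kind` carries the state back up.
  classify : ∀ n {v} → Lev n v → Placed v → ∃[ s ] OfKind s v
  classify zero    l placed = nothing , subst (State 0 4) (sym (Lev-zero l)) apex-state
  classify (suc n) {v} l placed = case Lev-suc l of λ { (τ , e , inc , l′) →
    case classify n l′ (Placed-lower e inc placed) of λ { (s , p) →
    case next-kind {s} p (EdgeAt-back e) (back-outgoing {τ} inc) (Passable-back e inc placed) of λ { (t , q) →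
      t , subst (OfKind t) (across-back τ v) q } } }

  record At (s : Kind) (n : ℕ) (v : Point) : Set where
    constructor at-level
    field
      level : Lev n v
      state : OfKind s v

  Above : Point → Point → Set
  Above u v = ∃[ ρ ] (EdgeAt ρ u × Outgoing ρ × v ≡ across ρ u)

  At-exclusive : ∀ {n s t v} → At s n v → At t n v → s ≡ t
  At-exclusive p q = kind-exclusive (At.state p) (At.state q)

  -- In a frame of u the edges sought are the roots in `steps s t linkRoots`. Conversely, an edge up
  -- to a vertex of kind t is passable because its upper end is placed.
  upward : ∀ {n u} s t → At s n u → HasCard (λ v → At t (suc n) v × Above u v) (outgoings s t)
  upward {n} {u} s t (at-level level state) = case frame-state state (incomings+walls≤4 s) of λ
      { (w , fr) → go w fr (steps s t linkRoots) (steps-unique s t linkRoots linkRoots-unique)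
          (steps-∈⁻ s t linkRoots) (steps-∈⁺ s t linkRoots) (steps-length s t) }
    where
    go : ∀ w → Framed state w → ∀ xs → Unique xs →
         (∀ {r} → r ∈ xs → r ∈ linkRoots × LeadsTo (incomingCount s) (wallCount s) (incomingCount t) (wallCount t) r) →
         (∀ {r} → r ∈ linkRoots → LeadsTo (incomingCount s) (wallCount s) (incomingCount t) (wallCount t) r → r ∈ xs) →
         length xs ≡ outgoings s t → HasCard (λ v → At t (suc n) v × Above u v) (outgoings s t)
    go w fr@(framed refl _ _) xs unique sound complete len = HasCard-cong (λ v → mk⇔ (forward v) (backward v))
        (HasCard-map (λ r → across (w ▷ r) u) (λ {r} {r′} eq → ▷-injective w (across-injective u eq))
          (xs , unique , (λ _ → mk⇔ (λ x → x) (λ x → x)) , len))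
      where
      forward : ∀ v → (∃[ r ] (r ∈ xs × v ≡ across (w ▷ r) u)) → At t (suc n) v × Above u v
      forward v (r , r∈ , refl) = arrive r (proj₁ (sound r∈)) (proj₂ (sound r∈))
        where
        arrive : ∀ r → r ∈ linkRoots → LeadsTo (incomingCount s) (wallCount s) (incomingCount t) (wallCount t) r →
                 At t (suc n) (across (w ▷ r) u) × Above u (across (w ▷ r) u)
        arrive r r∈ l = at-level (up {ρ = w ▷ r} {u} level e out) (leads state fr r∈ l) , (w ▷ r , e , out , refl)
          where
          e : EdgeAt (w ▷ r) u
          e = link-EdgeAt w r∈
          out : Outgoing (w ▷ r)
          out = leaves-outgoing state fr r∈ (LeadsTo.leaving l)
      backward : ∀ v → At t (suc n) v × Above u v → ∃[ r ] (r ∈ xs × v ≡ across (w ▷ r) u)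
      backward v (at-level _ q , ρ , e , out , refl) = departs (EdgeAt-link w e)
        where
        passable : Passable u ρ
        passable = subst₂ Passable (across-back ρ u) (-ᵥ-involutive ρ)
          (Passable-back (EdgeAt-back e) (back-incoming {ρ} out) (State.placed q))
        found : ∀ r → r ∈ linkRoots → OfKind t (across (w ▷ r) u) →
                (∃[ t′ ] LeadsTo (incomingCount s) (wallCount s) (incomingCount t′) (wallCount t′) r) → r ∈ xs
        found r r∈ q (t′ , l) = complete r∈ (subst (λ t → LeadsTo (incomingCount s) (wallCount s) (incomingCount t) (wallCount t) r)
          (kind-exclusive {t′} {t} (leads state fr r∈ l) q) l)
        departs : ∃[ r ] (r ∈ linkRoots × ρ ≡ w ▷ r) → ∃[ r ] (r ∈ xs × across ρ u ≡ across (w ▷ r) u)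
        departs (r , r∈ , eq) = r , found r r∈ (subst (λ ρ → OfKind t (across ρ u)) eq q)
            (leading s r∈ (leaves⁺ state fr (subst Outgoing eq out) (λ {τ} → subst (λ ρ → ∀ {τ} → WallAt u τ → τ ≡ ρ ⊎ ⟪ ρ , τ ⟫ ≡ 𝟎) eq passable {τ}))) ,
          cong (λ ρ → across ρ u) eq

  OnLevel : ℕ → Point → Set
  OnLevel n u = ∃[ s ] (s ∈ kinds × At s n u)

  downward : ∀ {n v} t → At t (suc n) v → HasCard (λ u → OnLevel n u × Above u v) (incomingCount t)
  downward {n} {v} t (at-level level state) = HasCard-cong (λ u → mk⇔ (forward u) (backward u))
      (HasCard-map (λ τ → across τ v) (across-injective v) (incs-card state))
    where
    forward : ∀ u → (∃[ τ ] (IncomingAt v τ × u ≡ across τ v)) → OnLevel n u × Above u v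
    forward u (τ , (e , inc) , refl) = (proj₁ kind , kind∈kinds (proj₁ kind) , at-level lower (proj₂ kind)) ,
        (-𝟏 ·ᵥ τ , EdgeAt-back e , back-outgoing {τ} inc , sym (across-back τ v))
      where
      lower : Lev n (across τ v)
      lower = case Lev-down level e inc of λ { (m , eq , l) → subst (λ m → Lev m (across τ v)) (sym (ℕ.suc-injective eq)) l }
      kind : ∃[ s ] OfKind s (across τ v)
      kind = classify n lower (Placed-lower e inc (State.placed state))
    backward : ∀ u → OnLevel n u × Above u v → ∃[ τ ] (IncomingAt v τ × u ≡ across τ v)
    backward u (_ , ρ , e , out , refl) = -𝟏 ·ᵥ ρ , (EdgeAt-back e , back-incoming {ρ} out) , sym (across-back ρ u)

  record Census (n : ℕ) : Set where
    field
      number : Kind → ℕ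
      card   : ∀ s → HasCard (At s n) (number s)

  census₀ : Census 0
  census₀ = record
    { number = apex-only
    ; card = λ
      { nothing  → HasCard-cong (λ v → mk⇔ (λ { refl → at-level apex apex-state }) (λ p → Lev-zero (At.level p))) (HasCard-singleton V₀)
      ; (just t) → HasCard-empty λ v p → case kind-exclusive {nothing} {just t} apex-state
          (subst (OfKind (just t)) (Lev-zero (At.level p)) (At.state p)) of λ () } }

  arrivals : ∀ {n} → Census n → Kind → ℕ
  arrivals c t = sum (map (λ s → Census.number c s ℕ.* outgoings s t) kinds)

  steps-card : ∀ {n} (c : Census n) t → HasCard (λ (u , v) → OnLevel n u × At t (suc n) v × Above u v) (arrivals c t)
  steps-card {n} c t = HasCard-cong
    (λ (u , v) → mk⇔ (λ (s , s∈ , p , q) → (s , s∈ , p) , q) (λ ((s , s∈ , p) , q) → s , s∈ , p , q))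
    (HasCard-⋃ {P = λ s → Pairs (At s n) (λ u v → At t (suc n) v × Above u v)} (λ p q → At-exclusive (proj₁ p) (proj₁ q))
      (λ s → HasCard-Σ-uniform (outgoings s t) (Census.card c s) (λ u p → upward s t p)) kinds kinds-unique)

  At-below : ∀ {n t v} → At t (suc n) v → ∃[ u ] (OnLevel n u × At t (suc n) v × Above u v)
  At-below {n} {t} {v} p = origin (Lev-suc (At.level p))
    where
    origin : ∃[ τ ] (EdgeAt τ v × Incoming τ × Lev n (across τ v)) → ∃[ u ] (OnLevel n u × At t (suc n) v × Above u v)
    origin (τ , e , inc , l) = across τ v , (proj₁ kind , kind∈kinds (proj₁ kind) , at-level l (proj₂ kind)) , p ,
        (-𝟏 ·ᵥ τ , EdgeAt-back e , back-outgoing {τ} inc , sym (across-back τ v))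
      where
      kind : ∃[ s ] OfKind s (across τ v)
      kind = classify n l (Placed-lower e inc (State.placed (At.state p)))

  -- The vertices are the upper ends of the finitely many edges from the level below. Their number
  -- is left unevaluated here; `census-step` relates it to the number of edges.
  vertices-card : ∀ {n} → Census n → ∀ t → ∃[ m ] HasCard (At t (suc n)) m
  vertices-card c t = case HasCard-proj₂ _≟ᵥ_ (steps-card c t) of λ { (m , h) →
    m , HasCard-cong (λ v → mk⇔ (λ (u , _ , p , _) → p) At-below) h }

  next-census : ∀ {n} → Census n → Census (suc n)
  next-census c = record { number = λ t → proj₁ (vertices-card c t) ; card = λ t → proj₂ (vertices-card c t) }

  -- Both sides count the edges to vertices of kind t.
  census-step : ∀ {n} (c : Census n) t → Census.number (next-census c) t ℕ.* incomingCount t ≡ arrivals c t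
  census-step {n} c t = HasCard-unique
    (HasCard-map swap (λ { refl → refl }) (HasCard-Σ-uniform (incomingCount t) (Census.card (next-census c) t) (λ v p → downward t p)))
    (steps-card c t)
    (λ (u , v) → mk⇔ (λ { ((.v , .u) , (p , q , r) , refl) → q , p , r }) (λ (q , p , r) → (v , u) , (p , q , r) , refl))

  census : ∀ n → Census n
  census zero    = census₀
  census (suc n) = next-census (census n)

-- Edges, paths and levels within 𝒫.

axisWord : Fin 4 → Word
axisWord zero                   = []
axisWord (suc zero)             = s₁ ∷ []
axisWord (suc (suc zero))       = s₂ ∷ s₁ ∷ []
axisWord (suc (suc (suc zero))) = s₃ ∷ s₂ ∷ s₁ ∷ []

axisWord-properties : ∀ l → axisWord l ▷ axis zero ≡ axis l × axisWord l ▷ center zero ≡ center zero × axisWord l ▷ center s₄ ≡ center s₄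
axisWord-properties = from-yes (Fin.all? λ l → (axisWord l ▷ axis zero ≟ᵥ axis l) ×-dec
  (axisWord l ▷ center zero ≟ᵥ center zero) ×-dec (axisWord l ▷ center s₄ ≟ᵥ center s₄))

module Paths (w₀ : Word) where

  open Levels w₀
  open Values w₀
  open Tops w₀
  open Region w₀
  open Completeness w₀
  open States w₀
  open Counting w₀
  private module S = Simplex V₀ Q₀

  good-placed : ∀ w → Good (w ▷ center s₄) → Placed (w ▷ center zero)
  good-placed w g k = case position w g k of λ
    { (beyond p)   → inj₁ p
    ; (along l eq) → inj₂ (subst (λ M → EdgeAt M (w ▷ center zero)) (sym eq) (frame-edge w l)) }

  framed-good : ∀ {i j v w} (s : State i j v) → Framed s w → Good (w ▷ center s₄)
  framed-good {i} {j} {v} {w} s (framed refl _ walls≡) = good w λ k → case State.placed s k of λ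
    { (inj₁ p) → beyond p
    ; (inj₂ e) → case ∈-map⁻ (λ l → w ▷ axis l) {xs = wallAxes i j}
                        (subst (wall k ∈_) walls≡ (State.walls-complete s (e , k , refl))) of λ { (l , _ , eq) → along l eq } }

  record 𝒫EdgeFrame (u v : Point) (w : Word) : Set where
    constructor edge-frame
    field
      source : u ≡ w ▷ center zero
      target : v ≡ across (w ▷ axis zero) u
      inside : Good (w ▷ center s₄)

  -- The edge and the hypercube come with separate frames; `cell-corner` supplies a frame of both
  -- that starts at u.
  𝒫Edge⁻ : ∀ {u v} → S.𝒫Edge u v → ∃[ w ] 𝒫EdgeFrame u v w
  𝒫Edge⁻ {u} {v} (e , joined , q , p , (x , e≡ , q≡)) = go (JoinedBy⁻ joined)
    where
    go : ∃[ w ] (u ≡ w ▷ center zero × e ≡ w ▷ center s₁ × v ≡ across (w ▷ normal zero) (w ▷ center zero)) → ∃[ w ] 𝒫EdgeFrame u v w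
    go (w , u≡ , e≡′ , v≡) = found (cell-corner (# 0) x w (trans (sym e≡) e≡′))
      where
      found : ∃[ f ] ((∀ i → 0 ℕ.≤ Fin.toℕ i → f ▷ center (suc i) ≡ center (suc i)) × x ▷ f ▷ center zero ≡ w ▷ center zero) → ∃[ w ] 𝒫EdgeFrame u v w
      found (f , fixes , vertex) = x ++ f , edge-frame (trans u≡ (sym source)) target
          (subst Good (trans q≡ (sym (++-fixes x f (fixes (# 3) ℕ.z≤n)))) (proj₁ (sound p)))
        where
        source : (x ++ f) ▷ center zero ≡ w ▷ center zero
        source = trans (▷-++ x f (center zero)) vertex
        middle : (x ++ f) ▷ center s₁ ≡ w ▷ center s₁
        middle = trans (++-fixes x f (fixes (# 0) ℕ.z≤n)) (trans (sym e≡) e≡′)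
        difference : ∀ y → y ▷ axis zero ≡ y ▷ center zero -ᵥ y ▷ center s₁
        difference y = trans (▷-+ᵥ y (center zero) (-𝟏 ·ᵥ center s₁)) (cong (y ▷ center zero +ᵥ_) (▷-·ᵥ y -𝟏 (center s₁)))
        target : v ≡ across ((x ++ f) ▷ axis zero) u
        target = trans v≡ (cong₂ across (trans (difference w) (trans (cong₂ _-ᵥ_ (sym source) (sym middle)) (sym (difference (x ++ f))))) (sym u≡))

  𝒫Edge⁺ : ∀ w l → Good (w ▷ center s₄) → S.𝒫Edge (w ▷ center zero) (across (w ▷ axis l) (w ▷ center zero))
  𝒫Edge⁺ w l g = subst₂ S.𝒫Edge vertex target 𝒫-edge
    where
    y : Word
    y = w ++ axisWord l
    vertex : y ▷ center zero ≡ w ▷ center zero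
    vertex = ++-fixes w (axisWord l) (proj₁ (proj₂ (axisWord-properties l)))
    cube : y ▷ center s₄ ≡ w ▷ center s₄
    cube = ++-fixes w (axisWord l) (proj₂ (proj₂ (axisWord-properties l)))
    ρ : y ▷ normal zero ≡ w ▷ axis l
    ρ = trans (▷-++ w (axisWord l) (axis zero)) (cong (w ▷_) (proj₁ (axisWord-properties l)))
    target : across (y ▷ normal zero) (y ▷ center zero) ≡ across (w ▷ axis l) (w ▷ center zero)
    target = cong₂ across ρ vertex
    𝒫-edge : S.𝒫Edge (y ▷ center zero) (across (y ▷ normal zero) (y ▷ center zero))
    𝒫-edge = y ▷ center s₁ , JoinedBy-across y , y ▷ center s₄ , complete y (subst Good (sym cube) g) , (y , refl , refl)

  𝒫Edge⇒MosaicEdge : ∀ {u v} → S.𝒫Edge u v → MosaicEdge u v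
  𝒫Edge⇒MosaicEdge (e , joined , _) = e , joined

  𝒫Edge⇒Placed : ∀ {u v} → S.𝒫Edge u v → Placed v
  𝒫Edge⇒Placed {u} {v} d = go (𝒫Edge⁻ d)
    where
    go : ∃[ w ] 𝒫EdgeFrame u v w → Placed v
    go (w , edge-frame refl v≡ g) = subst Placed (trans (raise-center₀ w zero) (sym v≡))
      (good-placed (w ++ flip zero) (subst Good (sym (raise-center₄ w zero)) g))

  -- The edge to a lower neighbour belongs to the hypercube below a frame of v.
  incoming-𝒫Edge : ∀ {t v τ} → OfKind t v → IncomingAt v τ → S.𝒫Edge (across τ v) v
  incoming-𝒫Edge {t} {v} {τ} p inc = go (frame-state p (incomings+walls≤4 t))
    where
    go : ∃[ w ] Framed p w → S.𝒫Edge (across τ v) v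
    go (w , fr@(framed refl incs≡ _)) = found (∈-map⁻ (λ l → w ▷ axis l) {xs = incomingAxes (incomingCount t) (wallCount t)}
        (subst (τ ∈_) incs≡ (State.incs-complete p inc)))
      where
      found : ∃[ l ] (l ∈ incomingAxes (incomingCount t) (wallCount t) × τ ≡ w ▷ axis l) → S.𝒫Edge (across τ v) v
      found (l , _ , refl) = subst₂ S.𝒫Edge (raise-center₀ w l) target
          (𝒫Edge⁺ (w ++ flip l) l (subst Good (sym (raise-center₄ w l)) (framed-good p fr)))
        where
        target : across ((w ++ flip l) ▷ axis l) ((w ++ flip l) ▷ center zero) ≡ v
        target = trans (cong₂ across (raise-axis w l) (raise-center₀ w l)) (across-back (w ▷ axis l) v)

  V₀-placed : Placed V₀
  V₀-placed k = inj₂ (wall-edge k)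

  path-placed : ∀ {u v} xs → Placed u → IsPath S.𝒫Edge u xs v → Placed v
  path-placed []       p refl    = p
  path-placed (x ∷ xs) p (d , q) = path-placed xs (𝒫Edge⇒Placed d) q

  path-vertex : ∀ {u v} xs → Vertex u → IsPath S.𝒫Edge u xs v → Vertex v
  path-vertex []       p refl    = p
  path-vertex (x ∷ xs) p (d , q) = path-vertex xs (MosaicEdge⇒Vertex (𝒫Edge⇒MosaicEdge d)) q

  mosaic-path : ∀ {u v} xs → IsPath S.𝒫Edge u xs v → IsPath MosaicEdge u xs v
  mosaic-path []       p       = p
  mosaic-path (x ∷ xs) (d , p) = 𝒫Edge⇒MosaicEdge d , mosaic-path xs p

  descend-path : ∀ n {v} → Lev n v → Placed v → ∃[ xs ] (IsPath S.𝒫Edge V₀ xs v × length xs ≡ n)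
  descend-path zero    l p = [] , sym (Lev-zero l) , refl
  descend-path (suc n) {v} l p = go (Lev-suc l)
    where
    go : ∃[ τ ] (EdgeAt τ v × Incoming τ × Lev n (across τ v)) → ∃[ xs ] (IsPath S.𝒫Edge V₀ xs v × length xs ≡ suc n)
    go (τ , e , inc , l′) = extend-path (descend-path n l′ (Placed-lower e inc p)) (classify (suc n) l p)
      where
      extend-path : ∃[ xs ] (IsPath S.𝒫Edge V₀ xs (across τ v) × length xs ≡ n) → ∃[ s ] OfKind s v →
                    ∃[ xs ] (IsPath S.𝒫Edge V₀ xs v × length xs ≡ suc n)
      extend-path (xs , path , len) (s , k) = xs ++ v ∷ [] , IsPath-snoc xs path (incoming-𝒫Edge {s} k (e , inc)) ,
        trans (List.length-++ xs) (trans (ℕ.+-comm (length xs) 1) (cong suc len))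

  -- Paths in 𝒫 are paths in the mosaic, so `path-length` bounds them from below, and the descent in
  -- `descend-path` attains the bound.
  Level⁺ : ∀ {n v} → Lev n v → Placed v → S.Level n v
  Level⁺ {n} {v} l p = go (descend-path n l p)
    where
    go : ∃[ xs ] (IsPath S.𝒫Edge V₀ xs v × length xs ≡ n) → S.Level n v
    go (xs , path , len) = xs , (path , λ ys q → ℕ.≤-trans (ℕ.≤-reflexive len) (path-length ys (mosaic-path ys q) apex l)) , len

  Level⁻ : ∀ {n v} → S.Level n v → Lev n v × Placed v
  Level⁻ {n} {v} (xs , (path , least) , len) = go (Lev-exists (path-vertex xs vertex₀ path))
    where
    placed : Placed v
    placed = path-placed xs V₀-placed path
    go : ∃[ m ] Lev m v → Lev n v × Placed v
    go (m , l) = subst (λ n → Lev n v) (ℕ.≤-antisym (ℕ.≤-trans (path-length xs (mosaic-path xs path) apex l) (ℕ.≤-reflexive len)) bound) l , placed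
      where
      bound : n ℕ.≤ m
      bound = shorter (descend-path m l placed)
        where
        shorter : ∃[ ys ] (IsPath S.𝒫Edge V₀ ys v × length ys ≡ m) → n ℕ.≤ m
        shorter (ys , q , len′) = ℕ.≤-trans (ℕ.≤-reflexive (sym len)) (ℕ.≤-trans (least ys q) (ℕ.≤-reflexive len′))

  -- Neighbours differ by one level, so an edge from the previous level is one whose bisector
  -- separates v from V₀.
  incoming-card : ∀ {n t v} → Lev n v → OfKind t v → HasCard (S.Incoming v) (incomingCount t)
  incoming-card {n} {t} {v} l p = HasCard-cong (λ u → mk⇔ (forward u) (backward u))
      (HasCard-map (λ τ → across τ v) (across-injective v) (incs-card p))
    where
    forward : ∀ u → (∃[ τ ] (IncomingAt v τ × u ≡ across τ v)) → S.Incoming v u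
    forward u (τ , (e , inc) , refl) = incoming-𝒫Edge {t} p (e , inc) , levels (Lev-down l e inc)
      where
      levels : ∃[ m ] (n ≡ suc m × Lev m (across τ v)) → ∃[ m ] (S.Level m (across τ v) × S.Level (suc m) v)
      levels (m , refl , l′) = m , Level⁺ l′ (Placed-lower e inc (State.placed p)) , Level⁺ l (State.placed p)
    backward : ∀ u → S.Incoming v u → ∃[ τ ] (IncomingAt v τ × u ≡ across τ v)
    backward u (d , m , lu , lv) = go (MosaicEdge⁻ (𝒫Edge⇒MosaicEdge d))
      where
      lower : ∀ {ρ} → EdgeAt ρ u → v ≡ across ρ u → ¬ (∃[ k ] (m ≡ suc k × Lev k (across ρ u)))
      lower e eq (k , refl , l′) = ℕ.m≢1+n+m k {1} (Lev-unique l′ (subst (Lev (suc (suc k))) eq (proj₁ (Level⁻ lv))))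
      back : ∀ {ρ} → v ≡ across ρ u → u ≡ across (-𝟏 ·ᵥ ρ) v
      back {ρ} eq = trans (sym (across-back ρ u)) (cong (across (-𝟏 ·ᵥ ρ)) (sym eq))
      go : ∃[ ρ ] (EdgeAt ρ u × v ≡ across ρ u) → ∃[ τ ] (IncomingAt v τ × u ≡ across τ v)
      go (ρ , e , eq) = case direction e of λ
        { (inj₁ out) → -𝟏 ·ᵥ ρ , (subst (EdgeAt (-𝟏 ·ᵥ ρ)) (sym eq) (EdgeAt-back e) , back-incoming {ρ} out) , back {ρ} eq
        ; (inj₂ inc) → ⊥-elim (lower e eq (Lev-down (proj₁ (Level⁻ lu)) e inc)) }

-- Boundary faces and the number of walls.

-- The longest permutation of the four axes. `frame-of` puts the walls on the first axes, while the
-- cells of the flag are cut out by the last ones.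
reversal : Word
reversal = s₁ ∷ s₂ ∷ s₃ ∷ s₁ ∷ s₂ ∷ s₁ ∷ []

reversal-axis : ∀ k → reversal ▷ axis k ≡ axis (Fin.opposite k)
reversal-axis = from-yes (Fin.all? λ k → reversal ▷ axis k ≟ᵥ axis (Fin.opposite k))

reversal-center₀ : reversal ▷ center zero ≡ center zero
reversal-center₀ = from-yes (reversal ▷ center zero ≟ᵥ center zero)

reversal-center₄ : reversal ▷ center s₄ ≡ center s₄
reversal-center₄ = from-yes (reversal ▷ center s₄ ≟ᵥ center s₄)

face : Fin 3 → Fin 5
face J = suc (Fin.inject₁ J)

∈-axes : ∀ l n → Fin.toℕ l ℕ.< n → l ∈ axes n
∈-axes zero                   (suc n)                   _ = here refl
∈-axes (suc zero)             (suc (suc n))             _ = there (here refl)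
∈-axes (suc (suc zero))       (suc (suc (suc n)))       _ = there (there (here refl))
∈-axes (suc (suc (suc zero))) (suc (suc (suc (suc n)))) _ = there (there (there (here refl)))
∈-axes (suc zero)             (suc zero)                (ℕ.s≤s ())
∈-axes (suc (suc zero))       (suc zero)                (ℕ.s≤s ())
∈-axes (suc (suc zero))       (suc (suc zero))          (ℕ.s≤s (ℕ.s≤s ()))
∈-axes (suc (suc (suc zero))) (suc zero)                (ℕ.s≤s ())
∈-axes (suc (suc (suc zero))) (suc (suc zero))          (ℕ.s≤s (ℕ.s≤s ()))
∈-axes (suc (suc (suc zero))) (suc (suc (suc zero)))    (ℕ.s≤s (ℕ.s≤s (ℕ.s≤s ())))

opposite-bound : ∀ (J : Fin 3) (k : Fin 4) {j} → 3 ℕ.≤ Fin.toℕ J ℕ.+ j → Fin.toℕ J ℕ.< Fin.toℕ k → Fin.toℕ (Fin.opposite k) ℕ.< j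
opposite-bound J k {j} 3≤J+j J<k = subst (λ m → suc m ℕ.≤ j) (sym (Fin.opposite-prop k))
  (ℕ.+-cancelˡ-≤ (Fin.toℕ J) (suc (3 ℕ.∸ Fin.toℕ k)) j (ℕ.≤-trans total 3≤J+j))
  where
  k≤3 : Fin.toℕ k ℕ.≤ 3
  k≤3 = ℕ.≤-pred (Fin.toℕ<n k)
  total : Fin.toℕ J ℕ.+ suc (3 ℕ.∸ Fin.toℕ k) ℕ.≤ 3
  total = ℕ.≤-trans (ℕ.≤-reflexive (ℕ.+-suc (Fin.toℕ J) (3 ℕ.∸ Fin.toℕ k)))
    (ℕ.≤-trans (ℕ.+-monoˡ-≤ (3 ℕ.∸ Fin.toℕ k) J<k) (ℕ.≤-reflexive (ℕ.m+[n∸m]≡n k≤3)))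

-- The centre of the cell is the centre of the hypercube plus the axes k > J.
face-pairing : ∀ J w z → (∀ k → Fin.toℕ J ℕ.< Fin.toℕ k → ⟪ w ▷ axis k , z ⟫ ≡ 𝟎) → ⟪ w ▷ center (face J) , z ⟫ ≡ ⟪ w ▷ center s₄ , z ⟫
face-pairing zero w z flat = ⟪⟫-absorb w (center s₄) (center s₁) (axis (# 1) +ᵥ (axis (# 2) +ᵥ axis (# 3))) z refl
  (⟪⟫-vanishes-+ w (axis (# 1)) (axis (# 2) +ᵥ axis (# 3)) z (flat (# 1) (ℕ.s≤s ℕ.z≤n))
    (⟪⟫-vanishes-+ w (axis (# 2)) (axis (# 3)) z (flat (# 2) (ℕ.s≤s ℕ.z≤n)) (flat (# 3) (ℕ.s≤s ℕ.z≤n))))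
face-pairing (suc zero) w z flat = ⟪⟫-absorb w (center s₄) (center s₂) (axis (# 2) +ᵥ axis (# 3)) z refl
  (⟪⟫-vanishes-+ w (axis (# 2)) (axis (# 3)) z (flat (# 2) (ℕ.s≤s (ℕ.s≤s ℕ.z≤n))) (flat (# 3) (ℕ.s≤s (ℕ.s≤s ℕ.z≤n))))
face-pairing (suc (suc zero)) w z flat = ⟪⟫-absorb w (center s₄) (center s₃) (axis (# 3)) z refl (flat (# 3) (ℕ.s≤s (ℕ.s≤s (ℕ.s≤s ℕ.z≤n))))

face-center : ∀ J → ⟪ center (face J) , center s₄ ⟫ ≡ ⟪ center s₄ , center s₄ ⟫
face-center = from-yes (Fin.all? λ J → ⟪ center (face J) , center s₄ ⟫ ≟ ⟪ center s₄ , center s₄ ⟫)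

higher : Fin 3 → List (Fin 4)
higher J = drop (suc (Fin.toℕ J)) (allFin 4)

higher-sound : ∀ J → All (λ k → Fin.toℕ J ℕ.< Fin.toℕ k) (higher J)
higher-sound = from-yes (Fin.all? λ J → all? (λ k → Fin.toℕ J ℕ.<? Fin.toℕ k) (higher J))

higher-length : ∀ J → Fin.toℕ J ℕ.+ length (higher J) ≡ 3
higher-length zero             = refl
higher-length (suc zero)       = refl
higher-length (suc (suc zero)) = refl

toLast-face : ∀ J k → Fin.toℕ J ℕ.< Fin.toℕ k → permutation (toLast k) ▷ center (face J) ≡ center (face J)
toLast-face = from-yes (Fin.all? λ J → Fin.all? λ k → (Fin.toℕ J ℕ.<? Fin.toℕ k) →-dec
  (permutation (toLast k) ▷ center (face J) ≟ᵥ center (face J)))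

far₁-face : ∀ J → far₁ ▷ center (face J) ≡ center (face J)
far₁-face = from-yes (Fin.all? λ J → far₁ ▷ center (face J) ≟ᵥ center (face J))

module Faces (w₀ : Word) where

  open Levels w₀
  open Values w₀
  open Tops w₀
  open Region w₀
  open Completeness w₀
  open States w₀
  open Counting w₀
  open Paths w₀
  private module S = Simplex V₀ Q₀

  module _ {i j v} (s : State i j v) (i+j≤4 : i ℕ.+ j ℕ.≤ 4) where
    open State s

    wall∈walls : ∀ k → EdgeAt (wall k) v → wall k ∈ walls
    wall∈walls k e = walls-complete (e , k , refl)

    record WallsLast (w : Word) : Set where
      field
        at   : w ▷ center zero ≡ v
        good′ : Good (w ▷ center s₄)
        last : ∀ (J : Fin 3) (k : Fin 4) → 3 ℕ.≤ Fin.toℕ J ℕ.+ j → Fin.toℕ J ℕ.< Fin.toℕ k → w ▷ axis k ∈ walls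

    walls-last : ∃[ w ] WallsLast w
    walls-last = case frame-of walls (ℕ.≤-trans (ℕ.≤-reflexive walls-length) (ℕ.≤-trans (ℕ.m≤n+m j i) i+j≤4)) vertex
        (All.tabulate λ ρ∈ → proj₁ (walls-sound ρ∈)) (AllPairs-++⁻ʳ incs orthogonal) of λ { (w , f) → w ++ reversal , reversed w f }
      where
      reversed : ∀ w → Frame v walls w → WallsLast (w ++ reversal)
      reversed w (frame at starts) = record { at = trans same-vertex at ; good′ = subst Good (sym same-cube) (good w positions) ; last = last }
        where
        same-vertex : (w ++ reversal) ▷ center zero ≡ w ▷ center zero
        same-vertex = ++-fixes w reversal reversal-center₀
        same-cube : (w ++ reversal) ▷ center s₄ ≡ w ▷ center s₄
        same-cube = ++-fixes w reversal reversal-center₄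
        same-axis : ∀ k → (w ++ reversal) ▷ axis k ≡ w ▷ axis (Fin.opposite k)
        same-axis k = trans (▷-++ w reversal (axis k)) (cong (w ▷_) (reversal-axis k))
        wall-axis : ∀ k → EdgeAt (wall k) v → ∃[ l ] (l ∈ axes (length walls) × wall k ≡ w ▷ axis l)
        wall-axis k e = ∈-map⁻ (λ l → w ▷ axis l) {xs = axes (length walls)} (subst (wall k ∈_) (sym starts) (wall∈walls k e))
        positions : ∀ k → Position w k
        positions k = case placed k of λ
          { (inj₁ p) → beyond (subst (λ u → Positive (⊝ ⟪ wall k , u ⟫)) (sym at) p)
          ; (inj₂ e) → case wall-axis k e of λ { (l , _ , eq) → along l eq } }
        last : ∀ (J : Fin 3) (k : Fin 4) → 3 ℕ.≤ Fin.toℕ J ℕ.+ j → Fin.toℕ J ℕ.< Fin.toℕ k → (w ++ reversal) ▷ axis k ∈ walls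
        last J k 3≤J+j J<k = subst (_∈ walls) (sym (same-axis k)) (subst (w ▷ axis (Fin.opposite k) ∈_) starts
          (∈-map⁺ (λ l → w ▷ axis l) (∈-axes (Fin.opposite k) (length walls)
            (subst (Fin.toℕ (Fin.opposite k) ℕ.<_) (sym walls-length) (opposite-bound J k 3≤J+j J<k)))))

    record CubeAt (J : Fin 3) (c q : Point) (y : Word) : Set where
      constructor cube-frame
      field
        at        : y ▷ center zero ≡ v
        same-face : y ▷ center (face J) ≡ c
        same-cube : y ▷ center s₄ ≡ q
        inside    : Good (y ▷ center s₄)

    cube-at : ∀ J {c q} x → S.𝒫HypercubeAt (face J) c q → c ≡ x ▷ center (face J) → x ▷ center zero ≡ v → ∃[ y ] CubeAt J c q y
    cube-at J {c} {q} x (p , (x′ , c≡ , q≡)) eq at = case cell-corner (Fin.inject₁ J) x′ x (trans (sym c≡) eq) of λ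
        { (f , fixes , vertex) → x′ ++ f , framed-at f vertex (fixes (Fin.inject₁ J) ℕ.≤-refl) (fixes (# 3) (ℕ.≤-pred (Fin.toℕ<n (Fin.inject₁ J)))) }
      where
      framed-at : ∀ f → x′ ▷ f ▷ center zero ≡ x ▷ center zero → f ▷ center (face J) ≡ center (face J) → f ▷ center s₄ ≡ center s₄ →
                  CubeAt J c q (x′ ++ f)
      framed-at f vertex fixes-face fixes-cube = cube-frame (trans (▷-++ x′ f (center zero)) (trans vertex at))
          (trans (++-fixes x′ f fixes-face) (sym c≡)) same-cube (subst Good (sym same-cube) (proj₁ (sound p)))
        where
        same-cube : (x′ ++ f) ▷ center s₄ ≡ q
        same-cube = trans (++-fixes x′ f fixes-cube) (sym q≡)

    -- The vertex v is on the V₀-side of a wall at v, so by `position` the wall is parallel to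
    -- facets of the hypercube and passes through its centre.
    wall-flat : ∀ y → y ▷ center zero ≡ v → Good (y ▷ center s₄) → ∀ {τ} → τ ∈ walls → ⟪ τ , y ▷ center s₄ ⟫ ≡ 𝟎
    wall-flat y at g τ∈ = case walls-sound τ∈ of λ { (e , k , refl) → case position y g k of λ
      { (beyond p)   → ⊥-elim (Positive-asym {𝟏} 𝟏>0 (subst (λ t → Positive (⊝ t))
          (trans (cong ⟪ wall k ,_⟫ at) (EdgeAt-pairing e)) p))
      ; (along l eq) → trans (cong ⟪_, y ▷ center s₄ ⟫ eq) (axis-flat y l) } }

    -- The cell has dimension J + 1, so the condition asks for at least 4 - (J + 1) walls. In a
    -- frame with the walls on the last axes they cut out the cell. The centre of any hypercube of 𝒫
    -- around it lies on them, which by `face-pairing` fixes its product with the centre of the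
    -- frame, and `cube-unique′` applies.
    onFace⁺ : ∀ J → 3 ℕ.≤ Fin.toℕ J ℕ.+ j → S.OnFace (face J) v
    onFace⁺ J 3≤J+j = case walls-last of λ { (w , last) → go w last }
      where
      go : ∀ w → WallsLast w → S.OnFace (face J) v
      go w last = w ▷ center (face J) , (w , sym at , refl) , w ▷ center s₄ ,
          (complete w good′ , (w , refl , refl)) , λ {q} p → unique p
        where
        open WallsLast last renaming (last to last-walls)
        unique : ∀ {q} → S.𝒫HypercubeAt (face J) (w ▷ center (face J)) q → w ▷ center s₄ ≡ q
        unique p = case cube-at J w p refl at of λ { (y , cube-frame at′ face≡ refl g) →
          cube-unique′ w y (trans at (sym at′))
            (trans (sym (face-pairing J w (y ▷ center s₄) λ k J<k → wall-flat y at′ g (last-walls J k 3≤J+j J<k)))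
              (trans (cong ⟪_, y ▷ center s₄ ⟫ (sym face≡)) (trans (▷-isometry y (center (face J)) (center s₄)) (face-center J)))) }

    -- Across a facet that is not on the boundary there is another hypercube.
    other-cube : ∀ J y k → y ▷ center zero ≡ v → Good (y ▷ center s₄) → Fin.toℕ J ℕ.< Fin.toℕ k → ¬ (y ▷ axis k ∈ walls) →
                 ∃[ q ] (S.𝒫HypercubeAt (face J) (y ▷ center (face J)) q × y ▷ center s₄ ≢ q)
    other-cube J y k at g J<k k∉ = y₂ ▷ center s₄ , (complete y₂ good₂ , (y₂ , sym same-face , refl)) , distinct
      where
      p : Word
      p = permutation (toLast k)
      y₁ y₂ : Word
      y₁ = y ++ reverse p
      y₂ = y₁ ++ far₁
      cube₁ : y₁ ▷ center s₄ ≡ y ▷ center s₄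
      cube₁ = ++-fixes y (reverse p) (reverse-fixes p (permutation-center₄ (toLast k)))
      at₁ : y₁ ▷ center zero ≡ v
      at₁ = trans (++-fixes y (reverse p) (reverse-fixes p (permutation-center₀ (toLast k)))) at
      axis₁ : y₁ ▷ axis (# 3) ≡ y ▷ axis k
      axis₁ = trans (cong (y₁ ▷_) (sym (toLast-axis k))) (++-reverse y p (axis k))
      same-face : y₂ ▷ center (face J) ≡ y ▷ center (face J)
      same-face = trans (++-fixes y₁ far₁ (far₁-face J)) (++-fixes y (reverse p) (reverse-fixes p (toLast-face J k J<k)))
      inner : ∀ m → wall m ≢ y₁ ▷ axis (# 3)
      inner m eq = k∉ (subst (_∈ walls) (trans eq axis₁) (wall∈walls m (subst₂ EdgeAt (sym eq) at₁ (frame-edge y₁ (# 3)))))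
      good₂ : Good (y₂ ▷ center s₄)
      good₂ = Turned-good {y₁} {y₂} (record
        { same-vertex = ++-fixes y₁ far₁ {center zero} refl
        ; same-walls  = λ m l eq → case far₁-axis l of λ
          { (inj₁ refl)  → ⊥-elim (inner m eq)
          ; (inj₂ fixed) → l , trans eq (sym (++-fixes y₁ far₁ fixed)) } }) (subst Good (sym cube₁) g)
      distinct : y ▷ center s₄ ≢ y₂ ▷ center s₄
      distinct eq = from-no (center s₄ ≟ᵥ far₁ ▷ center s₄) (▷-injective y₁ (trans cube₁ (trans eq (▷-++ y₁ far₁ (center s₄)))))

    -- If some axis k > J were not a wall, `other-cube` would give a second hypercube around the
    -- cell; so these 3 - J axes are distinct walls.
    onFace⁻ : ∀ J → S.OnFace (face J) v → 3 ℕ.≤ Fin.toℕ J ℕ.+ j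
    onFace⁻ J (c , (x , v≡ , c≡) , q , p , unique) = case cube-at J x p c≡ (sym v≡) of λ { (y , cube-frame at refl refl g) → go y at g unique }
      where
      go : ∀ y → y ▷ center zero ≡ v → Good (y ▷ center s₄) →
           (∀ {q} → S.𝒫HypercubeAt (face J) (y ▷ center (face J)) q → y ▷ center s₄ ≡ q) → 3 ℕ.≤ Fin.toℕ J ℕ.+ j
      go y at g unique = case all? (λ k → y ▷ axis k ∈? walls) (higher J) of λ
        { (yes all) → ℕ.≤-trans (ℕ.≤-reflexive (sym (higher-length J))) (ℕ.+-monoʳ-≤ (Fin.toℕ J) (bound all))
        ; (no ¬all) → case find (¬All⇒Any¬ (λ k → y ▷ axis k ∈? walls) (higher J) ¬all) of λ
          { (k , k∈ , k∉) → case other-cube J y k at g (All.lookup (higher-sound J) k∈) k∉ of λ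
            { (q , p , distinct) → ⊥-elim (distinct (unique p)) } } }
        where
        axis-injective : ∀ {k l} → y ▷ axis k ≡ y ▷ axis l → k ≡ l
        axis-injective {k} {l} eq = case axis-orthogonal k l of λ
          { (inj₁ k≡l) → k≡l
          ; (inj₂ z) → case trans (sym (Root-norm (EdgeAt⇒Root (EdgeAt-axis k))))
              (trans (cong ⟪ axis k ,_⟫ (▷-injective y eq)) z) of λ () }
        bound : All (λ k → y ▷ axis k ∈ walls) (higher J) → length (higher J) ℕ.≤ j
        bound all = subst₂ ℕ._≤_ (List.length-map (λ k → y ▷ axis k) (higher J)) walls-length
          (Unique-⊆-length (Unique.map⁺ axis-injective (Unique.drop⁺ (suc (Fin.toℕ J)) (Unique.allFin⁺ 4)))
            λ τ∈ → case ∈-map⁻ (λ k → y ▷ axis k) {xs = higher J} τ∈ of λ { (k , k∈ , refl) → All.lookup all k∈ })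

-- From states to the types of vertices.

-- The apex counts as a vertex of type 1.
typeNumber : (Kind → ℕ → ℕ) → VertexType → ℕ → ℕ
typeNumber M One n = M nothing n ℕ.+ M (just One) n
typeNumber M t   n = M (just t) n

module Types (w₀ : Word) where

  open Levels w₀
  open Values w₀
  open Tops w₀
  open Region w₀
  open Completeness w₀
  open States w₀
  open Counting w₀
  open Paths w₀
  open Faces w₀
  private module S = Simplex V₀ Q₀

  onFace : ∀ {s v} J → OfKind s v → 3 ℕ.≤ Fin.toℕ J ℕ.+ wallCount s → S.OnFace (face J) v
  onFace {s} J p = onFace⁺ p (incomings+walls≤4 s) J

  onFace⁻¹ : ∀ {s v} J → OfKind s v → S.OnFace (face J) v → 3 ℕ.≤ Fin.toℕ J ℕ.+ wallCount s
  onFace⁻¹ {s} J p = onFace⁻ p (incomings+walls≤4 s) J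

  hypercube-at : ∀ {s v} → OfKind s v → ∃ (S.𝒫HypercubeAt (# 0) v)
  hypercube-at {s} p = case frame-state p (incomings+walls≤4 s) of λ
    { (w , fr) → w ▷ center s₄ , complete w (framed-good p fr) , w , sym (Framed.at fr) , refl }

  hasType : ∀ {n v} t → Lev n v → OfKind (just t) v → S.HasType t v
  hasType One l p = onFace {just One} (# 0) p (ℕ.m≤m+n 3 0)
  hasType A   l p = (onFace {just A} (# 1) p (ℕ.m≤m+n 3 0) , λ f → case onFace⁻¹ {just A} (# 0) p f of λ { (ℕ.s≤s (ℕ.s≤s ())) }) , incoming-card {t = just A} l p
  hasType B   l p = (onFace {just B} (# 1) p (ℕ.m≤m+n 3 0) , λ f → case onFace⁻¹ {just B} (# 0) p f of λ { (ℕ.s≤s (ℕ.s≤s ())) }) , incoming-card {t = just B} l p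
  hasType C   l p = (onFace {just C} (# 2) p (ℕ.m≤m+n 3 0) , λ f → case onFace⁻¹ {just C} (# 1) p f of λ { (ℕ.s≤s (ℕ.s≤s ())) }) , incoming-card {t = just C} l p
  hasType D   l p = (onFace {just D} (# 2) p (ℕ.m≤m+n 3 0) , λ f → case onFace⁻¹ {just D} (# 1) p f of λ { (ℕ.s≤s (ℕ.s≤s ())) }) , incoming-card {t = just D} l p
  hasType E   l p = (onFace {just E} (# 2) p (ℕ.m≤m+n 3 0) , λ f → case onFace⁻¹ {just E} (# 1) p f of λ { (ℕ.s≤s (ℕ.s≤s ())) }) , incoming-card {t = just E} l p
  hasType F   l p = (hypercube-at {just F} p , λ f → case onFace⁻¹ {just F} (# 2) p f of λ { (ℕ.s≤s (ℕ.s≤s ())) }) , incoming-card {t = just F} l p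
  hasType G   l p = (hypercube-at {just G} p , λ f → case onFace⁻¹ {just G} (# 2) p f of λ { (ℕ.s≤s (ℕ.s≤s ())) }) , incoming-card {t = just G} l p
  hasType H   l p = (hypercube-at {just H} p , λ f → case onFace⁻¹ {just H} (# 2) p f of λ { (ℕ.s≤s (ℕ.s≤s ())) }) , incoming-card {t = just H} l p
  hasType K   l p = (hypercube-at {just K} p , λ f → case onFace⁻¹ {just K} (# 2) p f of λ { (ℕ.s≤s (ℕ.s≤s ())) }) , incoming-card {t = just K} l p

  incoming-unique : ∀ {n s v i} → Lev n v → OfKind s v → HasCard (S.Incoming v) i → incomingCount s ≡ i
  incoming-unique {s = s} l p c = HasCard-unique (incoming-card {t = s} l p) c (λ _ → mk⇔ (λ x → x) (λ x → x))

  ray-kind : ∀ s → 3 ℕ.≤ wallCount s → s ≡ nothing ⊎ s ≡ just One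
  ray-kind nothing    _ = inj₁ refl
  ray-kind (just One) _ = inj₂ refl
  ray-kind (just A) (ℕ.s≤s (ℕ.s≤s ()))
  ray-kind (just B) (ℕ.s≤s (ℕ.s≤s ()))
  ray-kind (just C) (ℕ.s≤s ())
  ray-kind (just D) (ℕ.s≤s ())
  ray-kind (just E) (ℕ.s≤s ())
  ray-kind (just F) ()
  ray-kind (just G) ()
  ray-kind (just H) ()
  ray-kind (just K) ()

  face-walls : ∀ {s v} J k → OfKind s v → S.OnFace (face J) v → ¬ S.OnFace (face k) v → Fin.toℕ J ≡ suc (Fin.toℕ k) →
               Fin.toℕ J ℕ.+ wallCount s ≡ 3
  face-walls {s} J k p f ¬f J≡k+1 = ℕ.≤-antisym
    (subst (λ n → n ℕ.+ wallCount s ℕ.≤ 3) (sym J≡k+1) (ℕ.≰⇒> λ le → ¬f (onFace {s} k p le))) (onFace⁻¹ {s} J p f)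

  inner-walls : ∀ {s v} → OfKind s v → ¬ S.OnFace (# 3) v → wallCount s ≡ 0
  inner-walls {s} p ¬f = ℕ.n≤0⇒n≡0 (ℕ.≤-pred (ℕ.≤-pred (ℕ.≤-pred (ℕ.≰⇒> λ le → ¬f (onFace {s} (# 2) p le)))))

  kind-of-type : ∀ {n s v} t → t ≢ One → Lev n v → OfKind s v → S.HasType t v → s ≡ just t
  kind-of-type One ≢One _ _ _ = ⊥-elim (≢One refl)
  kind-of-type {s = s} A _ l p ((f , ¬f) , c) = kind-unique s (just A) (incoming-unique {s = s} l p c) (ℕ.suc-injective (face-walls {s} (# 1) (# 0) p f ¬f refl))
  kind-of-type {s = s} B _ l p ((f , ¬f) , c) = kind-unique s (just B) (incoming-unique {s = s} l p c) (ℕ.suc-injective (face-walls {s} (# 1) (# 0) p f ¬f refl))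
  kind-of-type {s = s} C _ l p ((f , ¬f) , c) = kind-unique s (just C) (incoming-unique {s = s} l p c) (ℕ.suc-injective (ℕ.suc-injective (face-walls {s} (# 2) (# 1) p f ¬f refl)))
  kind-of-type {s = s} D _ l p ((f , ¬f) , c) = kind-unique s (just D) (incoming-unique {s = s} l p c) (ℕ.suc-injective (ℕ.suc-injective (face-walls {s} (# 2) (# 1) p f ¬f refl)))
  kind-of-type {s = s} E _ l p ((f , ¬f) , c) = kind-unique s (just E) (incoming-unique {s = s} l p c) (ℕ.suc-injective (ℕ.suc-injective (face-walls {s} (# 2) (# 1) p f ¬f refl)))
  kind-of-type {s = s} F _ l p ((_ , ¬f) , c) = kind-unique s (just F) (incoming-unique {s = s} l p c) (inner-walls {s} p ¬f)
  kind-of-type {s = s} G _ l p ((_ , ¬f) , c) = kind-unique s (just G) (incoming-unique {s = s} l p c) (inner-walls {s} p ¬f)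
  kind-of-type {s = s} H _ l p ((_ , ¬f) , c) = kind-unique s (just H) (incoming-unique {s = s} l p c) (inner-walls {s} p ¬f)
  kind-of-type {s = s} K _ l p ((_ , ¬f) , c) = kind-unique s (just K) (incoming-unique {s = s} l p c) (inner-walls {s} p ¬f)

  kindNumber : Kind → ℕ → ℕ
  kindNumber s n = Census.number (census n) s

  number : VertexType → ℕ → ℕ
  number = typeNumber kindNumber

  type-card : ∀ n t → t ≢ One → S.NumberOnLevel t n (kindNumber (just t) n)
  type-card n t ≢One = HasCard-cong (λ v → mk⇔
    (λ (at-level l p) → Level⁺ l (State.placed p) , hasType t l p)
    (λ (lv , type) → backward v (Level⁻ lv) type)) (Census.card (census n) (just t))
    where
    backward : ∀ v → Lev n v × Placed v → S.HasType t v → At (just t) n v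
    backward v (l , placed) type = case classify n l placed of λ
      { (s , p) → at-level l (subst (λ s → OfKind s v) (kind-of-type {s = s} t ≢One l p type) p) }

  ray-card : ∀ n → S.NumberOnLevel One n (number One n)
  ray-card n = HasCard-cong (λ v → mk⇔ forward (λ (lv , type) → backward v (Level⁻ lv) type))
    (HasCard-⊎ (Census.card (census n) nothing) (Census.card (census n) (just One)) (λ v p q → case At-exclusive p q of λ ()))
    where
    forward : ∀ {v} → At nothing n v ⊎ At (just One) n v → S.Level n v × S.OnRay v
    forward (inj₁ (at-level l p)) = Level⁺ l (State.placed p) , onFace {nothing} (# 0) p (ℕ.m≤m+n 3 1)
    forward (inj₂ (at-level l p)) = Level⁺ l (State.placed p) , hasType One l p
    backward : ∀ v → Lev n v × Placed v → S.OnRay v → At nothing n v ⊎ At (just One) n v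
    backward v (l , placed) type = case classify n l placed of λ
      { (s , p) → case ray-kind s (onFace⁻¹ {s} (# 0) p type) of λ
        { (inj₁ refl) → inj₁ (at-level l p) ; (inj₂ refl) → inj₂ (at-level l p) } }

  number-card : ∀ t n → S.NumberOnLevel t n (number t n)
  number-card One n = ray-card n
  number-card A   n = type-card n A λ ()
  number-card B   n = type-card n B λ ()
  number-card C   n = type-card n C λ ()
  number-card D   n = type-card n D λ ()
  number-card E   n = type-card n E λ ()
  number-card F   n = type-card n F λ ()
  number-card G   n = type-card n G λ ()
  number-card H   n = type-card n H λ ()
  number-card K   n = type-card n K λ ()

  -- Above level 0 every vertex has an incoming edge, while the apex state has none.
  apex-number : ∀ n → kindNumber nothing (suc n) ≡ 0
  apex-number n = HasCard-unique (Census.card (census (suc n)) nothing)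
    (HasCard-empty λ { v (at-level l p) → case Lev-suc l of λ { (τ , e , inc , _) → none p (State.incs-complete p (e , inc)) } })
    (λ _ → mk⇔ (λ x → x) (λ x → x))
    where
    none : ∀ {v τ} (p : OfKind nothing v) → ¬ (τ ∈ State.incs p)
    none p τ∈ = case subst (0 ℕ.<_) (State.incs-length p) (∈-length τ∈) of λ ()

  recurrence : ∀ n t → kindNumber t (suc n) ℕ.* incomingCount t ≡ sum (map (λ s → kindNumber s n ℕ.* outgoings s t) kinds)
  recurrence n t = census-step (census n) t

-- The recurrences from the edge counts.

divide : ∀ k q m x → ℚ.toℚᵘ q ≡ ℚᵘ.mkℚᵘ (+ 1) k → m * suc k ≡ x → ι m ≡ q ℚ.* ι x
divide k q m x q≡ refl = ℚ.toℚᵘ-injective (ℚᵘ.≃-trans (ℚ.toℚᵘ-fromℚᵘ (ℚᵘ.mkℚᵘ (+ m) 0)) (ℚᵘ.≃-sym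
  (ℚᵘ.≃-trans (ℚ.toℚᵘ-homo-* q (ι x)) (ℚᵘ.≃-trans
    (ℚᵘ.*-cong (ℚᵘ.≃-reflexive q≡) (ℚ.toℚᵘ-fromℚᵘ (ℚᵘ.mkℚᵘ (+ x) 0)))
    (ℚᵘ.*≡* cross)))))
  where
  cross : (+ 1 ℤ.* + x) ℤ.* + 1 ≡ + m ℤ.* + (suc k * 1)
  cross = trans (ℤ.*-identityʳ (+ 1 ℤ.* + x)) (trans (ℤ.*-identityˡ (+ x))
    (trans (ℤ.pos-* m (suc k)) (cong (λ n → + m ℤ.* + n) (sym (ℕ.*-identityʳ (suc k))))))

-- The sum of the products c * x, in the shape in which the recurrences are written.
term : ℕ → ℕ → ℕ
term 1 x = x
term c x = c * x

-- Zero coefficients drop out and sums nest to the left, so that for each type the equation `into`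
-- reduces to the recurrence as written.
collect : ℕ → List (ℕ × ℕ) → ℕ
collect acc []                = acc
collect acc ((zero , x) ∷ ts) = collect acc ts
collect acc ((suc c , x) ∷ ts) = collect (acc + term (suc c) x) ts

combination : List (ℕ × ℕ) → ℕ
combination []                 = 0
combination ((zero , x) ∷ ts)  = combination ts
combination ((suc c , x) ∷ ts) = collect (term (suc c) x) ts

term-* : ∀ c x → term c x ≡ x * c
term-* zero          x = sym (ℕ.*-zeroʳ x)
term-* (suc zero)    x = sym (ℕ.*-identityʳ x)
term-* (suc (suc c)) x = ℕ.*-comm (suc (suc c)) x

module _ {I : Set} (coefficient value : I → ℕ) where

  private
    pair : I → ℕ × ℕ
    pair i = coefficient i , value i

    total : List I → ℕ
    total is = sum (map (λ i → value i * coefficient i) is)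

  collect-sum : ∀ acc is → acc + total is ≡ collect acc (map pair is)
  collect-sum acc []       = ℕ.+-identityʳ acc
  collect-sum acc (i ∷ is) with coefficient i
  ... | zero  = trans (cong (λ z → acc + (z + total is)) (ℕ.*-zeroʳ (value i))) (collect-sum acc is)
  ... | suc c = trans (sym (ℕ.+-assoc acc _ (total is)))
    (trans (cong (λ z → acc + z + total is) (sym (term-* (suc c) (value i)))) (collect-sum _ is))

  combination-sum : ∀ is → total is ≡ combination (map pair is)
  combination-sum []       = refl
  combination-sum (i ∷ is) with coefficient i
  ... | zero  = trans (cong (_+ total is) (ℕ.*-zeroʳ (value i))) (combination-sum is)
  ... | suc c = trans (cong (_+ total is) (sym (term-* (suc c) (value i)))) (collect-sum _ is)

*-1-injective : ∀ {m n} → m * 1 ≡ n → m ≡ n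
*-1-injective {m} eq = trans (sym (ℕ.*-identityʳ m)) eq

*-suc≡0 : ∀ {m} k → m * suc k ≡ 0 → m ≡ 0
*-suc≡0 {m} k eq = ℕ.*-cancelʳ-≡ m 0 (suc k) eq

-- x and y are the numbers of vertices of each kind on consecutive levels.
module Recurrences (x y : Kind → ℕ)
  (counts : ∀ t → y t * incomingCount t ≡ sum (map (λ s → x s * outgoings s t) kinds)) where

  private
    o = x nothing
    a = x (just A)
    b = x (just B)
    c = x (just C)
    d = x (just D)
    e = x (just E)
    f = x (just F)
    g = x (just G)
    h = x (just H)
    k = x (just K)
    v = x (just One)

  into : ∀ t → y t * incomingCount t ≡ combination (map (λ s → outgoings s t , x s) kinds)
  into t = trans (counts t) (combination-sum (λ s → outgoings s t) x kinds)

  into-One : y (just One) ≡ 4 * o + v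
  into-One = *-1-injective (into (just One))

  linear : (y (just A) * 2 ≡ 2 * a + 2 * b + 3 * v) ×
           (y (just B) ≡ a + 2 * b) ×
           (y (just C) * 3 ≡ 2 * a + 3 * c + 2 * d) ×
           (y (just D) * 2 ≡ 2 * b + 3 * c + 4 * d + 5 * e) ×
           (y (just E) ≡ 3 * c + 4 * d + 6 * e) ×
           (y (just F) * 4 ≡ c + 4 * f + 2 * g) ×
           (y (just G) * 3 ≡ d + 6 * f + 6 * g + 5 * h) ×
           (y (just H) * 2 ≡ e + 12 * f + 12 * g + 12 * h + 12 * k) ×
           (y (just K) ≡ 94 * f + 97 * g + 101 * h + 107 * k)
  linear = into (just A) , *-1-injective (into (just B)) , into (just C) , into (just D) , *-1-injective (into (just E)) ,
           into (just F) , into (just G) , into (just H) , *-1-injective (into (just K))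

  step : (ι (y (just A)) ≡ ½ ℚ.* ι (2 * a + 2 * b + 3 * v)) ×
         (y (just B) ≡ a + 2 * b) ×
         (ι (y (just C)) ≡ ⅓ ℚ.* ι (2 * a + 3 * c + 2 * d)) ×
         (ι (y (just D)) ≡ ½ ℚ.* ι (2 * b + 3 * c + 4 * d + 5 * e)) ×
         (y (just E) ≡ 3 * c + 4 * d + 6 * e) ×
         (ι (y (just F)) ≡ ¼ ℚ.* ι (c + 4 * f + 2 * g)) ×
         (ι (y (just G)) ≡ ⅓ ℚ.* ι (d + 6 * f + 6 * g + 5 * h)) ×
         (ι (y (just H)) ≡ ½ ℚ.* ι (e + 12 * f + 12 * g + 12 * h + 12 * k)) ×
         (y (just K) ≡ 94 * f + 97 * g + 101 * h + 107 * k)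
  step = case linear of λ
    { (A₂ , B₁ , C₃ , D₂ , E₁ , F₄ , G₃ , H₂ , K₁) →
      divide 1 ½ (y (just A)) (2 * a + 2 * b + 3 * v) refl A₂ ,
      B₁ ,
      divide 2 ⅓ (y (just C)) (2 * a + 3 * c + 2 * d) refl C₃ ,
      divide 1 ½ (y (just D)) (2 * b + 3 * c + 4 * d + 5 * e) refl D₂ ,
      E₁ ,
      divide 3 ¼ (y (just F)) (c + 4 * f + 2 * g) refl F₄ ,
      divide 2 ⅓ (y (just G)) (d + 6 * f + 6 * g + 5 * h) refl G₃ ,
      divide 1 ½ (y (just H)) (e + 12 * f + 12 * g + 12 * h + 12 * k) refl H₂ ,
      K₁ }


module Solution (M : Kind → ℕ → ℕ)
  (initial : ∀ s → M s 0 ≡ apex-only s)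
  (counts : ∀ n t → M t (suc n) * incomingCount t ≡ sum (map (λ s → M s n * outgoings s t) kinds))
  (apex-number : ∀ n → M nothing (suc n) ≡ 0) where

  a = M (just A)
  b = M (just B)
  c = M (just C)
  d = M (just D)
  e = M (just E)
  f = M (just F)
  g = M (just G)
  h = M (just H)
  k = M (just K)
  v : ℕ → ℕ
  v n = M nothing n + M (just One) n

  recurrences : ∀ n → 1 ≤ n →
    (ι (a (suc n)) ≡ ½ ℚ.* ι (2 * a n + 2 * b n + 3 * v n)) ×
    (b (suc n) ≡ a n + 2 * b n) ×
    (ι (c (suc n)) ≡ ⅓ ℚ.* ι (2 * a n + 3 * c n + 2 * d n)) ×
    (ι (d (suc n)) ≡ ½ ℚ.* ι (2 * b n + 3 * c n + 4 * d n + 5 * e n)) ×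
    (e (suc n) ≡ 3 * c n + 4 * d n + 6 * e n) ×
    (ι (f (suc n)) ≡ ¼ ℚ.* ι (c n + 4 * f n + 2 * g n)) ×
    (ι (g (suc n)) ≡ ⅓ ℚ.* ι (d n + 6 * f n + 6 * g n + 5 * h n)) ×
    (ι (h (suc n)) ≡ ½ ℚ.* ι (e n + 12 * f n + 12 * g n + 12 * h n + 12 * k n)) ×
    (k (suc n) ≡ 94 * f n + 97 * g n + 101 * h n + 107 * k n) ×
    (v (suc n) ≡ v n)
  recurrences (suc n) _ = case step of λ
    { (A₂ , B₁ , C₃ , D₂ , E₁ , F₄ , G₃ , H₂ , K₁) →
      -- From level 1 on the apex is absent, and type 1 is counted by `just One` alone.
      subst (λ l → ι (a (2 + n)) ≡ ½ ℚ.* ι (2 * a (suc n) + 2 * b (suc n) + 3 * l)) (sym one) A₂ ,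
      B₁ , C₃ , D₂ , E₁ , F₄ , G₃ , H₂ , K₁ ,
      trans (cong₂ _+_ (apex-number (suc n)) (trans into-One (cong (λ o → 4 * o + M (just One) (suc n)) (apex-number n)))) (sym one) }
    where
    open Recurrences (λ t → M t (suc n)) (λ t → M t (2 + n)) (counts (suc n))
    one : v (suc n) ≡ M (just One) (suc n)
    one = cong (_+ M (just One) (suc n)) (apex-number n)

  -- Level 0 is the apex alone, and its four edges lead to type 1. The other edge counts are 0, and
  -- cancelling the numbers of incoming edges leaves 0.
  initial-values :
    (v 1 ≡ 4) ×
    (a 1 ≡ 0) × (b 1 ≡ 0) × (c 1 ≡ 0) × (d 1 ≡ 0) × (e 1 ≡ 0) ×
    (f 1 ≡ 0) × (g 1 ≡ 0) × (h 1 ≡ 0) × (k 1 ≡ 0)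
  initial-values = case linear of λ
    { (A₂ , B₁ , C₃ , D₂ , E₁ , F₄ , G₃ , H₂ , K₁) →
      cong₂ _+_ (apex-number 0) into-One ,
      *-suc≡0 1 A₂ , B₁ , *-suc≡0 2 C₃ , *-suc≡0 1 D₂ , E₁ , *-suc≡0 3 F₄ , *-suc≡0 2 G₃ , *-suc≡0 1 H₂ , K₁ }
    where open Recurrences apex-only (λ t → M t 1) (λ t →
            trans (counts 0 t) (cong sum (List.map-cong (λ s → cong (_* outgoings s t) (initial s)) kinds)))

solution : (P : VertexType → ℕ → ℕ → Set) (M : Kind → ℕ → ℕ) →
  (∀ t n → P t n (typeNumber M t n)) →
  (∀ s → M s 0 ≡ apex-only s) →
  (∀ n t → M t (suc n) * incomingCount t ≡ sum (map (λ s → M s n * outgoings s t) kinds)) →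
  (∀ n → M nothing (suc n) ≡ 0) →
  Σ[ N ∈ (VertexType → ℕ → ℕ) ]
    (∀ t n → P t n (N t n)) ×
    (let a = N A
         b = N B
         c = N C
         d = N D
         e = N E
         f = N F
         g = N G
         h = N H
         k = N K
         v = N One
     in
     (∀ n → 1 ≤ n →
       (ι (a (suc n)) ≡ ½ ℚ.* ι (2 * a n + 2 * b n + 3 * v n)) ×
       (b (suc n) ≡ a n + 2 * b n) ×
       (ι (c (suc n)) ≡ ⅓ ℚ.* ι (2 * a n + 3 * c n + 2 * d n)) ×
       (ι (d (suc n)) ≡ ½ ℚ.* ι (2 * b n + 3 * c n + 4 * d n + 5 * e n)) ×
       (e (suc n) ≡ 3 * c n + 4 * d n + 6 * e n) ×
       (ι (f (suc n)) ≡ ¼ ℚ.* ι (c n + 4 * f n + 2 * g n)) ×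
       (ι (g (suc n)) ≡ ⅓ ℚ.* ι (d n + 6 * f n + 6 * g n + 5 * h n)) ×
       (ι (h (suc n)) ≡ ½ ℚ.* ι (e n + 12 * f n + 12 * g n + 12 * h n + 12 * k n)) ×
       (k (suc n) ≡ 94 * f n + 97 * g n + 101 * h n + 107 * k n) ×
       (v (suc n) ≡ v n)) ×
     (v 1 ≡ 4) ×
     (a 1 ≡ 0) × (b 1 ≡ 0) × (c 1 ≡ 0) × (d 1 ≡ 0) × (e 1 ≡ 0) ×
     (f 1 ≡ 0) × (g 1 ≡ 0) × (h 1 ≡ 0) × (k 1 ≡ 0))
solution P M holds initial counts apex-number = typeNumber M , holds , recurrences , initial-values
  where open Solution M initial counts apex-number

theorem1 : ∀ V₀ Q₀ → Incident (# 0) (# 4) V₀ Q₀ →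
  Σ[ N ∈ (VertexType → ℕ → ℕ) ]
    (∀ t n → Simplex.NumberOnLevel V₀ Q₀ t n (N t n)) ×
    (let a = N A
         b = N B
         c = N C
         d = N D
         e = N E
         f = N F
         g = N G
         h = N H
         k = N K
         v = N One
     in
     (∀ n → 1 ≤ n →
       (ι (a (suc n)) ≡ ½ ℚ.* ι (2 * a n + 2 * b n + 3 * v n)) ×
       (b (suc n) ≡ a n + 2 * b n) ×
       (ι (c (suc n)) ≡ ⅓ ℚ.* ι (2 * a n + 3 * c n + 2 * d n)) ×
       (ι (d (suc n)) ≡ ½ ℚ.* ι (2 * b n + 3 * c n + 4 * d n + 5 * e n)) ×
       (e (suc n) ≡ 3 * c n + 4 * d n + 6 * e n) ×
       (ι (f (suc n)) ≡ ¼ ℚ.* ι (c n + 4 * f n + 2 * g n)) ×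
       (ι (g (suc n)) ≡ ⅓ ℚ.* ι (d n + 6 * f n + 6 * g n + 5 * h n)) ×
       (ι (h (suc n)) ≡ ½ ℚ.* ι (e n + 12 * f n + 12 * g n + 12 * h n + 12 * k n)) ×
       (k (suc n) ≡ 94 * f n + 97 * g n + 101 * h n + 107 * k n) ×
       (v (suc n) ≡ v n)) ×
     (v 1 ≡ 4) ×
     (a 1 ≡ 0) × (b 1 ≡ 0) × (c 1 ≡ 0) × (d 1 ≡ 0) × (e 1 ≡ 0) ×
     (f 1 ≡ 0) × (g 1 ≡ 0) × (h 1 ≡ 0) × (k 1 ≡ 0))
theorem1 _ _ (w , refl , refl) =
  solution (Simplex.NumberOnLevel (w ▷ center (# 0)) (w ▷ center (# 4))) kindNumber number-card (λ s → refl) recurrence apex-number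
  where open Types w
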